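{- Let $p$ be a prime, let $d\geq 2$ be an integer with $d\mid p-1$, let $A,C\in\mathbb{F}_p$ with $A\neq 0$, and put $f(X)=AX^d+C\in\mathbb{F}_p[X]$. Let $N\geq 0$ be an integer. There exists a constant $M$, not depending on $d,p,A,C$, such that whenever $$f^{\circ i}(0)\neq f^{\circ j}(0)\quad\text{for all } 0\leq i<j\leq N,$$ we have $$\left|\#f^{\circ N}(\mathbb{F}_p)-\mu_N\cdot p\right|\leq M d^{d^{6N}}\sqrt{p},$$ where the numbers $\mu_r$ are defined recursively by $\mu_0=1$ and $d\mu_r=1-(1-\mu_{r-1})^d$ for $r\geq 1$. Moreover, $$\mu_r\sim \frac{2}{(d-1)r}\quad\text{as } r\to\infty.$$
   Context: For a polynomial $f$, the iterates are defined by $f^{\circ 0}(X)=X$ and $f^{\circ (j+1)}(X)=f(f^{\circ j}(X))$. $f^{\circ N}(\mathbb{F}_p)$ denotes the image of the map $\mathbb{F}_p\to\mathbb{F}_p$, $x\mapsto f^{\circ N}(x)$. -}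

module Defs where

open import Data.Nat as ℕ using (ℕ; zero; suc; _%_; _≡ᵇ_; NonZero)
open import Data.Bool using (Bool; true; false; T?)
open import Data.List using (List; upTo; filter; length)
open import Data.Bool.ListAction using (any)
open import Data.Rational as ℚ using (ℚ; 1ℚ; _-_; _*_; _/_)
open import Data.Integer using (+_)

iterate : {A : Set} → (A → A) → ℕ → A → A
iterate f zero x = x
iterate f (suc n) x = f (iterate f n x)

-- Elements of F_p are represented by naturals in [0, p).
-- f(X) = A X^d + C over F_p, evaluated on representatives and reduced mod p.
polyMap : (p : ℕ) → .{{NonZero p}} → (d A C : ℕ) → ℕ → ℕ
polyMap p d A C x = (A ℕ.* (x ℕ.^ d) ℕ.+ C) % p

imageSize : (p : ℕ) → .{{NonZero p}} → (N d A C : ℕ) → ℕ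
imageSize p N d A C =
  length (filter (λ y → T? (any (λ x → iterate (polyMap p d A C) N x ≡ᵇ y) (upTo p))) (upTo p))

_^ℚ_ : ℚ → ℕ → ℚ
q ^ℚ zero = 1ℚ
q ^ℚ suc n = q * (q ^ℚ n)

mu : (d : ℕ) → .{{NonZero d}} → ℕ → ℚ
mu d zero = 1ℚ
mu d (suc r) = (1ℚ - ((1ℚ - mu d r) ^ℚ d)) * ((+ 1) / d)

-- Whether y lies in f^N(F_p) is decided by exploring the tree of preimages of y.  Adjoining to F_p[t] the preimages
-- met so far, each by a Kummer equation v^d = u (z - C), gives the coordinate ring of a curve whose F_p-points
-- parametrise the explored trees.  It stays a domain because every new radicand ramifies where the tree meets a
-- critical value f^a(0), a ≤ N, and these values are distinct.  Stepanov's method bounds the number of points of each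
-- such curve by p + O(√p); counting vectors over F_p replaces linear algebra.  Points where a radicand is not a d-th
-- power are reached through the twisted equations, so the probabilities of lying inside and outside the image are
-- both bounded above by their heuristic values mu and 1 - mu.  As the two counts add up to p, the bounds are sharp.
--
-- For the asymptotics, a = (d - 1)/2: the recursion x ↦ x′ satisfies x′ (1 + a x) ≤ x and x′ ≥ x (1 - a x), so that
-- 1/mu grows by a per step in the limit.

module Submission where

open import Defs
open import Level using (0ℓ)
open import Data.Nat as ℕ using (ℕ; zero; suc; NonZero; _≤_; _<_; z≤n; s≤s)
import Data.Nat.Properties as ℕₚ
open import Data.Nat.DivMod using (_%_)
import Data.Nat.DivMod as ℕ%
open import Data.Nat.Primality using (Prime)
import Data.Nat.Primality as Primality
import Data.Nat.Coprimality as Coprimality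
open import Data.Nat.GCD using (module Bézout)
open import Data.Nat.Divisibility using (_∣_)
import Data.Nat.Divisibility as ∣ₚ
open import Data.Nat.ListAction using (product)
open import Data.Nat.ListAction.Properties using (product-↭)
open import Data.Integer using (+_)
import Data.Integer as ℤ
import Data.Integer.Properties as ℤₚ
open import Data.Fin as Fin using (Fin; toℕ)
import Data.Fin.Properties as Finₚ
open import Data.List using (List; []; _∷_; length; _++_; filter; upTo)
import Data.List as List
import Data.List.Properties as Listₚ
open import Data.List.Membership.Propositional using (_∈_)
import Data.List.Membership.Propositional.Properties as ∈ₚ
open import Data.List.Relation.Unary.Any using (here; there)
open import Data.List.Relation.Unary.All as All using (All; []; _∷_)
import Data.List.Relation.Unary.All.Properties as Allₚ
open import Data.List.Relation.Unary.AllPairs as AllPairs using (AllPairs; []; _∷_)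
import Data.List.Relation.Unary.AllPairs.Properties as AllPairsₚ
open import Data.List.Relation.Unary.Unique.Propositional using (Unique)
import Data.List.Relation.Unary.Unique.Propositional.Properties as Uniqueₚ
open import Data.List.Relation.Binary.Permutation.Propositional as ↭ using (_↭_; ↭-sym)
import Data.List.Relation.Binary.Permutation.Propositional.Properties as ↭ₚ
open import Data.Maybe using (Maybe; just; nothing)
open import Data.Product using (Σ; ∃; _×_; _,_; proj₁; proj₂)
open import Data.Sum using (_⊎_; inj₁; inj₂)
open import Data.Empty using (⊥)
open import Data.Unit using (⊤; tt)
open import Data.Bool using (Bool; true; false)
open import Function using (_∘_; id)
open import Relation.Binary.Definitions using (tri<; tri≈; tri>)
open import Relation.Nullary using (¬_; Dec; yes; no; contradiction; ¬?; _×-dec_)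
open import Relation.Binary.PropositionalEquality as ≡ using (_≡_; _≢_)
open import Algebra.Structures using (IsCommutativeRing)
open import Algebra.Bundles using (CommutativeRing; CommutativeMonoid)

-- Stepanov's method needs the coordinate rings to be domains. At each new root this is an
-- Eisenstein argument in which a radical proper principal ideal replaces the prime: primes split in
-- the tower, radicality persists. The inductive hypothesis asks that z - f^a(0) generate such an
-- ideal for every unexplored vertex z and every a ≥ 1 within the depth, not only for a = 1 where it
-- is the next radicand, because a root adjoined at z turns the condition at a + 1 there into the
-- condition at a for its children. All is effective: the rings are free over F_p[t] with explicit
-- coordinates and degrees, the derivation is rescaled by each radicand to avoid denominators, and
-- the at most N residues t at which a radicand could vanish are set aside. At most 1 + d + ... +
-- d^(N-1) roots are adjoined, so ranks are bounded by g, which is d to this exponent, and the point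
-- bound is p + 52 g^4 B with B about √(p / 6g^3). Four times the exponent is at most d^(6N), whence
-- the double exponential; the constant is 52 + N.

-- Ring identities, finite sums and homomorphisms.

module RingKit (R : CommutativeRing 0ℓ 0ℓ) where
  open CommutativeRing R
  open import Algebra.Properties.Semiring.Mult semiring public
    using (×-homo-+; ×1-homo-*; ×-congʳ; ×-congˡ; ×-comm-*; ×-assoc-*; ×-homo-1)
    renaming (_×_ to _⨯_)
  open import Algebra.Properties.CommutativeSemiring.Exp commutativeSemiring public
    using (_^_; ^-congˡ; ^-homo-*; ^-assocʳ; ^-distrib-*)
  open import Algebra.Properties.Ring ring public
    using (-‿distribˡ-*; -‿distribʳ-*; -‿involutive; x+x≈x⇒x≈0)
  open import Algebra.Properties.AbelianGroup +-abelianGroup using (⁻¹-∙-comm; ε⁻¹≈ε)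
  open import Algebra.Solver.Ring.AlmostCommutativeRing
    using (fromCommutativeRing; _-Raw-AlmostCommutative⟶_)
  open import Algebra.Properties.Semiring.Mult.TCOptimised semiring
    using () renaming (_×_ to _×ₜ_; ×-homo-+ to ×ₜ-homo-+; ×1-homo-* to ×ₜ-homo-*)
  import Relation.Binary.Reasoning.Setoid setoid as ≈-Reasoning
  open ≈-Reasoning

  private
    -- Equality in the ring is not assumed decidable, so the solver works with integer coefficients
    -- and their images.
    ⟦_⟧ℤ : ℤ.ℤ → Carrier
    ⟦ + n ⟧ℤ = n ×ₜ 1#
    ⟦ ℤ.-[1+ n ] ⟧ℤ = - (suc n ×ₜ 1#)

    suc-×ₜ : ∀ n → suc n ×ₜ 1# ≈ 1# + n ×ₜ 1#
    suc-×ₜ n = ×ₜ-homo-+ 1# 1 n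

    ⊖-homo : ∀ m n → ⟦ m ℤ.⊖ n ⟧ℤ ≈ m ×ₜ 1# - n ×ₜ 1#
    ⊖-homo zero zero = sym (-‿inverseʳ 0#)
    ⊖-homo (suc m) zero = sym (trans (+-congˡ ε⁻¹≈ε) (+-identityʳ _))
    ⊖-homo zero (suc n) = sym (+-identityˡ _)
    ⊖-homo (suc m) (suc n) = begin
      ⟦ suc m ℤ.⊖ suc n ⟧ℤ ≡⟨ ≡.cong ⟦_⟧ℤ (ℤₚ.[1+m]⊖[1+n]≡m⊖n m n) ⟩
      ⟦ m ℤ.⊖ n ⟧ℤ ≈⟨ ⊖-homo m n ⟩
      M - N ≈⟨ +-congˡ (+-identityˡ _) ⟨
      M + (0# - N) ≈⟨ +-congˡ (+-congʳ (-‿inverseʳ 1#)) ⟨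
      M + ((1# - 1#) - N) ≈⟨ +-congˡ (trans (+-assoc _ _ _) (+-congˡ (⁻¹-∙-comm 1# N))) ⟩
      M + (1# - (1# + N)) ≈⟨ +-assoc _ _ _ ⟨
      (M + 1#) - (1# + N) ≈⟨ +-cong (trans (+-comm _ _) (sym (suc-×ₜ m))) (-‿cong (sym (suc-×ₜ n))) ⟩
      suc m ×ₜ 1# - suc n ×ₜ 1# ∎
      where M = m ×ₜ 1#; N = n ×ₜ 1#

    +ℤ-homo : ∀ i j → ⟦ i ℤ.+ j ⟧ℤ ≈ ⟦ i ⟧ℤ + ⟦ j ⟧ℤ
    +ℤ-homo (+ m) (+ n) = ×ₜ-homo-+ 1# m n
    +ℤ-homo (+ m) ℤ.-[1+ n ] = ⊖-homo m (suc n)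
    +ℤ-homo ℤ.-[1+ m ] (+ n) = trans (⊖-homo n (suc m)) (+-comm _ _)
    +ℤ-homo ℤ.-[1+ m ] ℤ.-[1+ n ] = begin
      - (suc (suc (m ℕ.+ n)) ×ₜ 1#) ≡⟨ ≡.cong (λ k → - (k ×ₜ 1#)) (≡.sym (≡.cong suc (ℕₚ.+-suc m n))) ⟩
      - ((suc m ℕ.+ suc n) ×ₜ 1#) ≈⟨ -‿cong (×ₜ-homo-+ 1# (suc m) (suc n)) ⟩
      - (suc m ×ₜ 1# + suc n ×ₜ 1#) ≈⟨ ⁻¹-∙-comm _ _ ⟨
      _ ∎

    -ℤ-homo : ∀ i → ⟦ ℤ.- i ⟧ℤ ≈ - ⟦ i ⟧ℤ
    -ℤ-homo (+ zero) = sym ε⁻¹≈ε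
    -ℤ-homo (+ suc n) = refl
    -ℤ-homo ℤ.-[1+ n ] = sym (-‿involutive _)

    *ℤ-homo : ∀ i j → ⟦ i ℤ.* j ⟧ℤ ≈ ⟦ i ⟧ℤ * ⟦ j ⟧ℤ
    *ℤ-homo (+ m) (+ n) = trans (reflexive (≡.cong ⟦_⟧ℤ (≡.sym (ℤₚ.pos-* m n)))) (×ₜ-homo-* m n)
    *ℤ-homo (+ m) ℤ.-[1+ n ] = begin
      ⟦ + m ℤ.* ℤ.-[1+ n ] ⟧ℤ ≡⟨ ≡.cong ⟦_⟧ℤ (≡.sym (ℤₚ.neg-distribʳ-* (+ m) (+ suc n))) ⟩
      ⟦ ℤ.- (+ m ℤ.* + suc n) ⟧ℤ ≈⟨ -ℤ-homo (+ m ℤ.* + suc n) ⟩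
      - ⟦ + m ℤ.* + suc n ⟧ℤ ≈⟨ -‿cong (*ℤ-homo (+ m) (+ suc n)) ⟩
      - (⟦ + m ⟧ℤ * ⟦ + suc n ⟧ℤ) ≈⟨ -‿distribʳ-* _ _ ⟩
      _ ∎
    *ℤ-homo ℤ.-[1+ m ] j = begin
      ⟦ ℤ.-[1+ m ] ℤ.* j ⟧ℤ ≡⟨ ≡.cong ⟦_⟧ℤ (≡.sym (ℤₚ.neg-distribˡ-* (+ suc m) j)) ⟩
      ⟦ ℤ.- (+ suc m ℤ.* j) ⟧ℤ ≈⟨ -ℤ-homo (+ suc m ℤ.* j) ⟩
      - ⟦ + suc m ℤ.* j ⟧ℤ ≈⟨ -‿cong (pos j) ⟩
      - (⟦ + suc m ⟧ℤ * ⟦ j ⟧ℤ) ≈⟨ -‿distribˡ-* _ _ ⟩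
      _ ∎
      where
      pos : ∀ j → ⟦ + suc m ℤ.* j ⟧ℤ ≈ ⟦ + suc m ⟧ℤ * ⟦ j ⟧ℤ
      pos (+ n) = trans (reflexive (≡.cong ⟦_⟧ℤ (≡.sym (ℤₚ.pos-* (suc m) n)))) (×ₜ-homo-* (suc m) n)
      pos ℤ.-[1+ n ] = begin
        ⟦ + suc m ℤ.* ℤ.-[1+ n ] ⟧ℤ ≡⟨ ≡.cong ⟦_⟧ℤ (≡.sym (ℤₚ.neg-distribʳ-* (+ suc m) (+ suc n))) ⟩
        ⟦ ℤ.- (+ suc m ℤ.* + suc n) ⟧ℤ ≈⟨ -ℤ-homo (+ suc m ℤ.* + suc n) ⟩
        - ⟦ + suc m ℤ.* + suc n ⟧ℤ ≈⟨ -‿cong (trans (reflexive (≡.cong ⟦_⟧ℤ (≡.sym (ℤₚ.pos-* (suc m) (suc n))))) (×ₜ-homo-* (suc m) (suc n))) ⟩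
        - (⟦ + suc m ⟧ℤ * ⟦ + suc n ⟧ℤ) ≈⟨ -‿distribʳ-* _ _ ⟩
        _ ∎

    ℤ-morphism : ℤ.+-*-rawRing -Raw-AlmostCommutative⟶ fromCommutativeRing R
    ℤ-morphism = record
      { ⟦_⟧ = ⟦_⟧ℤ ; +-homo = +ℤ-homo ; *-homo = *ℤ-homo ; -‿homo = -ℤ-homo
      ; 0-homo = refl ; 1-homo = refl }

    ℤ-dec : ∀ i j → Maybe (⟦ i ⟧ℤ ≈ ⟦ j ⟧ℤ)
    ℤ-dec i j with i ℤ.≟ j
    ... | yes e = just (reflexive (≡.cong ⟦_⟧ℤ e))
    ... | no _ = nothing

  open import Algebra.Solver.Ring ℤ.+-*-rawRing (fromCommutativeRing R) ℤ-morphism ℤ-dec public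
    using (solve; _:=_; _:+_; _:*_; _:-_; :-_; con)

  κ : ℕ → Carrier
  κ n = n ⨯ 1#

  x-y≈0⇒x≈y : ∀ {x y} → x - y ≈ 0# → x ≈ y
  x-y≈0⇒x≈y {x} {y} e = begin
    x ≈⟨ solve 2 (λ x y → x := (x :- y) :+ y) refl x y ⟩
    (x - y) + y ≈⟨ +-congʳ e ⟩
    0# + y ≈⟨ +-identityˡ y ⟩
    y ∎

  x≈y⇒x-y≈0 : ∀ {x y} → x ≈ y → x - y ≈ 0#
  x≈y⇒x-y≈0 e = trans (+-congʳ e) (-‿inverseʳ _)

  κ-*ˡ : ∀ n x → n ⨯ x ≈ κ n * x
  κ-*ˡ n x = trans (×-congʳ n (sym (*-identityˡ x))) (sym (×-assoc-* n 1# x))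

  ∑ : ∀ {n} → (Fin n → Carrier) → Carrier
  ∑ {zero} f = 0#
  ∑ {suc n} f = f Fin.zero + ∑ (f ∘ Fin.suc)

  ∑-cong : ∀ {n} {f g : Fin n → Carrier} → (∀ i → f i ≈ g i) → ∑ f ≈ ∑ g
  ∑-cong {zero} h = refl
  ∑-cong {suc n} h = +-cong (h Fin.zero) (∑-cong (h ∘ Fin.suc))

  ∑-+ : ∀ {n} (f g : Fin n → Carrier) → ∑ (λ i → f i + g i) ≈ ∑ f + ∑ g
  ∑-+ {zero} f g = sym (+-identityˡ 0#)
  ∑-+ {suc n} f g = trans (+-congˡ (∑-+ (f ∘ Fin.suc) (g ∘ Fin.suc)))
    (solve 4 (λ x y z w → (x :+ y) :+ (z :+ w) := (x :+ z) :+ (y :+ w)) refl _ _ _ _)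

  ∑-zero : ∀ {n} (f : Fin n → Carrier) → (∀ i → f i ≈ 0#) → ∑ f ≈ 0#
  ∑-zero {zero} f h = refl
  ∑-zero {suc n} f h = trans (+-cong (h Fin.zero) (∑-zero (f ∘ Fin.suc) (h ∘ Fin.suc))) (+-identityˡ 0#)

  ∑-single : ∀ {n} (f : Fin n → Carrier) i → (∀ j → j ≢ i → f j ≈ 0#) → ∑ f ≈ f i
  ∑-single f Fin.zero h = trans (+-congˡ (∑-zero (f ∘ Fin.suc) λ j → h (Fin.suc j) λ ())) (+-identityʳ _)
  ∑-single f (Fin.suc i) h = trans (+-cong (h Fin.zero λ ()) (∑-single (f ∘ Fin.suc) i λ j j≢i → h (Fin.suc j) (j≢i ∘ Finₚ.suc-injective))) (+-identityˡ _)

additive-∑ : (R S : CommutativeRing 0ℓ 0ℓ) (φ : CommutativeRing.Carrier R → CommutativeRing.Carrier S) →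
  (let module R = CommutativeRing R; module S = CommutativeRing S) →
  φ R.0# S.≈ S.0# → (∀ x y → φ (x R.+ y) S.≈ φ x S.+ φ y) →
  ∀ {n} (f : Fin n → R.Carrier) → φ (RingKit.∑ R f) S.≈ RingKit.∑ S (φ ∘ f)
additive-∑ R S φ φ0 φ+ {zero} f = φ0
additive-∑ R S φ φ0 φ+ {suc n} f = S.trans (φ+ _ _) (S.+-congˡ (additive-∑ R S φ φ0 φ+ (f ∘ Fin.suc)))
  where module S = CommutativeRing S

record Hom (R S : CommutativeRing 0ℓ 0ℓ) : Set where
  private
    module R = CommutativeRing R
    module S = CommutativeRing S
    module RK = RingKit R
    module SK = RingKit S
  field
    ⟦_⟧ : R.Carrier → S.Carrier
    ⟦⟧-cong : ∀ {x y} → x R.≈ y → ⟦ x ⟧ S.≈ ⟦ y ⟧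
    +-homo : ∀ x y → ⟦ x R.+ y ⟧ S.≈ ⟦ x ⟧ S.+ ⟦ y ⟧
    *-homo : ∀ x y → ⟦ x R.* y ⟧ S.≈ ⟦ x ⟧ S.* ⟦ y ⟧
    1-homo : ⟦ R.1# ⟧ S.≈ S.1#

  0-homo : ⟦ R.0# ⟧ S.≈ S.0#
  0-homo = SK.x+x≈x⇒x≈0 _ (S.trans (S.sym (+-homo _ _)) (⟦⟧-cong (R.+-identityˡ _)))

  -‿homo : ∀ x → ⟦ R.- x ⟧ S.≈ S.- ⟦ x ⟧
  -‿homo x = SK.x-y≈0⇒x≈y (S.trans (S.+-congˡ (SK.-‿involutive _))
    (S.trans (S.sym (+-homo _ _)) (S.trans (⟦⟧-cong (R.-‿inverseˡ x)) 0-homo)))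

  sub-homo : ∀ x y → ⟦ x R.- y ⟧ S.≈ ⟦ x ⟧ S.- ⟦ y ⟧
  sub-homo x y = S.trans (+-homo _ _) (S.+-congˡ (-‿homo y))

  ⨯-homo : ∀ n x → ⟦ n RK.⨯ x ⟧ S.≈ n SK.⨯ ⟦ x ⟧
  ⨯-homo zero x = 0-homo
  ⨯-homo (suc n) x = S.trans (+-homo _ _) (S.+-congˡ (⨯-homo n x))

  κ-homo : ∀ n → ⟦ RK.κ n ⟧ S.≈ SK.κ n
  κ-homo n = S.trans (⨯-homo n R.1#) (SK.×-congʳ n 1-homo)

  ^-homo : ∀ x n → ⟦ x RK.^ n ⟧ S.≈ ⟦ x ⟧ SK.^ n
  ^-homo x zero = 1-homo
  ^-homo x (suc n) = S.trans (*-homo _ _) (S.*-congˡ (^-homo x n))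

-- Polynomials as coefficient lists, and their evaluation.

module Polynomials (R : CommutativeRing 0ℓ 0ℓ) where
  open CommutativeRing R
  open RingKit R

  Poly : Set
  Poly = List Carrier

  coeff : Poly → ℕ → Carrier
  coeff [] i = 0#
  coeff (a ∷ p) zero = a
  coeff (a ∷ p) (suc i) = coeff p i

  infix 4 _≋_
  -- Lists that differ by trailing zeros must be equal, hence the comparison of all coefficients. A
  -- record, unlike a function type, lets `p` and `q` be inferred from a proof.
  record _≋_ (p q : Poly) : Set where
    constructor mk≋
    field at : ∀ i → coeff p i ≈ coeff q i
  open _≋_ public

  infixl 6 _⊕_
  infixl 7 _⊗_ _·_

  _⊕_ : Poly → Poly → Poly
  [] ⊕ q = q
  (a ∷ p) ⊕ [] = a ∷ p
  (a ∷ p) ⊕ (b ∷ q) = (a + b) ∷ (p ⊕ q)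

  _·_ : Carrier → Poly → Poly
  a · p = List.map (a *_) p

  ⊖_ : Poly → Poly
  ⊖ p = List.map -_ p

  _⊗_ : Poly → Poly → Poly
  [] ⊗ q = []
  (a ∷ p) ⊗ q = (a · q) ⊕ (0# ∷ (p ⊗ q))

  coeff-⊕ : ∀ p q i → coeff (p ⊕ q) i ≈ coeff p i + coeff q i
  coeff-⊕ [] q i = sym (+-identityˡ _)
  coeff-⊕ (a ∷ p) [] i = sym (+-identityʳ _)
  coeff-⊕ (a ∷ p) (b ∷ q) zero = refl
  coeff-⊕ (a ∷ p) (b ∷ q) (suc i) = coeff-⊕ p q i

  coeff-· : ∀ a p i → coeff (a · p) i ≈ a * coeff p i
  coeff-· a [] i = sym (zeroʳ a)
  coeff-· a (b ∷ p) zero = refl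
  coeff-· a (b ∷ p) (suc i) = coeff-· a p i

  coeff-⊖ : ∀ p i → coeff (⊖ p) i ≈ - coeff p i
  coeff-⊖ [] i = sym (trans (sym (+-identityˡ _)) (-‿inverseʳ 0#))
  coeff-⊖ (a ∷ p) zero = refl
  coeff-⊖ (a ∷ p) (suc i) = coeff-⊖ p i

  private
    ≋-refl : ∀ {p} → p ≋ p
    ≋-refl = mk≋ λ _ → refl
    ≋-sym : ∀ {p q} → p ≋ q → q ≋ p
    ≋-sym e = mk≋ λ i → sym (at e i)
    ≋-trans : ∀ {p q r} → p ≋ q → q ≋ r → p ≋ r
    ≋-trans e f = mk≋ λ i → trans (at e i) (at f i)

    ⊕-cong : ∀ {p p′ q q′} → p ≋ p′ → q ≋ q′ → p ⊕ q ≋ p′ ⊕ q′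
    ⊕-cong {p} {p′} {q} {q′} e f = mk≋ λ i →
      trans (coeff-⊕ p q i) (trans (+-cong (at e i) (at f i)) (sym (coeff-⊕ p′ q′ i)))

    ⊕-assoc : ∀ p q r → (p ⊕ q) ⊕ r ≋ p ⊕ (q ⊕ r)
    ⊕-assoc p q r = mk≋ λ i → trans (coeff-⊕ (p ⊕ q) r i) (trans (+-congʳ (coeff-⊕ p q i))
      (trans (+-assoc _ _ _) (sym (trans (coeff-⊕ p (q ⊕ r) i) (+-congˡ (coeff-⊕ q r i))))))

    ⊕-comm : ∀ p q → p ⊕ q ≋ q ⊕ p
    ⊕-comm p q = mk≋ λ i → trans (coeff-⊕ p q i) (trans (+-comm _ _) (sym (coeff-⊕ q p i)))

    ⊕-identityʳ : ∀ p → p ⊕ [] ≋ p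
    ⊕-identityʳ p = ⊕-comm p []

    ⊖-cong : ∀ {p q} → p ≋ q → ⊖ p ≋ ⊖ q
    ⊖-cong {p} {q} e = mk≋ λ i → trans (coeff-⊖ p i) (trans (-‿cong (at e i)) (sym (coeff-⊖ q i)))

    ⊖-inverseʳ : ∀ p → p ⊕ (⊖ p) ≋ []
    ⊖-inverseʳ p = mk≋ λ i → trans (coeff-⊕ p (⊖ p) i) (trans (+-congˡ (coeff-⊖ p i)) (-‿inverseʳ _))

  ∷-cong : ∀ {a b p q} → a ≈ b → p ≋ q → (a ∷ p) ≋ (b ∷ q)
  ∷-cong e f = mk≋ λ { zero → e ; (suc i) → at f i }

  ∷≋[] : ∀ {a p} → a ≈ 0# → p ≋ [] → (a ∷ p) ≋ []
  ∷≋[] e f = mk≋ λ { zero → e ; (suc i) → at f i }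

  ≋-head : ∀ {a b p q} → (a ∷ p) ≋ (b ∷ q) → a ≈ b
  ≋-head e = at e 0
  ≋-tail : ∀ {a b p q} → (a ∷ p) ≋ (b ∷ q) → p ≋ q
  ≋-tail e = mk≋ λ i → at e (suc i)

  private
    ·-cong : ∀ {a b p q} → a ≈ b → p ≋ q → a · p ≋ b · q
    ·-cong {a} {b} {p} {q} e f = mk≋ λ i →
      trans (coeff-· a p i) (trans (*-cong e (at f i)) (sym (coeff-· b q i)))

    ·-distribˡ : ∀ a p q → a · (p ⊕ q) ≋ a · p ⊕ a · q
    ·-distribˡ a p q = mk≋ λ i → trans (coeff-· a (p ⊕ q) i) (trans (*-congˡ (coeff-⊕ p q i))
      (trans (distribˡ _ _ _) (sym (trans (coeff-⊕ (a · p) (a · q) i) (+-cong (coeff-· a p i) (coeff-· a q i))))))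

    ·-distribʳ : ∀ a b p → (a + b) · p ≋ a · p ⊕ b · p
    ·-distribʳ a b p = mk≋ λ i → trans (coeff-· (a + b) p i)
      (trans (distribʳ _ _ _) (sym (trans (coeff-⊕ (a · p) (b · p) i) (+-cong (coeff-· a p i) (coeff-· b p i)))))

    ·-assoc : ∀ a b p → (a * b) · p ≋ a · (b · p)
    ·-assoc a b p = mk≋ λ i → trans (coeff-· (a * b) p i)
      (trans (*-assoc _ _ _) (sym (trans (coeff-· a (b · p) i) (*-congˡ (coeff-· b p i)))))

    x-⊕ : ∀ p q → (0# ∷ (p ⊕ q)) ≋ (0# ∷ p) ⊕ (0# ∷ q)
    x-⊕ p q = ∷-cong (sym (+-identityˡ 0#)) ≋-refl

    ·-x : ∀ a p → a · (0# ∷ p) ≋ (0# ∷ a · p)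
    ·-x a p = ∷-cong (zeroʳ a) ≋-refl

    0·-⊕ : ∀ q p → 0# · q ⊕ p ≋ p
    0·-⊕ q p = mk≋ λ i → trans (coeff-⊕ (0# · q) p i)
      (trans (+-congʳ (trans (coeff-· 0# q i) (zeroˡ _))) (+-identityˡ _))

    ⊕-interchange : ∀ p q r s → (p ⊕ q) ⊕ (r ⊕ s) ≋ (p ⊕ r) ⊕ (q ⊕ s)
    ⊕-interchange p q r s = mk≋ λ i →
      trans (coeff-⊕ (p ⊕ q) (r ⊕ s) i) (trans (+-cong (coeff-⊕ p q i) (coeff-⊕ r s i))
      (trans (solve 4 (λ a b c d → (a :+ b) :+ (c :+ d) := (a :+ c) :+ (b :+ d)) refl _ _ _ _)
      (sym (trans (coeff-⊕ (p ⊕ r) (q ⊕ s) i) (+-cong (coeff-⊕ p r i) (coeff-⊕ q s i))))))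

    ⊕-swap : ∀ p q r → p ⊕ (q ⊕ r) ≋ q ⊕ (p ⊕ r)
    ⊕-swap p q r = ≋-trans (≋-sym (⊕-assoc p q r)) (≋-trans (⊕-cong (⊕-comm p q) ≋-refl) (⊕-assoc q p r))

    ⊗-distribʳ : ∀ r p q → (p ⊕ q) ⊗ r ≋ p ⊗ r ⊕ q ⊗ r
    ⊗-distribʳ r [] q = ≋-refl
    ⊗-distribʳ r (a ∷ p) [] = ≋-sym (⊕-identityʳ _)
    ⊗-distribʳ r (a ∷ p) (b ∷ q) = ≋-trans
      (⊕-cong (·-distribʳ a b r) (≋-trans (∷-cong refl (⊗-distribʳ r p q)) (x-⊕ (p ⊗ r) (q ⊗ r))))
      (⊕-interchange (a · r) (b · r) (0# ∷ p ⊗ r) (0# ∷ q ⊗ r))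

    ⊗-distribˡ : ∀ p q r → p ⊗ (q ⊕ r) ≋ p ⊗ q ⊕ p ⊗ r
    ⊗-distribˡ [] q r = ≋-refl
    ⊗-distribˡ (a ∷ p) q r = ≋-trans
      (⊕-cong (·-distribˡ a q r) (≋-trans (∷-cong refl (⊗-distribˡ p q r)) (x-⊕ (p ⊗ q) (p ⊗ r))))
      (⊕-interchange (a · q) (a · r) (0# ∷ p ⊗ q) (0# ∷ p ⊗ r))

    ·-⊗ : ∀ a p q → (a · p) ⊗ q ≋ a · (p ⊗ q)
    ·-⊗ a [] q = ≋-refl
    ·-⊗ a (b ∷ p) q = ≋-trans
      (⊕-cong (·-assoc a b q) (≋-trans (∷-cong refl (·-⊗ a p q)) (≋-sym (·-x a (p ⊗ q)))))
      (≋-sym (·-distribˡ a (b · q) (0# ∷ p ⊗ q)))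

    ⊗-[] : ∀ p → p ⊗ [] ≋ []
    ⊗-[] [] = ≋-refl
    ⊗-[] (a ∷ p) = ∷≋[] refl (⊗-[] p)

    ⊗-∷ : ∀ p b q → p ⊗ (b ∷ q) ≋ b · p ⊕ (0# ∷ p ⊗ q)
    ⊗-∷ [] b q = ≋-sym (∷≋[] refl ≋-refl)
    ⊗-∷ (a ∷ p) b q = ∷-cong (+-congʳ (*-comm a b))
      (≋-trans (⊕-cong ≋-refl (⊗-∷ p b q)) (⊕-swap (a · q) (b · p) (0# ∷ p ⊗ q)))

    ⊗-comm : ∀ p q → p ⊗ q ≋ q ⊗ p
    ⊗-comm [] q = ≋-sym (⊗-[] q)
    ⊗-comm (a ∷ p) q = ≋-trans (⊕-cong ≋-refl (∷-cong refl (⊗-comm p q))) (≋-sym (⊗-∷ q a p))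

    ⊗-assoc : ∀ p q r → (p ⊗ q) ⊗ r ≋ p ⊗ (q ⊗ r)
    ⊗-assoc [] q r = ≋-refl
    ⊗-assoc (a ∷ p) q r = ≋-trans (⊗-distribʳ r (a · q) (0# ∷ p ⊗ q))
      (⊕-cong (·-⊗ a q r) (≋-trans (0·-⊕ r (0# ∷ (p ⊗ q) ⊗ r)) (∷-cong refl (⊗-assoc p q r))))

    ⊗-congˡ : ∀ p {q q′} → q ≋ q′ → p ⊗ q ≋ p ⊗ q′
    ⊗-congˡ [] e = ≋-refl
    ⊗-congˡ (a ∷ p) e = ⊕-cong (·-cong refl e) (∷-cong refl (⊗-congˡ p e))

    ⊗-cong : ∀ {p p′ q q′} → p ≋ p′ → q ≋ q′ → p ⊗ q ≋ p′ ⊗ q′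
    ⊗-cong {p} {p′} {q} {q′} e f = ≋-trans (⊗-congˡ p f)
      (≋-trans (⊗-comm p q′) (≋-trans (⊗-congˡ q′ e) (⊗-comm q′ p′)))

    ⊗-identityˡ : ∀ p → (1# ∷ []) ⊗ p ≋ p
    ⊗-identityˡ p = mk≋ λ i → trans (coeff-⊕ (1# · p) (0# ∷ []) i)
      (trans (+-cong (trans (coeff-· 1# p i) (*-identityˡ _)) (at (∷≋[] {0#} {[]} refl ≋-refl) i)) (+-identityʳ _))

  abstract
    polyRing-isCommutativeRing : IsCommutativeRing _≋_ _⊕_ _⊗_ ⊖_ [] (1# ∷ [])
    polyRing-isCommutativeRing = record
        { isRing = record
          { +-isAbelianGroup = record
            { isGroup = record
              { isMonoid = record
                { isSemigroup = record
                  { isMagma = record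
                    { isEquivalence = record { refl = ≋-refl ; sym = ≋-sym ; trans = ≋-trans }
                    ; ∙-cong = ⊕-cong }
                  ; assoc = ⊕-assoc }
                ; identity = (λ _ → ≋-refl) , ⊕-identityʳ }
              ; inverse = (λ p → ≋-trans (⊕-comm (⊖ p) p) (⊖-inverseʳ p)) , ⊖-inverseʳ
              ; ⁻¹-cong = ⊖-cong }
            ; comm = ⊕-comm }
          ; *-cong = ⊗-cong
          ; *-assoc = ⊗-assoc
          ; *-identity = ⊗-identityˡ , λ p → ≋-trans (⊗-comm p _) (⊗-identityˡ p)
          ; distrib = ⊗-distribˡ , ⊗-distribʳ }
        ; *-comm = ⊗-comm }

  polyRing : CommutativeRing 0ℓ 0ℓ
  polyRing = record
    { Carrier = Poly ; _≈_ = _≋_ ; _+_ = _⊕_ ; _*_ = _⊗_ ; -_ = ⊖_ ; 0# = [] ; 1# = 1# ∷ []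
    ; isCommutativeRing = polyRing-isCommutativeRing }

  X : Poly
  X = 0# ∷ 1# ∷ []

  module P = CommutativeRing polyRing
  module PK = RingKit polyRing

  ·≋ : ∀ a p → a · p ≋ (a ∷ []) ⊗ p
  ·≋ a p = mk≋ λ i → sym (trans (coeff-⊕ (a · p) (0# ∷ []) i)
    (trans (+-congˡ (at (∷≋[] {0#} {[]} refl ≋-refl) i)) (+-identityʳ _)))

  X⊗ : ∀ p → X ⊗ p ≋ (0# ∷ p)
  X⊗ p = ≋-trans (0·-⊕ p _) (∷-cong refl (⊗-identityˡ p))

  ∷≋ : ∀ a p → (a ∷ p) ≋ (a ∷ []) ⊕ X ⊗ p
  ∷≋ a p = ≋-trans (∷-cong (sym (+-identityʳ a)) ≋-refl) (⊕-cong {a ∷ []} ≋-refl (≋-sym (X⊗ p)))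

  constHom : Hom R polyRing
  constHom = record
    { ⟦_⟧ = λ a → a ∷ []
    ; ⟦⟧-cong = λ e → ∷-cong e ≋-refl
    ; +-homo = λ _ _ → ≋-refl
    ; *-homo = λ a b → ∷-cong (sym (+-identityʳ _)) ≋-refl
    ; 1-homo = ≋-refl }

  module Eval (S : CommutativeRing 0ℓ 0ℓ) (φ : Hom R S) (s : CommutativeRing.Carrier S) where
    private
      module S = CommutativeRing S
      module SK = RingKit S
      module φ = Hom φ

    eval : Poly → S.Carrier
    eval [] = S.0#
    eval (a ∷ p) = φ.⟦ a ⟧ S.+ s S.* eval p

    eval-[] : ∀ p → p ≋ [] → eval p S.≈ S.0#
    eval-[] [] e = S.refl
    eval-[] (a ∷ p) e = S.trans (S.+-cong (S.trans (φ.⟦⟧-cong (at e 0)) φ.0-homo)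
      (S.trans (S.*-congˡ (eval-[] p (mk≋ λ i → at e (suc i)))) (S.zeroʳ s))) (S.+-identityˡ _)

    eval-cong : ∀ p q → p ≋ q → eval p S.≈ eval q
    eval-cong [] q e = S.sym (eval-[] q (≋-sym e))
    eval-cong (a ∷ p) [] e = eval-[] (a ∷ p) e
    eval-cong (a ∷ p) (b ∷ q) e = S.+-cong (φ.⟦⟧-cong (≋-head e)) (S.*-congˡ (eval-cong p q (≋-tail e)))

    eval-⊕ : ∀ p q → eval (p ⊕ q) S.≈ eval p S.+ eval q
    eval-⊕ [] q = S.sym (S.+-identityˡ _)
    eval-⊕ (a ∷ p) [] = S.sym (S.+-identityʳ _)
    eval-⊕ (a ∷ p) (b ∷ q) = S.trans (S.+-cong (φ.+-homo a b) (S.*-congˡ (eval-⊕ p q)))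
      (SK.solve 5 (λ a b s x y → (a SK.:+ b) SK.:+ s SK.:* (x SK.:+ y) SK.:= (a SK.:+ s SK.:* x) SK.:+ (b SK.:+ s SK.:* y))
        S.refl _ _ _ _ _)

    eval-· : ∀ a p → eval (a · p) S.≈ φ.⟦ a ⟧ S.* eval p
    eval-· a [] = S.sym (S.zeroʳ _)
    eval-· a (b ∷ p) = S.trans (S.+-cong (φ.*-homo a b) (S.*-congˡ (eval-· a p)))
      (SK.solve 4 (λ a b s x → (a SK.:* b) SK.:+ s SK.:* (a SK.:* x) SK.:= a SK.:* (b SK.:+ s SK.:* x)) S.refl _ _ _ _)

    eval-⊗ : ∀ p q → eval (p ⊗ q) S.≈ eval p S.* eval q
    eval-⊗ [] q = S.sym (S.zeroˡ _)
    eval-⊗ (a ∷ p) q = S.trans (eval-⊕ (a · q) (0# ∷ p ⊗ q))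
      (S.trans (S.+-cong (eval-· a q) (S.+-cong φ.0-homo (S.*-congˡ (eval-⊗ p q))))
        (SK.solve 4 (λ a x s y → a SK.:* y SK.:+ (SK.con (+ 0) SK.:+ s SK.:* (x SK.:* y)) SK.:= (a SK.:+ s SK.:* x) SK.:* y)
          S.refl _ _ _ _))

    eval-const : ∀ a → eval (a ∷ []) S.≈ φ.⟦ a ⟧
    eval-const a = S.trans (S.+-congˡ (S.zeroʳ s)) (S.+-identityʳ _)

    eval-X : eval X S.≈ s
    eval-X = S.trans (S.+-cong φ.0-homo (S.*-congˡ (S.trans (eval-const 1#) φ.1-homo)))
      (S.trans (S.+-identityˡ _) (S.*-identityʳ s))

  evalHom : (S : CommutativeRing 0ℓ 0ℓ) → Hom R S → CommutativeRing.Carrier S → Hom polyRing S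
  evalHom S φ s = record
    { ⟦_⟧ = eval ; ⟦⟧-cong = eval-cong _ _ ; +-homo = eval-⊕ ; *-homo = eval-⊗
    ; 1-homo = CommutativeRing.trans S (eval-const 1#) (Hom.1-homo φ) }
    where open Eval S φ s

-- Derivations.

record Derivation (R : CommutativeRing 0ℓ 0ℓ) : Set where
  open CommutativeRing R
  field
    δ : Carrier → Carrier
    δ-cong : ∀ {x y} → x ≈ y → δ x ≈ δ y
    δ-+ : ∀ x y → δ (x + y) ≈ δ x + δ y
    δ-* : ∀ x y → δ (x * y) ≈ δ x * y + x * δ y

  open RingKit R
  δ-0 : δ 0# ≈ 0#
  δ-0 = x+x≈x⇒x≈0 _ (trans (sym (δ-+ _ _)) (δ-cong (+-identityˡ _)))

  δ-1 : δ 1# ≈ 0#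
  δ-1 = x+x≈x⇒x≈0 _ (trans (+-cong (sym (*-identityʳ _)) (sym (*-identityˡ _)))
    (trans (sym (δ-* 1# 1#)) (δ-cong (*-identityˡ _))))

  δ-⨯ : ∀ n x → δ (n ⨯ x) ≈ n ⨯ δ x
  δ-⨯ zero x = δ-0
  δ-⨯ (suc n) x = trans (δ-+ _ _) (+-congˡ (δ-⨯ n x))

  δ-κ : ∀ n → δ (κ n) ≈ 0#
  δ-κ n = trans (δ-⨯ n 1#) (trans (×-congʳ n δ-1) (n⨯0 n))
    where
    n⨯0 : ∀ n → n ⨯ 0# ≈ 0#
    n⨯0 zero = refl
    n⨯0 (suc n) = trans (+-identityˡ _) (n⨯0 n)

  δ-sub : ∀ x y → δ (x - y) ≈ δ x - δ y
  δ-sub x y = trans (solve 2 (λ a b → a := (a :+ b) :- b) refl _ (δ y))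
    (+-congʳ (trans (sym (δ-+ _ _)) (δ-cong (solve 2 (λ a b → (a :- b) :+ b := a) refl x y))))

-- Serves twice: for d/dt on F_p[t], with `X₁` = 1, and for a Kummer extension, where v is sent to a
-- multiple of v.
module PolyDerivation (R : CommutativeRing 0ℓ 0ℓ) (∂ : Derivation R) (X₁ : List (CommutativeRing.Carrier R)) where
  open CommutativeRing R
  open Polynomials R
  open Derivation ∂ renaming (δ to δ₀; δ-cong to δ₀-cong; δ-+ to δ₀-+; δ-* to δ₀-*; δ-0 to δ₀-0)
  open PK using (_:+_; _:*_; _:=_; con)

  -- The derivation of R[X] that extends δ₀ and sends X to X₁.
  D : Poly → Poly
  D [] = []
  D (a ∷ p) = (δ₀ a ∷ []) ⊕ ((0# ∷ D p) ⊕ X₁ ⊗ p)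

  D∷ : ∀ a p → D (a ∷ p) ≋ (δ₀ a ∷ []) ⊕ (X ⊗ D p ⊕ X₁ ⊗ p)
  D∷ a p = P.+-congˡ {δ₀ a ∷ []} (P.+-congʳ {X₁ ⊗ p} (P.sym (X⊗ (D p))))

  D-[] : ∀ p → p ≋ [] → D p ≋ []
  D-[] [] e = P.refl
  D-[] (a ∷ p) e = P.+-cong (∷≋[] (trans (δ₀-cong (at e 0)) δ₀-0) P.refl)
    (P.+-cong (∷≋[] refl (D-[] p e′)) (P.trans (P.*-congˡ {X₁} e′) (P.zeroʳ X₁)))
    where e′ = mk≋ λ i → at e (suc i)

  D-cong : ∀ p q → p ≋ q → D p ≋ D q
  D-cong [] q e = P.sym (D-[] q (P.sym e))
  D-cong (a ∷ p) [] e = D-[] (a ∷ p) e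
  D-cong (a ∷ p) (b ∷ q) e = P.+-cong (∷-cong (δ₀-cong (≋-head e)) P.refl)
    (P.+-cong (∷-cong refl (D-cong p q (≋-tail e))) (P.*-congˡ {X₁} (≋-tail e)))

  D-⊕ : ∀ p q → D (p ⊕ q) ≋ D p ⊕ D q
  D-⊕ [] q = P.refl
  D-⊕ (a ∷ p) [] = P.sym (P.+-identityʳ _)
  D-⊕ (a ∷ p) (b ∷ q) = P.trans (D∷ (a + b) (p ⊕ q)) (P.trans
    (P.+-cong (∷-cong (δ₀-+ a b) P.refl) (P.+-congʳ (P.*-congˡ {X} (D-⊕ p q))))
    (P.trans (PK.solve 8 (λ A B x P′ Q′ x₁ p q → (A :+ B) :+ (x :* (P′ :+ Q′) :+ x₁ :* (p :+ q))
        := (A :+ (x :* P′ :+ x₁ :* p)) :+ (B :+ (x :* Q′ :+ x₁ :* q))) P.refl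
        (δ₀ a ∷ []) (δ₀ b ∷ []) X (D p) (D q) X₁ p q)
    (P.sym (P.+-cong (D∷ a p) (D∷ b q)))))

  D-const : ∀ a → D (a ∷ []) ≋ (δ₀ a ∷ [])
  D-const a = P.trans (D∷ a []) (PK.solve 3 (λ A x x₁ → A :+ (x :* con (+ 0) :+ x₁ :* con (+ 0)) := A) P.refl (δ₀ a ∷ []) X X₁)

  D-X⊗ : ∀ p → D (X ⊗ p) ≋ X ⊗ D p ⊕ X₁ ⊗ p
  D-X⊗ p = P.trans (D-cong (X ⊗ p) (0# ∷ p) (X⊗ p)) (P.trans (D∷ 0# p) (P.+-congʳ (∷≋[] δ₀-0 P.refl)))

  D-· : ∀ a p → D ((a ∷ []) ⊗ p) ≋ (δ₀ a ∷ []) ⊗ p ⊕ (a ∷ []) ⊗ D p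
  D-· a p = P.trans (D-cong _ _ (P.sym (·≋ a p))) (go p)
    where
    go : ∀ p → D (a · p) ≋ (δ₀ a ∷ []) ⊗ p ⊕ (a ∷ []) ⊗ D p
    go [] = P.sym (P.trans (P.+-cong (P.zeroʳ (δ₀ a ∷ [])) (P.zeroʳ (a ∷ []))) P.refl)
    go (b ∷ p) = P.trans (D∷ (a * b) (a · p)) (P.trans
      (P.+-cong (P.trans (Hom.⟦⟧-cong constHom (δ₀-* a b))
          (P.trans (Hom.+-homo constHom (δ₀ a * b) (a * δ₀ b)) (P.+-cong (Hom.*-homo constHom (δ₀ a) b) (Hom.*-homo constHom a (δ₀ b)))))
        (P.+-cong (P.*-congˡ {X} (go p)) (P.*-congˡ {X₁} (·≋ a p))))
      (P.trans (PK.solve 8 (λ a′ b a b′ x p dp x₁ → (a′ :* b :+ a :* b′) :+ (x :* (a′ :* p :+ a :* dp) :+ x₁ :* (a :* p))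
          := a′ :* (b :+ x :* p) :+ a :* (b′ :+ (x :* dp :+ x₁ :* p))) P.refl
          (δ₀ a ∷ []) (b ∷ []) (a ∷ []) (δ₀ b ∷ []) X p (D p) X₁)
      (P.sym (P.+-cong (P.*-congˡ {δ₀ a ∷ []} (∷≋ b p)) (P.*-congˡ {a ∷ []} (D∷ b p))))))

  D-⊗ : ∀ p q → D (p ⊗ q) ≋ D p ⊗ q ⊕ p ⊗ D q
  D-⊗ [] q = P.refl
  D-⊗ (a ∷ p) q = P.trans (D-cong ((a ∷ p) ⊗ q) _ (P.trans (P.*-congʳ {q} (∷≋ a p))
      (P.trans (P.distribʳ q (a ∷ []) (X ⊗ p)) (P.+-congˡ {(a ∷ []) ⊗ q} (P.*-assoc X p q)))))
    (P.trans (D-⊕ ((a ∷ []) ⊗ q) (X ⊗ (p ⊗ q)))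
    (P.trans (P.+-cong (D-· a q) (P.trans (D-X⊗ (p ⊗ q)) (P.+-congʳ (P.*-congˡ {X} (D-⊗ p q)))))
    (P.trans (PK.solve 8 (λ a′ q a q′ x p′ p x₁ → (a′ :* q :+ a :* q′) :+ (x :* (p′ :* q :+ p :* q′) :+ x₁ :* (p :* q))
        := (a′ :+ (x :* p′ :+ x₁ :* p)) :* q :+ (a :+ x :* p) :* q′) P.refl
        (δ₀ a ∷ []) q (a ∷ []) (D q) X (D p) p X₁)
    (P.sym (P.+-cong (P.*-congʳ {q} (D∷ a p)) (P.*-congʳ {D q} (∷≋ a p)))))))

  polyDerivation : Derivation polyRing
  polyDerivation = record { δ = D ; δ-cong = D-cong _ _ ; δ-+ = D-⊕ ; δ-* = D-⊗ }

-- Kummer extensions, their derivations and automorphisms.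

module Extension (R : CommutativeRing 0ℓ 0ℓ) (d′ : ℕ) (ℓ : CommutativeRing.Carrier R) where
  open CommutativeRing R
  open RingKit R
  open Polynomials R

  -- nf p e is the coefficient of v^e (e ≤ d′) in p(v), where v^(1 + d′) = ℓ.
  nf : Poly → ℕ → Carrier
  nf [] e = 0#
  nf (a ∷ p) zero = a + ℓ * nf p d′
  nf (a ∷ p) (suc e) = nf p e

  nf-⊕ : ∀ p q e → nf (p ⊕ q) e ≈ nf p e + nf q e
  nf-⊕ [] q e = sym (+-identityˡ _)
  nf-⊕ (a ∷ p) [] e = sym (+-identityʳ _)
  nf-⊕ (a ∷ p) (b ∷ q) zero = trans (+-congˡ (*-congˡ (nf-⊕ p q d′)))
    (solve 5 (λ a b l x y → (a :+ b) :+ l :* (x :+ y) := (a :+ l :* x) :+ (b :+ l :* y)) refl _ _ _ _ _)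
  nf-⊕ (a ∷ p) (b ∷ q) (suc e) = nf-⊕ p q e

  nf-· : ∀ a p e → nf (a · p) e ≈ a * nf p e
  nf-· a [] e = sym (zeroʳ a)
  nf-· a (b ∷ p) zero = trans (+-congˡ (*-congˡ (nf-· a p d′)))
    (solve 4 (λ a b l x → a :* b :+ l :* (a :* x) := a :* (b :+ l :* x)) refl _ _ _ _)
  nf-· a (b ∷ p) (suc e) = nf-· a p e

  nf-⊖ : ∀ p e → nf (⊖ p) e ≈ - nf p e
  nf-⊖ [] e = sym (trans (sym (+-identityˡ _)) (-‿inverseʳ 0#))
  nf-⊖ (b ∷ p) zero = trans (+-congˡ (*-congˡ (nf-⊖ p d′)))
    (solve 3 (λ b l x → :- b :+ l :* (:- x) := :- (b :+ l :* x)) refl _ _ _)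
  nf-⊖ (b ∷ p) (suc e) = nf-⊖ p e

  nf-[] : ∀ p → p ≋ [] → ∀ e → nf p e ≈ 0#
  nf-[] [] _ e = refl
  nf-[] (a ∷ p) h zero = trans (+-cong (at h 0) (*-congˡ (nf-[] p (mk≋ (at h ∘ suc)) d′)))
    (trans (+-identityˡ _) (zeroʳ ℓ))
  nf-[] (a ∷ p) h (suc e) = nf-[] p (mk≋ (at h ∘ suc)) e

  nf-cong : ∀ p q → p ≋ q → ∀ e → nf p e ≈ nf q e
  nf-cong [] q h e = sym (nf-[] q (P.sym h) e)
  nf-cong (a ∷ p) [] h e = nf-[] (a ∷ p) h e
  nf-cong (a ∷ p) (b ∷ q) h zero = +-cong (≋-head h) (*-congˡ (nf-cong p q (≋-tail h) d′))
  nf-cong (a ∷ p) (b ∷ q) h (suc e) = nf-cong p q (≋-tail h) e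

  infix 4 _≈ₑ_
  -- Comparing reduced coefficients turns the polynomials themselves into the quotient by v^(1 + d′)
  -- - ℓ. The operations stay those of polynomials, and most ring laws are inherited through `≋⇒≈ₑ`.
  record _≈ₑ_ (p q : Poly) : Set where
    constructor mkₑ
    field atₑ : ∀ e → e ≤ d′ → nf p e ≈ nf q e
  open _≈ₑ_ public

  ≋⇒≈ₑ : ∀ {p q} → p ≋ q → p ≈ₑ q
  ≋⇒≈ₑ {p} {q} h = mkₑ λ e _ → nf-cong p q h e

  private
    x-cong : ∀ {p q} → p ≈ₑ q → ∀ e → e ≤ d′ → nf (0# ∷ p) e ≈ nf (0# ∷ q) e
    x-cong h zero _ = +-congˡ (*-congˡ (atₑ h d′ ℕₚ.≤-refl))
    x-cong h (suc e) e≤ = atₑ h e (ℕₚ.<⇒≤ e≤)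

    ⊗-congˡ : ∀ q {p p′} → p ≈ₑ p′ → q ⊗ p ≈ₑ q ⊗ p′
    ⊗-congˡ [] h = mkₑ λ _ _ → refl
    ⊗-congˡ (a ∷ q) {p} {p′} h = mkₑ λ e e≤ →
      trans (nf-⊕ (a · p) (0# ∷ q ⊗ p) e)
      (trans (+-cong (trans (nf-· a p e) (trans (*-congˡ (atₑ h e e≤)) (sym (nf-· a p′ e)))) (x-cong (⊗-congˡ q h) e e≤))
      (sym (nf-⊕ (a · p′) (0# ∷ q ⊗ p′) e)))

    ≈ₑ-trans : ∀ {p q r} → p ≈ₑ q → q ≈ₑ r → p ≈ₑ r
    ≈ₑ-trans h k = mkₑ λ e e≤ → trans (atₑ h e e≤) (atₑ k e e≤)

    ⊗-cong : ∀ {p p′ q q′} → p ≈ₑ p′ → q ≈ₑ q′ → p ⊗ q ≈ₑ p′ ⊗ q′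
    ⊗-cong {p} {p′} {q} {q′} h k = ≈ₑ-trans (⊗-congˡ p k) (≈ₑ-trans (≋⇒≈ₑ (P.*-comm p q′))
      (≈ₑ-trans (⊗-congˡ q′ h) (≋⇒≈ₑ (P.*-comm q′ p′))))

  abstract
    extRing-isCommutativeRing : IsCommutativeRing _≈ₑ_ _⊕_ _⊗_ ⊖_ [] (1# ∷ [])
    extRing-isCommutativeRing = record
        { isRing = record
          { +-isAbelianGroup = record
            { isGroup = record
              { isMonoid = record
                { isSemigroup = record
                  { isMagma = record
                    { isEquivalence = record
                      { refl = mkₑ λ _ _ → refl ; sym = λ h → mkₑ λ e e≤ → sym (atₑ h e e≤) ; trans = ≈ₑ-trans }
                    ; ∙-cong = λ {p} {p′} {q} {q′} h k → mkₑ λ e e≤ →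
                        trans (nf-⊕ p q e) (trans (+-cong (atₑ h e e≤) (atₑ k e e≤)) (sym (nf-⊕ p′ q′ e))) }
                  ; assoc = λ p q r → ≋⇒≈ₑ (P.+-assoc p q r) }
                ; identity = (λ _ → mkₑ λ _ _ → refl) , λ p → ≋⇒≈ₑ (P.+-identityʳ p) }
              ; inverse = (λ p → ≋⇒≈ₑ (P.-‿inverseˡ p)) , λ p → ≋⇒≈ₑ (P.-‿inverseʳ p)
              ; ⁻¹-cong = λ {p} {q} h → mkₑ λ e e≤ → trans (nf-⊖ p e) (trans (-‿cong (atₑ h e e≤)) (sym (nf-⊖ q e))) }
            ; comm = λ p q → ≋⇒≈ₑ (P.+-comm p q) }
          ; *-cong = ⊗-cong
          ; *-assoc = λ p q r → ≋⇒≈ₑ (P.*-assoc p q r)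
          ; *-identity = (λ p → ≋⇒≈ₑ (P.*-identityˡ p)) , λ p → ≋⇒≈ₑ (P.*-identityʳ p)
          ; distrib = (λ p q r → ≋⇒≈ₑ (P.distribˡ p q r)) , λ p q r → ≋⇒≈ₑ (P.distribʳ p q r) }
        ; *-comm = λ p q → ≋⇒≈ₑ (P.*-comm p q) }

  extRing : CommutativeRing 0ℓ 0ℓ
  extRing = record
    { Carrier = Poly ; _≈_ = _≈ₑ_ ; _+_ = _⊕_ ; _*_ = _⊗_ ; -_ = ⊖_ ; 0# = [] ; 1# = 1# ∷ []
    ; isCommutativeRing = extRing-isCommutativeRing }

  module E = CommutativeRing extRing
  module EK = RingKit extRing

  ι : Hom R extRing
  ι = record
    { ⟦_⟧ = λ a → a ∷ []
    ; ⟦⟧-cong = λ h → ≋⇒≈ₑ (Hom.⟦⟧-cong constHom h)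
    ; +-homo = λ x y → ≋⇒≈ₑ (Hom.+-homo constHom x y)
    ; *-homo = λ x y → ≋⇒≈ₑ (Hom.*-homo constHom x y)
    ; 1-homo = E.refl }
  module ι = Hom ι

  v : Poly
  v = X

  nf-ι-0 : ∀ a → nf ι.⟦ a ⟧ 0 ≈ a
  nf-ι-0 a = trans (+-congˡ (zeroʳ ℓ)) (+-identityʳ a)

  nf-ι* : ∀ a p e → nf (ι.⟦ a ⟧ ⊗ p) e ≈ a * nf p e
  nf-ι* a p e = trans (nf-cong _ _ (P.sym (·≋ a p)) e) (nf-· a p e)

  nf-v*-0 : ∀ p → nf (v ⊗ p) 0 ≈ ℓ * nf p d′
  nf-v*-0 p = trans (nf-cong _ _ (X⊗ p) 0) (+-identityˡ _)

  nf-v*-suc : ∀ p e → nf (v ⊗ p) (suc e) ≈ nf p e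
  nf-v*-suc p e = nf-cong _ _ (X⊗ p) (suc e)

  nf-applyUpTo-≥ : ∀ c n e → n ≤ e → e ≤ d′ → nf (List.applyUpTo c n) e ≈ 0#
  nf-applyUpTo-≥ c zero e _ _ = refl
  nf-applyUpTo-≥ c (suc n) (suc e) (s≤s n≤e) e≤ = nf-applyUpTo-≥ (c ∘ suc) n e n≤e (ℕₚ.<⇒≤ e≤)

  nf-applyUpTo : ∀ c n e → n ≤ suc d′ → e < n → nf (List.applyUpTo c n) e ≈ c e
  nf-applyUpTo c (suc n) zero (s≤s n≤d′) _ = trans
    (+-congˡ (trans (*-congˡ (nf-applyUpTo-≥ (c ∘ suc) n d′ n≤d′ ℕₚ.≤-refl)) (zeroʳ ℓ))) (+-identityʳ _)
  nf-applyUpTo c (suc n) (suc e) n≤ (s≤s e<n) = nf-applyUpTo (c ∘ suc) n e (ℕₚ.<⇒≤ n≤) e<n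

  normal : ∀ p → p ≈ₑ List.applyUpTo (nf p) (suc d′)
  normal p = mkₑ λ e e≤ → sym (nf-applyUpTo (nf p) (suc d′) e ℕₚ.≤-refl (s≤s e≤))

  nf-v^* : ∀ n e p → nf ((v EK.^ n) ⊗ p) (n ℕ.+ e) ≈ nf p e
  nf-v^* zero e p = nf-cong ((1# ∷ []) ⊗ p) p (P.*-identityˡ p) e
  nf-v^* (suc n) e p = trans (nf-cong ((v ⊗ (v EK.^ n)) ⊗ p) _ (P.*-assoc v (v EK.^ n) p) (suc (n ℕ.+ e)))
    (trans (nf-v*-suc ((v EK.^ n) ⊗ p) (n ℕ.+ e)) (nf-v^* n e p))

  module ExtEval (S : CommutativeRing 0ℓ 0ℓ) (φ : Hom R S) (s : CommutativeRing.Carrier S)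
                 (s^d : CommutativeRing._≈_ S (RingKit._^_ S s (suc d′)) (Hom.⟦_⟧ φ ℓ)) where
    private
      module S = CommutativeRing S
      module SK = RingKit S
      module φ = Hom φ
    open Eval S φ s public

    evalN : (ℕ → Carrier) → ℕ → S.Carrier
    evalN c zero = S.0#
    evalN c (suc n) = φ.⟦ c 0 ⟧ S.+ s S.* evalN (c ∘ suc) n

    evalN-cong : ∀ c c′ n → (∀ e → e < n → c e ≈ c′ e) → evalN c n S.≈ evalN c′ n
    evalN-cong c c′ zero h = S.refl
    evalN-cong c c′ (suc n) h = S.+-cong (φ.⟦⟧-cong (h 0 (s≤s z≤n)))
      (S.*-congˡ (evalN-cong (c ∘ suc) (c′ ∘ suc) n λ e e<n → h (suc e) (s≤s e<n)))

    evalN-last : ∀ c n → evalN c (suc n) S.≈ evalN c n S.+ s SK.^ n S.* φ.⟦ c n ⟧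
    evalN-last c zero = SK.solve 2 (λ a s → a SK.:+ s SK.:* SK.con (+ 0) SK.:= SK.con (+ 0) SK.:+ SK.con (+ 1) SK.:* a) S.refl _ _
    evalN-last c (suc n) = S.trans (S.+-congˡ (S.*-congˡ (evalN-last (c ∘ suc) n)))
      (SK.solve 5 (λ a s x y z → a SK.:+ s SK.:* (x SK.:+ y SK.:* z) SK.:= (a SK.:+ s SK.:* x) SK.:+ (s SK.:* y) SK.:* z)
        S.refl _ _ _ _ _)

    -- A coefficient carried past exponent `d′` re-enters at 0 with a factor `ℓ`, and in `S` this
    -- factor is s^(1 + d′). Evaluation therefore depends on the normal form only, which is the
    -- universal property of the quotient.
    eval≈evalN : ∀ p → eval p S.≈ evalN (nf p) (suc d′)
    eval≈evalN [] = S.sym (go (suc d′))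
      where
      go : ∀ n → evalN (λ _ → 0#) n S.≈ S.0#
      go zero = S.refl
      go (suc n) = S.trans (S.+-cong φ.0-homo (S.trans (S.*-congˡ (go n)) (S.zeroʳ s))) (S.+-identityˡ _)
    eval≈evalN (a ∷ p) = S.sym (S.trans
      (S.+-congʳ (S.trans (φ.+-homo _ _) (S.+-congˡ (S.trans (φ.*-homo _ _) (S.*-congʳ (S.sym s^d))))))
      (S.trans (SK.solve 5 (λ a s k x y → (a SK.:+ (s SK.:* k) SK.:* x) SK.:+ s SK.:* y SK.:= a SK.:+ s SK.:* (y SK.:+ k SK.:* x))
        S.refl _ _ _ _ _)
      (S.+-congˡ (S.*-congˡ (S.sym (S.trans (eval≈evalN p) (evalN-last (nf p) d′)))))))

    extHom : Hom extRing S
    extHom = record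
      { ⟦_⟧ = eval
      ; ⟦⟧-cong = λ {p} {q} h → S.trans (eval≈evalN p) (S.trans
          (evalN-cong _ _ (suc d′) λ { e (s≤s e≤) → atₑ h e e≤ }) (S.sym (eval≈evalN q)))
      ; +-homo = eval-⊕ ; *-homo = eval-⊗
      ; 1-homo = S.trans (eval-const 1#) φ.1-homo }

  v^d≈ℓ : v EK.^ suc d′ E.≈ ι.⟦ ℓ ⟧
  v^d≈ℓ = E.trans (pow d′ ℕₚ.≤-refl) top
    where
    mono : ℕ → Poly
    mono zero = 1# ∷ []
    mono (suc n) = 0# ∷ mono n
    pow : ∀ n → n ≤ d′ → v EK.^ suc n E.≈ (0# ∷ mono n)
    pow zero _ = ≋⇒≈ₑ (P.*-identityʳ v)
    pow (suc n) n≤ = E.trans (E.*-congˡ {v} (pow n (ℕₚ.<⇒≤ n≤))) (≋⇒≈ₑ (X⊗ (mono (suc n))))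
    hi : ∀ n e → n < e → nf (mono n) e ≈ 0#
    hi zero (suc e) _ = refl
    hi (suc n) (suc e) (s≤s n<e) = hi n e n<e
    eq : ∀ n → nf (mono n) n ≈ 1#
    eq zero = trans (+-congˡ (zeroʳ ℓ)) (+-identityʳ _)
    eq (suc n) = eq n
    lo : ∀ n → n ≤ d′ → ∀ e → e < n → nf (mono n) e ≈ 0#
    lo (suc n) n≤ zero _ = trans (+-identityˡ _) (trans (*-congˡ (hi n d′ n≤)) (zeroʳ ℓ))
    lo (suc n) n≤ (suc e) (s≤s e<) = lo n (ℕₚ.<⇒≤ n≤) e e<
    top : (0# ∷ mono d′) E.≈ ι.⟦ ℓ ⟧
    top = mkₑ λ { zero _ → trans (+-identityˡ _) (trans (*-congˡ (eq d′)) (trans (*-identityʳ ℓ) (sym (nf-ι-0 ℓ))))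
                ; (suc e) e< → lo d′ ℕₚ.≤-refl e e< }

idHom : (R : CommutativeRing 0ℓ 0ℓ) → Hom R R
idHom R = record { ⟦_⟧ = id ; ⟦⟧-cong = id ; +-homo = λ _ _ → refl ; *-homo = λ _ _ → refl ; 1-homo = refl }
  where open CommutativeRing R

module Factor (R : CommutativeRing 0ℓ 0ℓ) (r : CommutativeRing.Carrier R) where
  open CommutativeRing R
  open Polynomials R
  open Eval R (idHom R) r
  open PK using (_:+_; _:*_; _:=_; _:-_)

  -- Synthetic division by X - r: the coefficients of the quotient are the intermediate values of
  -- Horner's scheme.
  quot : Poly → Poly
  quot [] = []
  quot (a ∷ []) = []
  quot (a ∷ b ∷ p) = eval (b ∷ p) ∷ quot (b ∷ p)

  length-quot : ∀ p → length (quot p) ≡ ℕ.pred (length p)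
  length-quot [] = ≡.refl
  length-quot (a ∷ []) = ≡.refl
  length-quot (a ∷ b ∷ p) = ≡.cong suc (length-quot (b ∷ p))

  factor : ∀ p → p ≋ (eval p ∷ []) ⊕ (X ⊕ (⊖ (r ∷ []))) ⊗ quot p
  factor [] = P.sym (P.trans (P.+-congˡ {0# ∷ []} (P.zeroʳ (X ⊕ (⊖ (r ∷ []))))) (∷≋[] refl P.refl))
  factor (a ∷ []) = P.sym (P.trans (P.+-congˡ {eval (a ∷ []) ∷ []} (P.zeroʳ (X ⊕ (⊖ (r ∷ []))))) (∷-cong (eval-const a) P.refl))
  factor (a ∷ p@(b ∷ p′)) = P.trans (∷≋ a p) (P.trans (P.+-congˡ {a ∷ []} (P.*-congˡ {X} (factor p)))
    (P.trans (PK.solve 5 (λ a x y r q → a :+ x :* (y :+ (x :- r) :* q) := (a :+ r :* y) :+ (x :- r) :* (y :+ x :* q))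
        P.refl (a ∷ []) X (eval p ∷ []) (r ∷ []) (quot p))
    (P.+-cong (P.sym (P.trans (Hom.+-homo constHom a (r * eval p)) (P.+-congˡ {a ∷ []} (Hom.*-homo constHom r (eval p)))))
      (P.*-congˡ {X ⊕ (⊖ (r ∷ []))} (P.sym (∷≋ (eval p) (quot p)))))))

module ExtDerivation (R : CommutativeRing 0ℓ 0ℓ) (d′ : ℕ) (ℓ : CommutativeRing.Carrier R)
                     (∂ : Derivation R) (θ : CommutativeRing.Carrier R)
                     (dθ : CommutativeRing._≈_ R (RingKit._⨯_ R (suc d′) θ) (Derivation.δ ∂ ℓ)) where
  open CommutativeRing R
  open RingKit R
  open Polynomials R
  open Extension R d′ ℓ
  open Derivation ∂

  -- Differentiating v^d = ℓ gives δ v = v δ ℓ / (d ℓ). Scaling the derivation by `ℓ` removes this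
  -- denominator: v goes to θ v with d θ = δ ℓ, and nothing has to be localised.
  ℓδ : Derivation R
  ℓδ = record
    { δ = λ x → ℓ * δ x
    ; δ-cong = λ h → *-congˡ (δ-cong h)
    ; δ-+ = λ x y → trans (*-congˡ (δ-+ x y)) (distribˡ _ _ _)
    ; δ-* = λ x y → trans (*-congˡ (δ-* x y))
        (solve 5 (λ l a y x b → l :* (a :* y :+ x :* b) := (l :* a) :* y :+ x :* (l :* b)) refl _ _ _ _ _) }

  open PolyDerivation R ℓδ (0# ∷ θ ∷ [])

  nf-θv : ∀ k p e → nf ((0# ∷ k ∷ []) ⊗ p) e ≈ nf (0# ∷ (k · p)) e
  nf-θv k p e = nf-cong _ _ (P.trans (P.+-congʳ {0# ∷ (k ∷ []) ⊗ p} (P.trans (·≋ 0# p) (P.*-congʳ {p} (∷≋[] refl P.refl))))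
    (∷-cong refl (P.sym (·≋ k p)))) e

  -- Since v goes to θ v, the monomial v^e goes to e θ v^e and the coordinates do not mix. Hence the
  -- derivation respects equality of normal forms.
  nf-D : ∀ p e → e ≤ d′ → nf (D p) e ≈ ℓ * δ (nf p e) + (e ⨯ θ) * nf p e
  nf-D [] e _ = sym (trans (+-cong (trans (*-congˡ δ-0) (zeroʳ ℓ)) (zeroʳ _)) (+-identityˡ _))
  nf-D (a ∷ p) zero _ = trans (nf-⊕ (ℓ * δ a ∷ []) ((0# ∷ D p) ⊕ (0# ∷ θ ∷ []) ⊗ p) 0) (trans
    (+-cong (nf-ι-0 _) (trans (nf-⊕ (0# ∷ D p) ((0# ∷ θ ∷ []) ⊗ p) 0)
      (+-cong (trans (+-identityˡ _) (*-congˡ (nf-D p d′ ℕₚ.≤-refl)))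
        (trans (nf-θv θ p 0) (trans (+-identityˡ _) (*-congˡ (nf-· θ p d′)))))))
    -- The two terms with θ add up to (1 + d′) θ = δ ℓ and complete the product rule for ℓ c. The
    -- padded zero product is the eigenvalue 0 of v^0.
    (trans (solve 6 (λ l da dc n θ c → l :* da :+ (l :* (l :* dc :+ n :* c) :+ l :* (θ :* c))
        := l :* (da :+ ((θ :+ n) :* c :+ l :* dc)) :+ con (+ 0) :* (con (+ 0))) refl ℓ (δ a) (δ c) (d′ ⨯ θ) θ c)
    (+-cong (*-congˡ (sym (trans (δ-+ a (ℓ * c)) (+-congˡ (trans (δ-* ℓ c) (+-congʳ (*-congʳ (sym dθ)))))))) (trans (zeroˡ _) (sym (zeroˡ _))))))
    where c = nf p d′
  nf-D (a ∷ p) (suc e) e< = trans (nf-⊕ (ℓ * δ a ∷ []) ((0# ∷ D p) ⊕ (0# ∷ θ ∷ []) ⊗ p) (suc e)) (trans (+-identityˡ _)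
    (trans (nf-⊕ (0# ∷ D p) ((0# ∷ θ ∷ []) ⊗ p) (suc e))
    (trans (+-cong (nf-D p e (ℕₚ.<⇒≤ e<)) (trans (nf-θv θ p (suc e)) (nf-· θ p e)))
      (solve 4 (λ a n c t → (a :+ n :* c) :+ t :* c := a :+ (t :+ n) :* c) refl _ _ _ _))))

  extDerivation : Derivation extRing
  extDerivation = record
    { δ = D
    ; δ-cong = λ {p} {q} h → mkₑ λ e e≤ → trans (nf-D p e e≤)
        (trans (+-cong (*-congˡ (δ-cong (atₑ h e e≤))) (*-congˡ (atₑ h e e≤))) (sym (nf-D q e e≤)))
    ; δ-+ = λ p q → ≋⇒≈ₑ (D-⊕ p q)
    ; δ-* = λ p q → ≋⇒≈ₑ (D-⊗ p q) }

  D-ι : ∀ a → D ι.⟦ a ⟧ E.≈ ι.⟦ ℓ * δ a ⟧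
  D-ι a = ≋⇒≈ₑ (D-const a)

module ExtAutomorphism (R : CommutativeRing 0ℓ 0ℓ) (d′ : ℕ) (ℓ : CommutativeRing.Carrier R)
                       (k : CommutativeRing.Carrier R)
                       (k^d : CommutativeRing._≈_ R (RingKit._^_ R k (suc d′)) (CommutativeRing.1# R)) where
  open CommutativeRing R
  open RingKit R
  open Polynomials R
  open Extension R d′ ℓ

  kv : Poly
  kv = ι.⟦ k ⟧ ⊗ v

  kv^d : kv EK.^ suc d′ E.≈ ι.⟦ ℓ ⟧
  kv^d = E.trans (EK.^-distrib-* ι.⟦ k ⟧ v (suc d′)) (E.trans (E.*-cong (E.trans (E.sym (ι.^-homo k (suc d′)))
    (ι.⟦⟧-cong k^d)) v^d≈ℓ) (E.*-identityˡ _))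

  open ExtEval extRing ι kv kv^d

  σ : Hom extRing extRing
  σ = extHom

  -- The wrap from v^d to ℓ costs k^d = 1, so the automorphism is diagonal and its fixed elements
  -- can be found one coordinate at a time.
  nf-σ : ∀ p e → e ≤ d′ → nf (eval p) e ≈ k ^ e * nf p e
  nf-kv : ∀ p e → nf (kv ⊗ p) e ≈ k * nf (v ⊗ p) e
  nf-kv p e = trans (nf-cong (kv ⊗ p) _ (P.*-assoc ι.⟦ k ⟧ v p) e) (nf-ι* k (v ⊗ p) e)
  nf-σ [] e _ = sym (zeroʳ _)
  nf-σ (a ∷ p) zero _ = trans (nf-⊕ ι.⟦ a ⟧ (kv ⊗ eval p) 0) (trans
    (+-cong (nf-ι-0 a) (trans (nf-kv (eval p) 0) (*-congˡ (trans (nf-v*-0 (eval p)) (*-congˡ (nf-σ p d′ ℕₚ.≤-refl))))))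
    (trans (solve 5 (λ a k l kd c → a :+ k :* (l :* (kd :* c)) := a :+ (k :* kd) :* (l :* c)) refl a k ℓ (k ^ d′) (nf p d′))
    (trans (+-congˡ (trans (*-congʳ k^d) (*-identityˡ _))) (sym (*-identityˡ _)))))
  nf-σ (a ∷ p) (suc e) e< = trans (nf-⊕ ι.⟦ a ⟧ (kv ⊗ eval p) (suc e)) (trans (+-identityˡ _)
    (trans (nf-kv (eval p) (suc e)) (trans (*-congˡ (trans (nf-v*-suc (eval p) e) (nf-σ p e (ℕₚ.<⇒≤ e<)))) (sym (*-assoc _ _ _)))))

-- Principal ideals: radicality, comaximality, quotients.

module Ideals (R : CommutativeRing 0ℓ 0ℓ) where
  open CommutativeRing R
  open RingKit R

  infix 4 _∣ᵢ_
  record _∣ᵢ_ (c x : Carrier) : Set where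
    constructor _,ᵢ_
    field
      cofactor : Carrier
      equation : x ≈ c * cofactor
  open _∣ᵢ_ public

  -- The ideal generated by c is radical. Primality would be lost in the tower, where a prime may
  -- split on adjoining a root; radicality survives étale extensions.
  Reduced : Carrier → Set
  Reduced c = ∀ x k → c ∣ᵢ x ^ k → c ∣ᵢ x

  NonUnit : Carrier → Set
  NonUnit c = ¬ (c ∣ᵢ 1#)

  record Comaximal (c x : Carrier) : Set where
    constructor comax
    field
      r s : Carrier
      bezout : r * c + s * x ≈ 1#

  ∣-resp : ∀ {c c′ x x′} → c ≈ c′ → x ≈ x′ → c ∣ᵢ x → c′ ∣ᵢ x′
  ∣-resp e f (y ,ᵢ h) = y ,ᵢ trans (sym f) (trans h (*-congʳ e))

  ∣-+ : ∀ {c x y} → c ∣ᵢ x → c ∣ᵢ y → c ∣ᵢ x + y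
  ∣-+ (a ,ᵢ h) (b ,ᵢ k) = (a + b) ,ᵢ trans (+-cong h k) (sym (distribˡ _ _ _))

  ∣-*ˡ : ∀ {c x} y → c ∣ᵢ x → c ∣ᵢ y * x
  ∣-*ˡ y (a ,ᵢ h) = (y * a) ,ᵢ trans (*-congˡ h) (solve 3 (λ y c a → y :* (c :* a) := c :* (y :* a)) refl _ _ _)

  ∣-neg : ∀ {c x} → c ∣ᵢ x → c ∣ᵢ - x
  ∣-neg (a ,ᵢ h) = (- a) ,ᵢ trans (-‿cong h) (-‿distribʳ-* _ _)

  ∣-trans : ∀ {c x y} → c ∣ᵢ x → x ∣ᵢ y → c ∣ᵢ y
  ∣-trans (a ,ᵢ h) (b ,ᵢ k) = (a * b) ,ᵢ trans k (trans (*-congʳ h) (*-assoc _ _ _))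

  ∣-0 : ∀ {c} → c ∣ᵢ 0#
  ∣-0 = 0# ,ᵢ sym (zeroʳ _)

  ∣-refl : ∀ {c} → c ∣ᵢ c
  ∣-refl = 1# ,ᵢ sym (*-identityʳ _)

  comaximal-cancel : ∀ {c x y} → Comaximal c x → c ∣ᵢ x * y → c ∣ᵢ y
  comaximal-cancel {c} {x} {y} (comax r s h) (a ,ᵢ k) = (r * y + s * a) ,ᵢ trans (sym (*-identityˡ y))
    (trans (*-congʳ (sym h)) (trans (solve 5 (λ r c s x y → (r :* c :+ s :* x) :* y := c :* (r :* y) :+ s :* (x :* y)) refl r c s x y)
    (trans (+-congˡ (*-congˡ k)) (solve 5 (λ c r y s a → c :* (r :* y) :+ s :* (c :* a) := c :* (r :* y :+ s :* a)) refl c r y s a))))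

  Nilpotent : Carrier → Carrier → Set
  Nilpotent c x = ∃ λ k → c ∣ᵢ x ^ k

  nilpotent-* : ∀ {c} y {x} → Nilpotent c x → Nilpotent c (y * x)
  nilpotent-* y {x} (k , h) = k , ∣-resp refl (sym (^-distrib-* y x k)) (∣-*ˡ (y ^ k) h)

  -- Expanding one factor of (x + y)^l at a time moves it into x^i or y^j. When no factor is left, i
  -- + j ≥ m + n forces i ≥ m or j ≥ n, and no binomial coefficients appear.
  nilpotent-+ : ∀ {c x y} → Nilpotent c x → Nilpotent c y → Nilpotent c (x + y)
  nilpotent-+ {c} {x} {y} (m , h) (n , k) = m ℕ.+ n ,
    ∣-resp refl (trans (*-identityˡ _) (*-identityˡ _)) (go (m ℕ.+ n) 0 0 (ℕₚ.≤-reflexive (≡.sym (ℕₚ.+-identityʳ _))))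
    where
    big : ∀ {z} m i → c ∣ᵢ z ^ m → m ≤ i → c ∣ᵢ z ^ i
    big {z} m i h m≤i = ∣-resp refl (trans (sym (^-homo-* z (i ℕ.∸ m) m)) (reflexive (≡.cong (z ^_) (ℕₚ.m∸n+n≡m m≤i)))) (∣-*ˡ (z ^ (i ℕ.∸ m)) h)
    go : ∀ l i j → m ℕ.+ n ≤ l ℕ.+ (i ℕ.+ j) → c ∣ᵢ x ^ i * (y ^ j * (x + y) ^ l)
    go zero i j le with m ℕ.≤? i
    ... | yes m≤i = ∣-resp refl (*-comm _ _) (∣-*ˡ _ (big m i h m≤i))
    ... | no m≰i = ∣-*ˡ (x ^ i) (∣-resp refl (*-comm _ _) (∣-*ˡ _ (big n j k
            (ℕₚ.+-cancelˡ-≤ m n j (ℕₚ.≤-trans le (ℕₚ.+-monoˡ-≤ j (ℕₚ.<⇒≤ (ℕₚ.≰⇒> m≰i))))))))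
    go (suc l) i j le = ∣-resp refl
      (solve 5 (λ x y a b z → (x :* a) :* (b :* z) :+ a :* ((y :* b) :* z) := a :* (b :* ((x :+ y) :* z))) refl x y _ _ _)
      (∣-+ (go l (suc i) j (≡.subst (m ℕ.+ n ≤_) (≡.sym (ℕₚ.+-suc l (i ℕ.+ j))) le))
           (go l i (suc j) (≡.subst (m ℕ.+ n ≤_) (≡.sym (≡.trans (≡.cong (l ℕ.+_) (ℕₚ.+-suc i j)) (ℕₚ.+-suc l (i ℕ.+ j)))) le)))

  quotientRing : Carrier → CommutativeRing 0ℓ 0ℓ
  quotientRing c = record
    { Carrier = Carrier ; _≈_ = λ x y → c ∣ᵢ x - y ; _+_ = _+_ ; _*_ = _*_ ; -_ = -_ ; 0# = 0# ; 1# = 1#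
    ; isCommutativeRing = record
      { isRing = record
        { +-isAbelianGroup = record
          { isGroup = record
            { isMonoid = record
              { isSemigroup = record
                { isMagma = record
                  { isEquivalence = record
                    { refl = lift refl
                    ; sym = λ h → ∣-resp refl (solve 2 (λ x y → :- (x :- y) := y :- x) refl _ _) (∣-neg h)
                    ; trans = λ h k → ∣-resp refl (solve 3 (λ x y z → (x :- y) :+ (y :- z) := x :- z) refl _ _ _) (∣-+ h k) }
                  ; ∙-cong = λ h k → ∣-resp refl (solve 4 (λ x y u v → (x :- y) :+ (u :- v) := (x :+ u) :- (y :+ v)) refl _ _ _ _) (∣-+ h k) }
                ; assoc = λ x y z → lift (+-assoc x y z) }
              ; identity = (λ x → lift (+-identityˡ x)) , λ x → lift (+-identityʳ x) }
            ; inverse = (λ x → lift (-‿inverseˡ x)) , λ x → lift (-‿inverseʳ x)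
            ; ⁻¹-cong = λ h → ∣-resp refl (solve 2 (λ x y → :- (x :- y) := :- x :- :- y) refl _ _) (∣-neg h) }
          ; comm = λ x y → lift (+-comm x y) }
        ; *-cong = λ {x} {y} {u} {v} h k → ∣-resp refl
            (solve 4 (λ x y u v → x :* (u :- v) :+ v :* (x :- y) := x :* u :- y :* v) refl x y u v) (∣-+ (∣-*ˡ x k) (∣-*ˡ v h))
        ; *-assoc = λ x y z → lift (*-assoc x y z)
        ; *-identity = (λ x → lift (*-identityˡ x)) , λ x → lift (*-identityʳ x)
        ; distrib = (λ x y z → lift (distribˡ x y z)) , λ x y z → lift (distribʳ x y z) }
      ; *-comm = λ x y → lift (*-comm x y) } }
    where
    lift : ∀ {x y} → x ≈ y → c ∣ᵢ x - y
    lift h = ∣-resp refl (sym (x≈y⇒x-y≈0 h)) ∣-0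

  quotientHom : ∀ c → Hom R (quotientRing c)
  quotientHom c = record
    { ⟦_⟧ = id ; ⟦⟧-cong = λ h → ∣-resp refl (sym (x≈y⇒x-y≈0 h)) ∣-0
    ; +-homo = λ x y → Q.refl ; *-homo = λ x y → Q.refl ; 1-homo = Q.refl }
    where module Q = CommutativeRing (quotientRing c)

-- Counting in finite lists.

unique-map : ∀ {A B : Set} (g : A → B) (L : List A) → (∀ {x y} → x ∈ L → y ∈ L → g x ≡ g y → x ≡ y) →
             Unique L → Unique (List.map g L)
unique-map g [] inj [] = []
unique-map g (x ∷ L) inj (x∉ ∷ u) =
  Allₚ.map⁺ (All.tabulate λ y∈ e → All.lookup x∉ y∈ (inj (here ≡.refl) (there y∈) e)) ∷
  unique-map g L (λ x∈ y∈ → inj (there x∈) (there y∈)) u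

unique-⊆⇒↭ : ∀ {A : Set} (xs ys : List A) → Unique xs → (∀ {x} → x ∈ xs → x ∈ ys) → length ys ≤ length xs → xs ↭ ys
unique-⊆⇒↭ [] [] _ _ _ = ↭.refl
unique-⊆⇒↭ (x ∷ xs) ys (x∉ ∷ u) sub len with ∈ₚ.∈-∃++ (sub (here ≡.refl))
... | as , bs , ≡.refl = ↭.trans (↭.prep x (unique-⊆⇒↭ xs (as ++ bs) u sub′ len′)) (↭-sym (↭ₚ.shift x as bs))
  where
  len′ : length (as ++ bs) ≤ length xs
  len′ = ℕₚ.≤-pred (≡.subst (_≤ suc (length xs)) (↭ₚ.↭-length (↭ₚ.shift x as bs)) len)
  sub′ : ∀ {y} → y ∈ xs → y ∈ as ++ bs
  sub′ y∈ with ↭ₚ.∈-resp-↭ (↭ₚ.shift x as bs) (sub (there y∈))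
  ... | here ≡.refl = contradiction ≡.refl (All.lookup x∉ y∈)
  ... | there y∈′ = y∈′

-- An injection of a finite set into itself is onto. Applied to multiplication by a unit, this
-- reindexes products over the units and norms and traces over the roots of unity.
closed⇒↭ : ∀ {A : Set} (g : A → A) (L : List A) → Unique L → (∀ {x} → x ∈ L → g x ∈ L) →
           (∀ {x y} → x ∈ L → y ∈ L → g x ≡ g y → x ≡ y) → List.map g L ↭ L
closed⇒↭ g L u cl inj = unique-⊆⇒↭ _ L (unique-map g L inj u) sub (ℕₚ.≤-reflexive (≡.sym (Listₚ.length-map g L)))
  where
  sub : ∀ {y} → y ∈ List.map g L → y ∈ L
  sub y∈ with ∈ₚ.∈-map⁻ g y∈
  ... | x , x∈ , ≡.refl = cl x∈

length-filter-¬ : ∀ {A : Set} {P : A → Set} (P? : ∀ x → Dec (P x)) (L : List A) →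
                  length L ≡ length (filter P? L) ℕ.+ length (filter (¬? ∘ P?) L)
length-filter-¬ P? [] = ≡.refl
length-filter-¬ P? (x ∷ L) with P? x
... | yes _ = ≡.cong suc (length-filter-¬ P? L)
... | no _ = ≡.trans (≡.cong suc (length-filter-¬ P? L)) (≡.sym (ℕₚ.+-suc _ _))

length≤fibres : ∀ (h : ℕ → ℕ) (m : ℕ) (M L : List ℕ) → Unique L → (∀ {x} → x ∈ L → h x ∈ M) →
  (∀ y (F : List ℕ) → Unique F → (∀ {x} → x ∈ F → x ∈ L × h x ≡ y) → length F ≤ m) → length L ≤ length M ℕ.* m
length≤fibres h m [] [] u sub fib = z≤n
length≤fibres h m [] (x ∷ L) u sub fib with sub (here ≡.refl)
... | ()
length≤fibres h m (y ∷ M) L u sub fib = ≡.subst (_≤ m ℕ.+ length M ℕ.* m) (≡.sym (length-filter-¬ P? L))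
  (ℕₚ.+-mono-≤ (fib y _ (Uniqueₚ.filter⁺ P? u) (∈ₚ.∈-filter⁻ P?))
    (length≤fibres h m M _ (Uniqueₚ.filter⁺ (¬? ∘ P?) u) sub′
      λ y′ F uF e → fib y′ F uF λ x∈ → proj₁ (∈ₚ.∈-filter⁻ (¬? ∘ P?) (proj₁ (e x∈))) , proj₂ (e x∈)))
  where
  P? = λ x → h x ℕ.≟ y
  sub′ : ∀ {x} → x ∈ filter (¬? ∘ P?) L → h x ∈ M
  sub′ x∈ with ∈ₚ.∈-filter⁻ (¬? ∘ P?) x∈
  ... | x∈L , h≢ with sub x∈L
  ... | here e = contradiction e h≢
  ... | there q = q

-- The prime field and its roots of unity.

module PrimeField (p : ℕ) .{{_ : NonZero p}} (p-prime : Prime p) where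

  infix 4 _≈_ _≉_ _≈?_
  -- Field elements are arbitrary naturals compared by residue, so that sums, products and numerals
  -- need no reduction.
  record _≈_ (x y : ℕ) : Set where
    constructor mk≈
    field residues : x % p ≡ y % p
  open _≈_ public

  _≉_ : ℕ → ℕ → Set
  x ≉ y = ¬ (x ≈ y)

  _≈?_ : ∀ x y → Dec (x ≈ y)
  x ≈? y with x % p ℕ.≟ y % p
  ... | yes e = yes (mk≈ e)
  ... | no ne = no (ne ∘ residues)

  private
    ≡⇒≈ : ∀ {x y} → x ≡ y → x ≈ y
    ≡⇒≈ e = mk≈ (≡.cong (_% p) e)

    +-cong : ∀ {x y u v} → x ≈ y → u ≈ v → x ℕ.+ u ≈ y ℕ.+ v
    +-cong {x} {y} {u} {v} (mk≈ e) (mk≈ f) = mk≈ (≡.trans (ℕ%.%-distribˡ-+ x u p)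
      (≡.trans (≡.cong₂ (λ a b → (a ℕ.+ b) % p) e f) (≡.sym (ℕ%.%-distribˡ-+ y v p))))

    *-cong : ∀ {x y u v} → x ≈ y → u ≈ v → x ℕ.* u ≈ y ℕ.* v
    *-cong {x} {y} {u} {v} (mk≈ e) (mk≈ f) = mk≈ (≡.trans (ℕ%.%-distribˡ-* x u p)
      (≡.trans (≡.cong₂ (λ a b → (a ℕ.* b) % p) e f) (≡.sym (ℕ%.%-distribˡ-* y v p))))

    neg : ℕ → ℕ
    neg x = (p ℕ.∸ 1) ℕ.* x

    1≤p : 1 ≤ p
    1≤p = ℕ.>-nonZero⁻¹ p

    neg-inverse : ∀ x → x ℕ.+ neg x ≈ 0
    neg-inverse x = mk≈ (≡.trans (≡.cong (_% p) (≡.trans (≡.cong (ℕ._* x) (ℕₚ.m+[n∸m]≡n 1≤p)) (ℕₚ.*-comm p x)))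
      (≡.trans (ℕ%.m*n%n≡0 x p) (≡.sym (ℕ%.m*n%n≡0 0 p))))

  abstract
    K-isCommutativeRing : IsCommutativeRing _≈_ ℕ._+_ ℕ._*_ neg 0 1
    K-isCommutativeRing = record
        { isRing = record
          { +-isAbelianGroup = record
            { isGroup = record
              { isMonoid = record
                { isSemigroup = record
                  { isMagma = record
                    { isEquivalence = record
                      { refl = mk≈ ≡.refl ; sym = λ (mk≈ e) → mk≈ (≡.sym e)
                      ; trans = λ (mk≈ e) (mk≈ f) → mk≈ (≡.trans e f) }
                    ; ∙-cong = +-cong }
                  ; assoc = λ x y z → ≡⇒≈ (ℕₚ.+-assoc x y z) }
                ; identity = (λ _ → mk≈ ≡.refl) , λ x → ≡⇒≈ (ℕₚ.+-identityʳ x) }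
              ; inverse = (λ x → mk≈ (≡.trans (≡.cong (_% p) (ℕₚ.+-comm (neg x) x)) (residues (neg-inverse x)))) , neg-inverse
              ; ⁻¹-cong = *-cong {p ℕ.∸ 1} (mk≈ ≡.refl) }
            ; comm = λ x y → ≡⇒≈ (ℕₚ.+-comm x y) }
          ; *-cong = *-cong
          ; *-assoc = λ x y z → ≡⇒≈ (ℕₚ.*-assoc x y z)
          ; *-identity = (λ x → ≡⇒≈ (ℕₚ.*-identityˡ x)) , λ x → ≡⇒≈ (ℕₚ.*-identityʳ x)
          ; distrib = (λ x y z → ≡⇒≈ (ℕₚ.*-distribˡ-+ x y z)) , λ x y z → ≡⇒≈ (ℕₚ.*-distribʳ-+ x y z) }
        ; *-comm = λ x y → ≡⇒≈ (ℕₚ.*-comm x y) }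

  K : CommutativeRing 0ℓ 0ℓ
  K = record
    { Carrier = ℕ ; _≈_ = _≈_ ; _+_ = ℕ._+_ ; _*_ = ℕ._*_ ; -_ = neg ; 0# = 0 ; 1# = 1
    ; isCommutativeRing = K-isCommutativeRing }

  module K = CommutativeRing K
  module KK = RingKit K

  p≈0 : p ≈ 0
  p≈0 = mk≈ (≡.trans (ℕ%.n%n≡0 p) (≡.sym (ℕ%.m*n%n≡0 0 p)))

  %≈ : ∀ x → x % p ≈ x
  %≈ x = mk≈ (ℕ%.m%n%n≡m%n x p)

  ≈⇒≡ : ∀ {x y} → x < p → y < p → x ≈ y → x ≡ y
  ≈⇒≡ x< y< (mk≈ e) = ≡.trans (≡.sym (ℕ%.m<n⇒m%n≡m x<)) (≡.trans e (ℕ%.m<n⇒m%n≡m y<))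

  %<p : ∀ x → x % p < p
  %<p x = ℕ%.m%n<n x p

  ≈0⇒∣ : ∀ {x} → x ≈ 0 → p ∣ x
  ≈0⇒∣ {x} (mk≈ e) = ∣ₚ.m%n≡0⇒n∣m x p (≡.trans e (ℕ%.m*n%n≡0 0 p))

  ∣⇒≈0 : ∀ {x} → p ∣ x → x ≈ 0
  ∣⇒≈0 {x} h = mk≈ (≡.trans (∣ₚ.n∣m⇒m%n≡0 x p h) (≡.sym (ℕ%.m*n%n≡0 0 p)))

  2≤p : 2 ≤ p
  2≤p = ℕ.nonTrivial⇒n>1 p {{Primality.prime⇒nonTrivial p-prime}}

  x<p⇒x≉0 : ∀ {x} → 1 ≤ x → x < p → x ≉ 0
  x<p⇒x≉0 1≤ x<p e = ℕₚ.<⇒≢ 1≤ (≡.sym (≈⇒≡ x<p 1≤p e))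

  1≉0 : 1 ≉ 0
  1≉0 = x<p⇒x≉0 ℕₚ.≤-refl 2≤p

  integral : ∀ {x y} → x ℕ.* y ≈ 0 → x ≉ 0 → y ≈ 0
  integral {x} {y} h x≉0 with Primality.euclidsLemma x y p-prime (≈0⇒∣ h)
  ... | inj₁ d = contradiction (∣⇒≈0 d) x≉0
  ... | inj₂ d = ∣⇒≈0 d

  *-≉0 : ∀ {x y} → x ≉ 0 → y ≉ 0 → x ℕ.* y ≉ 0
  *-≉0 x≉0 y≉0 h = y≉0 (integral h x≉0)

  ^-≉0 : ∀ {x} n → x ≉ 0 → x KK.^ n ≉ 0
  ^-≉0 zero x≉0 = 1≉0
  ^-≉0 (suc n) x≉0 = *-≉0 x≉0 (^-≉0 n x≉0)

  abstract
    inverse : ∀ {x} → x ≉ 0 → ∃ λ y → y ℕ.* x ≈ 1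
    inverse {x} x≉0 with Coprimality.coprime-Bézout (Coprimality.prime⇒coprime p-prime {{ℕ.≢-nonZero x%p≢0}} (%<p x))
      where
      x%p≢0 : x % p ≢ 0
      x%p≢0 e = x≉0 (mk≈ (≡.trans e (≡.sym (ℕ%.m*n%n≡0 0 p))))
    ... | Bézout.-+ a b eq = b , K.trans (K.*-congˡ {b} (K.sym (%≈ x))) (K.trans (≡⇒≈ (≡.sym eq))
            (K.trans (K.+-congˡ {1} (K.trans (K.*-congˡ {a} p≈0) (K.zeroʳ a))) (K.+-identityʳ 1)))
    ... | Bézout.+- a b eq = (K.- b) , K.trans (K.*-congˡ {K.- b} (K.sym (%≈ x)))
            (K.trans (K.sym (KK.-‿distribˡ-* b (x % p)))
            (K.trans (K.-‿cong (K.trans (KK.solve 1 (λ y → y KK.:= (KK.con (+ 1) KK.:+ y) KK.:- KK.con (+ 1)) K.refl (b ℕ.* (x % p)))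
              (K.trans (K.+-congʳ {K.- 1} (K.trans (≡⇒≈ eq) (K.trans (K.*-congˡ {a} p≈0) (K.zeroʳ a)))) (K.+-identityˡ (K.- 1)))))
            (KK.-‿involutive 1)))

  *-cancelˡ : ∀ a {x y} → a ≉ 0 → a ℕ.* x ≈ a ℕ.* y → x ≈ y
  *-cancelˡ a {x} {y} a≉0 h = KK.x-y≈0⇒x≈y (integral {a} (K.trans
    (KK.solve 3 (λ a x y → a KK.:* (x KK.:- y) KK.:= a KK.:* x KK.:- a KK.:* y) K.refl a x y) (KK.x≈y⇒x-y≈0 h)) a≉0)

  ^≡ : ∀ x n → x KK.^ n ≡ x ℕ.^ n
  ^≡ x zero = ≡.refl
  ^≡ x (suc n) = ≡.cong (x ℕ.*_) (^≡ x n)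

  units : List ℕ
  units = List.applyUpTo suc (p ℕ.∸ 1)

  length-units : length units ≡ p ℕ.∸ 1
  length-units = Listₚ.length-applyUpTo suc (p ℕ.∸ 1)

  units-unique : Unique units
  units-unique = Uniqueₚ.applyUpTo⁺₁ suc (p ℕ.∸ 1) λ i<j _ e → ℕₚ.<⇒≢ i<j (ℕₚ.suc-injective e)

  ∈-units⁻ : ∀ {x} → x ∈ units → x < p × x ≉ 0
  ∈-units⁻ x∈ with ∈ₚ.∈-applyUpTo⁻ suc x∈
  ... | i , i< , ≡.refl = s<p , x<p⇒x≉0 (s≤s z≤n) s<p
    where s<p = ℕₚ.≤-trans (s≤s i<) (ℕₚ.≤-reflexive (ℕₚ.m+[n∸m]≡n 1≤p))

  ∈-units⁺ : ∀ {x} → x < p → x ≉ 0 → x ∈ units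
  ∈-units⁺ {zero} _ h = contradiction K.refl h
  ∈-units⁺ {suc x} x<p _ = ∈ₚ.∈-applyUpTo⁺ suc (ℕₚ.∸-monoˡ-≤ 1 x<p)

  scale-closed⇒↭ : ∀ η (L : List ℕ) → η ≉ 0 → Unique L → (∀ {x} → x ∈ L → x < p) →
    (∀ {x} → x ∈ L → (η ℕ.* x) % p ∈ L) → List.map (λ x → (η ℕ.* x) % p) L ↭ L
  scale-closed⇒↭ η L η≉0 u L<p cl = closed⇒↭ _ L u cl λ {x} {y} x∈ y∈ e →
    ≈⇒≡ (L<p x∈) (L<p y∈) (*-cancelˡ η η≉0 (mk≈ e))

  -- Multiplication by x permutes the units; their product is thereby multiplied by x^(p - 1) and
  -- yet unchanged.
  fermat : ∀ x → x ≉ 0 → x KK.^ (p ℕ.∸ 1) ≈ 1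
  fermat x x≉0 = *-cancelˡ (product units) (prod≉0 units λ x∈ → proj₂ (∈-units⁻ x∈)) (K.trans
      (K.trans (K.*-comm (product units) (x KK.^ (p ℕ.∸ 1))) (K.trans (K.*-congʳ {product units} (≡⇒≈ (≡.cong (x KK.^_) (≡.sym length-units)))) (K.sym (scaled units))))
      (K.trans (≡⇒≈ (product-↭ (scale-closed⇒↭ x units x≉0 units-unique (proj₁ ∘ ∈-units⁻)
          λ {y} y∈ → ∈-units⁺ (%<p _) λ h → *-≉0 x≉0 (proj₂ (∈-units⁻ y∈)) (K.trans (K.sym (%≈ _)) h))))
        (K.sym (K.*-identityʳ (product units)))))
    where
    prod≉0 : ∀ L → (∀ {x} → x ∈ L → x ≉ 0) → product L ≉ 0
    prod≉0 [] h = 1≉0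
    prod≉0 (y ∷ L) h = *-≉0 (h (here ≡.refl)) (prod≉0 L (h ∘ there))
    scaled : ∀ L → product (List.map (λ y → (x ℕ.* y) % p) L) ≈ x KK.^ length L ℕ.* product L
    scaled [] = K.refl
    scaled (y ∷ L) = K.trans (K.*-cong (%≈ (x ℕ.* y)) (scaled L))
      (KK.solve 4 (λ x y a b → (x KK.:* y) KK.:* (a KK.:* b) KK.:= (x KK.:* a) KK.:* (y KK.:* b)) K.refl x y (x KK.^ length L) (product L))

  frobenius : ∀ x → x KK.^ p ≈ x
  frobenius x with x ≈? 0
  ... | yes h = K.trans (K.trans (≡⇒≈ (≡.cong (x KK.^_) (≡.sym (ℕₚ.m+[n∸m]≡n 1≤p)))) (K.trans (K.*-congʳ h) (K.zeroˡ (x KK.^ (p ℕ.∸ 1))))) (K.sym h)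
  ... | no h = K.trans (≡⇒≈ (≡.cong (x KK.^_) (≡.sym (ℕₚ.m+[n∸m]≡n 1≤p)))) (K.trans (K.*-congˡ {x} (fermat x h)) (K.*-identityʳ x))

  module KP = Polynomials K

  roots≤degree : ∀ k (f : KP.Poly) → length f ≤ suc k → ¬ (f KP.≋ []) → ∀ (L : List ℕ) →
    AllPairs _≉_ L → (∀ {x} → x ∈ L → KP.Eval.eval K (idHom K) x f ≈ 0) → length L ≤ k
  roots≤degree k f len f≢0 [] _ _ = z≤n
  roots≤degree zero f len f≢0 (r ∷ L) _ root = contradiction (const f len (root (here ≡.refl))) f≢0
    where
    const : ∀ f → length f ≤ 1 → KP.Eval.eval K (idHom K) r f ≈ 0 → f KP.≋ []
    const [] _ _ = KP.P.refl
    const (a ∷ []) _ h = KP.∷≋[] (K.trans (K.sym (KP.Eval.eval-const K (idHom K) r a)) h) KP.P.refl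
    const (a ∷ b ∷ f) (s≤s ()) h
  roots≤degree (suc k) f len f≢0 (r ∷ L) (r∉ ∷ u) root = s≤s (roots≤degree k q len′ q≢0 L u root′)
    where
    open Factor K r
    module Er = KP.Eval K (idHom K) r
    q = quot f
    len′ : length q ≤ suc k
    len′ = ≡.subst (_≤ suc k) (≡.sym (length-quot f)) (ℕₚ.pred-mono-≤ len)
    X-r = KP.X KP.⊕ (KP.⊖ (r ∷ []))
    fact : f KP.≋ X-r KP.⊗ q
    fact = KP.P.trans (factor f) (KP.P.trans (KP.P.+-congʳ {X-r KP.⊗ q} (KP.∷≋[] (root (here ≡.refl)) KP.P.refl)) KP.P.refl)
    q≢0 : ¬ (q KP.≋ [])
    q≢0 h = f≢0 (KP.P.trans fact (KP.P.trans (KP.P.*-congˡ {X-r} h) (KP.P.zeroʳ X-r)))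
    root′ : ∀ {x} → x ∈ L → KP.Eval.eval K (idHom K) x q ≈ 0
    root′ {x} x∈ = integral (K.trans (K.sym (K.trans (Ex.eval-⊗ X-r q) (K.*-congʳ
        (K.trans (Ex.eval-⊕ KP.X (KP.⊖ (r ∷ []))) (K.+-cong Ex.eval-X (Ex.eval-const (K.- r)))))))
        (K.trans (K.sym (Ex.eval-cong f (X-r KP.⊗ q) fact)) (root (there x∈))))
      λ h → All.lookup r∉ x∈ (K.sym (KK.x-y≈0⇒x≈y h))
      where module Ex = KP.Eval K (idHom K) x

  unique⇒≉ : ∀ L → Unique L → (∀ {x} → x ∈ L → x < p) → AllPairs _≉_ L
  unique⇒≉ [] _ _ = []
  unique⇒≉ (x ∷ L) (x∉ ∷ u) b =
    All.tabulate (λ y∈ e → All.lookup x∉ y∈ (≈⇒≡ (b (here ≡.refl)) (b (there y∈)) e)) ∷ unique⇒≉ L u (b ∘ there)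

  power-roots≤ : ∀ k c → 1 ≤ k → ∀ (L : List ℕ) → Unique L → (∀ {x} → x ∈ L → x < p × x KK.^ k ≈ c) → length L ≤ k
  power-roots≤ (suc k) c _ L u h = roots≤degree (suc k) f len f≢0 L (unique⇒≉ L u (proj₁ ∘ h))
      λ {x} x∈ → K.trans (K.+-congˡ {K.- c} (eval-mono x)) (K.trans (K.+-congˡ {K.- c} (proj₂ (h x∈))) (K.-‿inverseˡ c))
    where
    mono : ℕ → KP.Poly
    mono zero = 1 ∷ []
    mono (suc n) = 0 ∷ mono n
    length-mono : ∀ n → length (mono n) ≡ suc n
    length-mono zero = ≡.refl
    length-mono (suc n) = ≡.cong suc (length-mono n)
    coeff-mono : ∀ n → KP.coeff (mono n) n ≡ 1
    coeff-mono zero = ≡.refl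
    coeff-mono (suc n) = coeff-mono n
    f = (K.- c) ∷ mono k
    len : length f ≤ suc (suc k)
    len = ℕₚ.≤-reflexive (≡.cong suc (length-mono k))
    f≢0 : ¬ (f KP.≋ [])
    f≢0 e = 1≉0 (K.trans (≡⇒≈ (≡.sym (coeff-mono k))) (KP.at e (suc k)))
    eval-mono : ∀ x → x ℕ.* KP.Eval.eval K (idHom K) x (mono k) ≈ x KK.^ suc k
    eval-mono x = K.*-congˡ {x} (go k)
      where
      go : ∀ n → KP.Eval.eval K (idHom K) x (mono n) ≈ x KK.^ n
      go zero = KP.Eval.eval-const K (idHom K) x 1
      go (suc n) = K.*-congˡ {x} (go n)

  module RootsOfUnity (d : ℕ) (1≤d : 1 ≤ d) (d∣p-1 : d ∣ p ℕ.∸ 1) where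

    μ? : ∀ x → Dec (x KK.^ d ≈ 1)
    μ? x = (x KK.^ d) ≈? 1

    abstract
      μ : List ℕ
      μ = filter μ? (upTo p)

      μ-unique : Unique μ
      μ-unique = Uniqueₚ.filter⁺ μ? (Uniqueₚ.upTo⁺ p)

      ∈-μ⁻ : ∀ {x} → x ∈ μ → x < p × x KK.^ d ≈ 1
      ∈-μ⁻ x∈ with ∈ₚ.∈-filter⁻ μ? x∈
      ... | x∈′ , h = ∈ₚ.∈-upTo⁻ x∈′ , h

      ∈-μ⁺ : ∀ {x} → x < p → x KK.^ d ≈ 1 → x ∈ μ
      ∈-μ⁺ x<p h = ∈ₚ.∈-filter⁺ μ? (∈ₚ.∈-upTo⁺ x<p) h

    μ-≉0 : ∀ {x} → x ∈ μ → x ≉ 0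
    μ-≉0 {x} x∈ h = 1≉0 (K.trans (K.sym (proj₂ (∈-μ⁻ x∈))) (K.trans (KK.^-congˡ d h) (0^ d 1≤d)))
      where
      0^ : ∀ d → 1 ≤ d → 0 KK.^ d ≈ 0
      0^ (suc d) _ = K.refl

    μ-scale : ∀ {η} → η ∈ μ → List.map (λ x → (η ℕ.* x) % p) μ ↭ μ
    μ-scale {η} η∈ = scale-closed⇒↭ η μ (μ-≉0 η∈) μ-unique (proj₁ ∘ ∈-μ⁻) λ {x} x∈ → ∈-μ⁺ (%<p _)
      (K.trans (KK.^-congˡ d (%≈ (η ℕ.* x))) (K.trans (KK.^-distrib-* η x d)
        (K.trans (K.*-cong (proj₂ (∈-μ⁻ η∈)) (proj₂ (∈-μ⁻ x∈))) (K.*-identityˡ 1))))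

    -- With p - 1 = d m, the map x ↦ x^m sends the units into `μ`, and each fibre consists of roots
    -- of X^m - y, so p - 1 ≤ m · `length μ`.
    d≤length-μ : d ≤ length μ
    d≤length-μ = ℕₚ.*-cancelʳ-≤ d (length μ) m {{ℕ.>-nonZero 1≤m}}
      (≡.subst (_≤ length μ ℕ.* m) (≡.trans length-units p-1≡dm)
        (length≤fibres (λ x → (x KK.^ m) % p) m μ units units-unique
          (λ {x} x∈ → ∈-μ⁺ (%<p _) (K.trans (KK.^-congˡ d (%≈ _)) (K.trans (KK.^-assocʳ x m d)
            (K.trans (≡⇒≈ (≡.cong (x KK.^_) (≡.trans (ℕₚ.*-comm m d) (≡.sym p-1≡dm)))) (fermat x (proj₂ (∈-units⁻ x∈)))))))
          λ y F uF hF → power-roots≤ m y 1≤m F uF λ x∈ → proj₁ (∈-units⁻ (proj₁ (hF x∈))) ,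
            K.trans (K.sym (%≈ _)) (≡⇒≈ (proj₂ (hF x∈)))))
      where
      m = ∣ₚ.quotient d∣p-1
      p-1≡dm : p ℕ.∸ 1 ≡ d ℕ.* m
      p-1≡dm = ∣ₚ.m∣n⇒n≡m*quotient d∣p-1
      1≤m : 1 ≤ m
      1≤m with m ℕ.≟ 0
      ... | no m≢0 = ℕₚ.n≢0⇒n>0 m≢0
      ... | yes m≡0 = contradiction (≡.trans p-1≡dm (≡.trans (≡.cong (d ℕ.*_) m≡0) (ℕₚ.*-zeroʳ d)))
        (ℕₚ.>⇒≢ (ℕₚ.∸-monoˡ-≤ 1 2≤p))

    -- Traces over `μ` will be divided by this number. It lies between 1 and d ≤ p - 1.
    length-μ≉0 : length μ ≉ 0
    length-μ≉0 = x<p⇒x≉0 (ℕₚ.≤-trans 1≤d d≤length-μ) (ℕₚ.≤-<-trans (power-roots≤ d 1 1≤d μ μ-unique ∈-μ⁻)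
      (ℕₚ.≤-<-trans (∣ₚ.∣⇒≤ {{ℕ.>-nonZero (ℕₚ.∸-monoˡ-≤ 1 2≤p)}} d∣p-1) (ℕₚ.≤-reflexive (ℕₚ.m+[n∸m]≡n 1≤p))))

    -- Otherwise X^e - 1 would have d > e roots. This is what tells the coordinate at v^0 from the
    -- others: it alone is fixed by all v ↦ η v.
    μ-separates : ∀ e → 1 ≤ e → e < d → ∃ λ η → η ∈ μ × η KK.^ e ≉ 1
    μ-separates e 1≤e e<d with All.all? (λ x → (x KK.^ e) ≈? 1) μ
    ... | yes all = contradiction (power-roots≤ e 1 1≤e μ μ-unique λ x∈ → proj₁ (∈-μ⁻ x∈) , All.lookup all x∈)
                      (ℕₚ.<⇒≱ (ℕₚ.<-≤-trans e<d d≤length-μ))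
    ... | no ¬all with find μ ¬all
      where
      find : ∀ L → ¬ All (λ x → x KK.^ e ≈ 1) L → ∃ λ η → η ∈ L × η KK.^ e ≉ 1
      find [] h = contradiction [] h
      find (x ∷ L) h with (x KK.^ e) ≈? 1
      ... | no ne = x , here ≡.refl , ne
      ... | yes eq with find L (h ∘ (eq ∷_))
      ... | η , η∈ , ne = η , there η∈ , ne
    ... | r = r

-- Linear algebra over F_p by counting; graded coordinate rings.

module LinearAlgebra (p : ℕ) .{{_ : NonZero p}} (p-prime : Prime p) where
  open PrimeField p p-prime

  private
    funToFin-cong : ∀ {m n} (f g : Fin m → Fin n) → (∀ i → f i ≡ g i) → Fin.funToFin f ≡ Fin.funToFin g
    funToFin-cong {zero} f g h = ≡.refl
    funToFin-cong {suc m} f g h = ≡.cong₂ Fin.combine (h Fin.zero) (funToFin-cong (f ∘ Fin.suc) (g ∘ Fin.suc) (h ∘ Fin.suc))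

  -- An additive map from F_p^n to F_p^m identifies two vectors when m < n, by counting.
  kernel-vector : ∀ {n m} → m < n → (L : (Fin n → ℕ) → Fin m → ℕ) →
    (∀ a b → (∀ i → a i ≈ b i) → ∀ j → L a j ≈ L b j) →
    (∀ a b j → L (λ i → a i ℕ.+ b i) j ≈ L a j ℕ.+ L b j) →
    ∃ λ a → (∃ λ i → a i ≉ 0) × (∀ j → L a j ≈ 0)
  kernel-vector {n} {m} m<n L L-cong L-+ with Finₚ.pigeonhole (ℕₚ.^-monoʳ-< p 2≤p m<n) image
    where
    image : Fin (p ℕ.^ n) → Fin (p ℕ.^ m)
    image k = Fin.funToFin λ j → Fin.fromℕ< (%<p (L (toℕ ∘ Fin.finToFun k) j))
  ... | k , l , k<l , same = diff , nonzero , zero′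
    where
    a b diff : Fin n → ℕ
    a = toℕ ∘ Fin.finToFun k
    b = toℕ ∘ Fin.finToFun l
    diff i = a i K.- b i
    nonzero : ∃ λ i → diff i ≉ 0
    nonzero with Finₚ.¬∀⟶∃¬ n _ (λ i → Fin.finToFun k i Fin.≟ Fin.finToFun l i) (λ h → Finₚ.<⇒≢ k<l
                  (≡.trans (≡.sym (Finₚ.funToFin-finToFin {n} {p} k)) (≡.trans (funToFin-cong {n} {p} _ _ h) (Finₚ.funToFin-finToFin {n} {p} l))))
    ... | i , ne = i , λ h → ne (Finₚ.toℕ-injective (≈⇒≡ (Finₚ.toℕ<n _) (Finₚ.toℕ<n _) (KK.x-y≈0⇒x≈y h)))
    La≈Lb : ∀ j → L a j ≈ L b j
    La≈Lb j = mk≈ (≡.trans (≡.sym (Finₚ.toℕ-fromℕ< _)) (≡.trans (≡.cong toℕ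
      (≡.trans (≡.sym (Finₚ.finToFun-funToFin (λ j → Fin.fromℕ< (%<p (L a j))) j))
        (≡.trans (≡.cong (λ z → Fin.finToFun z j) same) (Finₚ.finToFun-funToFin (λ j → Fin.fromℕ< (%<p (L b j))) j))))
      (Finₚ.toℕ-fromℕ< _)))
    zero′ : ∀ j → L diff j ≈ 0
    zero′ j = K.trans (KK.solve 2 (λ x y → x KK.:= (x KK.:+ y) KK.:- y) K.refl (L diff j) (L b j))
      (KK.x≈y⇒x-y≈0 (K.trans (K.sym (L-+ diff b j)) (K.trans
        (L-cong (λ i → diff i ℕ.+ b i) a (λ i → KK.solve 2 (λ x y → (x KK.:- y) KK.:+ y KK.:= x) K.refl (a i) (b i)) j) (La≈Lb j))))

  module CharP (R : CommutativeRing 0ℓ 0ℓ)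
               (char : CommutativeRing._≈_ R (RingKit.κ R p) (CommutativeRing.0# R)) where
    open CommutativeRing R using (Carrier; 1#; _+_; _*_; -_; trans; sym; refl; reflexive; +-cong; +-congˡ; *-congˡ; zeroʳ; zeroˡ; +-identityʳ; +-identityˡ; *-identityˡ; distribʳ) renaming (_≈_ to _≈ᴿ_)
    open RingKit R

    κ-+ : ∀ m n → κ (m ℕ.+ n) ≈ᴿ κ m + κ n
    κ-+ = ×-homo-+ 1#

    κ-* : ∀ m n → κ (m ℕ.* n) ≈ᴿ κ m * κ n
    κ-* = ×1-homo-*

    κ-1 : κ 1 ≈ᴿ 1#
    κ-1 = +-identityʳ 1#

    κ-% : ∀ x → κ x ≈ᴿ κ (x % p)
    κ-% x = trans (reflexive (≡.cong κ (ℕ%.m≡m%n+[m/n]*n x p))) (trans (κ-+ (x % p) (x ℕ%./ p ℕ.* p))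
      (trans (+-congˡ (trans (κ-* (x ℕ%./ p) p) (trans (*-congˡ char) (zeroʳ _)))) (+-identityʳ _)))

    κ-cong : ∀ {x y} → x ≈ y → κ x ≈ᴿ κ y
    κ-cong {x} {y} h = trans (κ-% x) (trans (reflexive (≡.cong κ (residues h))) (sym (κ-% y)))

    κ-neg : ∀ x → κ (K.- x) ≈ᴿ - κ x
    κ-neg x = trans (solve 2 (λ a b → a := (b :+ a) :- b) refl (κ (K.- x)) (κ x))
      (trans (+-cong (trans (sym (κ-+ x (K.- x))) (κ-cong (K.-‿inverseʳ x))) refl) (+-identityˡ _))

    κ-^ : ∀ x n → κ (x KK.^ n) ≈ᴿ κ x ^ n
    κ-^ x zero = κ-1
    κ-^ x (suc n) = trans (κ-* x (x KK.^ n)) (*-congˡ (κ-^ x n))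

    unit : ∀ {n} → Fin n → Fin n → ℕ
    unit Fin.zero Fin.zero = 1
    unit Fin.zero (Fin.suc i) = 0
    unit (Fin.suc j) Fin.zero = 0
    unit (Fin.suc j) (Fin.suc i) = unit j i

    private
      cons : ∀ {n} → ℕ → (Fin n → ℕ) → Fin (suc n) → ℕ
      cons k x Fin.zero = k
      cons k x (Fin.suc i) = x i

    -- Over a prime field additivity is linearity.
    additive⇒linear : ∀ {n} (φ : (Fin n → ℕ) → Carrier) →
      (∀ a b → (∀ i → a i ≈ b i) → φ a ≈ᴿ φ b) → (∀ a b → φ (λ i → a i ℕ.+ b i) ≈ᴿ φ a + φ b) →
      ∀ x → φ x ≈ᴿ ∑ λ j → κ (x j) * φ (unit j)
    additive⇒linear {zero} φ φ-cong φ-+ x = x+x≈x⇒x≈0 _ (trans (sym (φ-+ x x)) (φ-cong _ _ λ ()))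
    additive⇒linear {suc n} φ φ-cong φ-+ x = trans
      (φ-cong x (λ i → cons (x Fin.zero) (λ _ → 0) i ℕ.+ cons 0 (x ∘ Fin.suc) i)
        λ { Fin.zero → K.sym (K.+-identityʳ _) ; (Fin.suc i) → K.refl })
      (trans (φ-+ _ _) (+-cong (trans (scalar (x Fin.zero)) (*-congˡ (φ-cong _ _ λ { Fin.zero → K.refl ; (Fin.suc i) → K.refl })))
        (trans (additive⇒linear (λ y → φ (cons 0 y))
            (λ a b h → φ-cong _ _ λ { Fin.zero → K.refl ; (Fin.suc i) → h i })
            (λ a b → trans (φ-cong _ _ λ { Fin.zero → K.refl ; (Fin.suc i) → K.refl }) (φ-+ _ _)) (x ∘ Fin.suc))
          (∑-cong {n} {λ j → κ (x (Fin.suc j)) * φ (cons 0 (unit j))} {λ j → κ (x (Fin.suc j)) * φ (unit (Fin.suc j))}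
            λ j → *-congˡ (φ-cong (cons 0 (unit j)) (unit (Fin.suc j)) λ { Fin.zero → K.refl ; (Fin.suc i) → K.refl })))))
      where
      scalar : ∀ k → φ (cons k (λ _ → 0)) ≈ᴿ κ k * φ (cons 1 (λ _ → 0))
      scalar zero = trans (x+x≈x⇒x≈0 _ (trans (sym (φ-+ _ _)) (φ-cong _ _ λ { Fin.zero → K.refl ; (Fin.suc i) → K.refl }))) (sym (zeroˡ _))
      scalar (suc k) = trans (φ-cong _ (λ i → cons 1 (λ _ → 0) i ℕ.+ cons k (λ _ → 0) i) λ { Fin.zero → K.refl ; (Fin.suc i) → K.refl })
        (trans (φ-+ _ _) (trans (+-cong (sym (*-identityˡ _)) (scalar k)) (sym (distribʳ _ _ _))))

  -- R is free of rank 1 + c over F_p[t]; Deg k are the elements whose coordinates have degree at most k,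
  -- a vector space of dimension dim k, with coordinate map to k and parametrisation from k.
  record Graded : Set₁ where
    field
      R : CommutativeRing 0ℓ 0ℓ
    open CommutativeRing R using (Carrier; 0#; 1#; _+_; _*_) renaming (_≈_ to _≈ᴿ_)
    field
      char : RingKit.κ R p ≈ᴿ 0#
      ∂ : Derivation R
    open Derivation ∂
    field
      c : ℕ
      Deg : ℕ → Carrier → Set
      Deg-resp : ∀ {k x y} → x ≈ᴿ y → Deg k x → Deg k y
      Deg-mono : ∀ {j k x} → j ≤ k → Deg j x → Deg k x
      Deg-+ : ∀ {k x y} → Deg k x → Deg k y → Deg k (x + y)
      Deg-0 : ∀ {k} → Deg k 0#
      Deg-1 : Deg 0 1#
      -- Reducing a product by the equations v^d = ℓ raises degrees. The excess is bounded by the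
      -- same `c` that determines the rank.
      Deg-* : ∀ {j k x y} → Deg j x → Deg k y → Deg (j ℕ.+ k ℕ.+ c) (x * y)
      Deg-δ : ∀ {k x} → Deg k x → Deg (k ℕ.+ c) (δ x)
      deg∃ : ∀ x → ∃ λ k → Deg k x
      dim : ℕ → ℕ
      dim≡ : ∀ k → dim k ≡ suc c ℕ.* suc k
      from : ∀ k → (Fin (dim k) → ℕ) → Carrier
      from-cong : ∀ k a b → (∀ i → a i ≈ b i) → from k a ≈ᴿ from k b
      from-+ : ∀ k a b → from k (λ i → a i ℕ.+ b i) ≈ᴿ from k a + from k b
      from-Deg : ∀ k a → Deg k (from k a)
      from-0 : ∀ k a → from k a ≈ᴿ 0# → ∀ i → a i ≈ 0
      to : ∀ k → Carrier → Fin (dim k) → ℕ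
      to-cong : ∀ k {x y} → x ≈ᴿ y → ∀ i → to k x i ≈ to k y i
      to-+ : ∀ k x y i → to k (x + y) i ≈ to k x i ℕ.+ to k y i
      to-0 : ∀ k x → Deg k x → (∀ i → to k x i ≈ 0) → x ≈ᴿ 0#

  IsDomain : CommutativeRing 0ℓ 0ℓ → Set
  IsDomain R = ∀ x y → ¬ (x R.≈ R.0#) → x R.* y R.≈ R.0# → y R.≈ R.0#
    where module R = CommutativeRing R

  module GradedTheory (G : Graded) where
    open Graded G
    open CommutativeRing R using (Carrier; 0#; _+_; _*_; trans; sym; refl; +-cong; +-congʳ; *-congˡ; *-congʳ; zeroˡ; +-identityˡ; distribˡ; distribʳ) renaming (_≈_ to _≈ᴿ_)
    open RingKit R
    open CharP R char

    to-≈0 : ∀ k i → to k 0# i ≈ 0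
    to-≈0 k i = KK.x+x≈x⇒x≈0 _ (K.trans (K.sym (to-+ k 0# 0# i)) (to-cong k (+-identityˡ 0#) i))

    -- An element of known degree has finitely many coordinates in F_p. This decidability makes the
    -- later case distinctions on elements of the tower constructive.
    zero? : ∀ x → Dec (x ≈ᴿ 0#)
    zero? x with deg∃ x
    ... | k , deg with Finₚ.all? (λ i → to k x i ≈? 0)
    ... | yes h = yes (to-0 k x deg h)
    ... | no h = no λ e → h λ i → K.trans (to-cong k e i) (to-≈0 k i)

    Deg-κ* : ∀ n {k x} → Deg k x → Deg k (κ n * x)
    Deg-κ* n {k} {x} h = Deg-resp (κ-*ˡ n x) (go n)
      where
      go : ∀ n → Deg k (n ⨯ x)
      go zero = Deg-0
      go (suc n) = Deg-+ h (go n)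

    Deg-∑ : ∀ {k n} (f : Fin n → Carrier) → (∀ i → Deg k (f i)) → Deg k (∑ f)
    Deg-∑ {n = zero} f h = Deg-0
    Deg-∑ {n = suc n} f h = Deg-+ (h Fin.zero) (Deg-∑ (f ∘ Fin.suc) (h ∘ Fin.suc))

    deg-bound : ∀ {n} (f : Fin n → Carrier) → ∃ λ k → ∀ i → Deg k (f i)
    deg-bound {zero} f = 0 , λ ()
    deg-bound {suc n} f with deg∃ (f Fin.zero) | deg-bound (f ∘ Fin.suc)
    ... | j , h | k , g = j ℕ.+ k , λ { Fin.zero → Deg-mono (ℕₚ.m≤m+n j k) h ; (Fin.suc i) → Deg-mono (ℕₚ.m≤n+m k j) (g i) }

    Deg-^ : ∀ {k x} n → Deg k x → Deg (n ℕ.* (k ℕ.+ c)) (x ^ n)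
    Deg-^ zero h = Deg-1
    Deg-^ {k} (suc n) h = Deg-mono (ℕₚ.≤-reflexive (shuffle k (n ℕ.* (k ℕ.+ c)) c)) (Deg-* h (Deg-^ n h))
      where
      shuffle : ∀ a b c → a ℕ.+ b ℕ.+ c ≡ a ℕ.+ c ℕ.+ b
      shuffle a b c = ≡.trans (ℕₚ.+-assoc a b c) (≡.trans (≡.cong (a ℕ.+_) (ℕₚ.+-comm b c)) (≡.sym (ℕₚ.+-assoc a c b)))

    module _ (domain : IsDomain R) where

      -- Counting dimensions: multiplication by F embeds Deg S into Deg (S + k + c).
      independent-mod≤ : ∀ {k} F → ¬ (F ≈ᴿ 0#) → Deg k F → ∀ {M} (E : Fin M → Carrier) →
        (∀ (a : Fin M → ℕ) h → (∑ λ i → κ (a i) * E i) + F * h ≈ᴿ 0# → ∀ i → a i ≈ 0) →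
        M ≤ suc c ℕ.* (k ℕ.+ c)
      independent-mod≤ {k} F F≉0 degF {M} E indep = ℕₚ.≮⇒≥ λ big → contra big
        where
        S = proj₁ (deg-bound E)
        k′ = k ℕ.+ S ℕ.+ c
        term : (Fin (M ℕ.+ dim S) → ℕ) → Fin M → Carrier
        term a i = κ (a (i Fin.↑ˡ dim S)) * E i
        rest : (Fin (M ℕ.+ dim S) → ℕ) → Fin (dim S) → ℕ
        rest a i = a (M Fin.↑ʳ i)
        combo : (Fin (M ℕ.+ dim S) → ℕ) → Carrier
        combo a = ∑ (term a) + F * from S (rest a)
        combo-cong : ∀ a b → (∀ i → a i ≈ b i) → combo a ≈ᴿ combo b
        combo-cong a b h = +-cong (∑-cong {M} {term a} {term b} λ i → *-congʳ (κ-cong (h _))) (*-congˡ (from-cong S (rest a) (rest b) λ i → h _))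
        combo-+ : ∀ a b → combo (λ i → a i ℕ.+ b i) ≈ᴿ combo a + combo b
        combo-+ a b = trans (+-cong
            (trans (∑-cong {M} {term λ i → a i ℕ.+ b i} {λ i → term a i + term b i} λ i →
              trans (*-congʳ (κ-+ (a (i Fin.↑ˡ dim S)) (b (i Fin.↑ˡ dim S)))) (distribʳ _ _ _)) (∑-+ (term a) (term b)))
            (trans (*-congˡ (from-+ S (rest a) (rest b))) (distribˡ _ _ _)))
          (solve 4 (λ x y z w → (x :+ y) :+ (z :+ w) := (x :+ z) :+ (y :+ w)) refl (∑ (term a)) (∑ (term b)) (F * from S (rest a)) (F * from S (rest b)))
        combo-Deg : ∀ a → Deg k′ (combo a)
        combo-Deg a = Deg-+ (Deg-∑ (term a) λ i → Deg-κ* (a (i Fin.↑ˡ dim S)) (Deg-mono (ℕₚ.≤-trans (ℕₚ.m≤n+m S k) (ℕₚ.m≤m+n _ c)) (proj₂ (deg-bound E) i)))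
          (Deg-* degF (from-Deg S (rest a)))
        arith : ∀ D k c S → D ℕ.* suc (k ℕ.+ S ℕ.+ c) ≡ D ℕ.* (k ℕ.+ c) ℕ.+ D ℕ.* suc S
        arith D k c S = ≡.trans (≡.cong (D ℕ.*_) (≡.trans (≡.cong suc (≡.trans (ℕₚ.+-assoc k S c) (≡.trans (≡.cong (k ℕ.+_) (ℕₚ.+-comm S c)) (≡.sym (ℕₚ.+-assoc k c S))))) (≡.sym (ℕₚ.+-suc (k ℕ.+ c) S))))
          (ℕₚ.*-distribˡ-+ D (k ℕ.+ c) (suc S))
        lt : suc c ℕ.* (k ℕ.+ c) < M → dim k′ < M ℕ.+ dim S
        lt big = ≡.subst (_< M ℕ.+ dim S) (≡.sym (≡.trans (dim≡ k′) (≡.trans (arith (suc c) k c S) (≡.cong (suc c ℕ.* (k ℕ.+ c) ℕ.+_) (≡.sym (dim≡ S))))))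
          (ℕₚ.+-monoˡ-< (dim S) big)
        -- A kernel vector is a relation between the `E i` modulo `F`. Independence clears its first
        -- M coordinates; the rest then satisfies F h = 0 and vanishes in a domain.
        absurd : (∃ λ a → (∃ λ i → a i ≉ 0) × (∀ j → to k′ (combo a) j ≈ 0)) → ⊥
        absurd (a , (i , a≉0) , ker) = split (Fin.splitAt M i) ≡.refl
          where
          rel : combo a ≈ᴿ 0#
          rel = to-0 k′ (combo a) (combo-Deg a) ker
          a₁≈0 : ∀ i → a (i Fin.↑ˡ dim S) ≈ 0
          a₁≈0 = indep (λ i → a (i Fin.↑ˡ dim S)) (from S (rest a)) rel
          a₂≈0 : ∀ i → a (M Fin.↑ʳ i) ≈ 0
          a₂≈0 = from-0 S (rest a) (domain F (from S (rest a)) F≉0 (trans (sym (+-identityˡ _)) (trans (+-congʳ (sym (∑-zero (term a) λ i →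
            trans (*-congʳ (κ-cong (a₁≈0 i))) (zeroˡ _)))) rel)))
          split : ∀ s → Fin.splitAt M i ≡ s → ⊥
          split (inj₁ j) eq = a≉0 (≡.subst (λ i → a i ≈ 0) (Finₚ.splitAt⁻¹-↑ˡ eq) (a₁≈0 j))
          split (inj₂ j) eq = a≉0 (≡.subst (λ i → a i ≈ 0) (Finₚ.splitAt⁻¹-↑ʳ {M} eq) (a₂≈0 j))
        contra : suc c ℕ.* (k ℕ.+ c) < M → ⊥
        contra big = absurd (kernel-vector {M ℕ.+ dim S} {dim k′} (lt big) (λ a → to k′ (combo a))
            (λ a b h → to-cong k′ (combo-cong a b h)) (λ a b j → K.trans (to-cong k′ (combo-+ a b) j) (to-+ k′ (combo a) (combo b) j)))

-- Stepanov's method: orders of vanishing at rational points.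

module Stepanov (p : ℕ) .{{_ : NonZero p}} (p-prime : Prime p)
                (G : LinearAlgebra.Graded p p-prime)
                (domain : LinearAlgebra.IsDomain p p-prime (LinearAlgebra.Graded.R G)) where
  open PrimeField p p-prime
  open LinearAlgebra p p-prime
  open Graded G
  open GradedTheory G
  open CommutativeRing R using (Carrier; 0#; 1#; _+_; _*_; _-_; -_; trans; sym; refl; +-congˡ; +-congʳ; *-congˡ; *-congʳ; zeroʳ; zeroˡ; +-identityʳ; +-identityˡ; *-identityˡ; *-identityʳ; *-comm) renaming (_≈_ to _≈ᴿ_)
  open RingKit R
  open CharP R char
  open Derivation ∂

  δ^ : ℕ → Carrier → Carrier
  δ^ zero x = x
  δ^ (suc l) x = δ^ l (δ x)

  δ^-cong : ∀ l {x y} → x ≈ᴿ y → δ^ l x ≈ᴿ δ^ l y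
  δ^-cong zero h = h
  δ^-cong (suc l) h = δ^-cong l (δ-cong h)

  δ^-+ : ∀ l x y → δ^ l (x + y) ≈ᴿ δ^ l x + δ^ l y
  δ^-+ zero x y = refl
  δ^-+ (suc l) x y = trans (δ^-cong l (δ-+ x y)) (δ^-+ l _ _)

  δ^-0 : ∀ l → δ^ l 0# ≈ᴿ 0#
  δ^-0 l = x+x≈x⇒x≈0 _ (trans (sym (δ^-+ l _ _)) (δ^-cong l (+-identityˡ _)))

  δ^-const* : ∀ l k x → δ k ≈ᴿ 0# → δ^ l (x * k) ≈ᴿ δ^ l x * k
  δ^-const* zero k x h = refl
  δ^-const* (suc l) k x h = trans (δ^-cong l (trans (δ-* x k) (trans (+-congˡ (trans (*-congˡ h) (zeroʳ x))) (+-identityʳ _))))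
    (δ^-const* l k (δ x) h)

  δ^-κ* : ∀ l n x → δ^ l (κ n * x) ≈ᴿ κ n * δ^ l x
  δ^-κ* l n x = trans (δ^-cong l (*-comm _ _)) (trans (δ^-const* l (κ n) x (δ-κ n)) (*-comm _ _))

  Deg-δ^ : ∀ l {k x} → Deg k x → Deg (k ℕ.+ l ℕ.* c) (δ^ l x)
  Deg-δ^ zero h = Deg-mono (ℕₚ.≤-reflexive (≡.sym (ℕₚ.+-identityʳ _))) h
  Deg-δ^ (suc l) {k} h = Deg-mono (ℕₚ.≤-reflexive (ℕₚ.+-assoc k c (l ℕ.* c))) (Deg-δ^ l (Deg-δ h))

  δ-pth-power : ∀ b → δ (b ^ p) ≈ᴿ 0#
  δ-pth-power b = trans (go p) (trans (*-congʳ (trans (*-congʳ char) (zeroˡ _))) (zeroˡ _))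
    where
    go : ∀ n → δ (b ^ n) ≈ᴿ (κ n * b ^ ℕ.pred n) * δ b
    go zero = trans δ-1 (sym (trans (*-congʳ (zeroˡ _)) (zeroˡ _)))
    go (suc zero) = trans (δ-cong (*-identityʳ b)) (sym (trans (*-congʳ (trans (*-congʳ κ-1) (*-identityˡ _))) (*-identityˡ _)))
    go (suc (suc n)) = trans (δ-* b (b ^ suc n)) (trans (+-congˡ (*-congˡ (go (suc n))))
      (solve 4 (λ d b q k → d :* (b :* q) :+ b :* ((k :* q) :* d) := ((con (+ 1) :+ k) :* (b :* q)) :* d) refl (δ b) b (b ^ n) (κ (suc n))))

  module _ (P : Hom R K) where
    open Hom P

    -- Stands in for order of vanishing at least m at `P`, tested by derivatives so that no local
    -- ring is needed.
    Vanishes : ℕ → Carrier → Set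
    Vanishes m x = ∀ l → l < m → ⟦ δ^ l x ⟧ ≈ 0

    ψ-+ : ∀ l x y → ⟦ δ^ l (x + y) ⟧ ≈ ⟦ δ^ l x ⟧ ℕ.+ ⟦ δ^ l y ⟧
    ψ-+ l x y = K.trans (⟦⟧-cong (δ^-+ l x y)) (+-homo _ _)

    ψ-0 : ∀ l → ⟦ δ^ l 0# ⟧ ≈ 0
    ψ-0 l = K.trans (⟦⟧-cong (δ^-0 l)) 0-homo

    ψ-∑ : ∀ l {n} (f : Fin n → Carrier) → ⟦ δ^ l (∑ f) ⟧ ≈ KK.∑ (λ i → ⟦ δ^ l (f i) ⟧)
    ψ-∑ l f = additive-∑ R K (λ x → ⟦ δ^ l x ⟧) (ψ-0 l) (ψ-+ l) f

    κ-hom : ∀ n → ⟦ κ n ⟧ ≈ n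
    κ-hom n = K.trans (κ-homo n) (go n)
      where
      go : ∀ n → KK.κ n ≈ n
      go zero = K.refl
      go (suc n) = K.+-congˡ {1} (go n)

    ψ-κ* : ∀ l n x → ⟦ δ^ l (κ n * x) ⟧ ≈ n ℕ.* ⟦ δ^ l x ⟧
    ψ-κ* l n x = K.trans (⟦⟧-cong (δ^-κ* l n x)) (K.trans (*-homo _ _) (K.*-congʳ (κ-hom n)))

    -- By the product rule a derivative lowers the order of only one factor in each term.
    Vanishes-* : ∀ a b x y → Vanishes a x → Vanishes b y → Vanishes (a ℕ.+ b) (x * y)
    Vanishes-* zero zero x y h g zero ()
    Vanishes-* (suc a) b x y h g zero _ = K.trans (*-homo x y) (K.trans (K.*-congʳ (h 0 (s≤s z≤n))) K.refl)
    Vanishes-* zero (suc b) x y h g zero _ = K.trans (*-homo x y) (K.trans (K.*-congˡ {⟦ x ⟧} (g 0 (s≤s z≤n))) (K.zeroʳ ⟦ x ⟧))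
    Vanishes-* a b x y h g (suc l) l< = K.trans (⟦⟧-cong (δ^-cong l (δ-* x y))) (K.trans (ψ-+ l _ _)
      (K.+-cong (Vanishes-* (ℕ.pred a) b (δ x) y (shift a x h) g l (lt₁ a b l<))
                (Vanishes-* a (ℕ.pred b) x (δ y) h (shift b y g) l (lt₂ a b l<))))
      where
      shift : ∀ a x → Vanishes a x → Vanishes (ℕ.pred a) (δ x)
      shift (suc a) x h l l< = h (suc l) (s≤s l<)
      lt₁ : ∀ {l} a b → suc l < a ℕ.+ b → l < ℕ.pred a ℕ.+ b
      lt₁ zero b h = ℕₚ.<-trans (ℕₚ.n<1+n _) h
      lt₁ (suc a) b (s≤s h) = h
      lt₂ : ∀ {l} a b → suc l < a ℕ.+ b → l < a ℕ.+ ℕ.pred b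
      lt₂ a zero h = ℕₚ.<-trans (ℕₚ.n<1+n _) h
      lt₂ {l} a (suc b) h = ℕₚ.≤-pred (≡.subst (suc l <_) (ℕₚ.+-suc a b) h)

    Vanishes-0 : ∀ {x} → ⟦ x ⟧ ≈ 0 → Vanishes 1 x
    Vanishes-0 h zero _ = h
    Vanishes-0 h (suc l) (s≤s ())

    Vanishes-^ : ∀ {x} m → ⟦ x ⟧ ≈ 0 → Vanishes m (x ^ m)
    Vanishes-^ zero h l ()
    Vanishes-^ {x} (suc m) h = Vanishes-* 1 m x (x ^ m) (Vanishes-0 h) (Vanishes-^ m h)

    Vanishes-*ʳ : ∀ {m x} y → Vanishes m x → Vanishes m (x * y)
    Vanishes-*ʳ {m} {x} y h = ≡.subst (λ m → Vanishes m (x * y)) (ℕₚ.+-identityʳ m) (Vanishes-* m 0 x y h λ _ ())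

    -- The value is l! (δ T)^l H at the point, and l < p keeps the factorial invertible.
    leading≉0 : ∀ T → ⟦ T ⟧ ≈ 0 → ⟦ δ T ⟧ ≉ 0 → ∀ l → l < p → ∀ H → ⟦ H ⟧ ≉ 0 → ⟦ δ^ l (T ^ l * H) ⟧ ≉ 0
    leading≉0 T T≈0 δT≉0 zero _ H H≉0 e = H≉0 (K.trans (⟦⟧-cong (sym (*-identityˡ H))) e)
    leading≉0 T T≈0 δT≉0 (suc l) l< H H≉0 e = leading≉0 T T≈0 δT≉0 l (ℕₚ.<-trans (ℕₚ.n<1+n l) l<) (κ (suc l) * (δ T * H))
      (λ h → *-≉0 (x<p⇒x≉0 (s≤s z≤n) l<) (*-≉0 δT≉0 H≉0)
        (K.trans (K.sym (K.trans (*-homo _ _) (K.*-cong (κ-hom (suc l)) (*-homo _ _)))) h))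
      (K.trans (K.trans (K.sym (K.trans (K.+-congˡ {⟦ δ^ l (T ^ l * (κ (suc l) * (δ T * H))) ⟧}
          (Vanishes-*ʳ {suc l} (δ H) (Vanishes-^ (suc l) T≈0) l ℕₚ.≤-refl)) (K.+-identityʳ _)))
        (K.sym (K.trans (⟦⟧-cong (δ^-cong l (trans (δ-* (T ^ suc l) H) (+-congʳ (trans (*-congʳ (δ-pow l))
          (solve 4 (λ k t d h → (k :* t) :* d :* h := t :* (k :* (d :* h))) refl (κ (suc l)) (T ^ l) (δ T) H)))))) (ψ-+ l _ _)))) e)
      where
      δ-pow : ∀ l → δ (T ^ suc l) ≈ᴿ (κ (suc l) * T ^ l) * δ T
      δ-pow zero = trans (δ-cong (*-identityʳ T)) (sym (trans (*-congʳ (trans (*-congʳ κ-1) (*-identityˡ _))) (*-identityˡ _)))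
      δ-pow (suc l) = trans (δ-* T (T ^ suc l)) (trans (+-congˡ (*-congˡ (δ-pow l)))
        (solve 4 (λ d b q k → d :* (b :* q) :+ b :* ((k :* q) :* d) := ((con (+ 1) :+ k) :* (b :* q)) :* d) refl (δ T) T (T ^ l) (κ (suc l))))

  Separated : Hom R K → Hom R K → Set
  Separated P Q = ∃ λ r → Hom.⟦ P ⟧ r ≉ Hom.⟦ Q ⟧ r

  -- For each j take a function that distinguishes `P` from `Q j`, subtract its value at `Q j`, and
  -- raise the difference to the power m; the product over j does what is asked.
  isolating : ∀ m P {n} (Q : Fin n → Hom R K) → (∀ j → Separated P (Q j)) →
    ∃ λ H → (Hom.⟦ P ⟧ H ≉ 0) × (∀ j → Vanishes (Q j) m H)
  isolating m P {zero} Q sep = 1# , (λ h → 1≉0 (K.trans (K.sym (Hom.1-homo P)) h)) , λ ()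
  isolating m P {suc n} Q sep with isolating m P (Q ∘ Fin.suc) (sep ∘ Fin.suc) | sep Fin.zero
  ... | H , H≉0 , van | r , r≉ = (g ^ m) * H ,
        (λ h → *-≉0 (^-≉0 m g≉0) H≉0 (K.trans (K.sym (K.trans (Hom.*-homo P _ _) (K.*-congʳ (Hom.^-homo P g m)))) h)) ,
        λ { Fin.zero → Vanishes-*ʳ (Q Fin.zero) H (Vanishes-^ (Q Fin.zero) m g≈0)
          ; (Fin.suc j) → λ l l< → K.trans (Hom.⟦⟧-cong (Q (Fin.suc j)) (δ^-cong l (*-comm _ _))) (Vanishes-*ʳ (Q (Fin.suc j)) (g ^ m) (van j) l l<) }
    where
    q = Hom.⟦ Q Fin.zero ⟧ r
    g = r - κ q
    ev-g : ∀ P′ → Hom.⟦ P′ ⟧ g ≈ Hom.⟦ P′ ⟧ r K.- q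
    ev-g P′ = K.trans (Hom.sub-homo P′ r (κ q)) (K.+-congˡ {Hom.⟦ P′ ⟧ r} (K.-‿cong (κ-hom P′ q)))
    g≉0 : Hom.⟦ P ⟧ g ≉ 0
    g≉0 h = r≉ (KK.x-y≈0⇒x≈y (K.trans (K.sym (ev-g P)) h))
    g≈0 : Hom.⟦ Q Fin.zero ⟧ g ≈ 0
    g≈0 = K.trans (ev-g (Q Fin.zero)) (K.-‿inverseʳ q)

  -- F vanishing to order m at n points is orthogonal to n * m independent jets.
  zeros≤ : ∀ (t : Carrier) {n} (P : Fin n → Hom R K) → (∀ i → Hom.⟦ P i ⟧ (δ t) ≉ 0) →
    (∀ i j → i ≢ j → Separated (P i) (P j)) → ∀ m → m ≤ p → ∀ {k} F → ¬ (F ≈ᴿ 0#) → Deg k F →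
    (∀ i → Vanishes (P i) m F) → n ℕ.* m ≤ suc c ℕ.* (k ℕ.+ c)
  zeros≤ t {zero} P δt≉0 sep m m≤p F F≉0 degF van = z≤n
  zeros≤ t {suc n} P δt≉0 sep m m≤p F F≉0 degF van = independent-mod≤ domain F F≉0 degF E indep
    where
    iso : ∀ i → ∃ λ H → (Hom.⟦ P i ⟧ H ≉ 0) × (∀ j → Vanishes (P (Fin.punchIn i j)) m H)
    iso i = isolating m (P i) (P ∘ Fin.punchIn i) λ j → sep i (Fin.punchIn i j) (λ e → Finₚ.punchInᵢ≢i i j (≡.sym e))
    T : Fin (suc n) → Carrier
    T i = t - κ (Hom.⟦ P i ⟧ t)
    T≈0 : ∀ i → Hom.⟦ P i ⟧ (T i) ≈ 0
    T≈0 i = K.trans (Hom.sub-homo (P i) _ _) (KK.x≈y⇒x-y≈0 (K.sym (κ-hom (P i) _)))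
    δT≉0 : ∀ i → Hom.⟦ P i ⟧ (δ (T i)) ≉ 0
    δT≉0 i h = δt≉0 i (K.trans (Hom.⟦⟧-cong (P i) (sym (trans (δ-sub t (κ (Hom.⟦ P i ⟧ t))) (trans (+-congˡ (-‿cong′ (δ-κ (Hom.⟦ P i ⟧ t))))
        (solve 1 (λ x → x :- con (+ 0) := x) refl (δ t)))))) h)
      where open CommutativeRing R using () renaming (-‿cong to -‿cong′)
    -- Of order exactly l at `P i`, and of order at least m at the other points. The matrix of jets
    -- of these functions is thus block diagonal with triangular blocks, while multiples of `F` have
    -- zero jets.
    E₂ : Fin (suc n) × Fin m → Carrier
    E₂ (i , l) = T i ^ toℕ l * proj₁ (iso i)
    E : Fin (suc n ℕ.* m) → Carrier
    E b = E₂ (Fin.remQuot m b)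
    off : ∀ i l i′ l′ → toℕ l < m → (i ≢ i′ ⊎ (i ≡ i′ × toℕ {m} l < toℕ {m} l′)) → Hom.⟦ P i ⟧ (δ^ (toℕ l) (E₂ (i′ , l′))) ≈ 0
    off i l i′ l′ l< (inj₁ i≢i′) = K.trans (Hom.⟦⟧-cong (P i) (δ^-cong (toℕ l) (*-comm _ _)))
      (Vanishes-*ʳ (P i) (T i′ ^ toℕ l′) (≡.subst (λ z → Vanishes (P z) m (proj₁ (iso i′))) (Finₚ.punchIn-punchOut (i≢i′ ∘ ≡.sym)) (proj₂ (proj₂ (iso i′)) _)) (toℕ l) l<)
    off i l .i l′ l< (inj₂ (≡.refl , l<l′)) = Vanishes-*ʳ (P i) _ (Vanishes-^ (P i) (toℕ l′) (T≈0 i)) (toℕ l) l<l′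
    indep : ∀ (a : Fin (suc n ℕ.* m) → ℕ) h → (∑ λ b → κ (a b) * E b) + F * h ≈ᴿ 0# → ∀ b → a b ≈ 0
    indep a h rel b = ≡.subst (λ b → a b ≈ 0) (Finₚ.combine-remQuot {suc n} m b) (go (proj₁ (Fin.remQuot m b)) (suc (toℕ (proj₂ (Fin.remQuot {suc n} m b)))) _ ℕₚ.≤-refl)
      where
      -- Induction on the order: the l-th derivative at `P i` kills the functions of higher order
      -- there, and those of lower order already have coefficient 0.
      go : ∀ i N (l : Fin m) → toℕ l < N → a (Fin.combine i l) ≈ 0
      go i (suc N) l (s≤s l≤N) = integral (K.trans (K.*-comm ψE (a (Fin.combine i l))) (K.trans (K.sym eq) rel′)) ψE≉0
        where
        ψ : Carrier → ℕ
        ψ x = Hom.⟦ P i ⟧ (δ^ (toℕ l) x)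
        ψE = ψ (E (Fin.combine i l))
        rq : Fin.remQuot m (Fin.combine i l) ≡ (i , l)
        rq = Finₚ.remQuot-combine i l
        ψE≉0 : ψE ≉ 0
        ψE≉0 e = leading≉0 (P i) (T i) (T≈0 i) (δT≉0 i) (toℕ l) (ℕₚ.<-≤-trans (Finₚ.toℕ<n l) m≤p) (proj₁ (iso i)) (proj₁ (proj₂ (iso i)))
          (≡.subst (λ z → ψ (E₂ z) ≈ 0) rq e)
        rel′ : KK.∑ (λ b → a b ℕ.* ψ (E b)) ≈ 0
        rel′ = K.trans (K.sym (K.+-identityʳ _)) (K.trans (K.+-cong
            (KK.∑-cong λ b → K.sym (ψ-κ* (P i) (toℕ l) (a b) (E b))) (K.sym (Vanishes-*ʳ (P i) h (van i) (toℕ l) (Finₚ.toℕ<n l))))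
          (K.trans (K.+-congʳ (K.sym (ψ-∑ (P i) (toℕ l) (λ b → κ (a b) * E b)))) (K.trans (K.sym (ψ-+ (P i) (toℕ l) _ _))
            (K.trans (Hom.⟦⟧-cong (P i) (δ^-cong (toℕ l) rel)) (ψ-0 (P i) (toℕ l))))))
        eq : KK.∑ (λ b → a b ℕ.* ψ (E b)) ≈ a (Fin.combine i l) ℕ.* ψE
        eq = KK.∑-single (λ b → a b ℕ.* ψ (E b)) (Fin.combine i l) λ b b≢ → other b b≢ (Fin.remQuot {suc n} m b) ≡.refl
          where
          other : ∀ b → b ≢ Fin.combine i l → ∀ il′ → Fin.remQuot m b ≡ il′ → a b ℕ.* ψ (E b) ≈ 0
          other b b≢ (i′ , l′) e with i Fin.≟ i′
          ... | no i≢i′ = K.trans (K.*-congˡ {a b} (≡.subst (λ z → ψ (E₂ z) ≈ 0) (≡.sym e) (off i l i′ l′ (Finₚ.toℕ<n l) (inj₁ i≢i′)))) (K.zeroʳ (a b))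
          ... | yes ≡.refl with ℕₚ.<-cmp (toℕ l′) (toℕ l)
          ... | tri< l′<l _ _ = K.trans (K.*-congʳ {ψ (E b)} (≡.subst (λ z → a z ≈ 0)
                  (≡.trans (≡.cong (λ z → Fin.combine (proj₁ z) (proj₂ z)) (≡.sym e)) (Finₚ.combine-remQuot {suc n} m b)) (go i N l′ (ℕₚ.<-≤-trans l′<l l≤N)))) (K.zeroˡ (ψ (E b)))
          ... | tri≈ _ l′≡l _ = contradiction (≡.trans (≡.sym (Finₚ.combine-remQuot {suc n} m b)) (≡.trans (≡.cong (λ z → Fin.combine (proj₁ z) (proj₂ z)) e)
                  (≡.cong (Fin.combine i) (Finₚ.toℕ-injective l′≡l)))) b≢
          ... | tri> _ _ l<l′ = K.trans (K.*-congˡ {a b} (≡.subst (λ z → ψ (E₂ z) ≈ 0) (≡.sym e) (off i l i l′ (Finₚ.toℕ<n l) (inj₂ (≡.refl , l<l′))))) (K.zeroʳ (a b))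

-- Stepanov's method: choice of the parameters.

module StepanovArithmetic (p : ℕ) (2≤p : 2 ≤ p) (c : ℕ) (dim : ℕ → ℕ) (dim≡ : ∀ k → dim k ≡ suc c ℕ.* suc k) where
  open import Data.Nat using (_+_; _*_)
  open import Data.Nat.Solver using (module +-*-Solver)
  open +-*-Solver

  one≤ : ∀ {x y} → 1 ≤ x → 1 ≤ y → 1 ≤ x * y
  one≤ h g = ℕₚ.*-mono-≤ h g

  module _ (g B : ℕ) (c<g : suc c ≤ g) (1≤B : 1 ≤ B) where
    open ℕₚ.≤-Reasoning
    -- Here g bounds the rank, and A and B bound the degrees of the coefficients and of the
    -- functions whose p-th powers are taken. A is to absorb the degree losses collected in `slack`,
    -- which are of size g^2 B^2.
    A = 4 * (g * g * (B * B))
    1≤g : 1 ≤ g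
    1≤g = ℕₚ.≤-trans (s≤s z≤n) c<g
    c≤g : c ≤ g
    c≤g = ℕₚ.≤-trans (ℕₚ.n≤1+n c) c<g
    g≤gg : g ≤ g * g
    g≤gg = ℕₚ.≤-trans (ℕₚ.≤-reflexive (≡.sym (ℕₚ.*-identityʳ g))) (ℕₚ.*-monoʳ-≤ g 1≤g)
    ≤*B : ∀ x → x ≤ x * B
    ≤*B x = ℕₚ.≤-trans (ℕₚ.≤-reflexive (≡.sym (ℕₚ.*-identityʳ x))) (ℕₚ.*-monoʳ-≤ x 1≤B)
    B≤ : ∀ x → 1 ≤ x → B ≤ x * B
    B≤ x h = ℕₚ.≤-trans (ℕₚ.≤-reflexive (≡.sym (ℕₚ.*-identityˡ B))) (ℕₚ.*-monoˡ-≤ B h)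

    slack : B * (suc c * B * c + B + c) ≤ A
    slack = begin
      B * (suc c * B * c + B + c) ≤⟨ ℕₚ.*-monoʳ-≤ B (ℕₚ.+-mono-≤ (ℕₚ.+-mono-≤ (ℕₚ.*-mono-≤ (ℕₚ.*-monoˡ-≤ B c<g) c≤g) (B≤ (g * g) (one≤ 1≤g 1≤g)))
                                      (ℕₚ.≤-trans c≤g (ℕₚ.≤-trans g≤gg (≤*B (g * g))))) ⟩
      B * (g * B * g + g * g * B + g * g * B) ≡⟨ solve 2 (λ g b → b :* (g :* b :* g :+ g :* g :* b :+ g :* g :* b) := con 3 :* (g :* g :* (b :* b))) ≡.refl g B ⟩
      3 * (g * g * (B * B)) ≤⟨ ℕₚ.*-monoˡ-≤ (g * g * (B * B)) (ℕₚ.n≤1+n 3) ⟩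
      A ∎

    -- The auxiliary function exists because it has more free coefficients than conditions: (1 + c)
    -- B jets, each with `dim k` coordinates, are to vanish. After removing (1 + c)^2 the comparison
    -- is B (1 + k) < (1 + B) (1 + A).
    unknowns : suc c * B * dim (A + suc c * B * c + B + c) < dim B * dim A
    unknowns = begin-strict
      m * dim k ≡⟨ ≡.cong (m *_) (dim≡ k) ⟩
      m * (suc c * suc k) ≡⟨ solve 3 (λ D b k → (D :* b) :* (D :* k) := (D :* D) :* (b :* k)) ≡.refl (suc c) B (suc k) ⟩
      suc c * suc c * (B * suc k) <⟨ ℕₚ.*-monoʳ-< (suc c * suc c) lt ⟩
      suc c * suc c * (suc B * suc A) ≡⟨ solve 3 (λ D b a → (D :* D) :* (b :* a) := (D :* b) :* (D :* a)) ≡.refl (suc c) (suc B) (suc A) ⟩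
      suc c * suc B * (suc c * suc A) ≡⟨ ≡.cong₂ _*_ (≡.sym (dim≡ B)) (≡.sym (dim≡ A)) ⟩
      dim B * dim A ∎
      where
      m = suc c * B
      k = A + m * c + B + c
      lt : B * suc k < suc B * suc A
      lt = begin-strict
        B * suc k ≡⟨ solve 4 (λ b a x c → b :* (con 1 :+ (a :+ x :+ b :+ c)) := b :* (con 1 :+ a) :+ b :* (x :+ b :+ c)) ≡.refl B A (m * c) c ⟩
        B * suc A + B * (m * c + B + c) ≤⟨ ℕₚ.+-monoʳ-≤ (B * suc A) slack ⟩
        B * suc A + A <⟨ ℕₚ.+-monoʳ-< (B * suc A) (ℕₚ.n<1+n A) ⟩
        B * suc A + suc A ≡⟨ ℕₚ.+-comm (B * suc A) (suc A) ⟩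
        suc B * suc A ∎

    module _ (p-big : 6 * (g * g * g * (B * B)) ≤ p) where
      g³B² = g * g * g * (B * B)
      1≤g³B² : 1 ≤ g³B²
      1≤g³B² = one≤ (one≤ (one≤ 1≤g 1≤g) 1≤g) (one≤ 1≤B 1≤B)

      -- Forbids a nonzero element of degree A to vanish to order p at a single point. The 6 in the
      -- hypothesis comes from here: `A + c` is at most 5 g^2 B^2, and one more copy gives
      -- strictness.
      A-small : suc c * (A + c) < p
      A-small = begin-strict
        suc c * (A + c) ≤⟨ ℕₚ.*-mono-≤ c<g (ℕₚ.+-monoʳ-≤ A (ℕₚ.≤-trans c≤g (ℕₚ.≤-trans g≤gg (ℕₚ.≤-trans (≤*B (g * g)) (ℕₚ.≤-trans (≤*B (g * g * B)) (ℕₚ.≤-reflexive (ℕₚ.*-assoc (g * g) B B))))))) ⟩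
        g * (A + g * g * (B * B)) ≡⟨ solve 2 (λ g b → g :* (con 4 :* (g :* g :* (b :* b)) :+ g :* g :* (b :* b)) := con 5 :* (g :* g :* g :* (b :* b))) ≡.refl g B ⟩
        5 * g³B² <⟨ ℕₚ.*-monoˡ-< g³B² {{ℕ.>-nonZero 1≤g³B²}} (ℕₚ.n<1+n 5) ⟩
        6 * g³B² ≤⟨ p-big ⟩
        p ∎

      gg≤ggg : g * g ≤ g * g * g
      gg≤ggg = ℕₚ.≤-trans (ℕₚ.≤-reflexive (≡.sym (ℕₚ.*-identityʳ (g * g)))) (ℕₚ.*-monoʳ-≤ (g * g) 1≤g)

      -- Below this many points the point bound is immediate; above it there are enough of them to
      -- show that the auxiliary function is nonzero.
      few : suc c * (B + c) ≤ p
      few = begin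
        suc c * (B + c) ≤⟨ ℕₚ.*-mono-≤ c<g (ℕₚ.+-mono-≤ (B≤ g 1≤g) (ℕₚ.≤-trans c≤g (≤*B g))) ⟩
        g * (g * B + g * B) ≡⟨ solve 2 (λ g b → g :* (g :* b :+ g :* b) := con 2 :* (g :* g :* b)) ≡.refl g B ⟩
        2 * (g * g * B) ≤⟨ ℕₚ.*-mono-≤ {2} {6} (s≤s (s≤s z≤n)) (ℕₚ.*-mono-≤ gg≤ggg (≤*B B)) ⟩
        6 * g³B² ≤⟨ p-big ⟩
        p ∎

      m≤p : suc c * B ≤ p
      m≤p = ℕₚ.≤-trans (ℕₚ.*-monoʳ-≤ (suc c) (ℕₚ.m≤m+n B c)) few

      -- Since (1 + B)^2 ≤ 4 B^2, one has p ≤ 24 g^3 B^2, so the term (2 + p) g is at most 48 g^4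
      -- B^2; A adds 4 g^2 B^2. The sum 52 g^4 B^2 is then divided by B.
      final : p < 6 * (g * g * g) * (suc B * suc B) → ∀ n → n * (suc c * B) ≤ suc c * (A + p * (B + c) + c + c) →
        n ≤ p + 52 * (g * g * g * g) * B
      final p-small n h = ℕₚ.*-cancelʳ-≤ n _ B {{ℕ.>-nonZero 1≤B}} (begin
        n * B ≤⟨ ℕₚ.*-cancelˡ-≤ (suc c) (ℕₚ.≤-trans (ℕₚ.≤-reflexive (solve 3 (λ D n b → D :* (n :* b) := n :* (D :* b)) ≡.refl (suc c) n B)) h) ⟩
        A + p * (B + c) + c + c ≤⟨ ℕₚ.+-mono-≤ (ℕₚ.+-mono-≤ (ℕₚ.+-monoʳ-≤ A (ℕₚ.*-monoʳ-≤ p (ℕₚ.+-monoʳ-≤ B c≤g))) c≤g) c≤g ⟩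
        A + p * (B + g) + g + g ≡⟨ solve 4 (λ a p b g → a :+ p :* (b :+ g) :+ g :+ g := p :* b :+ a :+ (con 2 :+ p) :* g) ≡.refl A p B g ⟩
        p * B + A + (2 + p) * g ≤⟨ ℕₚ.+-monoʳ-≤ (p * B + A) (ℕₚ.*-monoˡ-≤ g (ℕₚ.≤-trans (ℕₚ.+-monoˡ-≤ p 2≤p) (ℕₚ.+-mono-≤ p≤ p≤))) ⟩
        p * B + A + (q + q) * g ≡⟨ solve 3 (λ p b g → p :* b :+ con 4 :* (g :* g :* (b :* b)) :+ (con 6 :* (g :* g :* g) :* (con 4 :* (b :* b)) :+ con 6 :* (g :* g :* g) :* (con 4 :* (b :* b))) :* g
                                     := p :* b :+ (con 4 :* (g :* g) :* b :+ con 48 :* (g :* g :* g :* g) :* b) :* b) ≡.refl p B g ⟩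
        p * B + (4 * (g * g) * B + 48 * (g * g * g * g) * B) * B ≤⟨ ℕₚ.+-monoʳ-≤ (p * B) (ℕₚ.*-monoˡ-≤ B (ℕₚ.+-monoˡ-≤ (48 * (g * g * g * g) * B) (ℕₚ.*-monoˡ-≤ B (ℕₚ.*-monoʳ-≤ 4 (ℕₚ.≤-trans gg≤ggg ggg≤))))) ⟩
        p * B + (4 * (g * g * g * g) * B + 48 * (g * g * g * g) * B) * B ≡⟨ solve 3 (λ p b x → p :* b :+ (con 4 :* x :* b :+ con 48 :* x :* b) :* b := (p :+ con 52 :* x :* b) :* b) ≡.refl p B (g * g * g * g) ⟩
        (p + 52 * (g * g * g * g) * B) * B ∎)
        where
        ggg≤ : g * g * g ≤ g * g * g * g
        ggg≤ = ℕₚ.≤-trans (ℕₚ.≤-reflexive (≡.sym (ℕₚ.*-identityʳ (g * g * g)))) (ℕₚ.*-monoʳ-≤ (g * g * g) 1≤g)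
        q = 6 * (g * g * g) * (4 * (B * B))
        p≤ : p ≤ q
        p≤ = ℕₚ.≤-trans (ℕₚ.<⇒≤ p-small) (ℕₚ.*-monoʳ-≤ (6 * (g * g * g)) (begin
          suc B * suc B ≤⟨ ℕₚ.*-mono-≤ (ℕₚ.+-monoˡ-≤ B 1≤B) (ℕₚ.+-monoˡ-≤ B 1≤B) ⟩
          (B + B) * (B + B) ≡⟨ solve 1 (λ b → (b :+ b) :* (b :+ b) := con 4 :* (b :* b)) ≡.refl B ⟩
          4 * (B * B) ∎))


-- Stepanov's method: the auxiliary function and the point bound.

module PointBound (p : ℕ) .{{_ : NonZero p}} (p-prime : Prime p)
                  (G : LinearAlgebra.Graded p p-prime)
                  (domain : LinearAlgebra.IsDomain p p-prime (LinearAlgebra.Graded.R G)) where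
  open PrimeField p p-prime
  open LinearAlgebra p p-prime
  open Graded G
  open GradedTheory G
  open Stepanov p p-prime G domain
  open CommutativeRing R using (Carrier; 0#; _+_; _*_; trans; sym; +-cong; *-congʳ; zeroˡ; *-identityˡ; distribʳ) renaming (_≈_ to _≈ᴿ_)
  open RingKit R
  open CharP R char
  open Derivation ∂

  module Auxiliary (t : Carrier) {n : ℕ} (P : Fin n → Hom R K) (δt≉0 : ∀ i → Hom.⟦ P i ⟧ (δ t) ≉ 0)
                   (sep : ∀ i j → i ≢ j → Separated (P i) (P j))
                   (A B m : ℕ) (m≤p : m ≤ p)
                   (A-small : suc c ℕ.* (A ℕ.+ c) < p)
                   (unknowns : m ℕ.* dim (A ℕ.+ m ℕ.* c ℕ.+ B ℕ.+ c) < dim B ℕ.* dim A)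
                   (n-large : suc c ℕ.* (B ℕ.+ c) < n) where

    k′ = A ℕ.+ m ℕ.* c ℕ.+ B ℕ.+ c

    b : Fin (dim B) → Carrier
    b j = from B (unit j)

    coords : (Fin (dim B ℕ.* dim A) → ℕ) → Fin (dim B) → Fin (dim A) → ℕ
    coords x j i = x (Fin.combine j i)

    a : (Fin (dim B ℕ.* dim A) → ℕ) → Fin (dim B) → Carrier
    a x j = from A (coords x j)

    a-cong : ∀ x y → (∀ q → x q ≈ y q) → ∀ j → a x j ≈ᴿ a y j
    a-cong x y h j = from-cong A _ _ λ i → h _

    a-+ : ∀ x y j → a (λ q → x q ℕ.+ y q) j ≈ᴿ a x j + a y j
    a-+ x y j = from-+ A _ _

    -- The l-th derivative of `F` with `b j` in place of `b j ^ p`. Its degree does not involve p,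
    -- so making it vanish identically is cheap, and this forces the derivative of `F` to vanish at
    -- every rational point.
    jet : ℕ → (Fin (dim B ℕ.* dim A) → ℕ) → Carrier
    jet l x = ∑ λ j → δ^ l (a x j) * b j

    jet-cong : ∀ l x y → (∀ q → x q ≈ y q) → jet l x ≈ᴿ jet l y
    jet-cong l x y h = ∑-cong {dim B} λ j → *-congʳ (δ^-cong l (a-cong x y h j))

    jet-+ : ∀ l x y → jet l (λ q → x q ℕ.+ y q) ≈ᴿ jet l x + jet l y
    jet-+ l x y = trans (∑-cong {dim B} λ j → trans (*-congʳ (trans (δ^-cong l (a-+ x y j)) (δ^-+ l _ _))) (distribʳ _ _ _))
      (∑-+ {dim B} (λ j → δ^ l (a x j) * b j) _)

    jet-Deg : ∀ l → l < m → ∀ x → Deg k′ (jet l x)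
    jet-Deg l l<m x = Deg-∑ {n = dim B} _ λ j → Deg-mono (ℕₚ.+-monoˡ-≤ c (ℕₚ.+-monoˡ-≤ B (ℕₚ.+-monoʳ-≤ A (ℕₚ.*-monoˡ-≤ c (ℕₚ.<⇒≤ l<m)))))
      (Deg-* (Deg-δ^ l (from-Deg A _)) (from-Deg B _))

    F : (Fin (dim B ℕ.* dim A) → ℕ) → Carrier
    F x = ∑ λ j → a x j * b j ^ p

    F-Deg : ∀ x → Deg (A ℕ.+ p ℕ.* (B ℕ.+ c) ℕ.+ c) (F x)
    F-Deg x = Deg-∑ {n = dim B} _ λ j → Deg-* (from-Deg A _) (Deg-^ p (from-Deg B _))

    -- p-th powers are constants of δ, and they agree with their base at the points over F_p.
    F-jet : ∀ i l x → Hom.⟦ P i ⟧ (δ^ l (F x)) ≈ KK.∑ (λ j → Hom.⟦ P i ⟧ (δ^ l (a x j)) ℕ.* Hom.⟦ P i ⟧ (b j))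
    F-jet i l x = K.trans (ψ-∑ (P i) l {dim B} _) (KK.∑-cong {dim B} λ j → K.trans (⟦⟧-cong (δ^-const* l (b j ^ p) (a x j) (δ-pth-power (b j))))
        (K.trans (*-homo _ _) (K.*-congˡ {⟦ δ^ l (a x j) ⟧} (K.trans (^-homo (b j) p) (frobenius _)))))
      where open Hom (P i)

    jet-eval : ∀ i l x → Hom.⟦ P i ⟧ (jet l x) ≈ KK.∑ (λ j → Hom.⟦ P i ⟧ (δ^ l (a x j)) ℕ.* Hom.⟦ P i ⟧ (b j))
    jet-eval i l x = K.trans (ψ-∑ (P i) 0 {dim B} _) (KK.∑-cong {dim B} λ j → Hom.*-homo (P i) _ _)

    -- The rational points themselves prove it. If F = 0, then at each point q the combination of
    -- the `a x j` with weights `b j` (q) has all derivatives of order below p equal to 0 there,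
    -- hence is 0 because its degree is small. Reading off its coordinates, each `h i` vanishes at
    -- all n points, which are too many for degree B; so `h i` = 0 and x = 0.
    F≉0 : ∀ x → (∃ λ q → x q ≉ 0) → ¬ (F x ≈ᴿ 0#)
    F≉0 x (q₀ , x≉0) F≈0 = x≉0 (≡.subst (λ q → x q ≈ 0) (Finₚ.combine-remQuot {dim B} (dim A) q₀) (x≈0 (proj₁ (Fin.remQuot {dim B} (dim A) q₀)) (proj₂ (Fin.remQuot {dim B} (dim A) q₀))))
      where
      β : Fin n → Fin (dim B) → ℕ
      β q j = Hom.⟦ P q ⟧ (b j)
      g : Fin n → Carrier
      g q = ∑ λ j → κ (β q j) * a x j
      g-van : ∀ q → Vanishes (P q) p (g q)
      g-van q l _ = K.trans (ψ-∑ (P q) l {dim B} _) (K.trans (KK.∑-cong {dim B} λ j → K.trans (ψ-κ* (P q) l (β q j) (a x j)) (K.*-comm (β q j) _))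
        (K.trans (K.sym (F-jet q l x)) (K.trans (Hom.⟦⟧-cong (P q) (δ^-cong l F≈0)) (ψ-0 (P q) l))))
      g≈0 : ∀ q → g q ≈ᴿ 0#
      g≈0 q with zero? (g q)
      ... | yes h = h
      ... | no h = contradiction
        (≡.subst (_≤ suc c ℕ.* (A ℕ.+ c)) (ℕₚ.*-identityˡ p) (zeros≤ t {1} (λ _ → P q) (λ _ → δt≉0 q) (λ { Fin.zero Fin.zero ne → contradiction ≡.refl ne })
          p ℕₚ.≤-refl (g q) h (Deg-∑ {n = dim B} _ λ j → Deg-κ* (β q j) (from-Deg A _)) λ _ → g-van q))
        (ℕₚ.<⇒≱ A-small)
      scaled : ∀ k y → from A (λ i → k ℕ.* y i) ≈ᴿ κ k * from A y
      scaled zero y = trans (x+x≈x⇒x≈0 _ (sym (from-+ A _ _))) (sym (zeroˡ _))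
      scaled (suc k) y = trans (from-+ A _ _) (trans (+-cong (sym (*-identityˡ _)) (scaled k y)) (sym (distribʳ _ _ _)))
      from-∑ : ∀ {N} (β : Fin N → ℕ) (y : Fin N → Fin (dim A) → ℕ) →
        from A (λ i → KK.∑ λ j → β j ℕ.* y j i) ≈ᴿ ∑ λ j → κ (β j) * from A (y j)
      from-∑ {zero} β y = x+x≈x⇒x≈0 _ (sym (from-+ A _ _))
      from-∑ {suc N} β y = trans (from-+ A _ _) (+-cong (scaled (β Fin.zero) (y Fin.zero)) (from-∑ (β ∘ Fin.suc) (y ∘ Fin.suc)))
      relation : ∀ q i → KK.∑ (λ j → β q j ℕ.* coords x j i) ≈ 0
      relation q = from-0 A _ (trans (from-∑ (β q) (coords x)) (g≈0 q))
      h : Fin (dim A) → Carrier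
      h i = from B λ j → coords x j i
      h-van : ∀ i q → Hom.⟦ P q ⟧ (h i) ≈ 0
      h-van i q = K.trans (Hom.⟦⟧-cong (P q) (additive⇒linear (from B) (from-cong B) (from-+ B) _)) (K.trans (ψ-∑ (P q) 0 {dim B} _)
        (K.trans (KK.∑-cong {dim B} λ j → K.trans (ψ-κ* (P q) 0 (coords x j i) (b j)) (K.*-comm (coords x j i) (β q j))) (relation q i)))
      h≈0 : ∀ i → h i ≈ᴿ 0#
      h≈0 i with zero? (h i)
      ... | yes e = e
      ... | no ne = contradiction (≡.subst (_≤ suc c ℕ.* (B ℕ.+ c)) (ℕₚ.*-identityʳ n) (zeros≤ t P δt≉0 sep 1 (ℕₚ.<⇒≤ 2≤p) (h i) ne (from-Deg B _) λ q → Vanishes-0 (P q) (h-van i q)))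
                    (ℕₚ.<⇒≱ n-large)
      x≈0 : ∀ j i → x (Fin.combine j i) ≈ 0
      x≈0 j i = from-0 B _ (h≈0 i) j

    bound : n ℕ.* m ≤ suc c ℕ.* (A ℕ.+ p ℕ.* (B ℕ.+ c) ℕ.+ c ℕ.+ c)
    bound = use (kernel-vector {dim B ℕ.* dim A} {m ℕ.* dim k′} unknowns (λ x j → L x (Fin.remQuot (dim k′) j))
          (λ x y h j → L-cong x y h (Fin.remQuot (dim k′) j)) (λ x y j → L-+ x y (Fin.remQuot (dim k′) j)))
      where
      L : (Fin (dim B ℕ.* dim A) → ℕ) → Fin m × Fin (dim k′) → ℕ
      L x (l , q) = to k′ (jet (toℕ l) x) q
      L-cong : ∀ x y → (∀ q → x q ≈ y q) → ∀ lq → L x lq ≈ L y lq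
      L-cong x y h (l , q) = to-cong k′ (jet-cong (toℕ l) x y h) q
      L-+ : ∀ x y lq → L (λ q → x q ℕ.+ y q) lq ≈ L x lq ℕ.+ L y lq
      L-+ x y (l , q) = K.trans (to-cong k′ (jet-+ (toℕ l) x y) q) (to-+ k′ (jet (toℕ l) x) (jet (toℕ l) y) q)
      use : (∃ λ x → (∃ λ q → x q ≉ 0) × (∀ j → L x (Fin.remQuot (dim k′) j) ≈ 0)) → n ℕ.* m ≤ suc c ℕ.* (A ℕ.+ p ℕ.* (B ℕ.+ c) ℕ.+ c ℕ.+ c)
      use (x , x≉0 , ker) = zeros≤ t P δt≉0 sep m m≤p (F x) (F≉0 x x≉0) (F-Deg x) van
        where
        jet≈0 : ∀ l → l < m → jet l x ≈ᴿ 0#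
        jet≈0 l l<m = to-0 k′ (jet l x) (jet-Deg l l<m x) λ q → ≡.subst (λ l → to k′ (jet l x) q ≈ 0) (Finₚ.toℕ-fromℕ< l<m)
          (≡.subst (λ lq → L x lq ≈ 0) (Finₚ.remQuot-combine (Fin.fromℕ< l<m) q) (ker (Fin.combine (Fin.fromℕ< l<m) q)))
        van : ∀ i → Vanishes (P i) m (F x)
        van i l l<m = K.trans (F-jet i l x) (K.trans (K.sym (jet-eval i l x)) (K.trans (Hom.⟦⟧-cong (P i) (jet≈0 l l<m)) (Hom.0-homo (P i))))

  private module Arith = StepanovArithmetic p 2≤p c dim dim≡

  points≤ : ∀ (g B : ℕ) → suc c ≤ g → 1 ≤ B → 6 ℕ.* (g ℕ.* g ℕ.* g ℕ.* (B ℕ.* B)) ≤ p →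
    p < 6 ℕ.* (g ℕ.* g ℕ.* g) ℕ.* (suc B ℕ.* suc B) →
    ∀ (t : Carrier) {n} (P : Fin n → Hom R K) → (∀ i → Hom.⟦ P i ⟧ (δ t) ≉ 0) →
    (∀ i j → i ≢ j → Separated (P i) (P j)) → n ≤ p ℕ.+ 52 ℕ.* (g ℕ.* g ℕ.* g ℕ.* g) ℕ.* B
  points≤ g B c<g 1≤B p-big p-small t {n} P δt≉0 sep with suc (suc c ℕ.* (B ℕ.+ c)) ℕ.≤? n
  -- With few points there may be no nonvanishing argument for the auxiliary function, but then n ≤
  -- p already.
  ... | no few = ℕₚ.≤-trans (ℕₚ.≤-trans (ℕₚ.≤-pred (ℕₚ.≰⇒> few)) (Arith.few g B c<g 1≤B p-big)) (ℕₚ.m≤m+n p _)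
  ... | yes many = Arith.final g B c<g 1≤B p-big p-small n
        (Auxiliary.bound t P δt≉0 sep (Arith.A g B c<g 1≤B) B (suc c ℕ.* B) (Arith.m≤p g B c<g 1≤B p-big)
          (Arith.A-small g B c<g 1≤B p-big) (Arith.unknowns g B c<g 1≤B) many)

-- The line: grading of F_p[t].

module BaseLine (p : ℕ) .{{_ : NonZero p}} (p-prime : Prime p) where
  open PrimeField p p-prime
  open LinearAlgebra p p-prime
  open KP

  private
    zeroDerivation : Derivation K
    zeroDerivation = record { δ = λ _ → 0 ; δ-cong = λ _ → K.refl ; δ-+ = λ _ _ → K.refl ; δ-* = λ x y → K.sym (K.zeroʳ x) }

  module ∂ₜ = PolyDerivation K zeroDerivation (1 ∷ [])

  DegP : ℕ → Poly → Set
  DegP k f = ∀ i → k < i → coeff f i ≈ 0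

  private
    tail≋[] : ∀ {a f} → DegP 0 (a ∷ f) → f ≋ []
    tail≋[] h = mk≋ λ i → h (suc i) (s≤s z≤n)

    tail-Deg : ∀ {k a f} → DegP (suc k) (a ∷ f) → DegP k f
    tail-Deg h i k<i = h (suc i) (s≤s k<i)

    DegP-⊗ : ∀ f {j k g} → DegP j f → DegP k g → DegP (j ℕ.+ k) (f ⊗ g)
    DegP-⊗ [] hf hg i _ = K.refl
    DegP-⊗ (a ∷ f) {j} {k} {g} hf hg i lt = K.trans (coeff-⊕ (a · g) (0 ∷ f ⊗ g) i) (K.+-cong
      (K.trans (coeff-· a g i) (K.trans (K.*-congˡ {a} (hg i (ℕₚ.≤-<-trans (ℕₚ.m≤n+m k j) lt))) (K.zeroʳ a))) (rest j hf i lt))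
      where
      rest : ∀ j → DegP j (a ∷ f) → ∀ i → j ℕ.+ k < i → coeff (0 ∷ f ⊗ g) i ≈ 0
      rest j hf zero _ = K.refl
      rest zero hf (suc i) _ = at (P.*-congʳ {g} (tail≋[] {a} hf)) i
      rest (suc j) hf (suc i) (s≤s lt) = DegP-⊗ f (tail-Deg {j} {a} hf) hg i lt

    DegP-D : ∀ f {k} → DegP k f → DegP k (∂ₜ.D f)
    DegP-D [] h i _ = K.refl
    DegP-D (a ∷ f) {k} h (suc i) lt = K.trans (coeff-⊕ (0 ∷ []) ((0 ∷ ∂ₜ.D f) ⊕ (1 ∷ []) ⊗ f) (suc i))
      (K.trans (coeff-⊕ (0 ∷ ∂ₜ.D f) ((1 ∷ []) ⊗ f) (suc i)) (K.+-cong (part k h lt) (K.trans (at (P.*-identityˡ f) (suc i)) (h (suc (suc i)) (ℕₚ.m<n⇒m<1+n lt)))))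
      where
      part : ∀ k → DegP k (a ∷ f) → k < suc i → coeff (∂ₜ.D f) i ≈ 0
      part zero h _ = at (∂ₜ.D-[] f (tail≋[] {a} h)) i
      part (suc k) h (s≤s lt) = DegP-D f (tail-Deg {k} {a} h) i lt

    length-Deg : ∀ f i → length f ≤ i → coeff f i ≈ 0
    length-Deg [] i _ = K.refl
    length-Deg (a ∷ f) (suc i) (s≤s h) = length-Deg f i h

    coeff-tabulate : ∀ {n} (a : Fin n → ℕ) i → coeff (List.tabulate a) (toℕ i) ≡ a i
    coeff-tabulate a Fin.zero = ≡.refl
    coeff-tabulate a (Fin.suc i) = coeff-tabulate (a ∘ Fin.suc) i

    coeff-tabulate-≥ : ∀ {n} (a : Fin n → ℕ) i → n ≤ i → coeff (List.tabulate a) i ≡ 0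
    coeff-tabulate-≥ {zero} a i _ = ≡.refl
    coeff-tabulate-≥ {suc n} a (suc i) (s≤s h) = coeff-tabulate-≥ (a ∘ Fin.suc) i h

    tabulate-≋ : ∀ {n} (f g : Poly) → (∀ (i : Fin n) → coeff f (toℕ i) ≈ coeff g (toℕ i)) →
      (∀ i → n ≤ i → coeff f i ≈ coeff g i) → f ≋ g
    tabulate-≋ {n} f g lo hi = mk≋ λ i → pick i (n ℕ.≤? i)
      where
      pick : ∀ i → Dec (n ≤ i) → coeff f i ≈ coeff g i
      pick i (yes n≤i) = hi i n≤i
      pick i (no n≰i) = ≡.subst (λ i → coeff f i ≈ coeff g i) (Finₚ.toℕ-fromℕ< (ℕₚ.≰⇒> n≰i)) (lo (Fin.fromℕ< (ℕₚ.≰⇒> n≰i)))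

    ≡⇒≈ : ∀ {x y} → x ≡ y → x ≈ y
    ≡⇒≈ e = mk≈ (≡.cong (_% p) e)

    κ-const : ∀ n → PK.κ n ≋ (n ∷ [])
    κ-const zero = P.sym (∷≋[] K.refl P.refl)
    κ-const (suc n) = P.+-congˡ {1 ∷ []} (κ-const n)

  graded : Graded
  graded = record
    { R = polyRing
    ; char = P.trans (κ-const p) (∷≋[] p≈0 P.refl)
    ; ∂ = ∂ₜ.polyDerivation
    ; c = 0
    ; Deg = DegP
    ; Deg-resp = λ e h i lt → K.trans (K.sym (at e i)) (h i lt)
    ; Deg-mono = λ le h i lt → h i (ℕₚ.≤-<-trans le lt)
    ; Deg-+ = λ {k} {x} {y} h g i lt → K.trans (coeff-⊕ x y i) (K.+-cong (h i lt) (g i lt))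
    ; Deg-0 = λ _ _ → K.refl
    ; Deg-1 = λ { (suc i) _ → K.refl }
    ; Deg-* = λ {j} {k} {x} {y} h g → ≡.subst (λ n → DegP n (x ⊗ y)) (≡.sym (ℕₚ.+-identityʳ (j ℕ.+ k))) (DegP-⊗ x h g)
    ; Deg-δ = λ {k} {x} h → ≡.subst (λ n → DegP n (∂ₜ.D x)) (≡.sym (ℕₚ.+-identityʳ k)) (DegP-D x h)
    ; deg∃ = λ x → length x , λ i lt → length-Deg x i (ℕₚ.<⇒≤ lt)
    ; dim = suc
    ; dim≡ = λ k → ≡.sym (ℕₚ.*-identityˡ (suc k))
    ; from = λ k a → List.tabulate a
    ; from-cong = λ k a b h → tabulate-≋ {suc k} _ _
        (λ i → K.trans (≡⇒≈ (coeff-tabulate a i)) (K.trans (h i) (≡⇒≈ (≡.sym (coeff-tabulate b i)))))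
        (λ i le → ≡⇒≈ (≡.trans (coeff-tabulate-≥ a i le) (≡.sym (coeff-tabulate-≥ b i le))))
    ; from-+ = λ k a b → tabulate-≋ {suc k} _ (List.tabulate a ⊕ List.tabulate b)
        (λ i → K.trans (≡⇒≈ (coeff-tabulate (λ i → a i ℕ.+ b i) i)) (K.sym (K.trans (coeff-⊕ (List.tabulate a) (List.tabulate b) (toℕ i))
          (≡⇒≈ (≡.cong₂ ℕ._+_ (coeff-tabulate a i) (coeff-tabulate b i))))))
        (λ i le → K.trans (≡⇒≈ (coeff-tabulate-≥ (λ i → a i ℕ.+ b i) i le)) (K.sym (K.trans (coeff-⊕ (List.tabulate a) (List.tabulate b) i)
          (≡⇒≈ (≡.cong₂ ℕ._+_ (coeff-tabulate-≥ a i le) (coeff-tabulate-≥ b i le))))))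
    ; from-Deg = λ k a i lt → ≡⇒≈ (coeff-tabulate-≥ a i lt)
    ; from-0 = λ k a h i → K.trans (≡⇒≈ (≡.sym (coeff-tabulate a i))) (at h (toℕ i))
    ; to = λ k x i → coeff x (toℕ i)
    ; to-cong = λ k e i → at e (toℕ i)
    ; to-+ = λ k x y i → coeff-⊕ x y (toℕ i)
    ; to-0 = λ k x deg h → tabulate-≋ {suc k} x [] h λ i le → deg i le
    }

  -- Factors X are stripped from the first polynomial until its constant term is nonzero; then the
  -- lowest coefficients of the second one vanish in turn.
  isDomain : IsDomain polyRing
  isDomain [] g f≉0 _ = contradiction P.refl f≉0
  isDomain (a ∷ f) g f≉0 fg≈0 with a ≈? 0
  ... | yes a≈0 = isDomain f g (λ h → f≉0 (∷≋[] a≈0 h)) (mk≋ λ i → at (P.trans (P.sym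
        (P.trans (P.*-congʳ {g} (P.trans (∷-cong a≈0 P.refl) (P.sym (X⊗ f)))) (P.trans (P.*-assoc X f g) (X⊗ (f ⊗ g))))) fg≈0) (suc i))
  ... | no a≉0 = go g fg≈0
    where
    go : ∀ g → (a ∷ f) ⊗ g ≋ [] → g ≋ []
    go [] _ = P.refl
    go (b ∷ g) h = ∷≋[] b≈0 (go g (mk≋ λ i → at shifted (suc i)))
      where
      b≈0 : b ≈ 0
      b≈0 = integral {a} (K.trans (K.sym (K.+-identityʳ (a ℕ.* b))) (at h 0)) a≉0
      shifted : (0 ∷ ((a ∷ f) ⊗ g)) ≋ []
      shifted = P.trans (P.sym (X⊗ ((a ∷ f) ⊗ g))) (P.trans (P.trans (P.sym (P.*-assoc X (a ∷ f) g))
        (P.trans (P.*-congʳ {g} (P.*-comm X (a ∷ f))) (P.*-assoc (a ∷ f) X g)))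
        (P.trans (P.*-congˡ {a ∷ f} (P.trans (X⊗ g) (∷-cong (K.sym b≈0) P.refl))) h))

-- Grading of a Kummer extension.

module KummerStep (p : ℕ) .{{_ : NonZero p}} (p-prime : Prime p) (d′ : ℕ) (1≤d′ : 1 ≤ d′)
                  (dinv : ℕ) (d-unit : PrimeField._≈_ p p-prime (dinv ℕ.* suc d′) 1)
                  (G : LinearAlgebra.Graded p p-prime)
                  (ℓ : CommutativeRing.Carrier (LinearAlgebra.Graded.R G))
                  (ℓ-Deg : LinearAlgebra.Graded.Deg G 1 ℓ) where
  open PrimeField p p-prime
  open LinearAlgebra p p-prime
  open Graded G
  open GradedTheory G
  open CommutativeRing R using (Carrier; 0#; 1#; _*_; trans; sym; refl; +-cong; +-congˡ; *-congˡ; *-congʳ; zeroʳ; +-identityʳ; *-identityˡ; *-assoc; *-comm) renaming (_≈_ to _≈ᴿ_)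
  open RingKit R
  open CharP R char
  open Derivation ∂
  open Polynomials R
  open Extension R d′ ℓ public

  θ : Carrier
  θ = κ dinv * δ ℓ

  dθ : suc d′ ⨯ θ ≈ᴿ δ ℓ
  dθ = trans (κ-*ˡ (suc d′) θ) (trans (sym (*-assoc _ _ _)) (trans (*-congʳ (trans (*-comm _ _)
    (trans (sym (κ-* dinv (suc d′))) (trans (κ-cong d-unit) κ-1)))) (*-identityˡ _)))

  open ExtDerivation R d′ ℓ ∂ θ dθ public using (nf-D; extDerivation; D-ι)

  -- A multiplication by v costs 1 + c in degree, because the coordinate that wraps is multiplied by
  -- ℓ of degree 1, and reduced elements contain at most `d′` factors v. At the same time 1 + c″ =
  -- (1 + d′)(1 + c), so the rank and the excess remain tied to one number.
  c″ : ℕ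
  c″ = c ℕ.+ d′ ℕ.* suc c

  Degₑ : ℕ → Poly → Set
  Degₑ k x = ∀ e → e ≤ d′ → Deg k (nf x e)

  private
    Degₑ-+ : ∀ {k x y} → Degₑ k x → Degₑ k y → Degₑ k (x ⊕ y)
    Degₑ-+ {k} {x} {y} h g e e≤ = Deg-resp (sym (nf-⊕ x y e)) (Deg-+ (h e e≤) (g e e≤))

    Degₑ-mono : ∀ {j k x} → j ≤ k → Degₑ j x → Degₑ k x
    Degₑ-mono le h e e≤ = Deg-mono le (h e e≤)

    Degₑ-resp : ∀ {k x y} → x ≈ₑ y → Degₑ k x → Degₑ k y
    Degₑ-resp q h e e≤ = Deg-resp (atₑ q e e≤) (h e e≤)

    Degₑ-v* : ∀ {k x} → Degₑ k x → Degₑ (k ℕ.+ suc c) (v ⊗ x)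
    Degₑ-v* {k} {x} h zero _ = Deg-resp (sym (nf-v*-0 x)) (Deg-mono (ℕₚ.≤-reflexive (≡.sym (ℕₚ.+-suc k c))) (Deg-* ℓ-Deg (h d′ ℕₚ.≤-refl)))
    Degₑ-v* {k} {x} h (suc e) e< = Deg-resp (sym (nf-v*-suc x e)) (Deg-mono (ℕₚ.m≤m+n k _) (h e (ℕₚ.<⇒≤ e<)))

    Degₑ-ι* : ∀ {j k a x} → Deg j a → Degₑ k x → Degₑ (j ℕ.+ k ℕ.+ c) (ι.⟦ a ⟧ ⊗ x)
    Degₑ-ι* {a = a} {x} h g e e≤ = Deg-resp (sym (nf-ι* a x e)) (Deg-* h (g e e≤))

    Degₑ-list : ∀ {j k y} L (a : ℕ → Carrier) → (∀ e → e ≤ L → Deg j (a e)) → Degₑ k y →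
      Degₑ (j ℕ.+ k ℕ.+ c ℕ.+ L ℕ.* suc c) (List.applyUpTo a (suc L) ⊗ y)
    Degₑ-list {j} {k} {y} zero a h g = Degₑ-mono {x = ι.⟦ a 0 ⟧ ⊗ y} (ℕₚ.m≤m+n _ 0) (Degₑ-ι* {a = a 0} {x = y} (h 0 z≤n) g)
    Degₑ-list {j} {k} {y} (suc L) a h g = Degₑ-resp {x = ι.⟦ a 0 ⟧ ⊗ y ⊕ v ⊗ (rest ⊗ y)} {y = List.applyUpTo a (suc (suc L)) ⊗ y} (≋⇒≈ₑ (P.sym (P.trans (P.*-congʳ {y} (∷≋ (a 0) rest))
        (P.trans (P.distribʳ y (a 0 ∷ []) (X ⊗ rest)) (P.+-congˡ {(a 0 ∷ []) ⊗ y} (P.*-assoc X rest y))))))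
      (Degₑ-+ {x = ι.⟦ a 0 ⟧ ⊗ y} {y = v ⊗ (rest ⊗ y)} (Degₑ-mono {x = ι.⟦ a 0 ⟧ ⊗ y} (ℕₚ.m≤m+n _ _) (Degₑ-ι* {a = a 0} {x = y} (h 0 z≤n) g))
        (Degₑ-mono {x = v ⊗ (rest ⊗ y)} (ℕₚ.≤-reflexive (≡.trans (ℕₚ.+-assoc (j ℕ.+ k ℕ.+ c) (L ℕ.* suc c) (suc c)) (≡.cong (j ℕ.+ k ℕ.+ c ℕ.+_) (ℕₚ.+-comm (L ℕ.* suc c) (suc c)))))
          (Degₑ-v* {x = rest ⊗ y} (Degₑ-list {y = y} L (a ∘ suc) (λ e e≤ → h (suc e) (s≤s e≤)) g))))
      where rest = List.applyUpTo (a ∘ suc) (suc L)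

    Degₑ-* : ∀ {j k x y} → Degₑ j x → Degₑ k y → Degₑ (j ℕ.+ k ℕ.+ c″) (x ⊗ y)
    Degₑ-* {j} {k} {x} {y} h g = Degₑ-resp {x = List.applyUpTo (nf x) (suc d′) ⊗ y} {y = x ⊗ y} (E.*-congʳ {y} (E.sym (normal x)))
      (Degₑ-mono {x = List.applyUpTo (nf x) (suc d′) ⊗ y} (ℕₚ.≤-reflexive (ℕₚ.+-assoc (j ℕ.+ k) c (d′ ℕ.* suc c))) (Degₑ-list {y = y} d′ (nf x) h g))

    Deg-⨯ : ∀ n {k x} → Deg k x → Deg k (n ⨯ x)
    Deg-⨯ zero h = Deg-0
    Deg-⨯ (suc n) h = Deg-+ h (Deg-⨯ n h)

    1+c≤ : suc c ≤ d′ ℕ.* suc c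
    1+c≤ = ℕₚ.≤-trans (ℕₚ.≤-reflexive (≡.sym (ℕₚ.*-identityˡ (suc c)))) (ℕₚ.*-monoˡ-≤ (suc c) 1≤d′)

    Degₑ-δ : ∀ {k x} → Degₑ k x → Degₑ (k ℕ.+ c″) (Derivation.δ extDerivation x)
    Degₑ-δ {k} {x} h e e≤ = Deg-resp (sym (nf-D x e e≤)) (Deg-+
      (Deg-mono le₁ (Deg-* ℓ-Deg (Deg-δ (h e e≤))))
      (Deg-mono le₂ (Deg-* (Deg-⨯ e (Deg-κ* dinv (Deg-δ ℓ-Deg))) (h e e≤))))
      where
      le₁ : 1 ℕ.+ (k ℕ.+ c) ℕ.+ c ≤ k ℕ.+ c″
      le₁ = ℕₚ.≤-trans (ℕₚ.≤-reflexive (≡.trans (≡.sym (ℕₚ.+-suc (k ℕ.+ c) c)) (ℕₚ.+-assoc k c (suc c)))) (ℕₚ.+-monoʳ-≤ k (ℕₚ.+-monoʳ-≤ c 1+c≤))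
      le₂ : 1 ℕ.+ c ℕ.+ k ℕ.+ c ≤ k ℕ.+ c″
      le₂ = ℕₚ.≤-trans (ℕₚ.≤-reflexive (≡.cong suc (≡.cong (ℕ._+ c) (ℕₚ.+-comm c k)))) le₁

    degₑ∃ : ∀ x → ∃ λ k → Degₑ k x
    degₑ∃ x with deg-bound {suc d′} (λ e → nf x (toℕ e))
    ... | k , h = k , λ e e≤ → ≡.subst (λ e → Deg k (nf x e)) (Finₚ.toℕ-fromℕ< (s≤s e≤)) (h (Fin.fromℕ< (s≤s e≤)))

    dimₑ : ℕ → ℕ
    dimₑ k = suc d′ ℕ.* dim k

    nf-tabulate-≥ : ∀ {n} (a : Fin n → Carrier) e → n ≤ e → nf (List.tabulate a) e ≈ᴿ 0#
    nf-tabulate-≥ {zero} a e _ = refl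
    nf-tabulate-≥ {suc n} a (suc e) (s≤s h) = nf-tabulate-≥ (a ∘ Fin.suc) e h

    nf-tabulate : ∀ {n} (a : Fin n → Carrier) → n ≤ suc d′ → ∀ e → nf (List.tabulate a) (toℕ e) ≈ᴿ a e
    nf-tabulate a (s≤s n≤) Fin.zero = trans (+-congˡ (trans (*-congˡ (nf-tabulate-≥ (a ∘ Fin.suc) d′ n≤)) (zeroʳ ℓ))) (+-identityʳ _)
    nf-tabulate a n≤ (Fin.suc e) = nf-tabulate (a ∘ Fin.suc) (ℕₚ.<⇒≤ n≤) e

    ≈ₑ-Fin : ∀ {x y} → (∀ (e : Fin (suc d′)) → nf x (toℕ e) ≈ᴿ nf y (toℕ e)) → x ≈ₑ y
    ≈ₑ-Fin {x} {y} h = mkₑ λ e e≤ → ≡.subst (λ e → nf x e ≈ᴿ nf y e) (Finₚ.toℕ-fromℕ< (s≤s e≤)) (h (Fin.fromℕ< (s≤s e≤)))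

    block : ∀ k → (Fin (dimₑ k) → ℕ) → Fin (suc d′) → Fin (dim k) → ℕ
    block k a e i = a (Fin.combine e i)

    fromₑ : ∀ k → (Fin (dimₑ k) → ℕ) → Poly
    fromₑ k a = List.tabulate λ e → from k (block k a e)

    nf-fromₑ : ∀ k a e → nf (fromₑ k a) (toℕ e) ≈ᴿ from k (block k a e)
    nf-fromₑ k a e = nf-tabulate (λ e → from k (block k a e)) ℕₚ.≤-refl e

    toℕ≤ : ∀ (e : Fin (suc d′)) → toℕ e ≤ d′
    toℕ≤ e = ℕₚ.≤-pred (Finₚ.toℕ<n e)

    toₑ : ∀ k → Poly → Fin (suc d′) × Fin (dim k) → ℕ
    toₑ k x (e , i) = to k (nf x (toℕ e)) i

  gradedₑ : Graded
  gradedₑ = record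
    { R = extRing
    ; char = E.trans (E.sym (ι.κ-homo p)) (E.trans (ι.⟦⟧-cong char) ι.0-homo)
    ; ∂ = extDerivation
    ; c = c″
    ; Deg = Degₑ
    ; Deg-resp = λ {k} {x} {y} → Degₑ-resp {k} {x} {y}
    ; Deg-mono = λ {j} {k} {x} → Degₑ-mono {j} {k} {x}
    ; Deg-+ = λ {k} {x} {y} → Degₑ-+ {k} {x} {y}
    ; Deg-0 = λ _ _ → Deg-0
    ; Deg-1 = λ { zero _ → Deg-resp (sym (nf-ι-0 1#)) Deg-1 ; (suc e) _ → Deg-0 }
    ; Deg-* = λ {j} {k} {x} {y} → Degₑ-* {j} {k} {x} {y}
    ; Deg-δ = λ {k} {x} → Degₑ-δ {k} {x}
    ; deg∃ = degₑ∃
    ; dim = dimₑ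
    ; dim≡ = λ k → ≡.trans (≡.cong (suc d′ ℕ.*_) (dim≡ k)) (≡.sym (ℕₚ.*-assoc (suc d′) (suc c) (suc k)))
    ; from = fromₑ
    ; from-cong = λ k a b h → ≈ₑ-Fin λ e → trans (nf-fromₑ k a e) (trans (from-cong k (block k a e) (block k b e) λ i → h _) (sym (nf-fromₑ k b e)))
    ; from-+ = λ k a b → ≈ₑ-Fin λ e → trans (nf-fromₑ k (λ i → a i ℕ.+ b i) e) (trans (from-+ k (block k a e) (block k b e))
        (sym (trans (nf-⊕ (fromₑ k a) (fromₑ k b) (toℕ e)) (+-cong (nf-fromₑ k a e) (nf-fromₑ k b e)))))
    ; from-Deg = λ k a e e≤ → ≡.subst (λ e → Deg k (nf (fromₑ k a) e)) (Finₚ.toℕ-fromℕ< (s≤s e≤))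
        (Deg-resp (sym (nf-fromₑ k a (Fin.fromℕ< (s≤s e≤)))) (from-Deg k (block k a (Fin.fromℕ< (s≤s e≤)))))
    ; from-0 = λ k a h q → ≡.subst (λ q → a q ≈ 0) (Finₚ.combine-remQuot {suc d′} (dim k) q)
        (from-0 k (block k a (proj₁ (Fin.remQuot {suc d′} (dim k) q)))
          (trans (sym (nf-fromₑ k a (proj₁ (Fin.remQuot {suc d′} (dim k) q)))) (atₑ h (toℕ (proj₁ (Fin.remQuot {suc d′} (dim k) q))) (toℕ≤ _))) (proj₂ (Fin.remQuot {suc d′} (dim k) q)))
    ; to = λ k x q → toₑ k x (Fin.remQuot (dim k) q)
    ; to-cong = λ k h q → to-cong k (atₑ h (toℕ (proj₁ (Fin.remQuot {suc d′} (dim k) q))) (toℕ≤ _)) _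
    ; to-+ = λ k x y q → K.trans (to-cong k (nf-⊕ x y (toℕ (proj₁ (Fin.remQuot {suc d′} (dim k) q)))) _) (to-+ k _ _ _)
    ; to-0 = λ k x deg h → ≈ₑ-Fin λ e → to-0 k _ (deg (toℕ e) (toℕ≤ e)) λ i →
        ≡.subst (λ q → toₑ k x q ≈ 0) (Finₚ.remQuot-combine e i) (h (Fin.combine e i))
    }

-- Kummer theory: norm and trace, domains, radical ideals.

module ListFold (M : CommutativeMonoid 0ℓ 0ℓ) where
  open CommutativeMonoid M

  fold : (ℕ → Carrier) → List ℕ → Carrier
  fold f [] = ε
  fold f (x ∷ L) = f x ∙ fold f L

  fold-↭ : ∀ f {L L′} → L ↭ L′ → fold f L ≈ fold f L′
  fold-↭ f ↭.refl = refl
  fold-↭ f (↭.prep x h) = ∙-congˡ (fold-↭ f h)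
  fold-↭ f (↭.swap x y h) = trans (∙-congˡ (∙-congˡ (fold-↭ f h)))
    (trans (sym (assoc _ _ _)) (trans (∙-congʳ (comm _ _)) (assoc _ _ _)))
  fold-↭ f (↭.trans h g) = trans (fold-↭ f h) (fold-↭ f g)

  fold-map : ∀ f (g : ℕ → ℕ) L → fold f (List.map g L) ≈ fold (f ∘ g) L
  fold-map f g [] = refl
  fold-map f g (x ∷ L) = ∙-congˡ (fold-map f g L)

  fold-factor : ∀ f {x L} → x ∈ L → ∃ λ r → fold f L ≈ f x ∙ r
  fold-factor f {L = _ ∷ L} (here ≡.refl) = fold f L , refl
  fold-factor f {x} {y ∷ L} (there x∈) with fold-factor f x∈
  ... | r , h = f y ∙ r , trans (∙-congˡ h) (trans (sym (assoc _ _ _)) (trans (∙-congʳ (comm _ _)) (assoc _ _ _)))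

module IdealLemmas (R : CommutativeRing 0ℓ 0ℓ) where
  open CommutativeRing R
  open RingKit R
  open Ideals R

  reduced-associate : ∀ {c c′} → c ∣ᵢ c′ → c′ ∣ᵢ c → Reduced c′ → Reduced c
  reduced-associate h g red x k d = ∣-trans h (red x k (∣-trans g d))

  nonUnit-associate : ∀ {c c′} → c′ ∣ᵢ c → NonUnit c′ → NonUnit c
  nonUnit-associate g nu d = nu (∣-trans g d)

  x-y∣xⁿ-yⁿ : ∀ x y n → x - y ∣ᵢ x ^ n - y ^ n
  x-y∣xⁿ-yⁿ x y zero = ∣-resp refl (sym (-‿inverseʳ 1#)) ∣-0
  x-y∣xⁿ-yⁿ x y (suc n) = ∣-resp refl (solve 4 (λ x y a b → x :* (a :- b) :+ b :* (x :- y) := x :* a :- y :* b) refl x y (x ^ n) (y ^ n))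
    (∣-+ (∣-*ˡ x (x-y∣xⁿ-yⁿ x y n)) (∣-*ˡ (y ^ n) ∣-refl))

module KummerTheory (p : ℕ) .{{_ : NonZero p}} (p-prime : Prime p) (d′ : ℕ) (d∣p-1 : suc d′ ∣ p ℕ.∸ 1)
                    (G : LinearAlgebra.Graded p p-prime) (ℓ : CommutativeRing.Carrier (LinearAlgebra.Graded.R G)) where
  open PrimeField p p-prime
  open RootsOfUnity (suc d′) (s≤s z≤n) d∣p-1
  open LinearAlgebra p p-prime
  open Graded G
  open GradedTheory G
  open CommutativeRing R using (Carrier; 0#; 1#; _+_; _*_; _-_; -_; trans; sym; refl; reflexive; +-cong; +-congˡ; +-congʳ; *-cong; *-congˡ; *-congʳ; zeroʳ; zeroˡ; +-identityˡ; *-identityˡ; *-identityʳ; distribˡ; distribʳ; *-assoc) renaming (_≈_ to _≈ᴿ_)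
  open RingKit R
  open CharP R char
  open Polynomials R
  open Extension R d′ ℓ
  open Ideals R
  private
    module I″ = Ideals extRing
    module IL = IdealLemmas R
    module IL″ = IdealLemmas extRing

  κ-unit : ∀ {x} → x ≉ 0 → ∃ λ u → u * κ x ≈ᴿ 1#
  κ-unit x≉0 with inverse x≉0
  ... | y , h = κ y , trans (sym (κ-* y _)) (trans (κ-cong h) κ-1)

  κμ^d : ∀ {ξ} → ξ KK.^ suc d′ ≈ 1 → κ ξ ^ suc d′ ≈ᴿ 1#
  κμ^d {ξ} h = trans (sym (κ-^ ξ (suc d′))) (trans (κ-cong h) κ-1)

  module Sg (ξ : ℕ) = Eval extRing ι (ι.⟦ κ ξ ⟧ ⊗ v)

  σ : ℕ → Poly → Poly
  σ ξ = Sg.eval ξ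

  nf-σ : ∀ ξ → ξ KK.^ suc d′ ≈ 1 → ∀ x e → e ≤ d′ → nf (σ ξ x) e ≈ᴿ κ ξ ^ e * nf x e
  nf-σ ξ h = ExtAutomorphism.nf-σ R d′ ℓ (κ ξ) (κμ^d {ξ} h)

  σ-cong : ∀ ξ → ξ KK.^ suc d′ ≈ 1 → ∀ {x y} → x E.≈ y → σ ξ x E.≈ σ ξ y
  σ-cong ξ h {x} {y} q = mkₑ λ e e≤ → trans (nf-σ ξ h x e e≤) (trans (*-congˡ (atₑ q e e≤)) (sym (nf-σ ξ h y e e≤)))

  σ-∘ : ∀ {η ξ} → η ∈ μ → ξ ∈ μ → ∀ x → σ η (σ ξ x) E.≈ σ ((η ℕ.* ξ) % p) x
  σ-∘ {η} {ξ} η∈ ξ∈ x = mkₑ λ e e≤ → trans (nf-σ η (proj₂ (∈-μ⁻ η∈)) (σ ξ x) e e≤) (trans (*-congˡ (nf-σ ξ (proj₂ (∈-μ⁻ ξ∈)) x e e≤))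
    (trans (sym (*-assoc _ _ _)) (trans (*-congʳ (trans (sym (^-distrib-* (κ η) (κ ξ) e))
      (^-congˡ e (trans (sym (κ-* η ξ)) (κ-% (η ℕ.* ξ)))))) (sym (nf-σ ((η ℕ.* ξ) % p) ηξ∈ x e e≤)))))
    where
    ηξ∈ : ((η ℕ.* ξ) % p) KK.^ suc d′ ≈ 1
    ηξ∈ = proj₂ (∈-μ⁻ (↭ₚ.∈-resp-↭ (μ-scale η∈) (∈ₚ.∈-map⁺ (λ x → (η ℕ.* x) % p) ξ∈)))

  module Mul = ListFold E.*-commutativeMonoid
  module Add = ListFold E.+-commutativeMonoid

  norm trace : Poly → Poly
  norm x = Mul.fold (λ ξ → σ ξ x) μ
  trace x = Add.fold (λ ξ → σ ξ x) μ

  private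
    σ-×-fold : ∀ {η} → η ∈ μ → ∀ x L → (∀ {ξ} → ξ ∈ L → ξ ∈ μ) →
      σ η (Mul.fold (λ ξ → σ ξ x) L) E.≈ Mul.fold (λ ξ → σ ((η ℕ.* ξ) % p) x) L
    σ-×-fold {η} η∈ x [] sub = E.trans (Sg.eval-const η 1#) E.refl
    σ-×-fold {η} η∈ x (ξ ∷ L) sub = E.trans (Sg.eval-⊗ η (σ ξ x) (Mul.fold (λ ξ → σ ξ x) L))
      (E.*-cong (σ-∘ η∈ (sub (here ≡.refl)) x) (σ-×-fold η∈ x L (sub ∘ there)))

    σ-+-fold : ∀ {η} → η ∈ μ → ∀ x L → (∀ {ξ} → ξ ∈ L → ξ ∈ μ) →
      σ η (Add.fold (λ ξ → σ ξ x) L) E.≈ Add.fold (λ ξ → σ ((η ℕ.* ξ) % p) x) L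
    σ-+-fold {η} η∈ x [] sub = E.refl
    σ-+-fold {η} η∈ x (ξ ∷ L) sub = E.trans (Sg.eval-⊕ η (σ ξ x) (Add.fold (λ ξ → σ ξ x) L))
      (E.+-cong (σ-∘ η∈ (sub (here ≡.refl)) x) (σ-+-fold η∈ x L (sub ∘ there)))

  σ-norm : ∀ {η} → η ∈ μ → ∀ x → σ η (norm x) E.≈ norm x
  σ-norm {η} η∈ x = E.trans (σ-×-fold η∈ x μ id) (E.trans (E.sym (Mul.fold-map (λ ξ → σ ξ x) (λ ξ → (η ℕ.* ξ) % p) μ))
    (Mul.fold-↭ (λ ξ → σ ξ x) (μ-scale η∈)))

  σ-trace : ∀ {η} → η ∈ μ → ∀ x → σ η (trace x) E.≈ trace x
  σ-trace {η} η∈ x = E.trans (σ-+-fold η∈ x μ id) (E.trans (E.sym (Add.fold-map (λ ξ → σ ξ x) (λ ξ → (η ℕ.* ξ) % p) μ))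
    (Add.fold-↭ (λ ξ → σ ξ x) (μ-scale η∈)))

  -- The coordinate at e is multiplied by η^e, and for 0 < e < d some η^e - 1 is invertible, so that
  -- coordinate is 0.
  invariant⇒constant : ∀ y → (∀ {η} → η ∈ μ → σ η y E.≈ y) → y E.≈ ι.⟦ nf y 0 ⟧
  invariant⇒constant y inv = mkₑ λ { zero _ → sym (nf-ι-0 (nf y 0)) ; (suc e) e≤ → vanish e e≤ (μ-separates (suc e) (s≤s z≤n) (s≤s e≤)) }
    where
    vanish : ∀ e → suc e ≤ d′ → (∃ λ η → η ∈ μ × η KK.^ suc e ≉ 1) → nf y (suc e) ≈ᴿ 0#
    vanish e e≤ (η , η∈ , ne) = finish (κ-unit {(η KK.^ suc e) K.- 1} λ h → ne (KK.x-y≈0⇒x≈y h))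
      where
      k = κ η ^ suc e
      κ≈ : κ ((η KK.^ suc e) K.- 1) ≈ᴿ k - 1#
      κ≈ = trans (κ-+ (η KK.^ suc e) (K.- 1)) (+-cong (κ-^ η (suc e)) (trans (κ-neg 1) (CommutativeRing.-‿cong R κ-1)))
      fixed : k * nf y (suc e) ≈ᴿ nf y (suc e)
      fixed = trans (sym (nf-σ η (proj₂ (∈-μ⁻ η∈)) y (suc e) e≤)) (atₑ (inv η∈) (suc e) e≤)
      finish : (∃ λ u → u * κ ((η KK.^ suc e) K.- 1) ≈ᴿ 1#) → nf y (suc e) ≈ᴿ 0#
      finish (u , hu) = trans (sym (*-identityˡ _)) (trans (*-congʳ (trans (sym hu) (*-congˡ κ≈)))
        (trans (solve 3 (λ u k y → (u :* (k :- con (+ 1))) :* y := u :* (k :* y :- y)) refl u k (nf y (suc e)))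
        (trans (*-congˡ (x≈y⇒x-y≈0 fixed)) (zeroʳ u))))

  1∈μ : 1 ∈ μ
  1∈μ = ∈-μ⁺ 2≤p (one^ (suc d′))
    where
    one^ : ∀ n → 1 KK.^ n ≈ 1
    one^ zero = K.refl
    one^ (suc n) = K.trans (K.*-identityˡ _) (one^ n)

  σ-1 : ∀ x → σ 1 x E.≈ x
  σ-1 x = mkₑ λ e e≤ → trans (nf-σ 1 (proj₂ (∈-μ⁻ 1∈μ)) x e e≤) (trans (*-congʳ (one^ e)) (*-identityˡ _))
    where
    one^ : ∀ n → κ 1 ^ n ≈ᴿ 1#
    one^ zero = refl
    one^ (suc n) = trans (*-cong κ-1 (one^ n)) (*-identityˡ 1#)

  low : Poly → Poly
  low x = List.applyUpTo (nf x ∘ suc) d′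

  split-low : ∀ x → x E.≈ ι.⟦ nf x 0 ⟧ ⊕ v ⊗ low x
  split-low x = E.trans (normal x) (≋⇒≈ₑ (∷≋ (nf x 0) (low x)))

  -- Conjugation only multiplies v by a constant; modulo v all conjugates of x equal its constant
  -- coordinate.
  norm-mod-v : ∀ x → ∃ λ s → norm x E.≈ ι.⟦ nf x 0 ^ length μ ⟧ ⊕ v ⊗ s
  norm-mod-v x = go μ (λ {ξ} → proj₂ ∘ ∈-μ⁻)
    where
    x₀ = nf x 0
    σ-low : ∀ ξ → ξ KK.^ suc d′ ≈ 1 → σ ξ x E.≈ ι.⟦ x₀ ⟧ ⊕ v ⊗ (ι.⟦ κ ξ ⟧ ⊗ σ ξ (low x))
    σ-low ξ h = E.trans (σ-cong ξ h (split-low x)) (E.trans (Sg.eval-⊕ ξ ι.⟦ x₀ ⟧ (v ⊗ low x))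
      (E.+-cong (Sg.eval-const ξ x₀) (E.trans (Sg.eval-⊗ ξ v (low x)) (E.trans (E.*-congʳ {σ ξ (low x)} (E.trans (Sg.eval-X ξ) (E.*-comm ι.⟦ κ ξ ⟧ v)))
        (E.*-assoc v ι.⟦ κ ξ ⟧ (σ ξ (low x)))))))
    go : ∀ L → (∀ {ξ} → ξ ∈ L → ξ KK.^ suc d′ ≈ 1) → ∃ λ s → Mul.fold (λ ξ → σ ξ x) L E.≈ ι.⟦ x₀ ^ length L ⟧ ⊕ v ⊗ s
    go [] h = [] , E.sym (E.trans (E.+-congˡ {ι.⟦ 1# ⟧} (E.zeroʳ v)) (E.+-identityʳ _))
    go (ξ ∷ L) h with go L (h ∘ there)
    ... | s , eq = w ⊗ (b ⊕ v ⊗ s) ⊕ ι.⟦ x₀ ⟧ ⊗ s , E.trans (E.*-cong (σ-low ξ (h (here ≡.refl))) eq)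
          (E.trans (EK.solve 5 (λ a v t b s → (a EK.:+ v EK.:* t) EK.:* (b EK.:+ v EK.:* s) EK.:= a EK.:* b EK.:+ v EK.:* (t EK.:* (b EK.:+ v EK.:* s) EK.:+ a EK.:* s)) E.refl
            ι.⟦ x₀ ⟧ v w b s)
          (E.+-congʳ {v ⊗ (w ⊗ (b ⊕ v ⊗ s) ⊕ ι.⟦ x₀ ⟧ ⊗ s)} (E.sym (ι.*-homo x₀ (x₀ ^ length L)))))
      where
      w = ι.⟦ κ ξ ⟧ ⊗ σ ξ (low x)
      b = ι.⟦ x₀ ^ length L ⟧

  κ-*-cancel : ∀ {c x} n → n ≉ 0 → c ∣ᵢ κ n * x → c ∣ᵢ x
  κ-*-cancel {c} {x} n n≉0 h with κ-unit n≉0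
  ... | u , hu = ∣-resp refl (trans (sym (*-assoc _ _ _)) (trans (*-congʳ hu) (*-identityˡ x))) (∣-*ˡ u h)

  -- Eisenstein's criterion at ℓ, with a radical ideal in place of a prime: v acts as the
  -- uniformiser, and a zero divisor turns out to be divisible by every power of v.
  module DomainStep (domain : IsDomain R) (ℓ≉0 : ¬ (ℓ ≈ᴿ 0#)) (ℓ-reduced : Reduced ℓ) (ℓ-nonUnit : NonUnit ℓ) where

    -- Krull's intersection theorem by counting dimensions: were x nonzero and divisible by all
    -- powers of ℓ, then 1, ℓ, ..., ℓ^M would be independent modulo x for every M, since a relation
    -- would make ℓ divide a nonzero constant.
    ℓ-adically-separated : ∀ x → (∀ k → ℓ ^ k ∣ᵢ x) → x ≈ᴿ 0#
    ℓ-adically-separated x div = decide (zero? x)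
      where
      independent : ∀ M (a : Fin M → ℕ) z → (∑ λ i → κ (a i) * ℓ ^ toℕ i) + ℓ ^ M * z ≈ᴿ 0# → ∀ i → a i ≈ 0
      independent (suc M) a z rel = λ { Fin.zero → a₀≈0 ; (Fin.suc i) → independent M (a ∘ Fin.suc) z rel″ i }
        where
        S = ∑ λ i → κ (a (Fin.suc i)) * ℓ ^ toℕ i
        pull : ∀ {M} (b : Fin M → ℕ) (f : Fin M → Carrier) → (∑ λ i → κ (b i) * (ℓ * f i)) ≈ᴿ ℓ * ∑ λ i → κ (b i) * f i
        pull {zero} b f = sym (zeroʳ ℓ)
        pull {suc M} b f = trans (+-cong (solve 3 (λ k l x → k :* (l :* x) := l :* (k :* x)) refl _ _ _) (pull (b ∘ Fin.suc) (f ∘ Fin.suc))) (sym (distribˡ ℓ _ _))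
        rel′ : κ (a Fin.zero) + ℓ * (S + ℓ ^ M * z) ≈ᴿ 0#
        rel′ = trans (sym (trans (+-congʳ (+-cong (*-identityʳ _) (pull (a ∘ Fin.suc) (λ i → ℓ ^ toℕ i))))
          (solve 5 (λ k l s m z → (k :+ l :* s) :+ (l :* m) :* z := k :+ l :* (s :+ m :* z)) refl (κ (a Fin.zero)) ℓ S (ℓ ^ M) z))) rel
        a₀≈0 : a Fin.zero ≈ 0
        a₀≈0 with a Fin.zero ≈? 0
        ... | yes h = h
        ... | no h = contradiction (κ-*-cancel (a Fin.zero) h (∣-resp refl (sym (*-identityʳ (κ (a Fin.zero))))
                ((- (S + ℓ ^ M * z)) ,ᵢ trans (solve 2 (λ k y → k := (k :+ y) :- y) refl (κ (a Fin.zero)) (ℓ * (S + ℓ ^ M * z)))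
                  (trans (+-congʳ rel′) (trans (+-identityˡ _) (-‿distribʳ-* ℓ (S + ℓ ^ M * z))))))) ℓ-nonUnit
        rel″ : S + ℓ ^ M * z ≈ᴿ 0#
        rel″ = domain ℓ _ ℓ≉0 (trans (sym (+-identityˡ _)) (trans (+-congʳ (sym (κ-cong a₀≈0))) rel′))
      decide : Dec (x ≈ᴿ 0#) → x ≈ᴿ 0#
      decide (yes h) = h
      decide (no x≉0) = contradiction (independent-mod≤ domain x x≉0 (proj₂ (deg∃ x)) {suc M} (λ i → ℓ ^ toℕ i) λ a h rel →
          independent (suc M) a (cofactor (div (suc M)) * h) (trans (+-congˡ (trans (sym (*-assoc _ _ _)) (*-congʳ (sym (equation (div (suc M))))))) rel))
          (ℕₚ.<⇒≱ (ℕₚ.n<1+n M))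
        where M = suc c ℕ.* (proj₁ (deg∃ x) ℕ.+ c)

    v-cancel : ∀ x → v ⊗ x E.≈ [] → x E.≈ []
    v-cancel x h = mkₑ λ e e≤ → coordinate e e≤ (e ℕ.≟ d′)
      where
      coordinate : ∀ e → e ≤ d′ → Dec (e ≡ d′) → nf x e ≈ᴿ 0#
      coordinate e e≤ (yes ≡.refl) = domain ℓ _ ℓ≉0 (trans (sym (nf-v*-0 x)) (atₑ h 0 z≤n))
      coordinate e e≤ (no e≢) = trans (sym (nf-v*-suc x e)) (atₑ h (suc e) (ℕₚ.≤∧≢⇒< e≤ e≢))

    -- The norm of g lies in R and kills h, so it is 0. Modulo v it is a power of the constant
    -- coordinate of g, and a multiple of v has constant coordinate divisible by ℓ. By radicality ℓ
    -- = v^d divides the constant coordinate of g, hence v divides g; finally v cancels from v g′ h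
    -- = 0.
    divide-v : ∀ g h → ¬ (h E.≈ []) → g ⊗ h E.≈ [] → ∃ λ g′ → (g E.≈ v ⊗ g′) × (g′ ⊗ h E.≈ [])
    divide-v g h h≉0 gh≈0 = g′ , g≈ , v-cancel (g′ ⊗ h) (E.trans (E.sym (E.*-assoc v g′ h)) (E.trans (E.*-congʳ {h} (E.sym g≈)) gh≈0))
      where
      N₀ = nf (norm g) 0
      N≈ : norm g E.≈ ι.⟦ N₀ ⟧
      N≈ = invariant⇒constant (norm g) λ η∈ → σ-norm η∈ g
      Nh≈0 : ι.⟦ N₀ ⟧ ⊗ h E.≈ []
      Nh≈0 = use (Mul.fold-factor (λ ξ → σ ξ g) 1∈μ)
        where
        use : (∃ λ r → norm g E.≈ σ 1 g ⊗ r) → ι.⟦ N₀ ⟧ ⊗ h E.≈ []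
        use (r , eq) = E.trans (E.*-congʳ {h} (E.trans (E.sym N≈) (E.trans eq (E.*-congʳ {r} (σ-1 g)))))
            (E.trans (EK.solve 3 (λ g r h → (g EK.:* r) EK.:* h EK.:= r EK.:* (g EK.:* h)) E.refl g r h) (E.trans (E.*-congˡ {r} gh≈0) (E.zeroʳ r)))
      N₀≈0 : N₀ ≈ᴿ 0#
      N₀≈0 = decide (zero? N₀)
        where
        decide : Dec (N₀ ≈ᴿ 0#) → N₀ ≈ᴿ 0#
        decide (yes e) = e
        decide (no ne) = contradiction (mkₑ λ e e≤ → domain N₀ (nf h e) ne (trans (sym (nf-ι* N₀ h e)) (atₑ Nh≈0 e e≤))) h≉0
      ℓ∣g₀ : ℓ ∣ᵢ nf g 0
      ℓ∣g₀ = use (norm-mod-v g)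
        where
        use : (∃ λ s → norm g E.≈ ι.⟦ nf g 0 ^ length μ ⟧ ⊕ v ⊗ s) → ℓ ∣ᵢ nf g 0
        use (s , eq) = ℓ-reduced (nf g 0) (length μ) ((- nf s d′) ,ᵢ trans (solve 2 (λ a b → a := (a :+ b) :- b) refl (nf g 0 ^ length μ) (ℓ * nf s d′))
            (trans (+-congʳ (trans (sym (trans (nf-⊕ ι.⟦ nf g 0 ^ length μ ⟧ (v ⊗ s) 0) (+-cong (nf-ι-0 _) (nf-v*-0 s)))) (trans (sym (atₑ eq 0 z≤n)) N₀≈0)))
            (trans (+-identityˡ _) (-‿distribʳ-* ℓ (nf s d′)))))
      y = cofactor ℓ∣g₀
      g′ = (v EK.^ d′) ⊗ ι.⟦ y ⟧ ⊕ low g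
      g≈ : g E.≈ v ⊗ g′
      g≈ = E.trans (split-low g) (E.trans (E.+-congʳ {v ⊗ low g} (E.trans (ι.⟦⟧-cong (equation ℓ∣g₀)) (E.trans (ι.*-homo ℓ y)
        (E.*-congʳ {ι.⟦ y ⟧} (E.sym v^d≈ℓ))))) (EK.solve 4 (λ v w y l → (v EK.:* w) EK.:* y EK.:+ v EK.:* l EK.:= v EK.:* (w EK.:* y EK.:+ l)) E.refl v (v EK.^ d′) ι.⟦ y ⟧ (low g)))

    v-divisible : ∀ n g h → ¬ (h E.≈ []) → g ⊗ h E.≈ [] → ∃ λ g′ → g E.≈ (v EK.^ n) ⊗ g′
    v-divisible zero g h h≉0 gh≈0 = g , E.sym (E.*-identityˡ g)
    v-divisible (suc n) g h h≉0 gh≈0 = g₂ , E.trans g≈ (E.trans (E.*-congˡ {v} g₁≈) (E.sym (E.*-assoc v (v EK.^ n) g₂)))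
      where
      step = divide-v g h h≉0 gh≈0
      g₁ = proj₁ step
      g≈ = proj₁ (proj₂ step)
      rec = v-divisible n g₁ h h≉0 (proj₂ (proj₂ step))
      g₂ = proj₁ rec
      g₁≈ = proj₂ rec

    -- Division by v can be repeated for ever, and ℓ = v^d, so every coordinate of g is divisible by
    -- all powers of ℓ.
    annihilator : ∀ g h → ¬ (h E.≈ []) → g ⊗ h E.≈ [] → g E.≈ []
    annihilator g h h≉0 gh≈0 = mkₑ λ e e≤ → ℓ-adically-separated (nf g e) λ k → div e e≤ k (v-divisible (suc d′ ℕ.* k) g h h≉0 gh≈0)
      where
      div : ∀ e → e ≤ d′ → ∀ k → (∃ λ g′ → g E.≈ (v EK.^ (suc d′ ℕ.* k)) ⊗ g′) → ℓ ^ k ∣ᵢ nf g e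
      div e e≤ k (g′ , eq) = nf g′ e ,ᵢ trans (atₑ (E.trans eq (E.*-congʳ {g′} (E.trans (E.sym (EK.^-assocʳ v (suc d′) k))
        (E.trans (EK.^-congˡ k v^d≈ℓ) (E.sym (ι.^-homo ℓ k)))))) e e≤) (nf-ι* (ℓ ^ k) g′ e)

  -- Where ℓ is a unit modulo c, adjoining a d-th root of ℓ is étale: the trace detects every coordinate.
  module EtaleStep (c : Carrier) (c-reduced : Reduced c) (c-nonUnit : NonUnit c) (coprime : Comaximal c ℓ) where

    nonUnit : I″.NonUnit ι.⟦ c ⟧
    nonUnit (y I″.,ᵢ h) = c-nonUnit (nf y 0 ,ᵢ trans (sym (nf-ι-0 1#)) (trans (atₑ h 0 z≤n) (nf-ι* c y 0)))

    private
      σ-nilpotent : ∀ {ξ} → ξ ∈ μ → ∀ {x} → I″.Nilpotent ι.⟦ c ⟧ x → I″.Nilpotent ι.⟦ c ⟧ (σ ξ x)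
      σ-nilpotent {ξ} ξ∈ {x} (k , y I″.,ᵢ h) = k , σ ξ y I″.,ᵢ E.trans (E.sym (pow k)) (E.trans (σ-cong ξ (proj₂ (∈-μ⁻ ξ∈)) h)
          (E.trans (Sg.eval-⊗ ξ ι.⟦ c ⟧ y) (E.*-congʳ {σ ξ y} (Sg.eval-const ξ c))))
        where
        pow : ∀ k → σ ξ (x EK.^ k) E.≈ σ ξ x EK.^ k
        pow zero = Sg.eval-const ξ 1#
        pow (suc k) = E.trans (Sg.eval-⊗ ξ x (x EK.^ k)) (E.*-congˡ {σ ξ x} (pow k))

      trace-nilpotent : ∀ {x} → I″.Nilpotent ι.⟦ c ⟧ x → I″.Nilpotent ι.⟦ c ⟧ (trace x)
      trace-nilpotent {x} h = go μ id
        where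
        go : ∀ L → (∀ {ξ} → ξ ∈ L → ξ ∈ μ) → I″.Nilpotent ι.⟦ c ⟧ (Add.fold (λ ξ → σ ξ x) L)
        go [] _ = 1 , I″.∣-resp E.refl (E.sym (E.*-identityʳ [])) I″.∣-0
        go (ξ ∷ L) sub = I″.nilpotent-+ (σ-nilpotent (sub (here ≡.refl)) h) (go L (sub ∘ there))

      nf-trace : ∀ x → nf (trace x) 0 ≈ᴿ κ (length μ) * nf x 0
      nf-trace x = go μ id
        where
        go : ∀ L → (∀ {ξ} → ξ ∈ L → ξ ∈ μ) → nf (Add.fold (λ ξ → σ ξ x) L) 0 ≈ᴿ κ (length L) * nf x 0
        go [] _ = sym (zeroˡ _)
        go (ξ ∷ L) sub = trans (nf-⊕ (σ ξ x) (Add.fold (λ ξ → σ ξ x) L) 0) (trans (+-cong (nf-σ ξ (proj₂ (∈-μ⁻ (sub (here ≡.refl)))) x 0 z≤n) (go L (sub ∘ there)))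
          (sym (distribʳ _ _ _)))

      -- Multiplication by v^(1 + d′ - e) moves coordinate e, times ℓ, to position 0, where the
      -- trace returns it with the factor `length μ`. A trace of nilpotents is nilpotent, c is
      -- radical in R, and both factors cancel modulo c.
      coordinate : ∀ {x} → I″.Nilpotent ι.⟦ c ⟧ x → ∀ e → e ≤ d′ → c ∣ᵢ nf x e
      coordinate {x} nil e e≤ = comaximal-cancel coprime (κ-*-cancel (length μ) length-μ≉0 (c-reduced _ (proj₁ T-nil)
          (∣-resp refl (^-congˡ (proj₁ T-nil) T₀≈) (nf (cofactor″ (proj₂ T-nil)) 0 ,ᵢ
            trans (sym (nf-ι-0 _)) (trans (atₑ (E.trans (ι.^-homo T₀ (proj₁ T-nil)) (E.trans (EK.^-congˡ (proj₁ T-nil) (E.sym T≈)) (I″.equation (proj₂ T-nil)))) 0 z≤n)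
              (nf-ι* c (cofactor″ (proj₂ T-nil)) 0))))))
        where
        cofactor″ = I″.cofactor
        n = d′ ℕ.∸ e
        w = (v EK.^ suc n) ⊗ x
        T₀ = nf (trace w) 0
        T≈ : trace w E.≈ ι.⟦ T₀ ⟧
        T≈ = invariant⇒constant (trace w) λ η∈ → σ-trace η∈ w
        T-nil : I″.Nilpotent ι.⟦ c ⟧ (trace w)
        T-nil = trace-nilpotent (I″.nilpotent-* (v EK.^ suc n) nil)
        T₀≈ : T₀ ≈ᴿ κ (length μ) * (ℓ * nf x e)
        T₀≈ = trans (nf-trace w) (*-congˡ (trans (atₑ (E.*-assoc v (v EK.^ n) x) 0 z≤n) (trans (nf-v*-0 ((v EK.^ n) ⊗ x))
          (*-congˡ (≡.subst (λ i → nf ((v EK.^ n) ⊗ x) i ≈ᴿ nf x e) (ℕₚ.m∸n+n≡m e≤) (nf-v^* n e x))))))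

    reduced : I″.Reduced ι.⟦ c ⟧
    reduced x k h = List.applyUpTo cof (suc d′) I″.,ᵢ mkₑ λ e e≤ → trans (eq e e≤)
        (sym (trans (nf-ι* c (List.applyUpTo cof (suc d′)) e) (*-congˡ (nf-applyUpTo cof (suc d′) e ℕₚ.≤-refl (s≤s e≤)))))
      where
      cof : ℕ → Carrier
      cof e with e ℕ.≤? d′
      ... | yes e≤ = cofactor (coordinate (k , h) e e≤)
      ... | no _ = 0#
      eq : ∀ e → e ≤ d′ → nf x e ≈ᴿ c * cof e
      eq e e≤ with e ℕ.≤? d′
      ... | yes e≤′ = equation (coordinate (k , h) e e≤′)
      ... | no e≰ = contradiction e≤ e≰

  -- Modulo v - b the extension is R/(ℓ - b^d).
  module EvaluationStep (b : Carrier) (q-reduced : Reduced (ℓ - b ^ suc d′)) (q-nonUnit : NonUnit (ℓ - b ^ suc d′)) where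
    private
      q = ℓ - b ^ suc d′
      Q = quotientRing q
      module Q = CommutativeRing Q
      QK^ : ∀ x n → RingKit._^_ Q x n ≡ x ^ n
      QK^ x zero = ≡.refl
      QK^ x (suc n) = ≡.cong (x *_) (QK^ x n)

      b^d : RingKit._^_ Q b (suc d′) Q.≈ ℓ
      b^d = ≡.subst (λ z → q ∣ᵢ z - ℓ) (≡.sym (QK^ b (suc d′)))
        (∣-resp refl (solve 2 (λ l b → :- (l :- b) := b :- l) refl ℓ (b ^ suc d′)) (∣-neg ∣-refl))

      module Ev = ExtEval Q (quotientHom q) b b^d
      module ev = Hom Ev.extHom
      module F = Factor R b

      eval≡ : ∀ x → Ev.eval x ≡ Eval.eval R (idHom R) b x
      eval≡ [] = ≡.refl
      eval≡ (a ∷ x) = ≡.cong (λ y → a + b * y) (eval≡ x)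

    v-b : Poly
    v-b = v ⊕ (⊖ ι.⟦ b ⟧)

    private
      ev-v-b : ev.⟦ v-b ⟧ Q.≈ 0#
      ev-v-b = Q.trans (ev.+-homo v (⊖ ι.⟦ b ⟧)) (Q.trans (Q.+-cong Ev.eval-X (Q.trans (ev.-‿homo ι.⟦ b ⟧) (Q.-‿cong (Ev.eval-const b)))) (Q.-‿inverseʳ b))

      ev-multiple : ∀ {y} → v-b I″.∣ᵢ y → ev.⟦ y ⟧ Q.≈ 0#
      ev-multiple (z I″.,ᵢ h) = Q.trans (ev.⟦⟧-cong h) (Q.trans (ev.*-homo v-b z) (Q.trans (Q.*-congʳ ev-v-b) (Q.zeroˡ _)))

      Q0 : ∀ {x} → x Q.≈ 0# → q ∣ᵢ x
      Q0 h = ∣-resp refl (solve 1 (λ x → x :- con (+ 0) := x) refl _) h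

    nonUnit : I″.NonUnit v-b
    nonUnit h = q-nonUnit (Q0 (Q.trans (Q.sym ev.1-homo) (ev-multiple h)))

    -- Write x = x(b) + (v - b) y. If v - b divides x^k, then q divides x(b)^k, hence x(b); and v -
    -- b divides q = v^d - b^d.
    reduced : I″.Reduced v-b
    reduced x k h = I″.∣-resp E.refl (E.sym (≋⇒≈ₑ (F.factor x)))
        (I″.∣-+ {v-b} {ι.⟦ Eval.eval R (idHom R) b x ⟧} {v-b ⊗ F.quot x}
          (I″.∣-trans v-b∣q (ι.⟦ cofactor q∣ ⟧ I″.,ᵢ E.trans (ι.⟦⟧-cong (trans (reflexive (≡.sym (eval≡ x))) (equation q∣))) (ι.*-homo q (cofactor q∣))))
          (F.quot x I″.,ᵢ E.refl))
      where
      q∣ : q ∣ᵢ Ev.eval x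
      q∣ = q-reduced _ k (≡.subst (q ∣ᵢ_) (QK^ (Ev.eval x) k) (Q0 (Q.trans (Q.sym (ev.^-homo x k)) (ev-multiple h))))
      v-b∣q : v-b I″.∣ᵢ ι.⟦ q ⟧
      v-b∣q = I″.∣-resp E.refl (E.sym (E.trans (ι.sub-homo ℓ (b ^ suc d′)) (E.+-cong (E.sym v^d≈ℓ) (E.-‿cong (ι.^-homo b (suc d′))))))
        (IL″.x-y∣xⁿ-yⁿ v ι.⟦ b ⟧ (suc d′))

-- Backward orbits of t and the stages of the tower.

-- A word codes a path in the backward orbit: ζ ∷ w is the child of w through the preimages of ζ v_w.
Word : Set
Word = List ℕ

-- Words grow at the head, so suffixes are the ancestors in the tree, the vertex itself included.
Suffix : Word → Word → Set
Suffix W V = ∃ λ us → V ≡ us ++ W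

suffix-∷ : ∀ {W V} ξ → Suffix W V → Suffix W (ξ ∷ V)
suffix-∷ ξ (us , e) = ξ ∷ us , ≡.cong (ξ ∷_) e

suffix-tail : ∀ {ζ W V} → Suffix (ζ ∷ W) V → Suffix W V
suffix-tail {ζ} {W} (us , e) = us ++ (ζ ∷ []) , ≡.trans e (≡.sym (Listₚ.++-assoc us (ζ ∷ []) W))

suffix-length : ∀ {W V} → Suffix W V → length W ≤ length V
suffix-length {W} (us , ≡.refl) = ≡.subst (length W ≤_) (≡.sym (Listₚ.length-++ us)) (ℕₚ.m≤n+m (length W) (length us))

-- The orbit of 0 enters through an abstract sequence of residues; only these congruences matter.
record Dynamics : Set where
  field
    p : ℕ
    p-prime : Prime p
  instance
    p-nonZero : NonZero p
    p-nonZero = Primality.prime⇒nonZero p-prime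
  open PrimeField p p-prime using (_≈_; _≉_; K)
  field
    d′ : ℕ
    1≤d′ : 1 ≤ d′
    d∣p-1 : suc d′ ∣ p ℕ.∸ 1
    A C N : ℕ
    A≉0 : A ≉ 0
    orbit : ℕ → ℕ
    orbit-0 : orbit 0 ≈ 0
    orbit-suc : ∀ a → orbit (suc a) ≈ A ℕ.* RingKit._^_ K (orbit a) (suc d′) ℕ.+ C
    orbit-distinct : ∀ i j → i < j → j ≤ N → orbit i ≉ orbit j

module Towers (D : Dynamics) where
  open Dynamics D
  open PrimeField p p-prime
  open RootsOfUnity (suc d′) (s≤s z≤n) d∣p-1
  open LinearAlgebra p p-prime

  orbit≉0 : ∀ a → 1 ≤ a → a ≤ N → orbit a ≉ 0
  orbit≉0 a 1≤a a≤N h = orbit-distinct 0 a 1≤a a≤N (K.trans orbit-0 (K.sym h))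

  orbit-≢ : ∀ a b → a ≤ N → b ≤ N → a ≢ b → orbit a ≉ orbit b
  orbit-≢ a b a≤ b≤ ne h with ℕₚ.<-cmp a b
  ... | tri< lt _ _ = orbit-distinct a b lt b≤ h
  ... | tri≈ _ e _ = ne e
  ... | tri> _ _ gt = orbit-distinct b a gt a≤ (K.sym h)

  -- Exactly the hypotheses on a radicand under which adjoining its d-th root keeps the ring a
  -- domain.
  record Good (R : CommutativeRing 0ℓ 0ℓ) (c : CommutativeRing.Carrier R) : Set where
    field
      nonZero : ¬ (CommutativeRing._≈_ R c (CommutativeRing.0# R))
      reduced : Ideals.Reduced R c
      nonUnit : Ideals.NonUnit R c

  module GoodLemmas (R : CommutativeRing 0ℓ 0ℓ) where
    open CommutativeRing R using (1#; _*_; trans; sym; *-congʳ; *-congˡ; *-assoc; *-comm; *-identityˡ; zeroʳ) renaming (_≈_ to _≈ᴿ_)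
    open Ideals R
    open IdealLemmas R

    good-associate : ∀ {c c′} u u⁻¹ → u⁻¹ * u ≈ᴿ 1# → c′ ≈ᴿ u * c → Good R c → Good R c′
    good-associate {c} {c′} u u⁻¹ inv eq g = record
      { nonZero = λ h → Good.nonZero g (trans c≈ (trans (*-congˡ h) (zeroʳ _)))
      ; reduced = reduced-associate (u⁻¹ ,ᵢ trans c≈ (*-comm _ _)) (u ,ᵢ trans eq (*-comm _ _)) (Good.reduced g)
      ; nonUnit = nonUnit-associate (u ,ᵢ trans eq (*-comm _ _)) (Good.nonUnit g) }
      where
      c≈ : c ≈ᴿ u⁻¹ * c′
      c≈ = trans (sym (trans (sym (*-assoc _ _ _)) (trans (*-congʳ inv) (*-identityˡ c)))) (*-congˡ (sym eq))

    good-resp : ∀ {c c′} → c ≈ᴿ c′ → Good R c → Good R c′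
    good-resp eq = good-associate 1# 1# (*-identityˡ 1#) (trans (sym eq) (sym (*-identityˡ _)))

  data ZOf (R : CommutativeRing 0ℓ 0ℓ) (t : CommutativeRing.Carrier R) (Node : Word → CommutativeRing.Carrier R → Set) :
           Word → CommutativeRing.Carrier R → Set where
    root : ZOf R t Node [] t
    child : ∀ {ζ w x} → ζ ∈ μ → Node w x → ZOf R t Node (ζ ∷ w) (CommutativeRing._*_ R (RingKit.κ R ζ) x)

  -- A curve that parametrises partial backward orbits of t.  Node w x: the preimage x = v_w has been adjoined,
  -- A x^d + C = z_w, and ZOf gives z_[] = t, z_(ζ ∷ w) = ζ v_w.  Used also records the twisted (leaf) extensions.
  record Stage : Set₁ where
    field
      G : Graded
    open Graded G public
    open CommutativeRing R using (Carrier; _+_; _*_; _-_) renaming (_≈_ to _≈ᴿ_) public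
    open RingKit R using (κ; _^_) public
    field
      domain : IsDomain R
      height : ℕ
      rank : suc c ≡ suc d′ ℕ.^ height
      t : Carrier
      t-Deg : Deg 1 t
      Node : Word → Carrier → Set
      Used : Word → Set
    Z : Word → Carrier → Set
    Z = ZOf R t Node
    Fresh : Word → Set
    Fresh W = ∀ V → Used V → ¬ Suffix W V
    field
      node-used : ∀ {w x} → Node w x → Used w
      node-rel : ∀ {w x} → Node w x → ∃ λ z → Z w z × (κ A * x ^ suc d′ + κ C ≈ᴿ z)
      node-unique : ∀ {w x x′} → Node w x → Node w x′ → x ≈ᴿ x′
      node-Deg : ∀ {w x} → Node w x → Deg 1 x
      -- Only a = 1 concerns the next radicand at W. The larger a are carried for the descendants:
      -- after the root at W is adjoined, the condition at a + 1 for W yields the one at a for its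
      -- children, and `length W` + a stays the same.
      good : ∀ {W z} a → Z W z → Fresh W → 1 ≤ a → length W ℕ.+ a ≤ N → Good R (z - κ (orbit a))
      points : List (Hom R K)
      points-t : All (λ P → ∀ k → 1 ≤ k → k ≤ N → Hom.⟦ P ⟧ t ≉ orbit k) points
      points-δt : All (λ P → Hom.⟦ P ⟧ (Derivation.δ ∂ t) ≉ 0) points
      points-separated : AllPairs (λ P Q → ∃ λ r → Hom.⟦ P ⟧ r ≉ Hom.⟦ Q ⟧ r) points

  κ-value : (R : CommutativeRing 0ℓ 0ℓ) (P : Hom R K) → ∀ n → Hom.⟦ P ⟧ (RingKit.κ R n) ≈ n
  κ-value R P n = K.trans (Hom.κ-homo P n) (go n)
    where
    go : ∀ n → KK.κ n ≈ n
    go zero = K.refl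
    go (suc n) = K.+-congˡ {1} (go n)

  module StageTheory (S : Stage) where
    open Stage S
    open CommutativeRing R using (1#; -_; trans; sym; refl; +-cong; +-congˡ; +-congʳ; *-congˡ; *-congʳ; *-identityˡ; -‿cong)
    open RingKit R hiding (κ; _^_)
    open CharP R char
    open GradedTheory G using (Deg-κ*)
    open Ideals R
    open IdealLemmas R

    z-Deg : ∀ {W z} → Z W z → Deg 1 z
    z-Deg root = t-Deg
    z-Deg (child {ζ} _ node) = Deg-κ* ζ (node-Deg node)

    cond : Carrier → ℕ → Carrier
    cond z a = z - κ (orbit a)

    κζ^d : ∀ {ζ} → ζ ∈ μ → κ ζ ^ suc d′ ≈ᴿ 1#
    κζ^d {ζ} ζ∈ = trans (sym (κ-^ ζ (suc d′))) (trans (κ-cong (proj₂ (∈-μ⁻ ζ∈))) κ-1)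

    -- Both conditions are differences, and f carries the lower pair to the upper one; so this is
    -- divisibility of f(x) - f(y) by x - y, where ζ^d = 1 allows ζ x for x.
    walk-up : ∀ {ζ x z′} → ζ ∈ μ → κ A * x ^ suc d′ + κ C ≈ᴿ z′ → ∀ a → cond (κ ζ * x) a ∣ᵢ cond z′ (suc a)
    walk-up {ζ} {x} {z′} ζ∈ rel a = ∣-resp refl (sym eq) (∣-*ˡ (κ A) (x-y∣xⁿ-yⁿ (κ ζ * x) (κ (orbit a)) (suc d′)))
      where
      eq : cond z′ (suc a) ≈ᴿ κ A * ((κ ζ * x) ^ suc d′ - κ (orbit a) ^ suc d′)
      eq = trans (+-cong (sym rel) (-‿cong (trans (κ-cong (orbit-suc a)) (trans (κ-+ (A ℕ.* orbit a KK.^ suc d′) C) (+-congʳ (trans (κ-* A (orbit a KK.^ suc d′)) (*-congˡ (κ-^ (orbit a) (suc d′)))))))))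
        (trans (solve 4 (λ a x c o → (a :* x :+ c) :- (a :* o :+ c) := a :* (x :- o)) refl (κ A) (x ^ suc d′) (κ C) (κ (orbit a) ^ suc d′))
          (*-congˡ (+-congʳ (sym (trans (^-distrib-* (κ ζ) x (suc d′)) (trans (*-congʳ (κζ^d ζ∈)) (*-identityˡ _)))))))

    comaximal-∣ : ∀ {c c′ y} → c ∣ᵢ c′ → Comaximal c′ y → Comaximal c y
    comaximal-∣ {c} {c′} {y} (m ,ᵢ h) (comax r s e) = comax (r * m) s (trans (+-congʳ (trans (solve 3 (λ r m c → (r :* m) :* c := r :* (c :* m)) refl r m c) (*-congˡ (sym h)))) e)

    comaximal-sym : ∀ {c y} → Comaximal c y → Comaximal y c
    comaximal-sym (comax r s e) = comax s r (trans (CommutativeRing.+-comm R _ _) e)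

    comaximal-difference : ∀ {c y} r s n → n ≉ 0 → r * c + s * y ≈ᴿ κ n → Comaximal c y
    comaximal-difference {c} {y} r s n n≉0 h with inverse n≉0
    ... | i , hi = comax (κ i * r) (κ i * s) (trans (solve 5 (λ i r c s y → (i :* r) :* c :+ (i :* s) :* y := i :* (r :* c :+ s :* y)) refl (κ i) r c s y)
          (trans (*-congˡ h) (trans (sym (κ-* i n)) (trans (κ-cong hi) κ-1))))

    private
      shift : ∀ (w : Word) a → length w ℕ.+ suc a ≡ suc (length w ℕ.+ a)
      shift w a = ℕₚ.+-suc (length w) a

      -- Walked up to the root, the two conditions become t - f^m(0) and t - f^n(0) with m ≠ n,
      -- whose difference is a nonzero constant. Comaximality passes down to divisors.
      comaximal-root : ∀ W V {z y} a b → Z W z → Z V y → length W ℕ.+ a ≤ N → length V ℕ.+ b ≤ N →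
        length W ℕ.+ a ≢ length V ℕ.+ b → Comaximal (cond z a) (cond y b)
      comaximal-root [] [] a b root root a≤ b≤ ne = comaximal-difference 1# (- 1#) (orbit b K.- orbit a)
        (λ h → orbit-≢ b a b≤ a≤ (ne ∘ ≡.sym) (KK.x-y≈0⇒x≈y h))
        (trans (solve 3 (λ t a b → con (+ 1) :* (t :- a) :+ (:- con (+ 1)) :* (t :- b) := b :- a) refl t (κ (orbit a)) (κ (orbit b)))
          (sym (trans (κ-+ (orbit b) (K.- orbit a)) (+-congˡ (κ-neg (orbit a))))))
      comaximal-root (ζ ∷ w) V a b (child ζ∈ node) zV a≤ b≤ ne with node-rel node
      ... | z′ , zw , rel = comaximal-∣ (walk-up ζ∈ rel a) (comaximal-root w V (suc a) b zw zV
              (≡.subst (_≤ N) (≡.sym (shift w a)) a≤) b≤ (ne ∘ ≡.trans (≡.sym (shift w a))))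
      comaximal-root [] (ξ ∷ v) a b root (child ξ∈ node) a≤ b≤ ne with node-rel node
      ... | z′ , zv , rel = comaximal-sym (comaximal-∣ (walk-up ξ∈ rel b) (comaximal-sym (comaximal-root [] v a (suc b) root zv a≤
              (≡.subst (_≤ N) (≡.sym (shift v b)) b≤) (ne ∘ λ e → ≡.trans e (shift v b)))))

      -- Walking up both words together, they differ last as children ζ, ξ of one vertex with root
      -- x. There ξ (ζ x - o) - ζ (ξ x - o) = (ζ - ξ) o is a nonzero constant, since the orbit of 0
      -- does not return to 0.
      comaximal-siblings : ∀ W V {z y} a → Z W z → Z V y → length W ≡ length V → W ≢ V → 1 ≤ a → length W ℕ.+ a ≤ N →
        Comaximal (cond z a) (cond y a)
      comaximal-siblings [] [] a zW zV len ne 1≤a a≤ = contradiction ≡.refl ne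
      comaximal-siblings (ζ ∷ w) (ξ ∷ v) a (child {x = x} ζ∈ node) (child {x = x′} ξ∈ node′) len ne 1≤a a≤ with Listₚ.≡-dec ℕ._≟_ w v
      ... | yes ≡.refl = comaximal-difference (κ ξ) (- κ ζ) ((ζ K.- ξ) ℕ.* orbit a)
            (*-≉0 (λ h → ne (≡.cong (_∷ w) (≈⇒≡ (proj₁ (∈-μ⁻ ζ∈)) (proj₁ (∈-μ⁻ ξ∈)) (KK.x-y≈0⇒x≈y h))))
                  (orbit≉0 a 1≤a (ℕₚ.≤-trans (ℕₚ.m≤n+m a (suc (length w))) a≤)))
            (trans (+-congˡ (*-congˡ (+-congʳ (*-congˡ (node-unique node′ node)))))
              (trans (solve 4 (λ x k z o → k :* (z :* x :- o) :+ (:- z) :* (k :* x :- o) := (z :- k) :* o) refl x (κ ξ) (κ ζ) (κ (orbit a)))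
                (sym (trans (κ-* (ζ K.- ξ) (orbit a)) (*-congʳ (trans (κ-+ ζ (K.- ξ)) (+-congˡ (κ-neg ξ))))))))
      ... | no w≢v with node-rel node | node-rel node′
      ... | z₁ , zw , rel | z₂ , zv , rel′ = comaximal-∣ (walk-up ζ∈ rel a) (comaximal-sym (comaximal-∣ (walk-up ξ∈ rel′ a) (comaximal-sym
              (comaximal-siblings w v (suc a) zw zv (ℕₚ.suc-injective len) w≢v (s≤s z≤n) (≡.subst (_≤ N) (≡.sym (shift w a)) a≤)))))

      -- The longer word is raised to the length of the other; not being its descendant, it arrives
      -- at a different vertex of that level.
      comaximal-branch : ∀ W V {z y} a b → Z W z → Z V y → length W ℕ.+ a ≡ length V ℕ.+ b → length W ≤ length V → ¬ Suffix W V →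
        1 ≤ b → length W ℕ.+ a ≤ N → Comaximal (cond z a) (cond y b)
      comaximal-branch W V a b zW zV eq le ns 1≤b a≤ with ℕₚ.m≤n⇒m<n∨m≡n le
      comaximal-branch W V a b zW zV eq le ns 1≤b a≤ | inj₂ len with ℕₚ.+-cancelˡ-≡ (length W) a b (≡.trans eq (≡.cong (ℕ._+ b) (≡.sym len)))
      ... | ≡.refl = comaximal-siblings W V a zW zV len (λ e → ns ([] , ≡.sym e)) 1≤b a≤
      comaximal-branch W (ξ ∷ v) a b zW (child ξ∈ node) eq le ns 1≤b a≤ | inj₁ (s≤s lt) with node-rel node
      ... | z′ , zv , rel = comaximal-sym (comaximal-∣ (walk-up ξ∈ rel b) (comaximal-sym
              (comaximal-branch W v a (suc b) zW zv (≡.trans eq (≡.sym (shift v b))) lt (ns ∘ suffix-∷ ξ) (s≤s z≤n) a≤)))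

    -- Up to a unit `cond y 1` is the radicand at V, so this supplies the hypothesis of the étale
    -- step for all conditions at words that are not ancestors of V.
    comaximal : ∀ {W V z y} a → Z W z → Z V y → 1 ≤ a → ¬ Suffix W V → length W ℕ.+ a ≤ N → length V ℕ.+ 1 ≤ N →
      Comaximal (cond z a) (cond y 1)
    comaximal {W} {V} a zW zV 1≤a ns a≤ b≤ with length W ℕ.+ a ℕ.≟ length V ℕ.+ 1
    ... | no ne = comaximal-root W V a 1 zW zV a≤ b≤ ne
    ... | yes eq = comaximal-branch W V a 1 zW zV eq (ℕₚ.+-cancelʳ-≤ 1 (length W) (length V)
            (ℕₚ.≤-trans (ℕₚ.+-monoʳ-≤ (length W) 1≤a) (ℕₚ.≤-reflexive eq))) ns ℕₚ.≤-refl a≤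

    -- Critical values are carried along f from any vertex to the root. It is thus enough that the
    -- points avoid them in the coordinate t.
    value-up : ∀ (P : Hom R K) W {z} a → Z W z → Hom.⟦ P ⟧ z ≈ orbit a → Hom.⟦ P ⟧ t ≈ orbit (length W ℕ.+ a)
    value-up P [] a root h = h
    value-up P (ζ ∷ w) a (child {x = x} ζ∈ node) h with node-rel node
    ... | z′ , zw , rel = ≡.subst (λ k → Hom.⟦ P ⟧ t ≈ orbit k) (shift w a) (value-up P w (suc a) zw
        (K.trans (⟦⟧-cong (sym rel)) (K.trans (+-homo (κ A * x ^ suc d′) (κ C)) (K.trans
          (K.+-cong (K.trans (*-homo (κ A) (x ^ suc d′)) (K.*-cong (κ-value R P A) (K.trans (^-homo x (suc d′)) (K.trans power (KK.^-congˡ (suc d′) h))))) (κ-value R P C))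
          (K.sym (orbit-suc a))))))
      where
      open Hom P
      power : ⟦ x ⟧ KK.^ suc d′ ≈ ⟦ κ ζ * x ⟧ KK.^ suc d′
      power = K.sym (K.trans (KK.^-congˡ (suc d′) (K.trans (*-homo (κ ζ) x) (K.*-congʳ (κ-value R P ζ)))) (K.trans (KK.^-distrib-* ζ ⟦ x ⟧ (suc d′))
        (K.trans (K.*-congʳ (proj₂ (∈-μ⁻ ζ∈))) (K.*-identityˡ (⟦ x ⟧ KK.^ suc d′)))))

    value≉ : ∀ {P} → P ∈ points → ∀ {W z} a → Z W z → 1 ≤ a → length W ℕ.+ a ≤ N → Hom.⟦ P ⟧ z ≉ orbit a
    value≉ {P} P∈ {W} a zW 1≤a a≤ h = All.lookup points-t P∈ (length W ℕ.+ a) (ℕₚ.≤-trans 1≤a (ℕₚ.m≤n+m a (length W))) a≤ (value-up P W a zW h)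

-- Adjoining one preimage, honest or twisted.

module StageStep (D : Dynamics) where
  open Dynamics D
  open PrimeField p p-prime
  open RootsOfUnity (suc d′) (s≤s z≤n) d∣p-1
  open LinearAlgebra p p-prime
  open Towers D

  d-unit : ∃ λ dinv → dinv ℕ.* suc d′ ≈ 1
  d-unit = inverse (x<p⇒x≉0 (s≤s z≤n) (ℕₚ.≤-<-trans (∣ₚ.∣⇒≤ {{ℕ.>-nonZero (ℕₚ.∸-monoˡ-≤ 1 2≤p)}} d∣p-1) (ℕₚ.≤-reflexive (ℕₚ.m+[n∸m]≡n (ℕₚ.<⇒≤ 2≤p)))))

  orbit-1 : orbit 1 ≈ C
  orbit-1 = K.trans (orbit-suc 0) (K.+-congʳ {C} (K.trans (K.*-congˡ {A} (K.*-congʳ {orbit 0 KK.^ d′} orbit-0)) (K.zeroʳ A)))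

  Root : ℕ → Set
  Root x = Σ ℕ λ w → w KK.^ suc d′ ≈ x

  rootsIn : ∀ x → List ℕ → List (Root x)
  rootsIn x [] = []
  rootsIn x (w ∷ L) with (w KK.^ suc d′) ≈? x
  ... | yes h = (w , h) ∷ rootsIn x L
  ... | no _ = rootsIn x L

  rootsIn-All : ∀ {Q : ℕ → Set} x L → All Q L → All (Q ∘ proj₁) (rootsIn x L)
  rootsIn-All x [] [] = []
  rootsIn-All x (w ∷ L) (q ∷ qs) with (w KK.^ suc d′) ≈? x
  ... | yes h = q ∷ rootsIn-All x L qs
  ... | no _ = rootsIn-All x L qs

  rootsIn-AllPairs : ∀ {Q : ℕ → ℕ → Set} x L → AllPairs Q L → AllPairs (λ a b → Q (proj₁ a) (proj₁ b)) (rootsIn x L)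
  rootsIn-AllPairs x [] [] = []
  rootsIn-AllPairs x (w ∷ L) (q ∷ qs) with (w KK.^ suc d′) ≈? x
  ... | yes h = rootsIn-All x L q ∷ rootsIn-AllPairs x L qs
  ... | no _ = rootsIn-AllPairs x L qs

  roots : ∀ x → List (Root x)
  roots x = rootsIn x (upTo p)

  -- For u = 1/A the new root is a preimage of `zJ` and becomes a node. For a twist it is not one:
  -- `isNode` is then empty, and the word is marked as used without having children.
  record StageExtension (S : Stage) (J : Word) (zJ : Stage.Carrier S) (u : ℕ) (isNode : Set) : Set₁ where
    open Stage S
    field
      next : Stage
      height-next : Stage.height next ≡ suc height
      used-next : ∀ {V} → Stage.Used next V → Used V ⊎ V ≡ J
      radicand : Hom R K → ℕ
      radicand-value : ∀ P → radicand P ≈ u ℕ.* (Hom.⟦ P ⟧ zJ K.- C)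
      radicand≉0 : ∀ {P} → P ∈ points → radicand P ≉ 0
      lift : (P : Hom R K) → Root (radicand P) → Hom (Stage.R next) K
      points-next : Stage.points next ≡ List.concatMap (λ P → List.map (lift P) (roots (radicand P))) points
      lift-Z : ∀ {W z} → Z W z → ∃ λ z′ → Stage.Z next W z′ × (∀ P ρ → Hom.⟦ lift P ρ ⟧ z′ ≈ Hom.⟦ P ⟧ z)
      new-node : isNode → ∃ λ v → Stage.Node next J v × (∀ P ρ → Hom.⟦ lift P ρ ⟧ v ≈ proj₁ ρ)

  module Step (S : Stage) {J : Word} {zJ : Stage.Carrier S} (ZJ : Stage.Z S J zJ) (J-fresh : Stage.Fresh S J)
              (J≤N : length J ℕ.+ 1 ≤ N) (u : ℕ) (u≉0 : u ≉ 0) (U : Set) (untwisted : U → A ℕ.* u ≈ 1) where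
    open Stage S
    open StageTheory S
    open CommutativeRing R using (0#; 1#; -_; trans; sym; refl; +-congˡ; +-congʳ; *-congˡ; *-congʳ; zeroʳ; +-identityʳ; +-identityˡ; *-identityˡ; *-identityʳ; *-assoc; -‿cong)
    open RingKit R hiding (κ; _^_)
    open CharP R char
    open GradedTheory G using (Deg-κ*)
    open Ideals R

    -- Since f(0) = C, this is a unit multiple of the condition z_J - f(0), so goodness of the
    -- radicand is the case a = 1 of the invariant.
    ℓ : Carrier
    ℓ = κ u * (zJ - κ C)

    private
      cond≈ : cond zJ 1 ≈ᴿ zJ - κ C
      cond≈ = +-congˡ (-‿cong (κ-cong orbit-1))

      Deg-κ : ∀ n → Deg 1 (κ n)
      Deg-κ n = Deg-mono z≤n (Deg-resp (*-identityʳ (κ n)) (Deg-κ* n Deg-1))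

      Deg-sub : ∀ {k x y} → Deg k x → Deg k y → Deg k (x - y)
      Deg-sub {k} {x} {y} h g = Deg-+ h (Deg-resp eq (Deg-κ* (p ℕ.∸ 1) g))
        where
        eq : κ (p ℕ.∸ 1) * y ≈ᴿ - y
        eq = trans (*-congʳ (trans (κ-cong (mk≈ (≡.cong (_% p) (≡.sym (ℕₚ.*-identityʳ (p ℕ.∸ 1)))))) (trans (κ-neg 1) (-‿cong κ-1)))) (trans (sym (-‿distribˡ-* 1# y)) (-‿cong (*-identityˡ y)))

      κu⁻¹ : ∃ λ i → κ i * κ u ≈ᴿ 1#
      κu⁻¹ = proj₁ (inverse u≉0) , trans (sym (κ-* (proj₁ (inverse u≉0)) u)) (trans (κ-cong (proj₂ (inverse u≉0))) κ-1)

    ℓ-Deg : Deg 1 ℓ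
    ℓ-Deg = Deg-κ* u (Deg-sub (z-Deg ZJ) (Deg-κ C))

    ℓ-good : Good R ℓ
    ℓ-good = GoodLemmas.good-associate R (κ u) (κ (proj₁ κu⁻¹)) (proj₂ κu⁻¹) (*-congˡ (sym cond≈)) (good 1 ZJ J-fresh ℕₚ.≤-refl J≤N)

    open KummerStep p p-prime d′ 1≤d′ (proj₁ d-unit) (proj₂ d-unit) G ℓ ℓ-Deg
    open KummerTheory p p-prime d′ d∣p-1 G ℓ using (module DomainStep; module EtaleStep; module EvaluationStep)
    private
      module GT″ = GradedTheory gradedₑ
      module CP″ = CharP extRing (Graded.char gradedₑ)
      module I″ = Ideals extRing

    domain″ : IsDomain extRing
    domain″ x y x≉0 xy≈0 = decide (GT″.zero? y)
      where
      open DomainStep domain (Good.nonZero ℓ-good) (Good.reduced ℓ-good) (Good.nonUnit ℓ-good)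
      decide : Dec (y E.≈ []) → y E.≈ []
      decide (yes h) = h
      decide (no y≉0) = contradiction (annihilator x y y≉0 xy≈0) x≉0

    data Node″ : Word → E.Carrier → Set where
      old : ∀ {w x} → Node w x → Node″ w ι.⟦ x ⟧
      new : U → Node″ J v

    Used″ : Word → Set
    Used″ V = Used V ⊎ V ≡ J

    Z″ : Word → E.Carrier → Set
    Z″ = ZOf extRing ι.⟦ t ⟧ Node″

    ι-κ* : ∀ n x → ι.⟦ κ n * x ⟧ E.≈ EK.κ n E.* ι.⟦ x ⟧
    ι-κ* n x = E.trans (ι.*-homo (κ n) x) (E.*-congʳ {ι.⟦ x ⟧} (ι.κ-homo n))

    lift-Z : ∀ {W z} → Z W z → ∃ λ z″ → Z″ W z″ × (ι.⟦ z ⟧ E.≈ z″)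
    lift-Z root = ι.⟦ t ⟧ , root , E.refl
    lift-Z (child {ζ} {x = x} ζ∈ node) = EK.κ ζ E.* ι.⟦ x ⟧ , child ζ∈ (old node) , ι-κ* ζ x

    node-rel″ : ∀ {w x} → Node″ w x → ∃ λ z → Z″ w z × (EK.κ A E.* x EK.^ suc d′ E.+ EK.κ C E.≈ z)
    node-rel″ (old {w} {x} node) with node-rel node
    ... | z , zw , rel with lift-Z zw
    ... | z″ , zw″ , eq = z″ , zw″ , E.trans (E.sym (E.trans (ι.+-homo (κ A * x ^ suc d′) (κ C)) (E.+-cong (E.trans (ι-κ* A (x ^ suc d′)) (E.*-congˡ {EK.κ A} (ι.^-homo x (suc d′)))) (ι.κ-homo C))))
          (E.trans (ι.⟦⟧-cong rel) eq)
    node-rel″ (new isU) with lift-Z ZJ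
    ... | z″ , zJ″ , eq = z″ , zJ″ , E.trans (E.+-cong (E.trans (E.*-congˡ {EK.κ A} v^d≈ℓ) (E.sym (ι-κ* A ℓ))) (E.sym (ι.κ-homo C)))
          (E.trans (E.sym (ι.+-homo (κ A * ℓ) (κ C))) (E.trans (ι.⟦⟧-cong value) eq))
      where
      value : κ A * ℓ + κ C ≈ᴿ zJ
      value = trans (+-congʳ (trans (sym (*-assoc _ _ _)) (trans (*-congʳ (trans (sym (κ-* A u)) (trans (κ-cong (untwisted isU)) κ-1))) (*-identityˡ _))))
        (solve 2 (λ z c → (z :- c) :+ c := z) refl zJ (κ C))

    node-unique″ : ∀ {w x x′} → Node″ w x → Node″ w x′ → x E.≈ x′
    node-unique″ (old n) (old n′) = ι.⟦⟧-cong (node-unique n n′)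
    node-unique″ (old n) (new _) = contradiction ([] , ≡.refl) (J-fresh J (node-used n))
    node-unique″ (new _) (old n) = contradiction ([] , ≡.refl) (J-fresh J (node-used n))
    node-unique″ (new _) (new _) = E.refl

    ι-Deg : ∀ {k x} → Deg k x → Degₑ k ι.⟦ x ⟧
    ι-Deg h zero _ = Deg-resp (sym (nf-ι-0 _)) h
    ι-Deg h (suc e) _ = Deg-0

    v-Deg : Degₑ 1 v
    v-Deg zero _ = Deg-resp (sym (trans (+-identityˡ _) refl)) (Deg-mono (ℕₚ.≤-reflexive ≡.refl) (Deg-resp (sym (nf-v-0 d′ 1≤d′)) Deg-0))
      where
      nf-v-0 : ∀ e → 1 ≤ e → ℓ * nf (1# ∷ []) e ≈ᴿ 0#
      nf-v-0 (suc e) _ = zeroʳ ℓ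
    v-Deg (suc zero) _ = Deg-mono z≤n (Deg-resp (sym (nf-ι-0 1#)) Deg-1)
    v-Deg (suc (suc e)) _ = Deg-0

    node-Deg″ : ∀ {w x} → Node″ w x → Degₑ 1 x
    node-Deg″ (old n) = ι-Deg (node-Deg n)
    node-Deg″ (new _) = v-Deg

    -- At words untouched by the new root the condition is comaximal with the radicand, so it stays
    -- radical by the étale step.
    good-ι : ∀ {W z} a → Z W z → Fresh W → ¬ Suffix W J → 1 ≤ a → length W ℕ.+ a ≤ N → Good extRing ι.⟦ cond z a ⟧
    good-ι {W} {z} a zW fr ns 1≤a a≤ = record
      { nonZero = λ h → Good.nonZero g (trans (sym (nf-ι-0 (cond z a))) (atₑ h 0 z≤n))
      ; reduced = Et.reduced
      ; nonUnit = Et.nonUnit }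
      where
      g : Good R (cond z a)
      g = good a zW fr 1≤a a≤
      com : Comaximal (cond z a) ℓ
      com with comaximal a zW ZJ 1≤a ns a≤ J≤N
      ... | comax r s e = comax r (s * κ (proj₁ κu⁻¹)) (trans (+-congˡ (trans (*-assoc _ _ _) (*-congˡ
              (trans (sym (*-assoc _ _ _)) (trans (*-congʳ (proj₂ κu⁻¹)) (trans (*-identityˡ _) (sym cond≈))))))) e)
      module Et = EtaleStep (cond z a) (Good.reduced g) (Good.nonUnit g) com

    -- With o = f^a(0), the condition at a child is ζ (v - b) for b = o / ζ. Since ζ^d = 1 and u A =
    -- 1, one has ℓ - b^d = u (z_J - f^(a+1)(0)), which the invariant at J covers; the evaluation
    -- step then applies.
    good-new : ∀ {ζ} a → U → ζ ∈ μ → 1 ≤ a → length (ζ ∷ J) ℕ.+ a ≤ N → Good extRing (EK.κ ζ E.* v E.- EK.κ (orbit a))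
    good-new {ζ} a isU ζ∈ 1≤a a≤ = GoodLemmas.good-associate extRing (EK.κ ζ) (EK.κ i) κζ⁻¹ eq record
        { nonZero = λ h → Good.nonUnit g (0# ,ᵢ trans (one≈0 h) (sym (zeroʳ q)))
        ; reduced = Ev.reduced
        ; nonUnit = Ev.nonUnit }
      where
      i = proj₁ (inverse (μ-≉0 ζ∈))
      iζ : i ℕ.* ζ ≈ 1
      iζ = proj₂ (inverse (μ-≉0 ζ∈))
      b = κ (i ℕ.* orbit a)
      q = ℓ - b ^ suc d′
      κζ⁻¹ : EK.κ i E.* EK.κ ζ E.≈ E.1#
      κζ⁻¹ = E.trans (E.sym (CP″.κ-* i ζ)) (E.trans (CP″.κ-cong iζ) CP″.κ-1)
      i^d : i KK.^ suc d′ ≈ 1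
      i^d = K.trans (K.sym (K.*-identityʳ _)) (K.trans (K.*-congˡ {i KK.^ suc d′} (K.sym (proj₂ (∈-μ⁻ ζ∈)))) (K.trans (K.sym (KK.^-distrib-* i ζ (suc d′)))
        (K.trans (KK.^-congˡ (suc d′) iζ) (one^ (suc d′)))))
        where
        one^ : ∀ n → 1 KK.^ n ≈ 1
        one^ zero = K.refl
        one^ (suc n) = K.trans (K.*-identityˡ _) (one^ n)
      Aq≈ : q ≈ᴿ κ u * cond zJ (suc a)
      Aq≈ = trans (+-congˡ (-‿cong b^≈)) (trans (solve 4 (λ u z c o → u :* (z :- c) :- u :* o := u :* (z :- (o :+ c))) refl (κ u) zJ (κ C) (κ (A ℕ.* orbit a KK.^ suc d′)))
          (*-congˡ (+-congˡ (-‿cong (trans (sym (κ-+ (A ℕ.* orbit a KK.^ suc d′) C)) (κ-cong (K.sym (orbit-suc a))))))))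
        where
        b^≈ : b ^ suc d′ ≈ᴿ κ u * κ (A ℕ.* orbit a KK.^ suc d′)
        b^≈ = trans (sym (κ-^ (i ℕ.* orbit a) (suc d′))) (trans (κ-cong (K.trans (KK.^-distrib-* i (orbit a) (suc d′))
          (K.trans (K.*-congʳ {orbit a KK.^ suc d′} (K.trans i^d (K.sym (K.trans (K.*-comm u A) (untwisted isU))))) (K.*-assoc u A (orbit a KK.^ suc d′))))) (κ-* u (A ℕ.* orbit a KK.^ suc d′)))
      g : Good R q
      g = GoodLemmas.good-associate R (κ u) (κ (proj₁ κu⁻¹)) (proj₂ κu⁻¹) Aq≈
            (good (suc a) ZJ J-fresh (s≤s z≤n) (≡.subst (_≤ N) (≡.sym (ℕₚ.+-suc (length J) a)) a≤))
      module Ev = EvaluationStep b (Good.reduced g) (Good.nonUnit g)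
      eq : EK.κ ζ E.* v E.- EK.κ (orbit a) E.≈ EK.κ ζ E.* (v E.- ι.⟦ b ⟧)
      eq = E.trans (E.+-congˡ {EK.κ ζ E.* v} (E.-‿cong (E.sym (E.trans (E.*-congˡ {EK.κ ζ} (ι.κ-homo (i ℕ.* orbit a))) (E.trans (E.sym (CP″.κ-* ζ (i ℕ.* orbit a)))
          (CP″.κ-cong (K.trans (K.sym (K.*-assoc ζ i (orbit a))) (K.trans (K.*-congʳ {orbit a} (K.trans (K.*-comm ζ i) iζ)) (K.*-identityˡ (orbit a))))))))))
        (EK.solve 3 (λ z v b → z EK.:* v EK.:- z EK.:* b EK.:= z EK.:* (v EK.:- b)) E.refl (EK.κ ζ) v ι.⟦ b ⟧)
      one≈0 : v E.- ι.⟦ b ⟧ E.≈ [] → 1# ≈ᴿ 0#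
      one≈0 h = trans (sym (nf-ι-0 1#)) (trans (sym (+-identityʳ _)) (trans (sym (nf-⊕′ 1)) (atₑ h 1 1≤d′)))
        where
        nf-⊕′ : ∀ e → nf (v E.- ι.⟦ b ⟧) 1 ≈ᴿ nf v 1 + 0#
        nf-⊕′ _ = trans (nf-⊕ v (E.- ι.⟦ b ⟧) 1) (+-congˡ refl)

    good″ : ∀ {W z} a → Z″ W z → (∀ V → Used″ V → ¬ Suffix W V) → 1 ≤ a → length W ℕ.+ a ≤ N → Good extRing (z E.- EK.κ (orbit a))
    good″ a root fr 1≤a a≤ = GoodLemmas.good-resp extRing
      (E.trans (ι.sub-homo t (κ (orbit a))) (E.+-congˡ {ι.⟦ t ⟧} (E.-‿cong (ι.κ-homo (orbit a)))))
      (good-ι a root (λ V used → fr V (inj₁ used)) (fr J (inj₂ ≡.refl)) 1≤a a≤)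
    good″ a (child {ζ} ζ∈ (old {x = x} node)) fr 1≤a a≤ = GoodLemmas.good-resp extRing
      (E.trans (ι.sub-homo (κ ζ * x) (κ (orbit a))) (E.+-cong (ι-κ* ζ x) (E.-‿cong (ι.κ-homo (orbit a)))))
      (good-ι a (child ζ∈ node) (λ V used → fr V (inj₁ used)) (fr J (inj₂ ≡.refl)) 1≤a a≤)
    good″ a (child ζ∈ (new isU)) fr 1≤a a≤ = good-new a isU ζ∈ 1≤a a≤

    module Lift (P : Hom R K) (r : Root (Hom.⟦ P ⟧ ℓ)) = ExtEval K P (proj₁ r) (proj₂ r)

    lift : (P : Hom R K) → Root (Hom.⟦ P ⟧ ℓ) → Hom extRing K
    lift P r = Lift.extHom P r

    lift-ι : ∀ P r x → Hom.⟦ lift P r ⟧ ι.⟦ x ⟧ ≈ Hom.⟦ P ⟧ x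
    lift-ι P r x = Lift.eval-const P r x

    lift-v : ∀ P r → Hom.⟦ lift P r ⟧ v ≈ proj₁ r
    lift-v P r = Lift.eval-X P r

    lifts : Hom R K → List (Hom extRing K)
    lifts P = List.map (lift P) (roots (Hom.⟦ P ⟧ ℓ))

    ℓ-value≉0 : ∀ {P} → P ∈ points → Hom.⟦ P ⟧ ℓ ≉ 0
    ℓ-value≉0 {P} P∈ h = value≉ P∈ 1 ZJ ℕₚ.≤-refl J≤N (K.trans (KK.x-y≈0⇒x≈y (integral {u} (K.trans (K.sym
      (K.trans (*-homo (κ u) (zJ - κ C)) (K.*-cong (κ-value R P u) (K.trans (sub-homo zJ (κ C)) (K.+-congˡ {⟦ zJ ⟧} (K.-‿cong (κ-value R P C))))))) h) u≉0)) (K.sym orbit-1))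
      where open Hom P

    points″ : List (Hom extRing K)
    points″ = List.concatMap lifts points

    private
      All-lifts : ∀ {Q : Hom extRing K → Set} → (∀ {P} → P ∈ points → ∀ r → Q (lift P r)) → All Q points″
      All-lifts {Q} h = Allₚ.concat⁺ (Allₚ.map⁺ (All.tabulate λ {P} P∈ → Allₚ.map⁺ (All.tabulate λ {r} _ → h P∈ r)))

      separated″ : AllPairs (λ P Q → ∃ λ r → Hom.⟦ P ⟧ r ≉ Hom.⟦ Q ⟧ r) points″
      separated″ = AllPairsₚ.concat⁺
        (Allₚ.map⁺ (All.tabulate λ {P} _ → AllPairsₚ.map⁺ (AllPairs.map
          (λ {r} {r′} ne → v , λ h → ne (K.trans (K.sym (lift-v P r)) (K.trans h (lift-v P r′))))
          (rootsIn-AllPairs {_≉_} (Hom.⟦ P ⟧ ℓ) (upTo p) (unique⇒≉ (upTo p) (Uniqueₚ.upTo⁺ p) ∈ₚ.∈-upTo⁻)))))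
        (AllPairsₚ.map⁺ (AllPairs.map (λ {P} {Q} (r , ne) → Allₚ.map⁺ (All.tabulate λ {a} _ → Allₚ.map⁺ (All.tabulate λ {b} _ →
          ι.⟦ r ⟧ , λ h → ne (K.trans (K.sym (lift-ι P a r)) (K.trans h (lift-ι Q b r)))))) points-separated))

    next : Stage
    next = record
      { G = gradedₑ
      ; domain = domain″
      ; height = suc height
      ; rank = ≡.cong (suc d′ ℕ.*_) rank
      ; t = ι.⟦ t ⟧
      ; t-Deg = ι-Deg t-Deg
      ; Node = Node″
      ; Used = Used″
      ; node-used = λ { (old n) → inj₁ (node-used n) ; (new _) → inj₂ ≡.refl }
      ; node-rel = node-rel″
      ; node-unique = node-unique″
      ; node-Deg = node-Deg″
      ; good = good″
      ; points = points″
      ; points-t = All-lifts λ {P} P∈ r k 1≤k k≤N h → All.lookup points-t P∈ k 1≤k k≤N (K.trans (K.sym (lift-ι P r t)) h)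
      -- The rescaled derivation multiplies δ t by the radicand, which is nonzero at the retained
      -- points.
      ; points-δt = All-lifts λ {P} P∈ r h → *-≉0 (ℓ-value≉0 P∈) (All.lookup points-δt P∈)
          (K.trans (K.sym (K.trans (Hom.⟦⟧-cong (lift P r) (D-ι t)) (K.trans (lift-ι P r (ℓ * Derivation.δ ∂ t)) (Hom.*-homo P ℓ _)))) h)
      ; points-separated = separated″ }

    extension : StageExtension S J zJ u U
    extension = record
      { next = next
      ; height-next = ≡.refl
      ; used-next = id
      ; radicand = λ P → Hom.⟦ P ⟧ ℓ
      ; radicand-value = λ P → K.trans (Hom.*-homo P (κ u) (zJ - κ C)) (K.*-cong (κ-value R P u)
          (K.trans (Hom.sub-homo P zJ (κ C)) (K.+-congˡ {Hom.⟦ P ⟧ zJ} (K.-‿cong (κ-value R P C)))))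
      ; radicand≉0 = ℓ-value≉0
      ; lift = lift
      ; points-next = ≡.refl
      ; lift-Z = λ {W} {z} zW → proj₁ (lift-Z zW) , proj₁ (proj₂ (lift-Z zW)) ,
          λ P ρ → K.trans (Hom.⟦⟧-cong (lift P ρ) (E.sym (proj₂ (proj₂ (lift-Z zW))))) (lift-ι P ρ z)
      ; new-node = λ isU → v , new isU , lift-v }

  abstract
    extend : ∀ (S : Stage) {J : Word} {zJ : Stage.Carrier S} → Stage.Z S J zJ → Stage.Fresh S J → length J ℕ.+ 1 ≤ N →
      ∀ u → u ≉ 0 → (isNode : Set) → (isNode → A ℕ.* u ≈ 1) → StageExtension S J zJ u isNode
    extend S ZJ J-fresh J≤N u u≉0 isNode untwisted = Step.extension S ZJ J-fresh J≤N u u≉0 isNode untwisted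

  -- The initial stage over F_p[t].

  module Base where
    open BaseLine p p-prime
    open KP

    -- Only the values f(0), ..., f^N(0) are excluded: t may equal 0, since radicands vanish at
    -- images of the critical point and not at the point itself.
    Avoids : ℕ → Set
    Avoids y = All (λ k → y ≉ orbit (suc k)) (upTo N)

    avoids? : ∀ y → Dec (Avoids y)
    avoids? y = All.all? (λ k → ¬? (y ≈? orbit (suc k))) (upTo N)

    values : List ℕ
    values = filter avoids? (upTo p)

    point : ℕ → Hom polyRing K
    point y = evalHom K (idHom K) y

    private
      X-Deg : DegP 1 X
      X-Deg (suc zero) (s≤s ())
      X-Deg (suc (suc i)) _ = K.refl

      module IP = Ideals polyRing

      κ≋ : ∀ n → PK.κ n ≋ (n ∷ [])
      κ≋ zero = P.sym (∷≋[] K.refl P.refl)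
      κ≋ (suc n) = P.+-congˡ {1 ∷ []} (κ≋ n)

      good₀ : ∀ b → Good polyRing (X P.- PK.κ b)
      good₀ b = GoodLemmas.good-resp polyRing (P.+-congˡ {X} (P.-‿cong (P.sym (κ≋ b)))) record
          { nonZero = λ h → 1≉0 (K.trans (K.sym (K.trans (coeff-⊕ X (⊖ (b ∷ [])) 1) K.refl)) (at h 1))
          ; reduced = λ x k h → IP.∣-resp P.refl (P.sym (factor x)) (IP.∣-+ {X ⊕ (⊖ (b ∷ []))} {Eb.eval x ∷ []} {(X ⊕ (⊖ (b ∷ []))) ⊗ quot x}
              (IP.∣-resp P.refl (P.sym (∷≋[] (power-zero (Eb.eval x) k (K.trans (K.sym (ev.^-homo x k)) (multiple h))) P.refl)) IP.∣-0)
              (quot x IP.,ᵢ P.refl))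
          ; nonUnit = λ h → 1≉0 (K.trans (K.sym ev.1-homo) (multiple h)) }
        where
        open Factor K b
        module Eb = Eval K (idHom K) b
        module ev = Hom (point b)
        multiple : ∀ {y} → (X ⊕ (⊖ (b ∷ []))) IP.∣ᵢ y → Eb.eval y ≈ 0
        multiple {y} (z IP.,ᵢ h) = K.trans (ev.⟦⟧-cong h) (K.trans (Eb.eval-⊗ (X ⊕ (⊖ (b ∷ []))) z) (K.trans (K.*-congʳ {Eb.eval z}
          (K.trans (Eb.eval-⊕ X (⊖ (b ∷ []))) (K.trans (K.+-cong Eb.eval-X (Eb.eval-const (K.- b))) (K.-‿inverseʳ b)))) (K.zeroˡ (Eb.eval z))))
        power-zero : ∀ x k → x KK.^ k ≈ 0 → x ≈ 0
        power-zero x k h with x ≈? 0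
        ... | yes e = e
        ... | no ne = contradiction h (^-≉0 k ne)

    stage : Stage
    stage = record
      { G = graded
      ; domain = isDomain
      ; height = 0
      ; rank = ≡.refl
      ; t = X
      ; t-Deg = X-Deg
      ; Node = λ _ _ → ⊥
      ; Used = λ _ → ⊥
      ; node-used = λ ()
      ; node-rel = λ ()
      ; node-unique = λ ()
      ; node-Deg = λ ()
      ; good = λ { a root _ _ _ → good₀ (orbit a) }
      ; points = List.map point values
      ; points-t = Allₚ.map⁺ (All.tabulate λ {y} y∈ → λ { (suc k) _ k<N h →
          All.lookup (proj₂ (∈ₚ.∈-filter⁻ avoids? {xs = upTo p} y∈)) (∈ₚ.∈-upTo⁺ k<N) (K.trans (K.sym (Eval.eval-X K (idHom K) y)) h) })
      ; points-δt = Allₚ.map⁺ (All.tabulate λ {y} _ h → 1≉0 (K.trans (K.sym (Hom.1-homo (point y))) (K.trans (Hom.⟦⟧-cong (point y) (P.sym δX)) h)))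
      ; points-separated = AllPairsₚ.map⁺ (AllPairs.map (λ {x} {y} ne → X , λ h → ne (K.trans (K.sym (Eval.eval-X K (idHom K) x)) (K.trans h (Eval.eval-X K (idHom K) y))))
          (unique⇒≉ values (Uniqueₚ.filter⁺ avoids? (Uniqueₚ.upTo⁺ p)) λ y∈ → ∈ₚ.∈-upTo⁻ (proj₁ (∈ₚ.∈-filter⁻ avoids? {xs = upTo p} y∈)))) }
      where
      δX : ∂ₜ.D X ≋ (1 ∷ [])
      δX = P.trans (∂ₜ.D-cong X (X ⊗ (1 ∷ [])) (P.sym (P.*-identityʳ X))) (P.trans (∂ₜ.D-X⊗ (1 ∷ []))
        (P.trans (P.+-cong (P.trans (P.*-congˡ {X} (P.trans (∂ₜ.D-const 1) (∷≋[] K.refl P.refl))) (P.zeroʳ X)) (P.*-identityʳ (1 ∷ []))) P.refl))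

-- Rational arithmetic.

module RationalKit where
  open import Data.Rational using (ℚ; 0ℚ; 1ℚ; _/_; _-_; _*_; _+_; -_; ½; fromℚᵘ; toℚᵘ) renaming (_≤_ to _≤ℚ_; _<_ to _<ℚ_)
  import Data.Rational as ℚ
  import Data.Rational.Properties as ℚₚ
  import Data.Rational.Unnormalised as ℚᵘ
  import Data.Rational.Unnormalised.Properties as ℚᵘₚ
  open import Data.Rational.Solver using (module +-*-Solver)
  open +-*-Solver

  fromℚᵘ-+ : ∀ p q → fromℚᵘ (p ℚᵘ.+ q) ≡ fromℚᵘ p + fromℚᵘ q
  fromℚᵘ-+ p q = ℚₚ.toℚᵘ-injective (ℚᵘₚ.≃-trans (ℚₚ.toℚᵘ-fromℚᵘ (p ℚᵘ.+ q)) (ℚᵘₚ.≃-sym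
    (ℚᵘₚ.≃-trans (ℚₚ.toℚᵘ-homo-+ (fromℚᵘ p) (fromℚᵘ q)) (ℚᵘₚ.+-cong (ℚₚ.toℚᵘ-fromℚᵘ p) (ℚₚ.toℚᵘ-fromℚᵘ q)))))

  fromℚᵘ-* : ∀ p q → fromℚᵘ (p ℚᵘ.* q) ≡ fromℚᵘ p * fromℚᵘ q
  fromℚᵘ-* p q = ℚₚ.toℚᵘ-injective (ℚᵘₚ.≃-trans (ℚₚ.toℚᵘ-fromℚᵘ (p ℚᵘ.* q)) (ℚᵘₚ.≃-sym
    (ℚᵘₚ.≃-trans (ℚₚ.toℚᵘ-homo-* (fromℚᵘ p) (fromℚᵘ q)) (ℚᵘₚ.*-cong (ℚₚ.toℚᵘ-fromℚᵘ p) (ℚₚ.toℚᵘ-fromℚᵘ q)))))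

  ν : ℕ → ℚ
  ν n = + n / 1

  ν-+ : ∀ m n → ν (m ℕ.+ n) ≡ ν m + ν n
  ν-+ m n = ≡.trans (ℚₚ.fromℚᵘ-cong {ℚᵘ.mkℚᵘ (+ (m ℕ.+ n)) 0} {ℚᵘ.mkℚᵘ (+ m) 0 ℚᵘ.+ ℚᵘ.mkℚᵘ (+ n) 0} (ℚᵘ.*≡* (≡.cong (ℤ._* + 1) (≡.trans (ℤₚ.pos-+ m n) (≡.cong₂ ℤ._+_ (≡.sym (ℤₚ.*-identityʳ (+ m))) (≡.sym (ℤₚ.*-identityʳ (+ n))))))))
    (fromℚᵘ-+ (ℚᵘ.mkℚᵘ (+ m) 0) (ℚᵘ.mkℚᵘ (+ n) 0))

  ν-* : ∀ m n → ν (m ℕ.* n) ≡ ν m * ν n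
  ν-* m n = ≡.trans (ℚₚ.fromℚᵘ-cong {ℚᵘ.mkℚᵘ (+ (m ℕ.* n)) 0} {ℚᵘ.mkℚᵘ (+ m) 0 ℚᵘ.* ℚᵘ.mkℚᵘ (+ n) 0} (ℚᵘ.*≡* (≡.cong (ℤ._* + 1) (ℤₚ.pos-* m n)))) (fromℚᵘ-* (ℚᵘ.mkℚᵘ (+ m) 0) (ℚᵘ.mkℚᵘ (+ n) 0))

  ν-suc : ∀ n → ν (suc n) ≡ 1ℚ + ν n
  ν-suc n = ν-+ 1 n

  1/d*d : ∀ d′ → (+ 1 / suc d′) * ν (suc d′) ≡ 1ℚ
  1/d*d d′ = ≡.trans (≡.sym (fromℚᵘ-* (ℚᵘ.mkℚᵘ (+ 1) d′) (ℚᵘ.mkℚᵘ (+ suc d′) 0)))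
    (ℚₚ.fromℚᵘ-cong {ℚᵘ.mkℚᵘ (+ 1) d′ ℚᵘ.* ℚᵘ.mkℚᵘ (+ suc d′) 0} {ℚᵘ.1ℚᵘ} (ℚᵘ.*≡* (≡.trans (ℤₚ.*-identityʳ (+ 1 ℤ.* + suc d′))
      (≡.trans (ℤₚ.*-identityˡ (+ suc d′)) (≡.trans (≡.cong +_ (≡.sym (ℕₚ.*-identityʳ (suc d′)))) (≡.sym (ℤₚ.*-identityˡ _)))))))

  /2 : ∀ k → + k / 2 ≡ ν k * ½
  /2 k = ≡.trans (ℚₚ.fromℚᵘ-cong {ℚᵘ.mkℚᵘ (+ k) 1} {ℚᵘ.mkℚᵘ (+ k) 0 ℚᵘ.* ℚᵘ.mkℚᵘ (+ 1) 1} (ℚᵘ.*≡* (≡.cong (ℤ._* + 2) (≡.sym (ℤₚ.*-identityʳ (+ k))))))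
    (fromℚᵘ-* (ℚᵘ.mkℚᵘ (+ k) 0) (ℚᵘ.mkℚᵘ (+ 1) 1))

  0≤ν : ∀ n → 0ℚ ≤ℚ ν n
  0≤ν n = ℚₚ.nonNegative⁻¹ (ν n) {{ℚₚ.normalize-nonNeg n 1}}

  0<ν : ∀ n → 0ℚ <ℚ ν (suc n)
  0<ν n = ℚₚ.positive⁻¹ (ν (suc n)) {{ℚₚ.normalize-pos (suc n) 1}}

  ≤-diff : ∀ {p q} r → 0ℚ ≤ℚ r → q ≡ p + r → p ≤ℚ q
  ≤-diff {p} {q} r 0≤r e = ≡.subst (p ≤ℚ_) (≡.sym e) (≡.subst (_≤ℚ p + r) (ℚₚ.+-identityʳ p) (ℚₚ.+-monoʳ-≤ p 0≤r))

  0≤-sub : ∀ {p q} → p ≤ℚ q → 0ℚ ≤ℚ q - p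
  0≤-sub {p} {q} h = ≡.subst (_≤ℚ q - p) (ℚₚ.+-inverseʳ p) (ℚₚ.+-monoˡ-≤ (- p) h)

  ν-mono : ∀ {m n} → m ≤ n → ν m ≤ℚ ν n
  ν-mono {m} {n} m≤n = ≤-diff (ν (n ℕ.∸ m)) (0≤ν (n ℕ.∸ m)) (≡.trans (≡.cong ν (≡.sym (ℕₚ.m+[n∸m]≡n m≤n))) (ν-+ m (n ℕ.∸ m)))

  *-monoˡ : ∀ {r p q} → 0ℚ ≤ℚ r → p ≤ℚ q → r * p ≤ℚ r * q
  *-monoˡ {r} 0≤r h = ℚₚ.*-monoˡ-≤-nonNeg r {{ℚ.nonNegative 0≤r}} h

  *-monoʳ : ∀ {r p q} → 0ℚ ≤ℚ r → p ≤ℚ q → p * r ≤ℚ q * r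
  *-monoʳ {r} 0≤r h = ℚₚ.*-monoʳ-≤-nonNeg r {{ℚ.nonNegative 0≤r}} h

  0≤* : ∀ {p q} → 0ℚ ≤ℚ p → 0ℚ ≤ℚ q → 0ℚ ≤ℚ p * q
  0≤* {p} {q} 0≤p 0≤q = ≡.subst (_≤ℚ p * q) (ℚₚ.*-zeroʳ p) (*-monoˡ 0≤p 0≤q)

  0≤+ : ∀ {p q} → 0ℚ ≤ℚ p → 0ℚ ≤ℚ q → 0ℚ ≤ℚ p + q
  0≤+ {p} {q} h g = ℚₚ.≤-trans h (≤-diff q g ≡.refl)

  0<1+ : ∀ {q} → 0ℚ ≤ℚ q → 0ℚ <ℚ 1ℚ + q
  0<1+ {q} g = ℚₚ.<-≤-trans (0<ν 0) (≤-diff q g ≡.refl)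

  *-cancelˡ : ∀ {r p q} → 0ℚ <ℚ r → r * p ≤ℚ r * q → p ≤ℚ q
  *-cancelˡ {r} 0<r h = ℚₚ.*-cancelˡ-≤-pos r {{ℚ.positive 0<r}} h

  ∣∣≤ : ∀ {p q} → p ≤ℚ q → - p ≤ℚ q → ℚ.∣ p ∣ ≤ℚ q
  ∣∣≤ {p} {q} h g with ℚₚ.∣p∣≡p∨∣p∣≡-p p
  ... | inj₁ e = ≡.subst (_≤ℚ q) (≡.sym e) h
  ... | inj₂ e = ≡.subst (_≤ℚ q) (≡.sym e) g

  archimedean : ∀ q M → 0ℚ <ℚ q → ∃ λ R → M ≤ℚ ν R * q
  archimedean q@(ℚ.mkℚ (+ suc n) m _) M _ = ℤ.∣ ℚ.↥ M ∣ ℕ.* suc m , ℚₚ.≤-trans M≤ (ℚₚ.≤-trans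
      (≡.subst (_≤ℚ ν k * (ν (suc m) * q)) (ℚₚ.*-identityʳ (ν k)) (*-monoˡ (0≤ν k) one≤))
      (ℚₚ.≤-reflexive (≡.trans (≡.sym (ℚₚ.*-assoc (ν k) (ν (suc m)) q)) (≡.cong (_* q) (≡.sym (ν-* k (suc m)))))))
    where
    k = ℤ.∣ ℚ.↥ M ∣
    one≤ : 1ℚ ≤ℚ ν (suc m) * q
    one≤ = ≡.subst (1ℚ ≤ℚ_) (≡.trans (ℚₚ.fromℚᵘ-cong {ℚᵘ.mkℚᵘ (+ suc n) 0} {ℚᵘ.mkℚᵘ (+ suc m) 0 ℚᵘ.* ℚᵘ.mkℚᵘ (+ suc n) m}
        (ℚᵘ.*≡* (≡.trans (≡.cong (λ z → + suc n ℤ.* + z) (ℕₚ.*-identityˡ (suc m))) (≡.trans (ℤₚ.*-comm (+ suc n) (+ suc m)) (≡.sym (ℤₚ.*-identityʳ _))))))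
        (≡.trans (fromℚᵘ-* (ℚᵘ.mkℚᵘ (+ suc m) 0) (ℚᵘ.mkℚᵘ (+ suc n) m)) (≡.cong (ν (suc m) *_) (ℚₚ.fromℚᵘ-toℚᵘ q)))) (ν-mono {1} {suc n} (s≤s z≤n))
    M≤ : M ≤ℚ ν k
    M≤ = ℚₚ.toℚᵘ-cancel-≤ (ℚᵘₚ.≤-respʳ-≃ (ℚᵘₚ.≃-sym (ℚₚ.toℚᵘ-fromℚᵘ (ℚᵘ.mkℚᵘ (+ k) 0))) (abs M))
      where
      abs : ∀ M → toℚᵘ M ℚᵘ.≤ ℚᵘ.mkℚᵘ (+ ℤ.∣ ℚ.↥ M ∣) 0
      abs (ℚ.mkℚ (+ a) b _) = ℚᵘ.*≤* (ℤₚ.*-monoˡ-≤-nonNeg (+ a) {+ 1} {+ suc b} (ℤ.+≤+ (s≤s z≤n)))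
      abs (ℚ.mkℚ ℤ.-[1+ a ] b _) = ℚᵘ.*≤* ℤ.-≤+
  archimedean (ℚ.mkℚ (+ 0) m _) M (ℚ.*<* (ℤ.+<+ ()))
  archimedean (ℚ.mkℚ ℤ.-[1+ n ] m _) M (ℚ.*<* ())

-- Asymptotics of the numbers mu.

module Asymptotics (d′ : ℕ) where
  open import Data.Rational using (ℚ; 0ℚ; 1ℚ; _/_; _-_; _*_; _+_; -_; ½) renaming (_≤_ to _≤ℚ_; _<_ to _<ℚ_)
  import Data.Rational as ℚ
  import Data.Rational.Properties as ℚₚ
  open import Data.Rational.Solver using (module +-*-Solver)
  open +-*-Solver
  open RationalKit

  d = suc d′

  0≤^ : ∀ {y} n → 0ℚ ≤ℚ y → 0ℚ ≤ℚ y ^ℚ n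
  0≤^ zero h = 0≤ν 1
  0≤^ (suc n) h = 0≤* h (0≤^ n h)

  module _ {x : ℚ} (0≤x : 0ℚ ≤ℚ x) (x≤1 : x ≤ℚ 1ℚ) where
    private
      y = 1ℚ - x
      0≤y : 0ℚ ≤ℚ y
      0≤y = 0≤-sub x≤1
      0≤x² : 0ℚ ≤ℚ x * x
      0≤x² = 0≤* 0≤x 0≤x
      0≤½ : 0ℚ ≤ℚ ½
      0≤½ = ℚₚ.nonNegative⁻¹ ½

    y^≤1 : ∀ n → y ^ℚ n ≤ℚ 1ℚ
    y^≤1 zero = ℚₚ.≤-refl
    y^≤1 (suc n) = ℚₚ.≤-trans (*-monoˡ 0≤y (y^≤1 n)) (≤-diff x 0≤x (solve 1 (λ x → con 1ℚ := (con 1ℚ :- x) :* con 1ℚ :+ x) ≡.refl x))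

    y^suc≤y : ∀ n → y ^ℚ suc n ≤ℚ y
    y^suc≤y n = ℚₚ.≤-trans (*-monoˡ 0≤y (y^≤1 n)) (ℚₚ.≤-reflexive (ℚₚ.*-identityʳ y))

    0≤tri : ∀ n → 0ℚ ≤ℚ ½ * (ν n * (ν n - 1ℚ))
    0≤tri zero = ℚₚ.≤-refl
    0≤tri (suc n) = 0≤* 0≤½ (0≤* (0≤ν (suc n)) (≡.subst (0ℚ ≤ℚ_) (≡.trans (solve 1 (λ n → n := (con 1ℚ :+ n) :- con 1ℚ) ≡.refl (ν n)) (≡.cong (_- 1ℚ) (≡.sym (ν-suc n)))) (0≤ν n)))

    -- A Bonferroni inequality for n independent events of probability x. In the induction, the
    -- factor 1 - x leaves over the nonnegative term n (n - 1)/2 · x^3.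
    y^≤quadratic : ∀ n → y ^ℚ n ≤ℚ 1ℚ - ν n * x + (½ * (ν n * (ν n - 1ℚ))) * (x * x)
    y^≤quadratic zero = ℚₚ.≤-reflexive (solve 1 (λ x → con 1ℚ := con 1ℚ :- con 0ℚ :* x :+ (con ½ :* (con 0ℚ :* (con 0ℚ :- con 1ℚ))) :* (x :* x)) ≡.refl x)
    y^≤quadratic (suc n) = ℚₚ.≤-trans (*-monoˡ 0≤y (y^≤quadratic n)) (≤-diff ((½ * (ν n * (ν n - 1ℚ))) * (x * (x * x)))
      (0≤* (0≤tri n) (0≤* 0≤x 0≤x²))
      (≡.trans (≡.cong (λ m → 1ℚ - m * x + (½ * (m * (m - 1ℚ))) * (x * x)) (ν-suc n))
        (solve 2 (λ n x → con 1ℚ :- (con 1ℚ :+ n) :* x :+ (con ½ :* ((con 1ℚ :+ n) :* ((con 1ℚ :+ n) :- con 1ℚ))) :* (x :* x)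
          := (con 1ℚ :- x) :* (con 1ℚ :- n :* x :+ (con ½ :* (n :* (n :- con 1ℚ))) :* (x :* x)) :+ (con ½ :* (n :* (n :- con 1ℚ))) :* (x :* (x :* x))) ≡.refl (ν n) x)))

    y^*linear≤1 : ∀ n → y ^ℚ n * (1ℚ + ν n * x) ≤ℚ 1ℚ
    y^*linear≤1 zero = ℚₚ.≤-reflexive (solve 1 (λ x → con 1ℚ :* (con 1ℚ :+ con 0ℚ :* x) := con 1ℚ) ≡.refl x)
    y^*linear≤1 (suc n) = ℚₚ.≤-trans (≤-diff (y ^ℚ n * ((1ℚ + ν n) * (x * x))) (0≤* (0≤^ n 0≤y) (0≤* (≡.subst (0ℚ ≤ℚ_) (ν-suc n) (0≤ν (suc n))) 0≤x²))
      (≡.trans (solve 3 (λ Y n x → Y :* (con 1ℚ :+ n :* x) := ((con 1ℚ :- x) :* Y) :* (con 1ℚ :+ (con 1ℚ :+ n) :* x) :+ Y :* ((con 1ℚ :+ n) :* (x :* x))) ≡.refl (y ^ℚ n) (ν n) x)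
        (≡.cong (λ m → (y * y ^ℚ n) * (1ℚ + m * x) + y ^ℚ n * ((1ℚ + ν n) * (x * x))) (≡.sym (ν-suc n)))))
      (y^*linear≤1 n)

    -- The rational bound 2 n x / (2 + (n - 1) x) agrees with 1 - (1 - x)^n to second order. This
    -- form, rather than a polynomial one, gives an upper estimate of mu that telescopes in 1/mu.
    trapezoid : ∀ n → (1ℚ - y ^ℚ n) * (ν 2 + (ν n - 1ℚ) * x) ≤ℚ ν 2 * (ν n * x)
    trapezoid zero = ℚₚ.≤-reflexive (solve 1 (λ x → (con 1ℚ :- con 1ℚ) :* (con (ν 2) :+ (con 0ℚ :- con 1ℚ) :* x) := con (ν 2) :* (con 0ℚ :* x)) ≡.refl x)
    trapezoid (suc n) = ≤-diff ((ν 2 * (ν n * x) - (1ℚ - y ^ℚ n) * (ν 2 + (ν n - 1ℚ) * x)) + x * (1ℚ - y ^ℚ n * (1ℚ + ν n * x)))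
      (0≤+ (0≤-sub (trapezoid n)) (0≤* 0≤x (0≤-sub (y^*linear≤1 n))))
      (≡.trans (≡.cong (λ m → ν 2 * (m * x)) (ν-suc n)) (≡.trans
        (solve 3 (λ Y n x → con (ν 2) :* ((con 1ℚ :+ n) :* x) := (con 1ℚ :- (con 1ℚ :- x) :* Y) :* (con (ν 2) :+ ((con 1ℚ :+ n) :- con 1ℚ) :* x)
            :+ ((con (ν 2) :* (n :* x) :- (con 1ℚ :- Y) :* (con (ν 2) :+ (n :- con 1ℚ) :* x)) :+ x :* (con 1ℚ :- Y :* (con 1ℚ :+ n :* x)))) ≡.refl (y ^ℚ n) (ν n) x)
        (≡.cong (λ m → (1ℚ - y * y ^ℚ n) * (ν 2 + (m - 1ℚ) * x) + ((ν 2 * (ν n * x) - (1ℚ - y ^ℚ n) * (ν 2 + (ν n - 1ℚ) * x)) + x * (1ℚ - y ^ℚ n * (1ℚ + ν n * x)))) (≡.sym (ν-suc n)))))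

  x = mu d
  1/d = + 1 / d

  0≤1/d : 0ℚ ≤ℚ 1/d
  0≤1/d = ℚₚ.nonNegative⁻¹ 1/d {{ℚₚ.normalize-nonNeg 1 d}}

  0<1/d : 0ℚ <ℚ 1/d
  0<1/d = ℚₚ.positive⁻¹ 1/d {{ℚₚ.normalize-pos 1 d}}

  1/d≤1 : 1/d ≤ℚ 1ℚ
  1/d≤1 = ℚₚ.≤-trans (≡.subst (_≤ℚ 1/d * ν d) (ℚₚ.*-identityʳ 1/d) (*-monoˡ 0≤1/d (ν-mono {1} {d} (s≤s z≤n)))) (ℚₚ.≤-reflexive (1/d*d d′))

  mu-bounds : ∀ r → (0ℚ <ℚ x r) × (x r ≤ℚ 1ℚ)
  mu-bounds zero = 0<ν 0 , ℚₚ.≤-refl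
  mu-bounds (suc r) = ℚₚ.<-≤-trans 0<x/d (*-monoʳ 0≤1/d x≤1-y^) ,
      ℚₚ.≤-trans (*-monoʳ 0≤1/d (≤-diff {1ℚ - Y} Y 0≤Y (solve 1 (λ Y → con 1ℚ := (con 1ℚ :- Y) :+ Y) ≡.refl Y))) (ℚₚ.≤-trans (ℚₚ.≤-reflexive (ℚₚ.*-identityˡ 1/d)) 1/d≤1)
    where
    0<x = proj₁ (mu-bounds r)
    x≤1 = proj₂ (mu-bounds r)
    0≤x = ℚₚ.<⇒≤ 0<x
    Y = (1ℚ - x r) ^ℚ d
    0≤Y : 0ℚ ≤ℚ Y
    0≤Y = 0≤^ d (0≤-sub x≤1)
    x≤1-y^ : x r ≤ℚ 1ℚ - Y
    x≤1-y^ = ≤-diff ((1ℚ - x r) - Y) (0≤-sub (y^suc≤y 0≤x x≤1 d′)) (solve 2 (λ x Y → con 1ℚ :- Y := x :+ ((con 1ℚ :- x) :- Y)) ≡.refl (x r) Y)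
    0<x/d : 0ℚ <ℚ x r * 1/d
    0<x/d = ℚₚ.positive⁻¹ (x r * 1/d) {{ℚₚ.pos*pos⇒pos (x r) {{ℚ.positive 0<x}} 1/d {{ℚ.positive 0<1/d}}}}

  0≤mu : ∀ r → 0ℚ ≤ℚ x r
  0≤mu r = ℚₚ.<⇒≤ (proj₁ (mu-bounds r))

  a : ℚ
  a = ν d′ * ½

  0≤a : 0ℚ ≤ℚ a
  0≤a = 0≤* (0≤ν d′) (ℚₚ.nonNegative⁻¹ ½)

  mu-step-≤ : ∀ r → x (suc r) * (1ℚ + a * x r) ≤ℚ x r
  mu-step-≤ r = *-cancelˡ (0<ν 1) (≡.subst₂ _≤ℚ_
      (≡.trans (≡.cong (λ m → 1/d * ((1ℚ - Y) * (ν 2 + (m - 1ℚ) * X))) (ν-suc d′))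
        (solve 4 (λ i Y n X → i :* ((con 1ℚ :- Y) :* (con (ν 2) :+ ((con 1ℚ :+ n) :- con 1ℚ) :* X)) := con (ν 2) :* (((con 1ℚ :- Y) :* i) :* (con 1ℚ :+ (n :* con ½) :* X))) ≡.refl 1/d Y (ν d′) X))
      (≡.trans (solve 3 (λ i n X → i :* (con (ν 2) :* (n :* X)) := con (ν 2) :* ((i :* n) :* X)) ≡.refl 1/d (ν d) X) (≡.cong (ν 2 *_) (≡.trans (≡.cong (_* X) (1/d*d d′)) (ℚₚ.*-identityˡ X))))
      (*-monoˡ 0≤1/d (trapezoid (0≤mu r) (proj₂ (mu-bounds r)) d)))
    where
    X = x r
    Y = (1ℚ - X) ^ℚ d

  mu-step-≥ : ∀ r → x r * (1ℚ - a * x r) ≤ℚ x (suc r)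
  mu-step-≥ r = ≡.subst (_≤ℚ x (suc r))
      (≡.trans (≡.cong (λ m → (1ℚ - (1ℚ - m * X + (½ * (m * (m - 1ℚ))) * (X * X))) * 1/d) (ν-suc d′))
        (≡.trans (solve 3 (λ i n X → (con 1ℚ :- (con 1ℚ :- (con 1ℚ :+ n) :* X :+ (con ½ :* ((con 1ℚ :+ n) :* ((con 1ℚ :+ n) :- con 1ℚ))) :* (X :* X))) :* i
            := (i :* (con 1ℚ :+ n)) :* (X :* (con 1ℚ :- (n :* con ½) :* X))) ≡.refl 1/d (ν d′) X)
          (≡.trans (≡.cong (_* (X * (1ℚ - a * X))) (≡.trans (≡.cong (1/d *_) (≡.sym (ν-suc d′))) (1/d*d d′))) (ℚₚ.*-identityˡ _))))
      (*-monoʳ 0≤1/d (≤-diff {1ℚ - Q} {1ℚ - Y} (Q - Y) (0≤-sub (y^≤quadratic (0≤mu r) (proj₂ (mu-bounds r)) d)) (solve 2 (λ Q Y → con 1ℚ :- Y := (con 1ℚ :- Q) :+ (Q :- Y)) ≡.refl Q Y)))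
    where
    X = x r
    Y = (1ℚ - X) ^ℚ d
    Q = 1ℚ - ν d * X + (½ * (ν d * (ν d - 1ℚ))) * (X * X)

  mu-upper : ∀ r → x r * (1ℚ + a * ν r) ≤ℚ 1ℚ
  mu-upper zero = ℚₚ.≤-reflexive (solve 1 (λ a → con 1ℚ :* (con 1ℚ :+ a :* con 0ℚ) := con 1ℚ) ≡.refl a)
  -- x′ (1 + a x) ≤ x and x L ≤ 1 give x′ (L + a) (1 + a x) ≤ x L + a x ≤ 1 + a x.
  mu-upper (suc r) = ℚₚ.≤-trans (ℚₚ.≤-reflexive (≡.cong (λ m → X′ * (1ℚ + a * m)) (ν-suc r))) (*-cancelˡ 0<1+ax (ℚₚ.≤-trans (ℚₚ.≤-trans
      (ℚₚ.≤-reflexive (solve 4 (λ X X′ a r → (con 1ℚ :+ a :* X) :* (X′ :* (con 1ℚ :+ a :* (con 1ℚ :+ r))) := (con 1ℚ :+ a :* (con 1ℚ :+ r)) :* (X′ :* (con 1ℚ :+ a :* X))) ≡.refl X X′ a (ν r)))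
      (*-monoˡ 0≤L (mu-step-≤ r)))
      (≤-diff (1ℚ - X * (1ℚ + a * ν r)) (0≤-sub (mu-upper r))
        (solve 3 (λ X a r → (con 1ℚ :+ a :* X) :* con 1ℚ := (con 1ℚ :+ a :* (con 1ℚ :+ r)) :* X :+ (con 1ℚ :- X :* (con 1ℚ :+ a :* r))) ≡.refl X a (ν r)))))
    where
    X = x r
    X′ = x (suc r)
    0≤L : 0ℚ ≤ℚ 1ℚ + a * (1ℚ + ν r)
    0≤L = 0≤+ (0≤ν 1) (0≤* 0≤a (≡.subst (0ℚ ≤ℚ_) (ν-suc r) (0≤ν (suc r))))
    0<1+ax : 0ℚ <ℚ 1ℚ + a * X
    0<1+ax = 0<1+ (0≤* 0≤a (0≤mu r))

  xar≤1 : ∀ r → x r * (a * ν r) ≤ℚ 1ℚ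
  xar≤1 r = ℚₚ.≤-trans (≤-diff (x r) (0≤mu r) (solve 2 (λ X y → X :* (con 1ℚ :+ y) := X :* y :+ X) ≡.refl (x r) (a * ν r))) (mu-upper r)

  module _ (1≤d′ : 1 ≤ d′) where
    0<a : 0ℚ <ℚ a
    0<a = positive d′ 1≤d′
      where
      positive : ∀ n → 1 ≤ n → 0ℚ <ℚ ν n * ½
      positive (suc n) _ = ℚₚ.positive⁻¹ (ν (suc n) * ½) {{ℚₚ.pos*pos⇒pos (ν (suc n)) {{ℚ.positive (0<ν n)}} ½}}

    mu-small : ∀ M ε → 0ℚ <ℚ ε → ∃ λ R → ∀ r → R ≤ r → x r * M ≤ℚ ε
    mu-small M ε 0<ε = R , bound
      where
      arch = archimedean (a * ε) M (ℚₚ.positive⁻¹ (a * ε) {{ℚₚ.pos*pos⇒pos a {{ℚ.positive 0<a}} ε {{ℚ.positive 0<ε}}}})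
      R = proj₁ arch
      0≤ε = ℚₚ.<⇒≤ 0<ε
      bound : ∀ r → R ≤ r → x r * M ≤ℚ ε
      bound r R≤r = ℚₚ.≤-trans (*-monoˡ (0≤mu r) (ℚₚ.≤-trans (proj₂ arch) (*-monoʳ (0≤* 0≤a 0≤ε) (ν-mono R≤r))))
        (ℚₚ.≤-trans (ℚₚ.≤-reflexive (solve 4 (λ X r a e → X :* (r :* (a :* e)) := (X :* (a :* r)) :* e) ≡.refl (x r) (ν r) a ε))
          (ℚₚ.≤-trans (*-monoʳ 0≤ε (xar≤1 r)) (ℚₚ.≤-reflexive (ℚₚ.*-identityˡ ε))))

    -- With b = a (1 + η): as soon as b x ≤ η, the inequality x (B + b r) ≥ 1 propagates.
    mu-lower : ∀ η → 0ℚ <ℚ η → ∃ λ R → ∃ λ B → ∀ k → 1ℚ ≤ℚ x (k ℕ.+ R) * (B + (a * (1ℚ + η)) * ν k)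
    mu-lower η 0<η = R , ν B , go
      where
      b = a * (1ℚ + η)
      0≤η = ℚₚ.<⇒≤ 0<η
      small = mu-small b η 0<η
      R = proj₁ small
      arch = archimedean (x R) 1ℚ (proj₁ (mu-bounds R))
      B = proj₁ arch
      go : ∀ k → 1ℚ ≤ℚ x (k ℕ.+ R) * (ν B + b * ν k)
      go zero = ℚₚ.≤-trans (proj₂ arch) (ℚₚ.≤-reflexive (solve 3 (λ X B b → B :* X := X :* (B :+ b :* con 0ℚ)) ≡.refl (x R) (ν B) b))
      go (suc k) = ℚₚ.≤-trans (≤-diff gain 0≤gain
          (solve 5 (λ X a η B k → (X :* (con 1ℚ :- a :* X)) :* (B :+ (a :* (con 1ℚ :+ η)) :* (con 1ℚ :+ k))
            := con 1ℚ :+ ((con 1ℚ :- a :* X) :* (X :* (B :+ (a :* (con 1ℚ :+ η)) :* k) :- con 1ℚ) :+ (a :* X) :* (η :- X :* (a :* (con 1ℚ :+ η))))) ≡.refl X a η (ν B) (ν k)))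
        (ℚₚ.≤-trans (*-monoʳ 0≤L (mu-step-≥ (k ℕ.+ R))) (ℚₚ.≤-reflexive (≡.cong (λ m → x (suc (k ℕ.+ R)) * (ν B + b * m)) (≡.sym (ν-suc k)))))
        where
        X = x (k ℕ.+ R)
        bX≤η : X * b ≤ℚ η
        bX≤η = proj₂ small (k ℕ.+ R) (ℕₚ.m≤n+m R k)
        0≤aX : 0ℚ ≤ℚ a * X
        0≤aX = 0≤* 0≤a (0≤mu (k ℕ.+ R))
        -- a X (1 + η) ≤ η forces a X ≤ 1, because otherwise a X (1 + η) > 1 + η.
        aX≤1 : a * X ≤ℚ 1ℚ
        aX≤1 = *-cancelˡ 0<1+η (ℚₚ.≤-trans (ℚₚ.≤-reflexive (solve 3 (λ a X η → (con 1ℚ :+ η) :* (a :* X) := X :* (a :* (con 1ℚ :+ η))) ≡.refl a X η))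
          (ℚₚ.≤-trans bX≤η (≤-diff 1ℚ (0≤ν 1) (solve 1 (λ η → (con 1ℚ :+ η) :* con 1ℚ := η :+ con 1ℚ) ≡.refl η))))
          where
          0<1+η : 0ℚ <ℚ 1ℚ + η
          0<1+η = 0<1+ 0≤η
        -- The exact excess over 1 of X (1 - a X)(B + b (k + 1)). The inductive hypothesis makes its
        -- first summand nonnegative, the smallness of b X its second.
        gain = (1ℚ - a * X) * (X * (ν B + b * ν k) - 1ℚ) + (a * X) * (η - X * b)
        0≤gain : 0ℚ ≤ℚ gain
        0≤gain = 0≤+ (0≤* (0≤-sub aX≤1) (0≤-sub (go k))) (0≤* 0≤aX (0≤-sub bX≤η))
        0≤L : 0ℚ ≤ℚ ν B + b * (1ℚ + ν k)
        0≤L = 0≤+ (0≤ν B) (0≤* (0≤* 0≤a (ℚₚ.<⇒≤ (0<1+ 0≤η))) (≡.subst (0ℚ ≤ℚ_) (ν-suc k) (0≤ν (suc k))))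

    asymptotics : ∀ ε → 0ℚ <ℚ ε → Σ ℕ λ R → ∀ r → R ≤ r → ℚ.∣ mu d r * (+ (d′ ℕ.* r) / 2) - 1ℚ ∣ ≤ℚ ε
    asymptotics ε 0<ε = R₁ ℕ.+ R₂ , λ r R≤r → ≡.subst (λ q → ℚ.∣ x r * q - 1ℚ ∣ ≤ℚ ε) (≡.sym (half r)) (∣∣≤ (upper r) (lower r R≤r))
      where
      -- One half of ε pays for the offset B, the other for the slope a (1 + η) in place of a.
      η = ε * ½
      0<η : 0ℚ <ℚ η
      0<η = ℚₚ.positive⁻¹ η {{ℚₚ.pos*pos⇒pos ε {{ℚ.positive 0<ε}} ½}}
      0≤η = ℚₚ.<⇒≤ 0<η
      low = mu-lower η 0<η
      R₁ = proj₁ low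
      B = proj₁ (proj₂ low)
      small = mu-small B η 0<η
      R₂ = proj₁ small
      half : ∀ r → + (d′ ℕ.* r) / 2 ≡ a * ν r
      half r = ≡.trans (/2 (d′ ℕ.* r)) (≡.trans (≡.cong (_* ½) (ν-* d′ r)) (solve 2 (λ d r → (d :* r) :* con ½ := (d :* con ½) :* r) ≡.refl (ν d′) (ν r)))
      upper : ∀ r → x r * (a * ν r) - 1ℚ ≤ℚ ε
      upper r = ℚₚ.≤-trans (≤-diff (1ℚ - x r * (a * ν r)) (0≤-sub (xar≤1 r)) (solve 1 (λ z → con 0ℚ := (z :- con 1ℚ) :+ (con 1ℚ :- z)) ≡.refl (x r * (a * ν r)))) (ℚₚ.<⇒≤ 0<ε)
      lower : ∀ r → R₁ ℕ.+ R₂ ≤ r → - (x r * (a * ν r) - 1ℚ) ≤ℚ ε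
      lower r R≤r = begin
          - (X * (a * ν r) - 1ℚ) ≤⟨ ≤-diff (X * (a * (ν r - ν k))) (0≤* (0≤mu r) (0≤* 0≤a (0≤-sub (ν-mono k≤r))))
              (solve 4 (λ X a r k → :- (X :* (a :* k) :- con 1ℚ) := :- (X :* (a :* r) :- con 1ℚ) :+ X :* (a :* (r :- k))) ≡.refl X a (ν r) (ν k)) ⟩
          - (X * (a * ν k) - 1ℚ) ≤⟨ ≤-diff (X * (B + (a * (1ℚ + η)) * ν k) - 1ℚ) (0≤-sub 1≤)
              (solve 5 (λ X a η B k → X :* B :+ (X :* (a :* k)) :* η := :- (X :* (a :* k) :- con 1ℚ) :+ (X :* (B :+ (a :* (con 1ℚ :+ η)) :* k) :- con 1ℚ)) ≡.refl X a η B (ν k)) ⟩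
          X * B + (X * (a * ν k)) * η ≤⟨ ℚₚ.+-mono-≤ (proj₂ small r (ℕₚ.≤-trans (ℕₚ.m≤n+m R₂ R₁) R≤r))
              (*-monoʳ 0≤η (ℚₚ.≤-trans (*-monoˡ (0≤mu r) (*-monoˡ 0≤a (ν-mono k≤r))) (xar≤1 r))) ⟩
          η + 1ℚ * η ≡⟨ solve 1 (λ e → e :* con ½ :+ con 1ℚ :* (e :* con ½) := e) ≡.refl ε ⟩
          ε ∎
        where
        open ℚₚ.≤-Reasoning
        k = r ℕ.∸ R₁
        X = x r
        k≤r : k ≤ r
        k≤r = ℕₚ.m∸n≤m r R₁
        1≤ : 1ℚ ≤ℚ X * (B + (a * (1ℚ + η)) * ν k)
        1≤ = ≡.subst (λ r → 1ℚ ≤ℚ x r * (B + (a * (1ℚ + η)) * ν k)) (ℕₚ.m∸n+n≡m (ℕₚ.≤-trans (ℕₚ.m≤m+n R₁ R₂) R≤r)) (proj₂ (proj₂ low) k)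

-- Sums over lists and indicators.

module ListSums where
  Σᴸ : {A : Set} → (A → ℕ) → List A → ℕ
  Σᴸ f [] = 0
  Σᴸ f (x ∷ xs) = f x ℕ.+ Σᴸ f xs

  Σ-mono : ∀ {A : Set} {f g : A → ℕ} xs → (∀ {x} → x ∈ xs → f x ≤ g x) → Σᴸ f xs ≤ Σᴸ g xs
  Σ-mono [] h = z≤n
  Σ-mono (x ∷ xs) h = ℕₚ.+-mono-≤ (h (here ≡.refl)) (Σ-mono xs (h ∘ there))

  Σ-cong : ∀ {A : Set} {f g : A → ℕ} xs → (∀ x → f x ≡ g x) → Σᴸ f xs ≡ Σᴸ g xs
  Σ-cong [] h = ≡.refl
  Σ-cong (x ∷ xs) h = ≡.cong₂ ℕ._+_ (h x) (Σ-cong xs h)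

  Σ-+ : ∀ {A : Set} (f g : A → ℕ) xs → Σᴸ (λ x → f x ℕ.+ g x) xs ≡ Σᴸ f xs ℕ.+ Σᴸ g xs
  Σ-+ f g [] = ≡.refl
  Σ-+ f g (x ∷ xs) = ≡.trans (≡.cong (f x ℕ.+ g x ℕ.+_) (Σ-+ f g xs)) (interchange (f x) (g x) (Σᴸ f xs) (Σᴸ g xs))
    where
    open import Data.Nat.Solver using (module +-*-Solver)
    interchange : ∀ a b c d → a ℕ.+ b ℕ.+ (c ℕ.+ d) ≡ a ℕ.+ c ℕ.+ (b ℕ.+ d)
    interchange = solve 4 (λ a b c d → a :+ b :+ (c :+ d) := a :+ c :+ (b :+ d)) ≡.refl
      where open +-*-Solver

  Σ-* : ∀ {A : Set} c (f : A → ℕ) xs → Σᴸ (λ x → c ℕ.* f x) xs ≡ c ℕ.* Σᴸ f xs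
  Σ-* c f [] = ≡.sym (ℕₚ.*-zeroʳ c)
  Σ-* c f (x ∷ xs) = ≡.trans (≡.cong (c ℕ.* f x ℕ.+_) (Σ-* c f xs)) (≡.sym (ℕₚ.*-distribˡ-+ c (f x) (Σᴸ f xs)))

  Σ-*ʳ : ∀ {A : Set} c (f : A → ℕ) xs → Σᴸ (λ x → f x ℕ.* c) xs ≡ Σᴸ f xs ℕ.* c
  Σ-*ʳ c f [] = ≡.refl
  Σ-*ʳ c f (x ∷ xs) = ≡.trans (≡.cong (f x ℕ.* c ℕ.+_) (Σ-*ʳ c f xs)) (≡.sym (ℕₚ.*-distribʳ-+ c (f x) (Σᴸ f xs)))

  Σ-++ : ∀ {A : Set} (f : A → ℕ) xs ys → Σᴸ f (xs ++ ys) ≡ Σᴸ f xs ℕ.+ Σᴸ f ys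
  Σ-++ f [] ys = ≡.refl
  Σ-++ f (x ∷ xs) ys = ≡.trans (≡.cong (f x ℕ.+_) (Σ-++ f xs ys)) (≡.sym (ℕₚ.+-assoc (f x) _ _))

  Σ-concatMap : ∀ {A B : Set} (f : B → ℕ) (h : A → List B) xs → Σᴸ f (List.concatMap h xs) ≡ Σᴸ (λ x → Σᴸ f (h x)) xs
  Σ-concatMap f h [] = ≡.refl
  Σ-concatMap f h (x ∷ xs) = ≡.trans (Σ-++ f (h x) (List.concatMap h xs)) (≡.cong (Σᴸ f (h x) ℕ.+_) (Σ-concatMap f h xs))

  Σ-map : ∀ {A B : Set} (f : B → ℕ) (h : A → B) xs → Σᴸ f (List.map h xs) ≡ Σᴸ (f ∘ h) xs
  Σ-map f h [] = ≡.refl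
  Σ-map f h (x ∷ xs) = ≡.cong (f (h x) ℕ.+_) (Σ-map f h xs)

  Σ-1 : ∀ {A : Set} (xs : List A) → Σᴸ (λ _ → 1) xs ≡ length xs
  Σ-1 [] = ≡.refl
  Σ-1 (x ∷ xs) = ≡.cong suc (Σ-1 xs)

  Σ-0 : ∀ {A : Set} (xs : List A) → Σᴸ (λ _ → 0) xs ≡ 0
  Σ-0 [] = ≡.refl
  Σ-0 (x ∷ xs) = Σ-0 xs

  Σ-swap : ∀ {A B : Set} (f : A → B → ℕ) xs ys → Σᴸ (λ x → Σᴸ (f x) ys) xs ≡ Σᴸ (λ y → Σᴸ (λ x → f x y) xs) ys
  Σ-swap f [] ys = ≡.sym (Σ-0 ys)
  Σ-swap f (x ∷ xs) ys = ≡.trans (≡.cong (Σᴸ (f x) ys ℕ.+_) (Σ-swap f xs ys)) (≡.sym (Σ-+ (f x) (λ y → Σᴸ (λ x → f x y) xs) ys))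

  module _ {X Y : Set} (lifts : X → List Y) (w : X → ℕ) (w′ : Y → ℕ) (compatible : ∀ {P Q} → Q ∈ lifts P → w′ Q ≡ w P) where

    -- Sums over the points of an extension are collected by fibres; weights pulled back from below
    -- are constant there and come out of the inner sum.
    Σ-lifts : ∀ (h : Y → ℕ) xs → Σᴸ (λ Q → h Q ℕ.* w′ Q) (List.concatMap lifts xs) ≡ Σᴸ (λ P → Σᴸ h (lifts P) ℕ.* w P) xs
    Σ-lifts h xs = ≡.trans (Σ-concatMap (λ Q → h Q ℕ.* w′ Q) lifts xs) (Σ-cong xs λ P → ≡.trans (inner P (lifts P) id) (Σ-*ʳ (w P) h (lifts P)))
      where
      inner : ∀ P L → (∀ {Q} → Q ∈ L → Q ∈ lifts P) → Σᴸ (λ Q → h Q ℕ.* w′ Q) L ≡ Σᴸ (λ Q → h Q ℕ.* w P) L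
      inner P [] sub = ≡.refl
      inner P (Q ∷ L) sub = ≡.cong₂ ℕ._+_ (≡.cong (h Q ℕ.*_) (compatible (sub (here ≡.refl)))) (inner P L (sub ∘ there))

    Σ-lifts-≥ : ∀ D (i : X → ℕ) (h : Y → ℕ) xs → (∀ {P} → P ∈ xs → D ℕ.* i P ≤ Σᴸ h (lifts P)) →
      D ℕ.* Σᴸ (λ P → i P ℕ.* w P) xs ≤ Σᴸ (λ Q → h Q ℕ.* w′ Q) (List.concatMap lifts xs)
    Σ-lifts-≥ D i h xs le = ℕₚ.≤-trans (ℕₚ.≤-reflexive (≡.trans (≡.sym (Σ-* D (λ P → i P ℕ.* w P) xs)) (Σ-cong xs λ P → ≡.sym (ℕₚ.*-assoc D (i P) (w P)))))
      (ℕₚ.≤-trans (Σ-mono xs λ {P} P∈ → ℕₚ.*-monoˡ-≤ (w P) (le P∈)) (ℕₚ.≤-reflexive (≡.sym (Σ-lifts h xs))))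

    Σ-lifts-twisted-≥ : ∀ D q e {Z : Set} (us : List Z) (o : X → ℕ) (h : Y → ℕ) (τ : X → Z → ℕ) xs →
      (∀ {P} → P ∈ xs → D ℕ.* o P ≤ q ℕ.* Σᴸ h (lifts P) ℕ.+ e ℕ.* Σᴸ (τ P) us) →
      D ℕ.* Σᴸ (λ P → o P ℕ.* w P) xs ≤ q ℕ.* Σᴸ (λ Q → h Q ℕ.* w′ Q) (List.concatMap lifts xs) ℕ.+ e ℕ.* Σᴸ (λ u → Σᴸ (λ P → τ P u ℕ.* w P) xs) us
    Σ-lifts-twisted-≥ D q e us o h τ xs le = ℕₚ.≤-trans (ℕₚ.≤-reflexive (≡.trans (≡.sym (Σ-* D (λ P → o P ℕ.* w P) xs)) (Σ-cong xs λ P → ≡.sym (ℕₚ.*-assoc D (o P) (w P)))))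
      (ℕₚ.≤-trans (Σ-mono xs λ {P} P∈ → ℕₚ.*-monoˡ-≤ (w P) (le P∈)) (ℕₚ.≤-reflexive
        (≡.trans (Σ-cong xs λ P → distribute q (Σᴸ h (lifts P)) e (Σᴸ (τ P) us) (w P))
        (≡.trans (Σ-+ (λ P → q ℕ.* (Σᴸ h (lifts P) ℕ.* w P)) (λ P → e ℕ.* (Σᴸ (τ P) us ℕ.* w P)) xs) (≡.cong₂ ℕ._+_
          (≡.trans (Σ-* q (λ P → Σᴸ h (lifts P) ℕ.* w P) xs) (≡.cong (q ℕ.*_) (≡.sym (Σ-lifts h xs))))
          (≡.trans (Σ-* e (λ P → Σᴸ (τ P) us ℕ.* w P) xs) (≡.cong (e ℕ.*_)
            (≡.trans (Σ-cong xs λ P → ≡.sym (Σ-*ʳ (w P) (τ P) us)) (Σ-swap (λ P u → τ P u ℕ.* w P) xs us)))))))))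
      where
      open import Data.Nat.Solver using (module +-*-Solver)
      distribute : ∀ q m d s w → (q ℕ.* m ℕ.+ d ℕ.* s) ℕ.* w ≡ q ℕ.* (m ℕ.* w) ℕ.+ d ℕ.* (s ℕ.* w)
      distribute = solve 5 (λ q m d s w → (q :* m :+ d :* s) :* w := q :* (m :* w) :+ d :* (s :* w)) ≡.refl
        where open +-*-Solver

    Σ-lifts-1 : ∀ xs → Σᴸ w′ (List.concatMap lifts xs) ≡ Σᴸ (λ P → length (lifts P) ℕ.* w P) xs
    Σ-lifts-1 xs = ≡.trans (Σ-cong (List.concatMap lifts xs) λ Q → ≡.sym (ℕₚ.*-identityˡ (w′ Q))) (≡.trans (Σ-lifts (λ _ → 1) xs)
      (Σ-cong xs λ P → ≡.cong (ℕ._* w P) (Σ-1 (lifts P))))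

  unique-⊆⇒length≤ : ∀ {A : Set} (xs ys : List A) → Unique xs → (∀ {x} → x ∈ xs → x ∈ ys) → length xs ≤ length ys
  unique-⊆⇒length≤ [] ys _ _ = z≤n
  unique-⊆⇒length≤ (x ∷ xs) ys (x∉ ∷ u) sub with ∈ₚ.∈-∃++ (sub (here ≡.refl))
  ... | as , bs , ≡.refl = ≡.subst (suc (length xs) ≤_) (≡.sym (↭ₚ.↭-length (↭ₚ.shift x as bs))) (s≤s (unique-⊆⇒length≤ xs (as ++ bs) u sub′))
    where
    sub′ : ∀ {y} → y ∈ xs → y ∈ as ++ bs
    sub′ y∈ with ↭ₚ.∈-resp-↭ (↭ₚ.shift x as bs) (sub (there y∈))
    ... | here ≡.refl = contradiction ≡.refl (All.lookup x∉ y∈)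
    ... | there y∈′ = y∈′

  length≤Σ-filter : ∀ {A B : Set} {Rel : B → A → Set} (rel? : ∀ u w → Dec (Rel u w)) (M : List B) (L : List A) →
    (∀ {w} → w ∈ L → ∃ λ u → u ∈ M × Rel u w) → length L ≤ Σᴸ (λ u → length (filter (rel? u) L)) M
  length≤Σ-filter rel? M [] h = z≤n
  length≤Σ-filter {A} {B} {Rel} rel? M (w ∷ L) h = ℕₚ.≤-trans (ℕₚ.+-mono-≤ (one (h (here ≡.refl))) (length≤Σ-filter rel? M L (h ∘ there)))
      (ℕₚ.≤-reflexive (≡.trans (≡.sym (Σ-+ hit (λ u → length (filter (rel? u) L)) M)) (Σ-cong M λ u → ≡.sym (split u))))
    where
    hit : B → ℕ
    hit u with rel? u w
    ... | yes _ = 1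
    ... | no _ = 0
    split : ∀ u → length (filter (rel? u) (w ∷ L)) ≡ hit u ℕ.+ length (filter (rel? u) L)
    split u with rel? u w
    ... | yes _ = ≡.refl
    ... | no _ = ≡.refl
    one : (∃ λ u → u ∈ M × Rel u w) → 1 ≤ Σᴸ hit M
    one (u , u∈ , r) = go u∈
      where
      hit-u : hit u ≡ 1
      hit-u with rel? u w
      ... | yes _ = ≡.refl
      ... | no ¬r = contradiction r ¬r
      go : ∀ {M} → u ∈ M → 1 ≤ Σᴸ hit M
      go {_ ∷ M} (here ≡.refl) = ≡.subst (λ k → 1 ≤ k ℕ.+ Σᴸ hit M) (≡.sym hit-u) (s≤s z≤n)
      go {x ∷ M} (there u∈) = ℕₚ.≤-trans (go u∈) (ℕₚ.m≤n+m _ (hit x))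

  ind : {P : Set} → Dec P → ℕ
  ind (yes _) = 1
  ind (no _) = 0

  ind-cong : ∀ {P Q : Set} (p : Dec P) (q : Dec Q) → (P → Q) → (Q → P) → ind p ≡ ind q
  ind-cong (yes _) (yes _) f g = ≡.refl
  ind-cong (no _) (no _) f g = ≡.refl
  ind-cong (yes p) (no ¬q) f g = contradiction (f p) ¬q
  ind-cong (no ¬p) (yes q) f g = contradiction (g q) ¬p

  ind-yes : ∀ {P : Set} (d : Dec P) → P → ind d ≡ 1
  ind-yes (yes _) _ = ≡.refl
  ind-yes (no ¬p) p = contradiction p ¬p

  ind-no : ∀ {P : Set} (d : Dec P) → ¬ P → ind d ≡ 0
  ind-no (yes p) ¬p = contradiction p ¬p
  ind-no (no _) _ = ≡.refl

-- Power residues and twists.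

module Residues (p : ℕ) .{{_ : NonZero p}} (p-prime : Prime p) (d′ : ℕ) (d∣p-1 : suc d′ ∣ p ℕ.∸ 1)
                (A C : ℕ) (A≉0 : PrimeField._≉_ p p-prime A 0) where
  open PrimeField p p-prime
  open RootsOfUnity (suc d′) (s≤s z≤n) d∣p-1
  open ListSums

  d = suc d′

  Power : ℕ → Set
  Power x = ∃ λ w → w < p × w KK.^ d ≈ x

  abstract
   power? : ∀ x → Dec (Power x)
   power? x = ℕₚ.anyUpTo? (λ w → (w KK.^ d) ≈? x) p

  power : ∀ {x} w → w KK.^ d ≈ x → Power x
  power {x} w h = w % p , %<p w , K.trans (KK.^-congˡ d (%≈ w)) h

  -- If u A = s^d, then v = s x turns v^d = u (z - C) back into A x^d + C = z. The remaining u give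
  -- the proper twists.
  twists : List ℕ
  twists = filter (λ u → ¬? (power? (u ℕ.* A))) units

  A⁻¹ : ℕ
  A⁻¹ = proj₁ (inverse A≉0)

  A⁻¹A : A⁻¹ ℕ.* A ≈ 1
  A⁻¹A = proj₂ (inverse A≉0)

  -- w ↦ A⁻¹ w^d maps the units at most d-to-one to those u for which u A is a d-th power.
  d*twists≤ : d ℕ.* length twists ≤ d′ ℕ.* (p ℕ.∸ 1)
  d*twists≤ = ℕₚ.+-cancelˡ-≤ (p ℕ.∸ 1) _ _ (ℕₚ.≤-trans (ℕₚ.+-monoˡ-≤ (d ℕ.* length twists) fibres)
      (ℕₚ.≤-reflexive (≡.trans (≡.cong (ℕ._+ d ℕ.* length twists) (ℕₚ.*-comm (length pows) d)) (≡.trans (≡.sym (ℕₚ.*-distribˡ-+ d (length pows) (length twists)))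
        (≡.cong (d ℕ.*_) (≡.trans (≡.sym (length-filter-¬ (λ u → power? (u ℕ.* A)) units)) length-units))))))
    where
    pows = filter (λ u → power? (u ℕ.* A)) units
    h : ℕ → ℕ
    h w = (A⁻¹ ℕ.* w KK.^ d) % p
    hA : ∀ w → h w ℕ.* A ≈ w KK.^ d
    hA w = K.trans (K.*-congʳ {A} (%≈ (A⁻¹ ℕ.* w KK.^ d))) (K.trans (KK.solve 3 (λ a x b → (a KK.:* x) KK.:* b KK.:= (a KK.:* b) KK.:* x) K.refl A⁻¹ (w KK.^ d) A)
      (K.trans (K.*-congʳ {w KK.^ d} A⁻¹A) (K.*-identityˡ (w KK.^ d))))
    fibres : p ℕ.∸ 1 ≤ length pows ℕ.* d
    fibres = ≡.subst (_≤ length pows ℕ.* d) length-units (length≤fibres h d pows units units-unique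
      (λ {w} w∈ → ∈ₚ.∈-filter⁺ (λ u → power? (u ℕ.* A)) (∈-units⁺ (%<p _) λ e → ^-≉0 d (proj₂ (∈-units⁻ w∈)) (K.trans (K.sym (hA w)) (K.*-congʳ {A} e)))
        (w , proj₁ (∈-units⁻ w∈) , K.sym (hA w)))
      λ y F uF hF → power-roots≤ d (y ℕ.* A) (s≤s z≤n) F uF λ {w} w∈ → proj₁ (∈-units⁻ (proj₁ (hF w∈))) ,
        K.trans (K.sym (hA w)) (K.*-congʳ {A} (mk≈ (≡.cong (_% p) (proj₂ (hF w∈))))))

  length-μ≡d : length μ ≡ d
  length-μ≡d = ℕₚ.≤-antisym (power-roots≤ d 1 (s≤s z≤n) μ μ-unique ∈-μ⁻) d≤length-μ

  -- Each unit w solves w^d = u x for exactly one u, and for it u A is not a d-th power since A⁻¹ x is not.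
  units≤twisted-roots : ∀ x → x ≉ 0 → ¬ Power (A⁻¹ ℕ.* x) →
    p ℕ.∸ 1 ≤ Σᴸ (λ u → length (filter (λ w → (w KK.^ d) ≈? (u ℕ.* x)) units)) twists
  units≤twisted-roots x x≉0 np = ℕₚ.≤-trans (ℕₚ.≤-reflexive (≡.sym length-units)) (length≤Σ-filter (λ u w → (w KK.^ d) ≈? (u ℕ.* x)) twists units
    λ {w} w∈ → u w , ∈ₚ.∈-filter⁺ (λ u → ¬? (power? (u ℕ.* A))) (∈-units⁺ (%<p _) (u≉0 w (proj₂ (∈-units⁻ w∈)))) (uA w (proj₂ (∈-units⁻ w∈))) , K.sym (ux w))
    where
    x⁻¹ = proj₁ (inverse x≉0)
    x⁻¹x : x⁻¹ ℕ.* x ≈ 1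
    x⁻¹x = proj₂ (inverse x≉0)
    u : ℕ → ℕ
    u w = (x⁻¹ ℕ.* w KK.^ d) % p
    ux : ∀ w → u w ℕ.* x ≈ w KK.^ d
    ux w = K.trans (K.*-congʳ {x} (%≈ (x⁻¹ ℕ.* w KK.^ d))) (K.trans (KK.solve 3 (λ a y b → (a KK.:* y) KK.:* b KK.:= (a KK.:* b) KK.:* y) K.refl x⁻¹ (w KK.^ d) x)
      (K.trans (K.*-congʳ {w KK.^ d} x⁻¹x) (K.*-identityˡ (w KK.^ d))))
    u≉0 : ∀ w → w ≉ 0 → u w ≉ 0
    u≉0 w w≉0 e = ^-≉0 d w≉0 (K.trans (K.sym (ux w)) (K.*-congʳ {x} e))
    uA : ∀ w → w ≉ 0 → ¬ Power (u w ℕ.* A)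
    uA w w≉0 (s , _ , hs) = np (power (w ℕ.* s⁻¹) (K.trans (KK.^-distrib-* w s⁻¹ d) (K.trans (K.*-congʳ {s⁻¹ KK.^ d} (K.sym (ux w)))
        (K.trans (K.*-congʳ {s⁻¹ KK.^ d} (K.*-congʳ {x} uw≈)) (K.trans
          (KK.solve 4 (λ sd a x t → ((sd KK.:* a) KK.:* x) KK.:* t KK.:= (t KK.:* sd) KK.:* (a KK.:* x)) K.refl (s KK.^ d) A⁻¹ x (s⁻¹ KK.^ d))
          (K.trans (K.*-congʳ {A⁻¹ ℕ.* x} (K.trans (K.sym (KK.^-distrib-* s⁻¹ s d)) (K.trans (KK.^-congˡ d (proj₂ (inverse s≉0))) (one^ d)))) (K.*-identityˡ (A⁻¹ ℕ.* x))))))))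
      where
      one^ : ∀ n → 1 KK.^ n ≈ 1
      one^ zero = K.refl
      one^ (suc n) = K.trans (K.*-identityˡ _) (one^ n)
      s≉0 : s ≉ 0
      s≉0 e = *-≉0 (u≉0 w w≉0) A≉0 (K.trans (K.sym hs) (K.trans (K.*-congʳ {s KK.^ d′} e) K.refl))
      s⁻¹ = proj₁ (inverse s≉0)
      uw≈ : u w ≈ s KK.^ d ℕ.* A⁻¹
      uw≈ = K.sym (K.trans (K.*-congʳ {A⁻¹} hs) (K.trans (KK.solve 3 (λ u a b → (u KK.:* a) KK.:* b KK.:= u KK.:* (b KK.:* a)) K.refl (u w) A A⁻¹)
        (K.trans (K.*-congˡ {u w} A⁻¹A) (K.*-identityʳ (u w)))))

  root-quotient : ∀ {v w} → w ≉ 0 → v KK.^ d ≈ w KK.^ d → ∃ λ ζ → ζ ∈ μ × ζ ℕ.* w ≈ v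
  root-quotient {v} {w} w≉0 h = ζ , ∈-μ⁺ (%<p _) ζ^d , K.trans (K.*-congʳ {w} (%≈ (v ℕ.* w⁻¹))) (K.trans (K.*-assoc v w⁻¹ w) (K.trans (K.*-congˡ {v} w⁻¹w) (K.*-identityʳ v)))
    where
    w⁻¹ = proj₁ (inverse w≉0)
    w⁻¹w : w⁻¹ ℕ.* w ≈ 1
    w⁻¹w = proj₂ (inverse w≉0)
    ζ = (v ℕ.* w⁻¹) % p
    one^ : ∀ n → 1 KK.^ n ≈ 1
    one^ zero = K.refl
    one^ (suc n) = K.trans (K.*-identityˡ _) (one^ n)
    ζ^d : ζ KK.^ d ≈ 1
    ζ^d = K.trans (KK.^-congˡ d (%≈ (v ℕ.* w⁻¹))) (K.trans (KK.^-distrib-* v w⁻¹ d) (K.trans (K.*-congʳ {w⁻¹ KK.^ d} h)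
      (K.trans (K.sym (KK.^-distrib-* w w⁻¹ d)) (K.trans (KK.^-congˡ d (K.trans (K.*-comm w w⁻¹) w⁻¹w)) (one^ d)))))

  -- The outermost f is peeled off first, in step with a tree explored downwards from its root.
  InImage : ℕ → ℕ → Set
  InImage zero x = ⊤
  InImage (suc r) x = ∃ λ v → v < p × (A ℕ.* v KK.^ d ℕ.+ C ≈ x × InImage r v)

  abstract
   inImage? : ∀ r x → Dec (InImage r x)
   inImage? zero x = yes tt
   inImage? (suc r) x = ℕₚ.anyUpTo? (λ v → ((A ℕ.* v KK.^ d ℕ.+ C) ≈? x) ×-dec inImage? r v) p

  InImage-resp : ∀ r {x y} → x ≈ y → InImage r x → InImage r y
  InImage-resp zero _ _ = tt
  InImage-resp (suc r) h (v , v< , e , i) = v , v< , K.trans e h , i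

-- Pairwise relations, incomparable words and the size of the tree.

AllPairs-lookup : ∀ {A : Set} {Q : A → A → Set} → (∀ {x y} → Q x y → Q y x) → ∀ xs → AllPairs Q xs →
  ∀ i j → i ≢ j → Q (List.lookup xs i) (List.lookup xs j)
AllPairs-lookup sym (x ∷ xs) (q ∷ qs) Fin.zero Fin.zero ne = contradiction ≡.refl ne
AllPairs-lookup sym (x ∷ xs) (q ∷ qs) Fin.zero (Fin.suc j) ne = All.lookup q (∈ₚ.∈-lookup j)
AllPairs-lookup sym (x ∷ xs) (q ∷ qs) (Fin.suc i) Fin.zero ne = sym (All.lookup q (∈ₚ.∈-lookup i))
AllPairs-lookup sym (x ∷ xs) (q ∷ qs) (Fin.suc i) (Fin.suc j) ne = AllPairs-lookup sym xs qs i j (ne ∘ ≡.cong Fin.suc)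

-- Neither vertex is an ancestor of the other, so exploring below one leaves the question at the
-- other untouched.
Incomparable : Word → Word → Set
Incomparable W V = ¬ Suffix W V × ¬ Suffix V W

Incomparable-sym : ∀ {W V} → Incomparable W V → Incomparable V W
Incomparable-sym (a , b) = b , a

suffix-of-∷ : ∀ {V ζ W} → Suffix V (ζ ∷ W) → V ≡ ζ ∷ W ⊎ Suffix V W
suffix-of-∷ ([] , e) = inj₁ (≡.sym e)
suffix-of-∷ (u ∷ us , e) = inj₂ (us , Listₚ.∷-injectiveʳ e)

child-incomparable : ∀ {W V} ζ → Incomparable W V → Incomparable (ζ ∷ W) V
child-incomparable {W} {V} ζ (a , b) = (λ h → a (suffix-tail h)) , λ h → up (suffix-of-∷ h)
  where
  up : V ≡ ζ ∷ W ⊎ Suffix V W → ⊥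
  up (inj₁ ≡.refl) = a (ζ ∷ [] , ≡.refl)
  up (inj₂ h) = b h

siblings-incomparable : ∀ {W ζ ξ} → ζ ≢ ξ → Incomparable (ζ ∷ W) (ξ ∷ W)
siblings-incomparable {W} ne = (λ h → no′ ne (suffix-of-∷ h)) , λ h → no′ (ne ∘ ≡.sym) (suffix-of-∷ h)
  where
  no′ : ∀ {ζ ξ} → ζ ≢ ξ → (ζ ∷ W) ≡ ξ ∷ W ⊎ Suffix (ζ ∷ W) W → ⊥
  no′ ne (inj₁ e) = ne (Listₚ.∷-injectiveˡ e)
  no′ ne (inj₂ h) = ℕₚ.<-irrefl ≡.refl (suffix-length h)

-- The number 1 + d + ... + d^(r-1) of inner vertices of the d-ary tree of depth r. Deciding
-- membership in f^r(F_p) adjoins at most this many roots, each multiplying the rank by d.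
nodeBudget : ℕ → ℕ → ℕ
nodeBudget d zero = 0
nodeBudget d (suc r) = 1 ℕ.+ d ℕ.* nodeBudget d r

-- Counting points with prescribed memberships.

module Counting (D : Dynamics) where
  open Dynamics D
  open PrimeField p p-prime
  open RootsOfUnity (suc d′) (s≤s z≤n) d∣p-1
  open LinearAlgebra p p-prime
  open Towers D
  open StageStep D
  open Residues p p-prime d′ d∣p-1 A C A≉0
  open ListSums
  open RationalKit renaming (*-cancelˡ to *ℚ-cancelˡ)
  open import Data.Rational using (ℚ; 0ℚ; 1ℚ; _/_; _-_; _*_; _+_) renaming (_≤_ to _≤ℚ_)
  import Data.Rational as ℚ
  import Data.Rational.Properties as ℚₚ
  open import Data.Rational.Solver using (module +-*-Solver)

  points≤ : ∀ hmax g B → suc d′ ℕ.^ hmax ≤ g → 1 ≤ B → 6 ℕ.* (g ℕ.* g ℕ.* g ℕ.* (B ℕ.* B)) ≤ p →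
    p < 6 ℕ.* (g ℕ.* g ℕ.* g) ℕ.* (suc B ℕ.* suc B) →
    ∀ S → Stage.height S ≤ hmax → length (Stage.points S) ≤ p ℕ.+ 52 ℕ.* (g ℕ.* g ℕ.* g ℕ.* g) ℕ.* B
  points≤ hmax g B g-large 1≤B p-large p-small S h≤ = PointBound.points≤ p p-prime G domain g B
      (ℕₚ.≤-trans (ℕₚ.≤-reflexive rank) (ℕₚ.≤-trans (ℕₚ.^-monoʳ-≤ (suc d′) h≤) g-large)) 1≤B p-large p-small t (List.lookup points)
      (λ i → All.lookup points-δt (∈ₚ.∈-lookup i))
      (AllPairs-lookup (λ (r , ne) → r , ne ∘ K.sym) points points-separated)
    where open Stage S

  -- An open question: whether the value of `z` lies in the image of the iterate of order `level`,
  -- at a vertex with nothing explored below it.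
  record Pending (S : Stage) : Set where
    constructor pending
    open Stage S
    field
      level : ℕ
      word : Word
      z : Carrier
      isZ : Z word z
      fresh : Fresh word
      fits : length word ℕ.+ level ≤ N
  open Pending

  inside : ∀ {S} → Pending S → Hom (Stage.R S) K → ℕ
  inside q P = ind (inImage? (level q) (Hom.⟦ P ⟧ (z q)))

  outside : ∀ {S} → Pending S → Hom (Stage.R S) K → ℕ
  outside q P = ind (¬? (inImage? (level q) (Hom.⟦ P ⟧ (z q))))

  Item : Stage → Set
  Item S = Bool × Pending S

  value : ∀ {S} → Item S → Hom (Stage.R S) K → ℕ
  value (true , q) = inside q
  value (false , q) = outside q

  -- The indicator of the points at which all questions have the prescribed answers.
  weight : ∀ {S} → List (Item S) → Hom (Stage.R S) K → ℕ
  weight [] P = 1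
  weight (i ∷ Λ) P = value i P ℕ.* weight Λ P

  Shape : Set
  Shape = Bool × ℕ × Word

  shape : ∀ {S} → Item S → Shape
  shape (b , q) = b , level q , word q

  shapes : ∀ {S} → List (Item S) → List Shape
  shapes = List.map shape

  Inc : Shape → Shape → Set
  Inc (_ , _ , W) (_ , _ , V) = Incomparable W V

  probability : Bool → ℕ → ℚ
  probability true r = mu d r
  probability false r = 1ℚ - mu d r

  -- The probability of the prescribed answers if they were independent. It depends on the shapes
  -- only, so it does not change when items are lifted to another stage.
  θ : List Shape → ℚ
  θ [] = 1ℚ
  θ ((b , r , _) ∷ Λ) = probability b r * θ Λ

  -- Two measures: `fuel` decreases at every step, so a question of level 0 counts 1; `nodes` counts
  -- the roots still to be adjoined, and there such a question is free.
  fuel nodes : ℕ → ℕ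
  fuel zero = 1
  fuel (suc r) = 1 ℕ.+ d ℕ.* fuel r
  nodes = nodeBudget d

  fuels nodess : List Shape → ℕ
  fuels = Σᴸ λ (_ , r , _) → fuel r
  nodess = Σᴸ λ (_ , r , _) → nodes r

  total : ∀ S → List (Item S) → ℕ
  total S Λ = Σᴸ (weight Λ) (Stage.points S)

  -- The indicator that some child lies inside, split by the first such child, so that each summand
  -- is again a weight of prescribed answers.
  some-inside : ∀ {S} → List (Pending S) → Hom (Stage.R S) K → ℕ
  some-inside [] Q = 0
  some-inside (c ∷ cs) Q = inside c Q ℕ.+ outside c Q ℕ.* some-inside cs Q

  all-outside : ∀ {S} → List (Pending S) → Hom (Stage.R S) K → ℕ
  all-outside [] Q = 1
  all-outside (c ∷ cs) Q = outside c Q ℕ.* all-outside cs Q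

  total-some : ∀ S → List (Pending S) → List (Item S) → ℕ
  total-some S cs Λ = Σᴸ (λ Q → some-inside cs Q ℕ.* weight Λ Q) (Stage.points S)

  module Transition (S : Stage) {J : Word} {zJ : Stage.Carrier S} (ZJ : Stage.Z S J zJ) (J-fresh : Stage.Fresh S J)
                    {u : ℕ} {isNode : Set} (ext : StageExtension S J zJ u isNode) where
    open Stage S
    open StageExtension ext public

    lifts : Hom R K → List (Hom (Stage.R next) K)
    lifts P = List.map (lift P) (roots (radicand P))

    liftPending : (q : Pending S) → ¬ Suffix (word q) J → Pending next
    liftPending (pending r W z zW fr ft) ns = pending r W (proj₁ (lift-Z zW)) (proj₁ (proj₂ (lift-Z zW)))
      (λ V used → fresh′ V (used-next used)) ft
      where
      fresh′ : ∀ V → Used V ⊎ V ≡ J → ¬ Suffix W V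
      fresh′ V (inj₁ used) = fr V used
      fresh′ V (inj₂ ≡.refl) = ns

    liftPending-value : ∀ q ns P r → Hom.⟦ lift P r ⟧ (z (liftPending q ns)) ≈ Hom.⟦ P ⟧ (z q)
    liftPending-value (pending _ W z zW fr ft) ns P r = proj₂ (proj₂ (lift-Z zW)) P r

    liftItems : (Λ : List (Item S)) → All (λ i → ¬ Suffix (word (proj₂ i)) J) Λ → List (Item next)
    liftItems [] [] = []
    liftItems ((b , q) ∷ Λ) (ns ∷ nss) = (b , liftPending q ns) ∷ liftItems Λ nss

    shapes-lift : ∀ Λ nss → shapes (liftItems Λ nss) ≡ shapes Λ
    shapes-lift [] [] = ≡.refl
    shapes-lift ((b , q) ∷ Λ) (ns ∷ nss) = ≡.cong (_ ∷_) (shapes-lift Λ nss)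

    weight-lift : ∀ Λ nss P r → weight (liftItems Λ nss) (lift P r) ≡ weight Λ P
    weight-lift [] [] P r = ≡.refl
    weight-lift ((b , q) ∷ Λ) (ns ∷ nss) P r = ≡.cong₂ ℕ._*_ (val b) (weight-lift Λ nss P r)
      where
      to′ : InImage (level q) (Hom.⟦ lift P r ⟧ (z (liftPending q ns))) → InImage (level q) (Hom.⟦ P ⟧ (z q))
      to′ = InImage-resp (level q) (liftPending-value q ns P r)
      from′ : InImage (level q) (Hom.⟦ P ⟧ (z q)) → InImage (level q) (Hom.⟦ lift P r ⟧ (z (liftPending q ns)))
      from′ = InImage-resp (level q) (K.sym (liftPending-value q ns P r))
      val : ∀ b → value (b , liftPending q ns) (lift P r) ≡ value (b , q) P
      val true = ind-cong (inImage? (level q) _) (inImage? (level q) _) to′ from′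
      val false = ind-cong (¬? (inImage? (level q) _)) (¬? (inImage? (level q) _)) (λ n → n ∘ from′) (λ n → n ∘ to′)

    weight-lifts : ∀ Λ nss {P Q} → Q ∈ lifts P → weight (liftItems Λ nss) Q ≡ weight Λ P
    weight-lifts Λ nss {P} Q∈ with ∈ₚ.∈-map⁻ (lift P) Q∈
    ... | ρ , _ , ≡.refl = weight-lift Λ nss P ρ

  roots-complete : ∀ x L → (∀ {w} → w ∈ L → w < p × w KK.^ d ≈ x) → Unique L → length L ≤ length (roots x)
  roots-complete x L h u = ≡.subst (length L ≤_) (Listₚ.length-map proj₁ (roots x)) (unique-⊆⇒length≤ L (List.map proj₁ (roots x)) u
      λ {w} w∈ → complete (upTo p) (∈ₚ.∈-upTo⁺ (proj₁ (h w∈))) (proj₂ (h w∈)))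
    where
    complete : ∀ M {w} → w ∈ M → w KK.^ d ≈ x → w ∈ List.map proj₁ (rootsIn x M)
    complete (m ∷ M) (here ≡.refl) e with (m KK.^ suc d′) ≈? x
    ... | yes _ = here ≡.refl
    ... | no ne = contradiction e ne
    complete (m ∷ M) (there w∈) e with (m KK.^ suc d′) ≈? x
    ... | yes _ = there (complete M w∈ e)
    ... | no _ = complete M w∈ e

  d≤roots : ∀ {x} w → x ≉ 0 → w KK.^ d ≈ x → d ≤ length (roots x)
  d≤roots {x} w x≉0 h = ℕₚ.≤-trans (ℕₚ.≤-trans d≤length-μ (ℕₚ.≤-reflexive (≡.sym (Listₚ.length-map scale μ))))
      (roots-complete x (List.map scale μ) member (unique-map scale μ (λ {ζ} {ξ} ζ∈ ξ∈ e → ≈⇒≡ (proj₁ (∈-μ⁻ ζ∈)) (proj₁ (∈-μ⁻ ξ∈))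
        (*-cancelˡ w w≉0 (K.trans (K.*-comm w ζ) (K.trans (mk≈ e) (K.*-comm ξ w))))) μ-unique))
    where
    scale : ℕ → ℕ
    scale ζ = (ζ ℕ.* w) % p
    w≉0 : w ≉ 0
    w≉0 e = x≉0 (K.trans (K.sym h) (K.*-congʳ {w KK.^ d′} e))
    member : ∀ {y} → y ∈ List.map scale μ → y < p × y KK.^ d ≈ x
    member y∈ with ∈ₚ.∈-map⁻ scale y∈
    ... | ζ , ζ∈ , ≡.refl = %<p _ , K.trans (KK.^-congˡ d (%≈ (ζ ℕ.* w))) (K.trans (KK.^-distrib-* ζ w d)
            (K.trans (K.*-congʳ {w KK.^ d} (proj₂ (∈-μ⁻ ζ∈))) (K.trans (K.*-identityˡ (w KK.^ d)) h)))

  module Split (S : Stage) {J : Word} {zJ : Stage.Carrier S} (r : ℕ) (ZJ : Stage.Z S J zJ) (J-fresh : Stage.Fresh S J)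
               (fits′ : length J ℕ.+ suc r ≤ N) where
    open Stage S using (points; R)
    open StageTheory S using (value≉)

    J≤N : length J ℕ.+ 1 ≤ N
    J≤N = ℕₚ.≤-trans (ℕₚ.+-monoʳ-≤ (length J) (s≤s z≤n)) fits′

    A⁻¹≉0 : A⁻¹ ≉ 0
    A⁻¹≉0 e = 1≉0 (K.trans (K.sym A⁻¹A) (K.*-congʳ {A} e))

    main-extension : StageExtension S J zJ A⁻¹ ⊤
    main-extension = extend S ZJ J-fresh J≤N A⁻¹ A⁻¹≉0 ⊤ λ _ → K.trans (K.*-comm A A⁻¹) A⁻¹A
    module Main = Transition S ZJ J-fresh main-extension
    module Twist (u : ℕ) (u≉0 : u ≉ 0) = Transition S ZJ J-fresh (extend S ZJ J-fresh J≤N u u≉0 ⊥ λ ())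
    private
      module EK = RingKit (Stage.R Main.next)

    child-of : ∀ {ζ} → ζ ∈ μ → Pending Main.next
    child-of {ζ} ζ∈ = pending r (ζ ∷ J) _ (child ζ∈ (proj₁ (proj₂ (Main.new-node tt)))) (λ V used → fresh′ V (Main.used-next used))
      (≡.subst (_≤ N) (ℕₚ.+-suc (length J) r) fits′)
      where
      fresh′ : ∀ V → Stage.Used S V ⊎ V ≡ J → ¬ Suffix (ζ ∷ J) V
      fresh′ V (inj₁ used) h = J-fresh V used (suffix-tail h)
      fresh′ V (inj₂ ≡.refl) h = ℕₚ.<-irrefl ≡.refl (suffix-length h)

    children : ∀ L → (∀ {ζ} → ζ ∈ L → ζ ∈ μ) → List (Pending Main.next)
    children [] sub = []
    children (ζ ∷ L) sub = child-of (sub (here ≡.refl)) ∷ children L (sub ∘ there)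

    child-value : ∀ {ζ} (ζ∈ : ζ ∈ μ) P ρ → Hom.⟦ Main.lift P ρ ⟧ (z (child-of ζ∈)) ≈ ζ ℕ.* proj₁ ρ
    child-value {ζ} ζ∈ P ρ = K.trans (Hom.*-homo (Main.lift P ρ) (EK.κ ζ) _) (K.*-cong (κ-value (Stage.R Main.next) (Main.lift P ρ) ζ) (proj₂ (proj₂ (Main.new-node tt)) P ρ))

    f-root : ∀ P (ρ : Root (Main.radicand P)) {y} → y KK.^ d ≈ proj₁ ρ KK.^ d → A ℕ.* y KK.^ d ℕ.+ C ≈ Hom.⟦ P ⟧ zJ
    f-root P (w , h) {y} e = K.trans (K.+-congʳ {C} (K.*-congˡ {A} (K.trans e (K.trans h (Main.radicand-value P)))))
      (K.trans (KK.solve 4 (λ a i x c → a KK.:* (i KK.:* (x KK.:- c)) KK.:+ c KK.:= (i KK.:* a) KK.:* (x KK.:- c) KK.:+ c) K.refl A A⁻¹ (Hom.⟦ P ⟧ zJ) C)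
        (K.trans (K.+-congʳ {C} (K.trans (K.*-congʳ {Hom.⟦ P ⟧ zJ K.- C} A⁻¹A) (K.*-identityˡ _))) (KK.solve 2 (λ x c → (x KK.:- c) KK.:+ c KK.:= x) K.refl (Hom.⟦ P ⟧ zJ) C)))

    root≉0 : ∀ {P} → P ∈ points → (ρ : Root (Main.radicand P)) → proj₁ ρ ≉ 0
    root≉0 {P} P∈ (w , h) e = Main.radicand≉0 P∈ (K.trans (K.sym h) (K.*-congʳ {w KK.^ d′} e))

    private
      some≥1 : ∀ L (sub : ∀ {ζ} → ζ ∈ L → ζ ∈ μ) P ρ {ζ} → ζ ∈ L → InImage r (ζ ℕ.* proj₁ ρ) → 1 ≤ some-inside (children L sub) (Main.lift P ρ)
      some≥1 (ξ ∷ L) sub P ρ (here ≡.refl) h = ℕₚ.≤-trans (ℕₚ.≤-reflexive (≡.sym (ind-yes (inImage? r (Hom.⟦ Main.lift P ρ ⟧ (z (child-of (sub (here ≡.refl))))))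
        (InImage-resp r (K.sym (child-value (sub (here ≡.refl)) P ρ)) h)))) (ℕₚ.m≤m+n (inside (child-of (sub (here ≡.refl))) (Main.lift P ρ)) _)
      some≥1 (ξ ∷ L) sub P ρ (there ζ∈) h = cover (inImage? r (Hom.⟦ Main.lift P ρ ⟧ (z (child-of (sub (here ≡.refl)))))) (some≥1 L (sub ∘ there) P ρ ζ∈ h)
        where
        cover : ∀ {X : Set} (x : Dec X) {k} → 1 ≤ k → 1 ≤ ind x ℕ.+ ind (¬? x) ℕ.* k
        cover (yes _) _ = s≤s z≤n
        cover (no _) {k} h = ≡.subst (1 ≤_) (≡.sym (ℕₚ.+-identityʳ k)) h

      all≥1 : ∀ L (sub : ∀ {ζ} → ζ ∈ L → ζ ∈ μ) P ρ → (∀ {ζ} → ζ ∈ L → ¬ InImage r (ζ ℕ.* proj₁ ρ)) → 1 ≤ all-outside (children L sub) (Main.lift P ρ)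
      all≥1 [] sub P ρ h = ℕₚ.≤-refl
      all≥1 (ξ ∷ L) sub P ρ h = ≡.subst (λ k → 1 ≤ k ℕ.* all-outside (children L (sub ∘ there)) (Main.lift P ρ))
        (≡.sym (ind-yes (¬? (inImage? r _)) (h (here ≡.refl) ∘ InImage-resp r (child-value (sub (here ≡.refl)) P ρ))))
        (ℕₚ.≤-trans (all≥1 L (sub ∘ there) P ρ (h ∘ there)) (ℕₚ.≤-reflexive (≡.sym (ℕₚ.*-identityˡ _))))

      Σ≥length : ∀ {X : Set} (f : X → ℕ) xs → (∀ {x} → x ∈ xs → 1 ≤ f x) → length xs ≤ Σᴸ f xs
      Σ≥length f xs h = ≡.subst (_≤ Σᴸ f xs) (Σ-1 xs) (Σ-mono xs h)

    whole : List (Pending Main.next)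
    whole = children μ id

    -- If f(v) is the value of `zJ`, the radicand has d roots ρ, and for each of them v = ζ ρ for
    -- some ζ in `μ`. Hence at each of d lifts some child lies inside.
    inside-split : ∀ {P} → P ∈ points → d ℕ.* ind (inImage? (suc r) (Hom.⟦ P ⟧ zJ)) ≤ Σᴸ (some-inside whole) (Main.lifts P)
    inside-split {P} P∈ = ≡.subst (d ℕ.* ind (inImage? (suc r) (Hom.⟦ P ⟧ zJ)) ≤_) (≡.sym (Σ-map (some-inside whole) (Main.lift P) (roots (Main.radicand P)))) (decide (inImage? (suc r) (Hom.⟦ P ⟧ zJ)))
      where
      decide : (q : Dec (InImage (suc r) (Hom.⟦ P ⟧ zJ))) → d ℕ.* ind q ≤ Σᴸ (λ ρ → some-inside whole (Main.lift P ρ)) (roots (Main.radicand P))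
      decide (no _) = ℕₚ.≤-trans (ℕₚ.≤-reflexive (ℕₚ.*-zeroʳ d)) z≤n
      decide (yes (v , _ , fv , iv)) = ℕₚ.≤-trans (ℕₚ.≤-reflexive (ℕₚ.*-identityʳ d)) (ℕₚ.≤-trans (d≤roots v (Main.radicand≉0 P∈) v^d≈)
          (Σ≥length _ (roots (Main.radicand P)) λ {ρ} _ → found ρ (root-quotient (root≉0 P∈ ρ) (K.trans v^d≈ (K.sym (proj₂ ρ))))))
        where
        v^d≈ : v KK.^ d ≈ Main.radicand P
        v^d≈ = K.sym (K.trans (Main.radicand-value P) (K.trans (K.*-congˡ {A⁻¹} (K.+-congʳ {K.- C} (K.sym fv)))
          (K.trans (KK.solve 4 (λ i a y c → i KK.:* ((a KK.:* y KK.:+ c) KK.:- c) KK.:= (i KK.:* a) KK.:* y) K.refl A⁻¹ A (v KK.^ d) C)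
            (K.trans (K.*-congʳ {v KK.^ d} A⁻¹A) (K.*-identityˡ (v KK.^ d))))))
        found : ∀ ρ → (∃ λ ζ → ζ ∈ μ × ζ ℕ.* proj₁ ρ ≈ v) → 1 ≤ some-inside whole (Main.lift P ρ)
        found ρ (ζ , ζ∈ , e) = some≥1 μ id P ρ ζ∈ (InImage-resp r (K.sym e) iv)

    twisted-roots : Hom R K → ℕ → ℕ
    twisted-roots P u = length (roots (u ℕ.* (Hom.⟦ P ⟧ zJ K.- C)))

    -- Let x be the value of `zJ` minus C. If x / A is a d-th power, there are d lifts, and outside
    -- the image all children are outside at each. If it is not, the twisted equations have at least
    -- p - 1 roots in total. The weights p - 1 and d put the two cases on one scale.
    outside-split : ∀ {P} → P ∈ points → d ℕ.* (p ℕ.∸ 1) ℕ.* ind (¬? (inImage? (suc r) (Hom.⟦ P ⟧ zJ))) ≤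
      (p ℕ.∸ 1) ℕ.* Σᴸ (all-outside whole) (Main.lifts P) ℕ.+ d ℕ.* Σᴸ (twisted-roots P) twists
    outside-split {P} P∈ = ≡.subst (λ m → d ℕ.* (p ℕ.∸ 1) ℕ.* ind (¬? (inImage? (suc r) (Hom.⟦ P ⟧ zJ))) ≤ (p ℕ.∸ 1) ℕ.* m ℕ.+ d ℕ.* rest)
        (≡.sym (Σ-map (all-outside whole) (Main.lift P) (roots (Main.radicand P)))) (decide (inImage? (suc r) (Hom.⟦ P ⟧ zJ)) (power? (A⁻¹ ℕ.* x)))
      where
      x = Hom.⟦ P ⟧ zJ K.- C
      main = Σᴸ (λ ρ → all-outside whole (Main.lift P ρ)) (roots (Main.radicand P))
      rest = Σᴸ (twisted-roots P) twists
      x≉0 : x ≉ 0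
      x≉0 h = value≉ {P} P∈ 1 ZJ ℕₚ.≤-refl J≤N (K.trans (KK.x-y≈0⇒x≈y h) (K.sym orbit-1))
      decide : (q : Dec (InImage (suc r) (Hom.⟦ P ⟧ zJ))) → Dec (Power (A⁻¹ ℕ.* x)) → d ℕ.* (p ℕ.∸ 1) ℕ.* ind (¬? q) ≤ (p ℕ.∸ 1) ℕ.* main ℕ.+ d ℕ.* rest
      decide (yes _) _ = ℕₚ.≤-trans (ℕₚ.≤-reflexive (ℕₚ.*-zeroʳ (d ℕ.* (p ℕ.∸ 1)))) z≤n
      decide (no ¬i) (yes (v , _ , hv)) = ℕₚ.≤-trans (ℕₚ.≤-reflexive (ℕₚ.*-identityʳ (d ℕ.* (p ℕ.∸ 1))))
        (ℕₚ.≤-trans (ℕₚ.≤-reflexive (ℕₚ.*-comm d (p ℕ.∸ 1))) (ℕₚ.≤-trans (ℕₚ.*-monoʳ-≤ (p ℕ.∸ 1) (ℕₚ.≤-trans (d≤roots v (Main.radicand≉0 P∈) (K.trans hv (K.sym (Main.radicand-value P))))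
          (Σ≥length _ (roots (Main.radicand P)) λ {ρ} _ → all≥1 μ id P ρ λ {ζ} ζ∈ i → ¬i ((ζ ℕ.* proj₁ ρ) % p , %<p _ ,
            f-root P ρ {(ζ ℕ.* proj₁ ρ) % p} (K.trans (KK.^-congˡ d (%≈ (ζ ℕ.* proj₁ ρ))) (K.trans (KK.^-distrib-* ζ (proj₁ ρ) d) (K.trans (K.*-congʳ {proj₁ ρ KK.^ d} (proj₂ (∈-μ⁻ ζ∈))) (K.*-identityˡ (proj₁ ρ KK.^ d))))) ,
            InImage-resp r (K.sym (%≈ (ζ ℕ.* proj₁ ρ))) i)))) (ℕₚ.m≤m+n ((p ℕ.∸ 1) ℕ.* main) (d ℕ.* rest))))
      decide (no ¬i) (no np) = ℕₚ.≤-trans (ℕₚ.≤-reflexive (ℕₚ.*-identityʳ (d ℕ.* (p ℕ.∸ 1))))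
        (ℕₚ.≤-trans (ℕₚ.*-monoʳ-≤ d (ℕₚ.≤-trans (units≤twisted-roots x x≉0 np) (Σ-mono twists λ {u} _ →
          roots-complete (u ℕ.* x) _ (λ w∈ → proj₁ (∈-units⁻ (proj₁ (∈ₚ.∈-filter⁻ (λ w → (w KK.^ d) ≈? (u ℕ.* x)) w∈))) , proj₂ (∈ₚ.∈-filter⁻ (λ w → (w KK.^ d) ≈? (u ℕ.* x)) {xs = units} w∈))
            (Uniqueₚ.filter⁺ (λ w → (w KK.^ d) ≈? (u ℕ.* x)) units-unique)))) (ℕₚ.m≤n+m (d ℕ.* rest) ((p ℕ.∸ 1) ℕ.* main)))

  private
    module ℕ-Solver where
      open import Data.Nat.Solver using (module +-*-Solver) public
    open ℕ-Solver.+-*-Solver using () renaming (solve to ℕsolve; _:+_ to _⊞_; _:*_ to _⊠_; _:=_ to _≗_; con to ℕcon)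

  total-some-∷ : ∀ S c cs Λ → total-some S (c ∷ cs) Λ ≡ total S ((true , c) ∷ Λ) ℕ.+ total-some S cs ((false , c) ∷ Λ)
  total-some-∷ S c cs Λ = ≡.trans (Σ-cong (Stage.points S) λ Q →
      ℕsolve 4 (λ i o s w → (i ⊞ o ⊠ s) ⊠ w ≗ i ⊠ w ⊞ s ⊠ (o ⊠ w)) ≡.refl (inside c Q) (outside c Q) (some-inside cs Q) (weight Λ Q))
    (Σ-+ (λ Q → inside c Q ℕ.* weight Λ Q) (λ Q → some-inside cs Q ℕ.* (outside c Q ℕ.* weight Λ Q)) (Stage.points S))

  outs : ∀ {S} → List (Pending S) → List (Item S)
  outs = List.map (false ,_)

  weight-outs : ∀ {S} (cs : List (Pending S)) Λ Q → weight (outs cs ++ Λ) Q ≡ all-outside cs Q ℕ.* weight Λ Q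
  weight-outs [] Λ Q = ≡.sym (ℕₚ.*-identityˡ _)
  weight-outs (c ∷ cs) Λ Q = ≡.trans (≡.cong (outside c Q ℕ.*_) (weight-outs cs Λ Q)) (≡.sym (ℕₚ.*-assoc (outside c Q) _ _))

  module _ {S : Stage} (r : ℕ) where
    fuels-outs : ∀ (cs : List (Pending S)) Λ → All (λ c → level c ≡ r) cs → fuels (shapes (outs cs ++ Λ)) ≡ length cs ℕ.* fuel r ℕ.+ fuels (shapes Λ)
    fuels-outs [] Λ [] = ≡.refl
    fuels-outs (c ∷ cs) Λ (≡.refl ∷ es) = ≡.trans (≡.cong (fuel r ℕ.+_) (fuels-outs cs Λ es)) (≡.sym (ℕₚ.+-assoc (fuel r) _ _))

    nodess-outs : ∀ (cs : List (Pending S)) Λ → All (λ c → level c ≡ r) cs → nodess (shapes (outs cs ++ Λ)) ≡ length cs ℕ.* nodes r ℕ.+ nodess (shapes Λ)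
    nodess-outs [] Λ [] = ≡.refl
    nodess-outs (c ∷ cs) Λ (≡.refl ∷ es) = ≡.trans (≡.cong (nodes r ℕ.+_) (nodess-outs cs Λ es)) (≡.sym (ℕₚ.+-assoc (nodes r) _ _))

    θ-outs : ∀ (cs : List (Pending S)) Λ → All (λ c → level c ≡ r) cs → θ (shapes (outs cs ++ Λ)) ≡ (1ℚ - mu d r) ^ℚ length cs * θ (shapes Λ)
    θ-outs [] Λ [] = ≡.sym (ℚₚ.*-identityˡ _)
    θ-outs (c ∷ cs) Λ (≡.refl ∷ es) = ≡.trans (≡.cong ((1ℚ - mu d r) *_) (θ-outs cs Λ es)) (≡.sym (ℚₚ.*-assoc (1ℚ - mu d r) _ _))

  Apart : ∀ {S} → List (Pending S) → List Shape → Set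
  Apart cs Λ = All (λ c → All (λ (_ , _ , V) → Incomparable (word c) V) Λ) cs

  Spread : ∀ {S} → List (Pending S) → Set
  Spread = AllPairs λ c c′ → Incomparable (word c) (word c′)

  outs-AllPairs : ∀ {S} (cs : List (Pending S)) Λ → Spread cs → AllPairs Inc (shapes Λ) → Apart cs (shapes Λ) → AllPairs Inc (shapes (outs cs ++ Λ))
  outs-AllPairs [] Λ [] inc [] = inc
  outs-AllPairs (c ∷ cs) Λ (sp ∷ sps) inc (ap ∷ aps) = head cs sp ∷ outs-AllPairs cs Λ sps inc aps
    where
    head : ∀ cs → All (λ c′ → Incomparable (word c) (word c′)) cs → All (Inc (false , level c , word c)) (shapes (outs cs ++ Λ))
    head [] [] = ap
    head (c′ ∷ cs) (q ∷ qs) = q ∷ head cs qs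

  length-rootsIn-cong : ∀ {x y} → x ≈ y → ∀ L → length (rootsIn x L) ≡ length (rootsIn y L)
  length-rootsIn-cong h [] = ≡.refl
  length-rootsIn-cong {x} {y} h (w ∷ L) with (w KK.^ suc d′) ≈? x | (w KK.^ suc d′) ≈? y
  ... | yes _ | yes _ = ≡.cong suc (length-rootsIn-cong h L)
  ... | no _ | no _ = length-rootsIn-cong h L
  ... | yes e | no ne = contradiction (K.trans e h) ne
  ... | no ne | yes e = contradiction (K.trans e (K.sym h)) ne

  module Recursion (S : Stage) {J : Word} {zJ : Stage.Carrier S} (r : ℕ) (ZJ : Stage.Z S J zJ) (J-fresh : Stage.Fresh S J)
                   (fits′ : length J ℕ.+ suc r ≤ N) (Λ : List (Item S)) (inc : All (λ (_ , _ , V) → Incomparable J V) (shapes Λ)) where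
    open Split S r ZJ J-fresh fits′ public
    open Stage S using (points)

    nss : All (λ i → ¬ Suffix (word (proj₂ i)) J) Λ
    nss = All.map proj₂ (Allₚ.map⁻ inc)

    Λ″ : List (Item Main.next)
    Λ″ = Main.liftItems Λ nss

    shapes≡ : shapes Λ″ ≡ shapes Λ
    shapes≡ = Main.shapes-lift Λ nss

    whole-level : All (λ c → level c ≡ r) whole
    whole-level = go μ id
      where
      go : ∀ L (sub : ∀ {ζ} → ζ ∈ L → ζ ∈ μ) → All (λ c → level c ≡ r) (children L sub)
      go [] sub = []
      go (ζ ∷ L) sub = ≡.refl ∷ go L (sub ∘ there)

    whole-length : length whole ≡ d
    whole-length = ≡.trans (go μ id) length-μ≡d
      where
      go : ∀ L (sub : ∀ {ζ} → ζ ∈ L → ζ ∈ μ) → length (children L sub) ≡ length L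
      go [] sub = ≡.refl
      go (ζ ∷ L) sub = ≡.cong suc (go L (sub ∘ there))

    whole-spread : Spread whole
    whole-spread = go μ id μ-unique
      where
      others : ∀ ζ L (sub : ∀ {ζ} → ζ ∈ L → ζ ∈ μ) → All (ζ ≢_) L → All (λ c → Incomparable (ζ ∷ J) (word c)) (children L sub)
      others ζ [] sub [] = []
      others ζ (ξ ∷ L) sub (ne ∷ nes) = siblings-incomparable ne ∷ others ζ L (sub ∘ there) nes
      go : ∀ L (sub : ∀ {ζ} → ζ ∈ L → ζ ∈ μ) → Unique L → Spread (children L sub)
      go [] sub [] = []
      go (ζ ∷ L) sub (ne ∷ u) = others ζ L (sub ∘ there) ne ∷ go L (sub ∘ there) u

    whole-apart : Apart whole (shapes Λ″)
    whole-apart = go μ id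
      where
      go : ∀ L (sub : ∀ {ζ} → ζ ∈ L → ζ ∈ μ) → Apart (children L sub) (shapes Λ″)
      go [] sub = []
      go (ζ ∷ L) sub = ≡.subst (All (λ (_ , _ , V) → Incomparable (ζ ∷ J) V)) (≡.sym shapes≡) (All.map (child-incomparable ζ) inc) ∷ go L (sub ∘ there)

    J-item : Pending S
    J-item = pending (suc r) J zJ ZJ J-fresh fits′

    inside-total : d ℕ.* total S ((true , J-item) ∷ Λ) ≤ total-some Main.next whole Λ″
    inside-total = ≡.subst (λ xs → d ℕ.* total S ((true , J-item) ∷ Λ) ≤ Σᴸ (λ Q → some-inside whole Q ℕ.* weight Λ″ Q) xs) (≡.sym Main.points-next)
      (Σ-lifts-≥ Main.lifts (weight Λ) (weight Λ″) (Main.weight-lifts Λ nss) d (inside J-item) (some-inside whole) points inside-split)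

    twisted : ℕ → ℕ
    twisted u = Σᴸ (λ P → twisted-roots P u ℕ.* weight Λ P) points

    -- The twisted roots form the fibres of the twisted stage, so the weighted count is a total over
    -- that stage and is open to the induction.
    twisted-total : ∀ u (u≉0 : u ≉ 0) → twisted u ≡ total (Twist.next u u≉0) (Twist.liftItems u u≉0 Λ nss)
    twisted-total u u≉0 = ≡.sym (≡.trans (≡.trans (≡.cong (Σᴸ (weight (T.liftItems Λ nss))) T.points-next) (Σ-lifts-1 T.lifts (weight Λ) (weight (T.liftItems Λ nss)) (T.weight-lifts Λ nss) points))
        (Σ-cong points λ P → ≡.cong (ℕ._* weight Λ P) (≡.trans (Listₚ.length-map (T.lift P) (roots (T.radicand P))) (length-rootsIn-cong (T.radicand-value P) (upTo p)))))
      where module T = Twist u u≉0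

    outside-total : d ℕ.* (p ℕ.∸ 1) ℕ.* total S ((false , J-item) ∷ Λ) ≤
      (p ℕ.∸ 1) ℕ.* total Main.next (outs whole ++ Λ″) ℕ.+ d ℕ.* Σᴸ twisted twists
    outside-total = ≡.subst (λ k → d ℕ.* (p ℕ.∸ 1) ℕ.* total S ((false , J-item) ∷ Λ) ≤ (p ℕ.∸ 1) ℕ.* k ℕ.+ d ℕ.* Σᴸ twisted twists)
      (≡.trans (≡.cong (Σᴸ (λ Q → all-outside whole Q ℕ.* weight Λ″ Q)) (≡.sym Main.points-next)) (≡.sym (Σ-cong (Stage.points Main.next) (weight-outs whole Λ″))))
      (Σ-lifts-twisted-≥ Main.lifts (weight Λ) (weight Λ″) (Main.weight-lifts Λ nss) (d ℕ.* (p ℕ.∸ 1)) (p ℕ.∸ 1) d twists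
        (outside J-item) (all-outside whole) twisted-roots points outside-split)

  open +-*-Solver

  private
    1/d = + 1 / d

    scale-down : ∀ t {q} → ν d * t ≤ℚ q → t ≤ℚ 1/d * q
    scale-down t {q} h = ≡.subst (_≤ℚ 1/d * q) (≡.trans (≡.sym (ℚₚ.*-assoc 1/d (ν d) t)) (≡.trans (≡.cong (_* t) (1/d*d d′)) (ℚₚ.*-identityˡ t)))
      (*-monoˡ (ℚₚ.nonNegative⁻¹ 1/d {{ℚₚ.normalize-nonNeg 1 d}}) h)

    Σ-bound : ∀ (f : ℕ → ℕ) b L → (∀ {u} → u ∈ L → ν (f u) ≤ℚ b) → ν (Σᴸ f L) ≤ℚ ν (length L) * b
    Σ-bound f b [] h = ℚₚ.≤-reflexive (≡.sym (ℚₚ.*-zeroˡ b))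
    Σ-bound f b (u ∷ L) h = ≡.subst₂ _≤ℚ_ (≡.sym (ν-+ (f u) (Σᴸ f L)))
      (≡.trans (solve 2 (λ b n → b :+ n :* b := (con 1ℚ :+ n) :* b) ≡.refl b (ν (length L))) (≡.cong (_* b) (≡.sym (ν-suc (length L)))))
      (ℚₚ.+-mono-≤ (h (here ≡.refl)) (Σ-bound f b L (h ∘ there)))

  module Induction (hmax U : ℕ) (points-bound : ∀ S → Stage.height S ≤ hmax → length (Stage.points S) ≤ U) where
    Bound : ∀ S → List (Item S) → Set
    Bound S Λ = ν (total S Λ) ≤ℚ θ (shapes Λ) * ν U

    -- The first question is resolved by adjoining the root at its vertex, which passes it to the
    -- children or, in a twist, closes it. With no questions left the point bound applies; that
    -- `height` plus remaining nodes is at most `hmax` guarantees the rank it requires.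
    bound : ∀ n S (Λ : List (Item S)) → AllPairs Inc (shapes Λ) → fuels (shapes Λ) ≤ n → Stage.height S ℕ.+ nodess (shapes Λ) ≤ hmax → Bound S Λ
    -- Splitting by the first child inside gives m + (1 - m)(1 - (1 - m)^k) = 1 - (1 - m)^(k+1),
    -- where m is `mu d r`.
    some-bound : ∀ n r S (cs : List (Pending S)) Λ → All (λ c → level c ≡ r) cs → Spread cs → AllPairs Inc (shapes Λ) → Apart cs (shapes Λ) →
      length cs ℕ.* fuel r ℕ.+ fuels (shapes Λ) ≤ n → Stage.height S ℕ.+ (length cs ℕ.* nodes r ℕ.+ nodess (shapes Λ)) ≤ hmax →
      ν (total-some S cs Λ) ≤ℚ (1ℚ - (1ℚ - mu d r) ^ℚ length cs) * (θ (shapes Λ) * ν U)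

    some-bound n r S [] Λ [] [] inc [] fu ht = ℚₚ.≤-reflexive (≡.trans (≡.cong ν (Σ-0 (Stage.points S))) (≡.sym (ℚₚ.*-zeroˡ (θ (shapes Λ) * ν U))))
    some-bound n r S (c ∷ cs) Λ (≡.refl ∷ es) (sp ∷ sps) inc (ap ∷ aps) fu ht = ≡.subst₂ _≤ℚ_
        (≡.trans (≡.sym (ν-+ (total S ((true , c) ∷ Λ)) (total-some S cs ((false , c) ∷ Λ)))) (≡.cong ν (≡.sym (total-some-∷ S c cs Λ))))
        (solve 4 (λ m Y t u → (m :* t) :* u :+ (con 1ℚ :- Y) :* (((con 1ℚ :- m) :* t) :* u) := (con 1ℚ :- (con 1ℚ :- m) :* Y) :* (t :* u)) ≡.refl (mu d r) ((1ℚ - mu d r) ^ℚ length cs) (θ (shapes Λ)) (ν U))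
        (ℚₚ.+-mono-≤
          (bound n S ((true , c) ∷ Λ) (ap ∷ inc) (ℕₚ.≤-trans (ℕₚ.+-monoˡ-≤ (fuels (shapes Λ)) (ℕₚ.m≤m+n (fuel r) _)) fu)
            (ℕₚ.≤-trans (ℕₚ.+-monoʳ-≤ (Stage.height S) (ℕₚ.+-monoˡ-≤ (nodess (shapes Λ)) (ℕₚ.m≤m+n (nodes r) _))) ht))
          (some-bound n r S cs ((false , c) ∷ Λ) es sps (ap ∷ inc) (apart cs sp aps)
            (≡.subst (_≤ n) (shuffle (fuel r) (length cs ℕ.* fuel r) (fuels (shapes Λ))) fu)
            (≡.subst (λ k → Stage.height S ℕ.+ k ≤ hmax) (shuffle (nodes r) (length cs ℕ.* nodes r) (nodess (shapes Λ))) ht)))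
      where
      shuffle : ∀ a b c → a ℕ.+ b ℕ.+ c ≡ b ℕ.+ (a ℕ.+ c)
      shuffle = ℕsolve 3 (λ a b c → a ⊞ b ⊞ c ≗ b ⊞ (a ⊞ c)) ≡.refl
      apart : ∀ cs → All (λ c′ → Incomparable (word c) (word c′)) cs → Apart cs (shapes Λ) → Apart cs (shapes ((false , c) ∷ Λ))
      apart [] [] [] = []
      apart (c′ ∷ cs) (q ∷ qs) (a ∷ as) = (Incomparable-sym q ∷ a) ∷ apart cs qs as

    bound n S [] inc fu ht = ℚₚ.≤-trans (ν-mono (ℕₚ.≤-trans (ℕₚ.≤-reflexive (Σ-1 (Stage.points S))) (points-bound S (ℕₚ.≤-trans (ℕₚ.m≤m+n _ 0) ht))))
      (ℚₚ.≤-reflexive (≡.sym (ℚₚ.*-identityˡ (ν U))))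
    bound zero S ((b , pending zero W z zW fr ft) ∷ Λ) inc () ht
    bound zero S ((b , pending (suc r) W z zW fr ft) ∷ Λ) inc () ht
    bound (suc n) S ((true , pending zero W z zW fr ft) ∷ Λ) (_ ∷ inc) (s≤s fu) ht = ≡.subst₂ _≤ℚ_
      (≡.cong ν (Σ-cong (Stage.points S) λ P → ≡.sym (≡.trans (≡.cong (ℕ._* weight Λ P) (ind-yes (inImage? 0 (Hom.⟦ P ⟧ z)) tt)) (ℕₚ.*-identityˡ (weight Λ P))))) (≡.cong (_* ν U) (≡.sym (ℚₚ.*-identityˡ (θ (shapes Λ))))) (bound n S Λ inc fu ht)
    bound (suc n) S ((false , pending zero W z zW fr ft) ∷ Λ) (_ ∷ inc) (s≤s fu) ht = ℚₚ.≤-reflexive (≡.trans (≡.cong ν (≡.trans (Σ-cong (Stage.points S) λ P → ≡.cong (ℕ._* weight Λ P) (ind-no (¬? (inImage? 0 (Hom.⟦ P ⟧ z))) λ n → n tt)) (Σ-0 (Stage.points S))))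
      (solve 2 (λ t u → con 0ℚ := ((con 1ℚ :- con 1ℚ) :* t) :* u) ≡.refl (θ (shapes Λ)) (ν U)))
    bound (suc n) S ((true , pending (suc r) W z zW fr ft) ∷ Λ) (ap ∷ inc) (s≤s fu) ht = ℚₚ.≤-trans
        (scale-down (ν T) (ℚₚ.≤-trans (≡.subst (_≤ℚ ν (total-some Main.next whole Λ″)) (ν-* d T) (ν-mono inside-total)) rec))
        (ℚₚ.≤-reflexive (≡.trans (≡.cong₂ (λ k s → 1/d * ((1ℚ - (1ℚ - mu d r) ^ℚ k) * (θ s * ν U))) whole-length shapes≡)
          (solve 4 (λ i y t u → i :* (y :* (t :* u)) := ((y :* i) :* t) :* u) ≡.refl 1/d (1ℚ - (1ℚ - mu d r) ^ℚ d) (θ (shapes Λ)) (ν U))))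
      where
      open Recursion S r zW fr ft Λ ap
      T = total S ((true , J-item) ∷ Λ)
      rec = some-bound n r Main.next whole Λ″ whole-level whole-spread (≡.subst (AllPairs Inc) (≡.sym shapes≡) inc) whole-apart
        (≡.subst₂ (λ k s → k ℕ.* fuel r ℕ.+ fuels s ≤ n) (≡.sym whole-length) (≡.sym shapes≡) fu)
        (≡.subst (λ h → h ℕ.+ (length whole ℕ.* nodes r ℕ.+ nodess (shapes Λ″)) ≤ hmax) (≡.sym Main.height-next)
          (≡.subst₂ (λ k s → suc (Stage.height S) ℕ.+ (k ℕ.* nodes r ℕ.+ nodess s) ≤ hmax) (≡.sym whole-length) (≡.sym shapes≡)
          (ℕₚ.≤-trans (ℕₚ.≤-reflexive (≡.sym (ℕₚ.+-suc (Stage.height S) _))) ht)))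
    bound (suc n) S ((false , pending (suc r) W z zW fr ft) ∷ Λ) (ap ∷ inc) (s≤s fu) ht = ℚₚ.≤-trans (scale-down (ν T) (*ℚ-cancelˡ 0<q step))
        (ℚₚ.≤-reflexive (≡.trans (solve 4 (λ i Y t u → i :* (Y :* (t :* u)) := (i :* Y) :* t :* u) ≡.refl 1/d (Y + ν d′) (θ (shapes Λ)) (ν U))
          (≡.cong (λ k → k * θ (shapes Λ) * ν U) complement)))
      where
      open Recursion S r zW fr ft Λ ap
      T = total S ((false , J-item) ∷ Λ)
      q = ν (p ℕ.∸ 1)
      b = θ (shapes Λ) * ν U
      Y = (1ℚ - mu d r) ^ℚ d
      0<q : ℚ._<_ 0ℚ q
      0<q = positive (p ℕ.∸ 1) (ℕₚ.∸-monoˡ-≤ 1 2≤p)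
        where
        positive : ∀ k → 1 ≤ k → ℚ._<_ 0ℚ (ν k)
        positive (suc k) _ = 0<ν k
      -- The untwisted cover contributes Y and the twists `d′`, because a share `d′`/d of the p - 1
      -- units at most are twists, each weighted by d. The recursion for mu makes the sum the
      -- complementary probability.
      complement : 1/d * (Y + ν d′) ≡ 1ℚ - mu d (suc r)
      complement = ≡.trans (solve 3 (λ i Y n → i :* (Y :+ n) := i :* (con 1ℚ :+ n) :- (con 1ℚ :- Y) :* i) ≡.refl 1/d Y (ν d′))
        (≡.cong (_- mu d (suc r)) (≡.trans (≡.cong (1/d *_) (≡.sym (ν-suc d′))) (1/d*d d′)))
      below : Bound S Λ
      below = bound n S Λ inc (ℕₚ.≤-trans (ℕₚ.m≤n+m _ (d ℕ.* fuel r)) fu) (ℕₚ.≤-trans (ℕₚ.+-monoʳ-≤ (Stage.height S) (ℕₚ.m≤n+m _ (nodes (suc r)))) ht)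
      0≤b : 0ℚ ≤ℚ b
      0≤b = ℚₚ.≤-trans (0≤ν (total S Λ)) below
      main : ν (total Main.next (outs whole ++ Λ″)) ≤ℚ Y * b
      main = ≡.subst (ν (total Main.next (outs whole ++ Λ″)) ≤ℚ_)
        (≡.trans (≡.cong (_* ν U) (≡.trans (θ-outs r whole Λ″ whole-level) (≡.cong₂ (λ k s → (1ℚ - mu d r) ^ℚ k * θ s) whole-length shapes≡))) (ℚₚ.*-assoc Y (θ (shapes Λ)) (ν U)))
        (bound n Main.next (outs whole ++ Λ″) (outs-AllPairs whole Λ″ whole-spread (≡.subst (AllPairs Inc) (≡.sym shapes≡) inc) whole-apart)
          (≡.subst (_≤ n) (≡.sym (≡.trans (fuels-outs r whole Λ″ whole-level) (≡.cong₂ (λ k s → k ℕ.* fuel r ℕ.+ fuels s) whole-length shapes≡))) fu)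
          (≡.subst₂ (λ h k → h ℕ.+ k ≤ hmax) (≡.sym Main.height-next) (≡.sym (≡.trans (nodess-outs r whole Λ″ whole-level) (≡.cong₂ (λ k s → k ℕ.* nodes r ℕ.+ nodess s) whole-length shapes≡)))
            (ℕₚ.≤-trans (ℕₚ.≤-reflexive (≡.sym (ℕₚ.+-suc (Stage.height S) _))) ht)))
      -- A twisted root certifies that the vertex is outside the image, so its question disappears
      -- and only the list Λ is left to bound.
      tw : ∀ {u} → u ∈ twists → ν (twisted u) ≤ℚ b
      tw {u} u∈ = ≡.subst₂ (λ k s → ν k ≤ℚ θ s * ν U) (≡.sym (twisted-total u u≉0)) sh
        (bound n (Twist.next u u≉0) (Twist.liftItems u u≉0 Λ nss) (≡.subst (AllPairs Inc) (≡.sym sh) inc)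
          (≡.subst (λ s → fuels s ≤ n) (≡.sym sh) (ℕₚ.≤-trans (ℕₚ.m≤n+m _ (d ℕ.* fuel r)) fu))
          (≡.subst₂ (λ h s → h ℕ.+ nodess s ≤ hmax) (≡.sym (Twist.height-next u u≉0)) (≡.sym sh) (ℕₚ.≤-trans (ℕₚ.≤-reflexive (≡.sym (ℕₚ.+-suc (Stage.height S) _)))
            (ℕₚ.≤-trans (ℕₚ.+-monoʳ-≤ (Stage.height S) (s≤s (ℕₚ.m≤n+m _ (d ℕ.* nodes r)))) ht))))
        where
        u≉0 : u ≉ 0
        u≉0 = proj₂ (∈-units⁻ (proj₁ (∈ₚ.∈-filter⁻ (λ u → ¬? (power? (u ℕ.* A))) {xs = units} u∈)))
        sh : shapes (Twist.liftItems u u≉0 Λ nss) ≡ shapes Λ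
        sh = Twist.shapes-lift u u≉0 Λ nss
      step : q * (ν d * ν T) ≤ℚ q * ((Y + ν d′) * b)
      step = ℚₚ.≤-trans (ℚₚ.≤-reflexive (≡.trans (solve 3 (λ q d t → q :* (d :* t) := (d :* q) :* t) ≡.refl q (ν d) (ν T))
            (≡.sym (≡.trans (ν-* (d ℕ.* (p ℕ.∸ 1)) T) (≡.cong (_* ν T) (ν-* d (p ℕ.∸ 1)))))))
        (ℚₚ.≤-trans (ν-mono outside-total) (ℚₚ.≤-trans (ℚₚ.≤-reflexive (≡.trans (ν-+ ((p ℕ.∸ 1) ℕ.* total Main.next (outs whole ++ Λ″)) (d ℕ.* Σᴸ twisted twists))
            (≡.cong₂ _+_ (ν-* (p ℕ.∸ 1) (total Main.next (outs whole ++ Λ″))) (ν-* d (Σᴸ twisted twists)))))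
          (ℚₚ.≤-trans (ℚₚ.+-mono-≤ (*-monoˡ (0≤ν (p ℕ.∸ 1)) main) (*-monoˡ (0≤ν d) (Σ-bound twisted b twists tw)))
          (ℚₚ.≤-trans (ℚₚ.+-monoʳ-≤ (q * (Y * b)) (≡.subst₂ _≤ℚ_ (≡.trans (≡.cong (_* b) (ν-* d (length twists))) (ℚₚ.*-assoc (ν d) (ν (length twists)) b)) (≡.cong (_* b) (ν-* d′ (p ℕ.∸ 1)))
              (*-monoʳ 0≤b (ν-mono d*twists≤))))
            (ℚₚ.≤-reflexive (solve 4 (λ q Y b n → q :* (Y :* b) :+ (n :* q) :* b := q :* ((Y :+ n) :* b)) ≡.refl q Y b (ν d′)))))))

-- Numerical estimates for rank and error.

module SizeEstimates where
  open import Data.Nat using (_+_; _*_; _^_)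
  open import Data.Nat.Solver using (module +-*-Solver)
  open +-*-Solver

  -- The factor 4 answers the fourth power of the rank in the point bound. A further level replaces
  -- 4 n by 4 + d (4 n), at most four times d x, while the right side gains d^6.
  nodeBudget-bound : ∀ d → 2 ≤ d → ∀ N → 4 * nodeBudget d N ≤ d ^ (6 * N)
  nodeBudget-bound d 2≤d zero = z≤n
  nodeBudget-bound d 2≤d (suc N) = begin
      4 * (1 + d * n) ≡⟨ solve 2 (λ d n → con 4 :* (con 1 :+ d :* n) := con 4 :+ d :* (con 4 :* n)) ≡.refl d n ⟩
      4 + d * (4 * n) ≤⟨ ℕₚ.+-monoʳ-≤ 4 (ℕₚ.*-monoʳ-≤ d (nodeBudget-bound d 2≤d N)) ⟩
      4 + d * x ≤⟨ ℕₚ.+-monoˡ-≤ (d * x) 4≤ ⟩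
      3 * (d * x) + d * x ≡⟨ solve 1 (λ y → con 3 :* y :+ y := con 4 :* y) ≡.refl (d * x) ⟩
      4 * (d * x) ≤⟨ ℕₚ.*-monoˡ-≤ (d * x) (ℕₚ.≤-trans (ℕₚ.*-mono-≤ 2≤d 2≤d) (ℕₚ.≤-trans (ℕₚ.≤-reflexive (≡.sym (ℕₚ.*-identityʳ (d * d)))) (ℕₚ.*-monoʳ-≤ (d * d) 1≤d³))) ⟩
      d * d * (d * d * d) * (d * x) ≡⟨ solve 2 (λ d x → d :* d :* (d :* d :* d) :* (d :* x) := (d :* (d :* (d :* (d :* (d :* (d :* con 1)))))) :* x) ≡.refl d x ⟩
      d ^ 6 * x ≡⟨ ≡.sym (ℕₚ.^-distribˡ-+-* d 6 (6 * N)) ⟩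
      d ^ (6 + 6 * N) ≡⟨ ≡.cong (d ^_) (≡.sym (ℕₚ.*-suc 6 N)) ⟩
      d ^ (6 * suc N) ∎
    where
    open ℕₚ.≤-Reasoning
    n = nodeBudget d N
    x = d ^ (6 * N)
    1≤d : 1 ≤ d
    1≤d = ℕₚ.≤-trans (s≤s z≤n) 2≤d
    1≤d³ : 1 ≤ d * d * d
    1≤d³ = ℕₚ.*-mono-≤ (ℕₚ.*-mono-≤ 1≤d 1≤d) 1≤d
    1≤x : 1 ≤ x
    1≤x = ℕₚ.m^n>0 d {{ℕ.>-nonZero 1≤d}} (6 * N)
    4≤ : 4 ≤ 3 * (d * x)
    4≤ = ℕₚ.≤-trans (ℕₚ.m≤m+n 4 2) (ℕₚ.*-monoʳ-≤ 3 (ℕₚ.*-mono-≤ 2≤d 1≤x))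

  -- Searching downwards from p, where the upper inequality holds, stops at the integer part of the
  -- square root of p / E.
  floor-root : ∀ E p → 1 ≤ E → ∃ λ B → (E * (B * B) ≤ p) × (p < E * (suc B * suc B))
  floor-root E p 1≤E = search p (ℕₚ.<-≤-trans (ℕₚ.n<1+n p) (ℕₚ.≤-trans (ℕₚ.m≤m*n (suc p) (suc p)) (ℕₚ.≤-trans (ℕₚ.≤-reflexive (≡.sym (ℕₚ.*-identityˡ _))) (ℕₚ.*-monoˡ-≤ (suc p * suc p) 1≤E))))
    where
    search : ∀ n → p < E * (suc n * suc n) → ∃ λ B → (E * (B * B) ≤ p) × (p < E * (suc B * suc B))
    search n h with E * (n * n) ℕ.≤? p
    ... | yes le = n , le , h
    search zero h | no nle = contradiction (≡.subst (_≤ p) (≡.sym (ℕₚ.*-zeroʳ E)) z≤n) nle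
    search (suc n) h | no nle = search n (ℕₚ.≰⇒> nle)

  module Constants (N d : ℕ) (2≤d : 2 ≤ d) where
    g = d ^ nodeBudget d N
    bound = (52 + N) * d ^ (d ^ (6 * N))

    1≤g : 1 ≤ g
    1≤g = ℕₚ.m^n>0 d {{ℕ.>-nonZero (ℕₚ.≤-trans (s≤s z≤n) 2≤d)}} (nodeBudget d N)

    g⁴≤ : g * g * g * g ≤ d ^ (d ^ (6 * N))
    g⁴≤ = ℕₚ.≤-trans (ℕₚ.≤-reflexive (≡.trans (solve 1 (λ g → g :* g :* g :* g := g :* (g :* (g :* (g :* con 1)))) ≡.refl g)
      (≡.trans (ℕₚ.^-*-assoc d (nodeBudget d N) 4) (≡.cong (d ^_) (ℕₚ.*-comm (nodeBudget d N) 4)))))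
      (ℕₚ.^-monoʳ-≤ d {{ℕ.>-nonZero (ℕₚ.≤-trans (s≤s z≤n) 2≤d)}} (nodeBudget-bound d 2≤d N))

    -- For such p no B ≥ 1 is available; here p is itself below the error constant, so the deviation
    -- may be as large as p.
    small-prime : ∀ p → p < 6 * (g * g * g) → p * p ≤ bound * bound * p
    small-prime p h = ℕₚ.*-monoˡ-≤ p (begin
        p ≤⟨ ℕₚ.<⇒≤ h ⟩
        6 * (g * g * g) ≤⟨ ℕₚ.*-mono-≤ {6} {52 + N} (ℕₚ.≤-trans (ℕₚ.m≤m+n 6 46) (ℕₚ.m≤m+n 52 N)) (ℕₚ.≤-trans (ℕₚ.≤-trans (ℕₚ.≤-reflexive (≡.sym (ℕₚ.*-identityʳ (g * g * g)))) (ℕₚ.*-monoʳ-≤ (g * g * g) 1≤g)) g⁴≤) ⟩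
        bound ≤⟨ ℕₚ.≤-trans (ℕₚ.≤-reflexive (≡.sym (ℕₚ.*-identityʳ bound))) (ℕₚ.*-monoʳ-≤ bound 1≤bound) ⟩
        bound * bound ∎)
      where
      open ℕₚ.≤-Reasoning
      1≤bound : 1 ≤ bound
      1≤bound = ℕₚ.*-mono-≤ {1} {52 + N} (s≤s z≤n) (ℕₚ.≤-trans (ℕₚ.*-mono-≤ (ℕₚ.*-mono-≤ (ℕₚ.*-mono-≤ 1≤g 1≤g) 1≤g) 1≤g) g⁴≤)

    -- B plays the role of √p. The summand N, from the discarded residues, is absorbed into the
    -- constant because B ≥ 1.
    large-prime : ∀ p B → 1 ≤ B → B * B ≤ p → (52 * (g * g * g * g) * B + N) * (52 * (g * g * g * g) * B + N) ≤ bound * bound * p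
    large-prime p B 1≤B B²≤p = begin
        e * e ≤⟨ ℕₚ.*-mono-≤ e≤ e≤ ⟩
        (bound * B) * (bound * B) ≡⟨ solve 2 (λ x b → (x :* b) :* (x :* b) := x :* x :* (b :* b)) ≡.refl bound B ⟩
        bound * bound * (B * B) ≤⟨ ℕₚ.*-monoʳ-≤ (bound * bound) B²≤p ⟩
        bound * bound * p ∎
      where
      open ℕₚ.≤-Reasoning
      x = d ^ (d ^ (6 * N))
      e = 52 * (g * g * g * g) * B + N
      1≤xB : 1 ≤ x * B
      1≤xB = ℕₚ.*-mono-≤ (ℕₚ.≤-trans (ℕₚ.*-mono-≤ (ℕₚ.*-mono-≤ (ℕₚ.*-mono-≤ 1≤g 1≤g) 1≤g) 1≤g) g⁴≤) 1≤B
      e≤ : e ≤ bound * B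
      e≤ = begin
        52 * (g * g * g * g) * B + N ≤⟨ ℕₚ.+-mono-≤ (ℕₚ.*-monoˡ-≤ B (ℕₚ.*-monoʳ-≤ 52 g⁴≤)) (ℕₚ.≤-trans (ℕₚ.≤-reflexive (≡.sym (ℕₚ.*-identityʳ N))) (ℕₚ.*-monoʳ-≤ N 1≤xB)) ⟩
        52 * x * B + N * (x * B) ≡⟨ solve 3 (λ x b n → con 52 :* x :* b :+ n :* (x :* b) := (con 52 :+ n) :* x :* b) ≡.refl x B N ⟩
        bound * B ∎

-- From memberships to the size of the image.

module ImageSize (p : ℕ) .{{_ : NonZero p}} (p-prime : Prime p) (d′ : ℕ) (1≤d′ : 1 ≤ d′) (d∣p-1 : suc d′ ∣ p ℕ.∸ 1)
                 (A C N : ℕ) (A<p : A < p) (A≢0 : A ≢ 0)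
                 (distinct : ∀ i j → i < j → j ≤ N → iterate (polyMap p (suc d′) A C) i 0 ≢ iterate (polyMap p (suc d′) A C) j 0) where
  open PrimeField p p-prime
  open ListSums
  open RationalKit hiding (*-cancelˡ)
  open import Data.Rational using (ℚ; 1ℚ; _-_; _*_; _+_; -_) renaming (_≤_ to _≤ℚ_)
  import Data.Rational as ℚ
  import Data.Rational.Properties as ℚₚ
  open import Data.Rational.Solver using (module +-*-Solver)
  open import Data.Bool using (T; T?)
  open import Data.Bool.ListAction using (any)
  open import Data.List.Relation.Unary.Any.Properties using (any⁺; any⁻)
  open import Data.List.Membership.Propositional using (find; lose)

  d = suc d′
  f = polyMap p d A C

  A≉0 : A ≉ 0
  A≉0 = x<p⇒x≉0 (ℕₚ.n≢0⇒n>0 A≢0) A<p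

  open Residues p p-prime d′ d∣p-1 A C A≉0 using (InImage; inImage?; InImage-resp)

  orbit : ℕ → ℕ
  orbit a = iterate f a 0

  f≈ : ∀ v → A ℕ.* v KK.^ d ℕ.+ C ≈ f v
  f≈ v = K.sym (K.trans (%≈ (A ℕ.* v ℕ.^ d ℕ.+ C)) (mk≈ (≡.cong (λ w → (A ℕ.* w ℕ.+ C) % p) (≡.sym (^≡ v d)))))

  orbit-suc : ∀ a → orbit (suc a) ≈ A ℕ.* orbit a KK.^ d ℕ.+ C
  orbit-suc a = K.sym (f≈ (orbit a))

  iterate<p : ∀ n x → x < p → iterate f n x < p
  iterate<p zero x x<p = x<p
  iterate<p (suc n) x x<p = %<p _

  0<p : 0 < p
  0<p = ℕₚ.<-trans (s≤s z≤n) 2≤p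

  orbit-distinct : ∀ i j → i < j → j ≤ N → orbit i ≉ orbit j
  orbit-distinct i j i<j j≤N h = distinct i j i<j j≤N (≈⇒≡ (iterate<p i 0 0<p) (iterate<p j 0 0<p) h)

  iterate-inImage : ∀ n x → x < p → InImage n (iterate f n x)
  iterate-inImage zero x x<p = tt
  iterate-inImage (suc n) x x<p = iterate f n x , iterate<p n x x<p , f≈ (iterate f n x) , iterate-inImage n x x<p

  inImage-iterate : ∀ n y → y < p → InImage n y → ∃ λ x → x < p × iterate f n x ≡ y
  inImage-iterate zero y y<p _ = y , y<p , ≡.refl
  inImage-iterate (suc n) y y<p (v , v<p , e , i) with inImage-iterate n v v<p i
  ... | x , x<p , ≡.refl = x , x<p , ≈⇒≡ (%<p _) y<p (K.trans (K.sym (f≈ v)) e)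

  hits : ℕ → ℕ → Bool
  hits y x = iterate f N x ℕ.≡ᵇ y

  Im? : ∀ y → Dec (T (any (hits y) (upTo p)))
  Im? y = T? (any (hits y) (upTo p))

  Im⇒InImage : ∀ {y} → T (any (hits y) (upTo p)) → InImage N y
  Im⇒InImage {y} h with find (any⁻ (hits y) (upTo p) h)
  ... | x , x∈ , e = ≡.subst (InImage N) (ℕₚ.≡ᵇ⇒≡ (iterate f N x) y e) (iterate-inImage N x (∈ₚ.∈-upTo⁻ x∈))

  InImage⇒Im : ∀ {y} → y < p → InImage N y → T (any (hits y) (upTo p))
  InImage⇒Im {y} y<p i with inImage-iterate N y y<p i
  ... | x , x<p , e = any⁺ (hits y) (lose (∈ₚ.∈-upTo⁺ x<p) (ℕₚ.≡⇒≡ᵇ (iterate f N x) y e))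

  I : ℕ
  I = imageSize p N d A C

  module _ {P : ℕ → Set} (P? : ∀ x → Dec (P x)) where
    length-filter≡Σ : ∀ L → length (filter P? L) ≡ Σᴸ (λ y → ind (P? y)) L
    length-filter≡Σ [] = ≡.refl
    length-filter≡Σ (x ∷ L) with P? x
    ... | yes _ = ≡.cong suc (length-filter≡Σ L)
    ... | no _ = length-filter≡Σ L

    Σ-filter-split : ∀ (h : ℕ → ℕ) → (∀ x → h x ≤ 1) → ∀ L → Σᴸ h L ≤ Σᴸ h (filter P? L) ℕ.+ length (filter (¬? ∘ P?) L)
    Σ-filter-split h h≤1 [] = z≤n
    Σ-filter-split h h≤1 (x ∷ L) with P? x
    ... | yes _ = ℕₚ.≤-trans (ℕₚ.+-monoʳ-≤ (h x) (Σ-filter-split h h≤1 L)) (ℕₚ.≤-reflexive (≡.sym (ℕₚ.+-assoc (h x) _ _)))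
    ... | no _ = ℕₚ.≤-trans (ℕₚ.+-mono-≤ (h≤1 x) (Σ-filter-split h h≤1 L)) (ℕₚ.≤-reflexive (≡.sym (ℕₚ.+-suc _ _)))

  dynamics : Dynamics
  dynamics = record
    { p = p ; p-prime = p-prime ; d′ = d′ ; 1≤d′ = 1≤d′ ; d∣p-1 = d∣p-1 ; A = A ; C = C ; N = N ; A≉0 = A≉0
    ; orbit = orbit ; orbit-0 = K.refl ; orbit-suc = orbit-suc ; orbit-distinct = orbit-distinct }

  open StageStep dynamics using (module Base)
  open Base using (values; avoids?; point)

  -- Each discarded residue is one of f(0), ..., f^N(0).
  critical≤N : length (filter (¬? ∘ avoids?) (upTo p)) ≤ N
  critical≤N = ≡.subst (length (filter (¬? ∘ avoids?) (upTo p)) ≤_) (≡.trans (Listₚ.length-map (orbit ∘ suc) (upTo N)) (Listₚ.length-upTo N))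
    (unique-⊆⇒length≤ _ (List.map (orbit ∘ suc) (upTo N)) (Uniqueₚ.filter⁺ (¬? ∘ avoids?) (Uniqueₚ.upTo⁺ p)) λ {y} y∈ →
      member y (∈ₚ.∈-upTo⁻ (proj₁ (∈ₚ.∈-filter⁻ (¬? ∘ avoids?) {xs = upTo p} y∈))) (upTo N) (proj₂ (∈ₚ.∈-filter⁻ (¬? ∘ avoids?) {xs = upTo p} y∈)))
    where
    member : ∀ y → y < p → ∀ ks → ¬ All (λ k → y ≉ orbit (suc k)) ks → y ∈ List.map (orbit ∘ suc) ks
    member y y<p [] h = contradiction [] h
    member y y<p (k ∷ ks) h with y ≈? orbit (suc k)
    ... | yes e = here (≈⇒≡ y<p (iterate<p (suc k) 0 0<p) e)
    ... | no ne = there (member y y<p ks (h ∘ (ne ∷_)))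

  ind≤1 : ∀ {P : Set} (q : Dec P) → ind q ≤ 1
  ind≤1 (yes _) = ℕₚ.≤-refl
  ind≤1 (no _) = z≤n

  values<p : ∀ {y} → y ∈ values → y < p
  values<p y∈ = ∈ₚ.∈-upTo⁻ (proj₁ (∈ₚ.∈-filter⁻ avoids? {xs = upTo p} y∈))

  point-X : ∀ y → Hom.⟦ point y ⟧ KP.X ≈ y
  point-X y = KP.Eval.eval-X K (idHom K) y

  T-in T-out : ℕ
  T-in = Σᴸ (λ y → ind (inImage? N (Hom.⟦ point y ⟧ KP.X))) values
  T-out = Σᴸ (λ y → ind (¬? (inImage? N (Hom.⟦ point y ⟧ KP.X)))) values

  I≤ : I ≤ T-in ℕ.+ N
  I≤ = ℕₚ.≤-trans (ℕₚ.≤-reflexive (length-filter≡Σ Im? (upTo p))) (ℕₚ.≤-trans (Σ-filter-split avoids? _ (λ y → ind≤1 (Im? y)) (upTo p))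
    (ℕₚ.+-mono-≤ (Σ-mono values λ {y} y∈ → ℕₚ.≤-reflexive (ind-cong (Im? y) (inImage? N _)
      (λ h → InImage-resp N (K.sym (point-X y)) (Im⇒InImage h)) (λ h → InImage⇒Im (values<p y∈) (InImage-resp N (point-X y) h)))) critical≤N))

  p≤ : p ≤ I ℕ.+ (T-out ℕ.+ N)
  p≤ = ℕₚ.≤-trans (ℕₚ.≤-reflexive (≡.trans (≡.sym (Listₚ.length-upTo p)) (length-filter-¬ Im? (upTo p)))) (ℕₚ.+-monoʳ-≤ I
    (ℕₚ.≤-trans (ℕₚ.≤-reflexive (length-filter≡Σ (¬? ∘ Im?) (upTo p))) (ℕₚ.≤-trans (Σ-filter-split avoids? _ (λ y → ind≤1 (¬? (Im? y))) (upTo p))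
    (ℕₚ.+-mono-≤ (Σ-mono values λ {y} y∈ → ℕₚ.≤-reflexive (ind-cong (¬? (Im? y)) (¬? (inImage? N _))
      (λ n h → n (InImage⇒Im (values<p y∈) (InImage-resp N (point-X y) h))) (λ n h → n (InImage-resp N (K.sym (point-X y)) (Im⇒InImage h))))) critical≤N))))

  I≤p : I ≤ p
  I≤p = ℕₚ.≤-trans (Listₚ.length-filter Im? (upTo p)) (ℕₚ.≤-reflexive (Listₚ.length-upTo p))

  dev : ℚ
  dev = ν I - mu d N * ν p

  open +-*-Solver
  open Asymptotics d′ using (mu-bounds; 0≤mu)

  private
    m = mu d N

    square : ∀ b → ℚ.∣ dev ∣ ≤ℚ ν b → ℚ.∣ dev ∣ * ℚ.∣ dev ∣ ≤ℚ ν (b ℕ.* b)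
    square b h = ℚₚ.≤-trans (ℚₚ.≤-trans (*-monoˡ (ℚₚ.0≤∣p∣ dev) h) (*-monoʳ (0≤ν b) h)) (ℚₚ.≤-reflexive (≡.sym (ν-* b b)))

    mul≤ : ∀ {q} k → q ≤ℚ 1ℚ → q * ν k ≤ℚ ν k
    mul≤ k h = ℚₚ.≤-trans (*-monoʳ (0≤ν k) h) (ℚₚ.≤-reflexive (ℚₚ.*-identityˡ (ν k)))

  trivial-bound : ℚ.∣ dev ∣ ≤ℚ ν p
  trivial-bound = ∣∣≤ (ℚₚ.≤-trans (≤-diff (m * ν p) (0≤* (0≤mu N) (0≤ν p)) (solve 2 (λ i x → i := (i :- x) :+ x) ≡.refl (ν I) (m * ν p))) (ν-mono I≤p))
    (ℚₚ.≤-trans (≤-diff (ν I) (0≤ν I) (solve 2 (λ i x → x := :- (i :- x) :+ i) ≡.refl (ν I) (m * ν p))) (mul≤ p (proj₂ (mu-bounds N))))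

  open SizeEstimates.Constants N d (s≤s 1≤d′) using (g; 1≤g; small-prime; large-prime) renaming (bound to error)

  module Main (B : ℕ) (1≤B : 1 ≤ B)
              (p-large : 6 ℕ.* (g ℕ.* g ℕ.* g) ℕ.* (B ℕ.* B) ≤ p) (p-small : p < 6 ℕ.* (g ℕ.* g ℕ.* g) ℕ.* (suc B ℕ.* suc B)) where
    open Counting dynamics
    open Induction (nodeBudget d N) (p ℕ.+ 52 ℕ.* (g ℕ.* g ℕ.* g ℕ.* g) ℕ.* B) (points≤ (nodeBudget d N) g B ℕₚ.≤-refl 1≤B
      (ℕₚ.≤-trans (ℕₚ.≤-reflexive (≡.sym (ℕₚ.*-assoc 6 (g ℕ.* g ℕ.* g) (B ℕ.* B)))) p-large) p-small)

    start : Pending Base.stage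
    start = pending N [] KP.X Towers.root (λ V ()) ℕₚ.≤-refl

    e : ℕ
    e = 52 ℕ.* (g ℕ.* g ℕ.* g ℕ.* g) ℕ.* B

    start-bound : ∀ b → ν (total Base.stage ((b , start) ∷ [])) ≤ℚ probability b N * (ν p + ν e)
    start-bound b = ℚₚ.≤-trans (bound (fuel N) Base.stage ((b , start) ∷ []) ([] ∷ []) (ℕₚ.≤-reflexive (ℕₚ.+-identityʳ (fuel N))) (ℕₚ.≤-reflexive (ℕₚ.+-identityʳ (nodeBudget d N))))
      (ℚₚ.≤-reflexive (≡.cong₂ _*_ (ℚₚ.*-identityʳ (probability b N)) (ν-+ p e)))

    T-in≤ : ν T-in ≤ℚ m * (ν p + ν e)
    T-in≤ = ≡.subst (λ k → ν k ≤ℚ m * (ν p + ν e)) (≡.trans (Σ-map (weight ((true , start) ∷ [])) point values) (Σ-cong values λ y → ℕₚ.*-identityʳ _)) (start-bound true)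

    T-out≤ : ν T-out ≤ℚ (1ℚ - m) * (ν p + ν e)
    T-out≤ = ≡.subst (λ k → ν k ≤ℚ (1ℚ - m) * (ν p + ν e)) (≡.trans (Σ-map (weight ((false , start) ∷ [])) point values) (Σ-cong values λ y → ℕₚ.*-identityʳ _)) (start-bound false)

    upper : dev ≤ℚ ν (e ℕ.+ N)
    upper = begin
      ν I - m * ν p ≤⟨ ℚₚ.+-monoˡ-≤ (- (m * ν p)) (ν-mono I≤) ⟩
      ν (T-in ℕ.+ N) - m * ν p ≡⟨ ≡.cong (_- m * ν p) (ν-+ T-in N) ⟩
      ν T-in + ν N - m * ν p ≤⟨ ℚₚ.+-monoˡ-≤ (- (m * ν p)) (ℚₚ.+-monoˡ-≤ (ν N) T-in≤) ⟩
      m * (ν p + ν e) + ν N - m * ν p ≡⟨ solve 4 (λ m p e n → m :* (p :+ e) :+ n :- m :* p := m :* e :+ n) ≡.refl m (ν p) (ν e) (ν N) ⟩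
      m * ν e + ν N ≤⟨ ℚₚ.+-monoˡ-≤ (ν N) (mul≤ e (proj₂ (mu-bounds N))) ⟩
      ν e + ν N ≡⟨ ≡.sym (ν-+ e N) ⟩
      ν (e ℕ.+ N) ∎
      where open ℚₚ.≤-Reasoning

    lower : - dev ≤ℚ ν (e ℕ.+ N)
    lower = begin
      - (ν I - m * ν p) ≡⟨ solve 3 (λ i m p → :- (i :- m :* p) := p :- (i :+ (con 1ℚ :- m) :* p)) ≡.refl (ν I) m (ν p) ⟩
      ν p - (ν I + (1ℚ - m) * ν p) ≤⟨ ℚₚ.+-monoˡ-≤ (- (ν I + (1ℚ - m) * ν p)) (ν-mono p≤) ⟩
      ν (I ℕ.+ (T-out ℕ.+ N)) - (ν I + (1ℚ - m) * ν p) ≡⟨ ≡.cong (_- (ν I + (1ℚ - m) * ν p)) (≡.trans (ν-+ I (T-out ℕ.+ N)) (≡.cong (λ k → ν I + k) (ν-+ T-out N))) ⟩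
      (ν I + (ν T-out + ν N)) - (ν I + (1ℚ - m) * ν p) ≤⟨ ℚₚ.+-monoˡ-≤ (- (ν I + (1ℚ - m) * ν p)) (ℚₚ.+-monoʳ-≤ (ν I) (ℚₚ.+-monoˡ-≤ (ν N) T-out≤)) ⟩
      (ν I + ((1ℚ - m) * (ν p + ν e) + ν N)) - (ν I + (1ℚ - m) * ν p) ≡⟨ solve 5 (λ i m p e n → (i :+ ((con 1ℚ :- m) :* (p :+ e) :+ n)) :- (i :+ (con 1ℚ :- m) :* p) := (con 1ℚ :- m) :* e :+ n) ≡.refl (ν I) m (ν p) (ν e) (ν N) ⟩
      (1ℚ - m) * ν e + ν N ≤⟨ ℚₚ.+-monoˡ-≤ (ν N) (mul≤ {1ℚ - m} e (≤-diff m (0≤mu N) (solve 1 (λ m → con 1ℚ := (con 1ℚ :- m) :+ m) ≡.refl m))) ⟩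
      ν e + ν N ≡⟨ ≡.sym (ν-+ e N) ⟩
      ν (e ℕ.+ N) ∎
      where open ℚₚ.≤-Reasoning

    main-bound : ℚ.∣ dev ∣ * ℚ.∣ dev ∣ ≤ℚ ν ((e ℕ.+ N) ℕ.* (e ℕ.+ N))
    main-bound = square (e ℕ.+ N) (∣∣≤ upper lower)

  -- Squaring both sides keeps √p out of the rationals.
  deviation-bound : ℚ.∣ dev ∣ * ℚ.∣ dev ∣ ≤ℚ ν (error ℕ.* error ℕ.* p)
  deviation-bound = decide (p ℕ.<? E)
    where
    E = 6 ℕ.* (g ℕ.* g ℕ.* g)
    Goal = ℚ.∣ dev ∣ * ℚ.∣ dev ∣ ≤ℚ ν (error ℕ.* error ℕ.* p)
    1≤E : 1 ≤ E
    1≤E = ℕₚ.*-mono-≤ {1} {6} (s≤s z≤n) (ℕₚ.*-mono-≤ (ℕₚ.*-mono-≤ 1≤g 1≤g) 1≤g)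
    use : ¬ (p < E) → (∃ λ B → (E ℕ.* (B ℕ.* B) ≤ p) × (p < E ℕ.* (suc B ℕ.* suc B))) → Goal
    -- B = 0 would mean p < E, the case already settled by the trivial bound.
    use large (zero , _ , lt) = contradiction (≡.subst (p <_) (ℕₚ.*-identityʳ E) lt) large
    use large (suc B , le , lt) = ℚₚ.≤-trans (Main.main-bound (suc B) (s≤s z≤n) le lt)
      (ν-mono {_} {error ℕ.* error ℕ.* p} (large-prime p (suc B) (s≤s z≤n) (ℕₚ.≤-trans (ℕₚ.≤-trans (ℕₚ.≤-reflexive (≡.sym (ℕₚ.*-identityˡ (suc B ℕ.* suc B)))) (ℕₚ.*-monoˡ-≤ (suc B ℕ.* suc B) 1≤E)) le)))
    decide : Dec (p < E) → Goal
    decide (yes small) = ℚₚ.≤-trans (square p trivial-bound) (ν-mono {p ℕ.* p} {error ℕ.* error ℕ.* p} (small-prime p small))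
    decide (no large) = use large (SizeEstimates.floor-root E p 1≤E)

open import Data.Rational as ℚ using (ℚ; 0ℚ; 1ℚ; _/_; ∣_∣; _-_; _*_)

theorem1p1 :
    ((N : ℕ) → Σ ℕ λ M →
      (p d A C : ℕ) → .{{_ : NonZero p}} → .{{_ : NonZero d}} →
      Prime p → 2 ≤ d → d ∣ p ℕ.∸ 1 → A < p → A ≢ 0 → C < p →
      ((i j : ℕ) → i < j → j ≤ N →
        iterate (polyMap p d A C) i 0 ≢ iterate (polyMap p d A C) j 0) →
      let dev = (+ imageSize p N d A C / 1) - mu d N * (+ p / 1)
          bound = M ℕ.* (d ℕ.^ (d ℕ.^ (6 ℕ.* N)))
      in ∣ dev ∣ * ∣ dev ∣ ℚ.≤ (+ (bound ℕ.* bound ℕ.* p) / 1))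
    ×
    ((d : ℕ) → .{{_ : NonZero d}} → 2 ≤ d →
      (ε : ℚ) → 0ℚ ℚ.< ε → Σ ℕ λ R → (r : ℕ) → R ≤ r →
        ∣ mu d r * (+ ((d ℕ.∸ 1) ℕ.* r) / 2) - 1ℚ ∣ ℚ.≤ ε)
theorem1p1 =
  -- The 52 comes from the point bound, the N from the residues set aside.
  (λ N → 52 ℕ.+ N , λ { p (suc d′) A C p-prime (s≤s 1≤d′) d∣p-1 A<p A≢0 _ distinct →
    ImageSize.deviation-bound p p-prime d′ 1≤d′ d∣p-1 A C N A<p A≢0 distinct }) ,
  λ { (suc d′) (s≤s 1≤d′) → Asymptotics.asymptotics d′ 1≤d′ }
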